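{- There exist $\epsilon\in(0,1]$ and an infinite family of finite bipartite graphs (with arbitrarily many vertices), each of which is a bipartite $\epsilon$-expander and is $3$-monotone (with respect to some orderings of its two colour classes).
   Context: For $\epsilon\in(0,1]$, a bipartite graph $G$ with bipartition $V(G)=A\cup B$ is a bipartite $\epsilon$-expander if $|A|=|B|$ and $|N(S)|\geq(1+\epsilon)|S|$ for every subset $S\subset A$ with $|S|\leq |A|/2$, where $N(S)$ is the set of vertices adjacent to some vertex of $S$. Let $G$ be a bipartite graph with ordered colour classes $(v_1,\dots,v_n)$ and $(w_1,\dots,w_m)$. Two edges $v_iw_j$ and $v_kw_\ell$ cross if $i<k$ and $\ell<j$. A matching is monotone if no two of its edges cross. $G$ (with these orderings) is $d$-monotone if its edge set is the union of $d$ monotone matchings. -}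

module Defs where

open import Data.Nat as ℕ using (ℕ; _≤_)
open import Data.Fin using (Fin; _<_)
open import Data.Fin.Subset using (Subset; _∈_; ∣_∣)
open import Data.Fin.Subset.Properties using (_∈?_)
open import Data.Fin.Properties using (any?)
open import Data.Bool using (Bool; true; _≟_)
open import Data.Vec using (tabulate)
open import Data.Integer using (+_)
open import Data.Rational as ℚ using (ℚ; 1ℚ; _/_)
open import Data.Product using (Σ; ∃; _×_; _,_)
open import Relation.Nullary using (¬_; ⌊_⌋)
open import Relation.Nullary.Decidable using (_×-dec_)
open import Relation.Binary.PropositionalEquality using (_≡_)
open import Function.Bundles using (_⇔_)

-- A bipartite graph with colour classes A = (v_0,…,v_{n-1}) and
-- B = (w_0,…,w_{n-1}) (so |A| = |B| = n), ordered by index.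
-- E i j ≡ true  iff  v_i w_j is an edge.
BipGraph : ℕ → Set
BipGraph n = Fin n → Fin n → Bool

nbhd : ∀ {n} → BipGraph n → Subset n → Subset n
nbhd E S = tabulate λ j → ⌊ any? (λ i → (i ∈? S) ×-dec (E i j ≟ true)) ⌋

toℚ : ℕ → ℚ
toℚ k = (+ k) / 1

IsExpander : ∀ {n} → ℚ → BipGraph n → Set
IsExpander {n} ε E =
  ∀ (S : Subset n) → 2 ℕ.* ∣ S ∣ ≤ n →
    (1ℚ ℚ.+ ε) ℚ.* toℚ ∣ S ∣ ℚ.≤ toℚ ∣ nbhd E S ∣

IsMatching : ∀ {n} → BipGraph n → Set
IsMatching {n} M = ∀ (i j k l : Fin n) → M i j ≡ true → M k l ≡ true →
  (i ≡ k → j ≡ l) × (j ≡ l → i ≡ k)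

IsNonCrossing : ∀ {n} → BipGraph n → Set
IsNonCrossing {n} M = ∀ (i j k l : Fin n) → M i j ≡ true → M k l ≡ true →
  ¬ (i < k × l < j)

IsMonotoneMatching : ∀ {n} → BipGraph n → Set
IsMonotoneMatching M = IsMatching M × IsNonCrossing M

IsMonotone : ∀ {n} → ℕ → BipGraph n → Set
IsMonotone {n} d E = Σ (Fin d → BipGraph n) λ M →
  (∀ k → IsMonotoneMatching (M k)) ×
  (∀ i j → (E i j ≡ true) ⇔ (∃ λ k → M k i j ≡ true))

{-# OPTIONS --safe #-}

-- The graphs come from a tower of random lifts. Vertices are words of digits, ordered lexicographically, and every permutation
-- φ_a of a D-regular bipartite graph is lifted to (x, z) ↦ (φ_a x, z + s_a(x)), where z < PQ stands for two new digits and the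
-- shifts s_a(x) are small compared with PQ. Such a lift is increasing wherever φ_a is, except on the few z that wrap around.
-- If the graph has large girth, the trace method bounds the norm of the lift on functions whose mean over the last digit is zero,
-- for some choice of the shifts that also doubles the girth once the few vertices on short closed walks are removed.
-- One tower contracts the variation of a function in the odd digits, a second one, offset by a digit, that in the even digits;
-- one of the two carries at most half of the variance of the indicator of a neighbourhood N(S), so sets S of linear size expand.
-- Deleting a largest set that does not expand, together with its neighbours, leaves an expander which is the union of boundedly
-- many monotone matchings. Three matchings suffice after placing these matchings in consecutive blocks joined by shifted
-- identity matchings: either a set already gains from the shifts, or its traces on all blocks nearly coincide.

module Submission where

open import Defs
open import Algebra.Bundles using (CommutativeRing)
open import Algebra.Structures using (IsCommutativeRing)
open import Data.Bool using (Bool; true; false; if_then_else_; _∧_; _∨_; not)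
open import Data.Bool.Properties using (∧-comm)
import Data.Bool.Properties as Bool
open import Data.Empty using (⊥; ⊥-elim)
open import Data.Fin as Fin using (Fin; zero; suc; toℕ)
open import Data.Fin.Permutation using (permutation)
import Data.Fin.Properties as Fin
open import Data.Fin.Subset using (Subset) renaming (∣_∣ to ∣_∣ₛ)
open import Data.Fin.Subset.Properties using (anySubset?)
open import Data.Integer as ℤ using (ℤ; +_; -[1+_])
import Data.Integer.Divisibility.Signed as ℤD
import Data.Integer.Properties as ℤ
import Data.Integer.Tactic.RingSolver as ℤ-Ring
open import Data.List using (List; []; _∷_; _++_; length)
import Data.List.Properties as List
open import Data.List.Membership.Propositional using (_∈_)
open import Data.List.Relation.Unary.Any using (here; there)
open import Data.Nat as ℕ using (ℕ; zero; suc; NonZero)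
import Data.Nat.Coprimality as Coprime
open import Data.Nat.DivMod using (_%_; m%n<n; m≡m%n+[m/n]*n; %-distribˡ-+; m%n%n≡m%n; m<n⇒m%n≡m; [m+n]%n≡m%n)
import Data.Nat.DivMod as ℕD
open import Data.Nat.Divisibility using (∣-refl; ∣⇒≤) renaming (_∣_ to _divs_; _∣?_ to _divs?_; _∣0 to _divs0)
import Data.Nat.Properties as ℕ
import Data.Nat.Tactic.RingSolver as ℕ-Ring
open import Data.Product using (_×_; _,_; Σ; ∃; ∃₂; proj₁; proj₂)
open import Data.Rational as ℚ using (ℚ; 0ℚ; 1ℚ) renaming (_≤_ to _≤ℚ_; _<_ to _<ℚ_)
import Data.Rational.Properties as ℚ
open import Data.Rational.Solver using (module +-*-Solver)
open +-*-Solver using (solve; con; _:=_; _:+_; _:*_; _:-_; :-_)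
open import Data.Sum using (_⊎_; inj₁; inj₂)
open import Data.Vec using ([]; _∷_; lookup; tabulate)
open import Data.Vec.Functional using () renaming (_∷_ to _∷ᶠ_)
import Data.Vec.Properties as Vec
open import Function using (_∘_)
open import Function.Bundles using (mk⇔)
open import Level using (0ℓ)
open import Relation.Binary.Definitions using (tri<; tri≈; tri>)
open import Relation.Binary.PropositionalEquality hiding ([_])
open import Relation.Nullary using (Dec; yes; no; ¬_; does)
open import Relation.Nullary.Decidable using (map′; dec-true; dec-false; isYes≗does; _×-dec_)

open +-*-Solver using (solve; con; _:=_; _:+_; _:*_; _:-_; :-_)

-- A lift mixes a digit only if its shifts are large compared with that digit, and stays almost
-- increasing only if they are small compared with the whole fibre. So two digits are added at a
-- time: the lower one is mixed, the upper one is only the room that makes wrapping rare. As the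
-- upper digit is not mixed, the second, offset tower is unavoidable. Girth and size are tied
-- together. For the trace to bound the norm, the walk length n must be of the order of the
-- logarithm of the number of points; to beat the trivial bound D^n by a square root, a walk may
-- revisit a vertex only boundedly often, so the girth g must be of order n. Conversely, doubling g
-- needs a fibre that outnumbers the roughly D^(2g) short walks. Both hold if digit lengths and
-- girth double together. Points lost to wrapping or short walks are only marked, so all maps remain
-- permutations; the losses form a geometric series with a small sum. Norm bounds are stated as 2⟨e,
-- Tf⟩ ≤ Λ(|e|² + |f|²), and exponents that are powers of two replace eigenvalues, so everything
-- stays rational.

infixl 6 _⊕_ _⊖_
infixl 7 _⊗_
infix 8 ⊝_
infix 4 _≼_

-- The ordered field ℚ behind an opaque interface, so that no rational number is ever normalised.
opaque
  Q : Set
  Q = ℚ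

  𝟘 𝟙 : Q
  𝟘 = ℚ.0ℚ
  𝟙 = ℚ.1ℚ

  _⊕_ _⊗_ _⊖_ : Q → Q → Q
  _⊕_ = ℚ._+_
  _⊗_ = ℚ._*_
  _⊖_ = ℚ._-_

  ⊝_ : Q → Q
  ⊝_ = ℚ.-_

  _≼_ : Q → Q → Set
  _≼_ = ℚ._≤_

  ∣_∣ : Q → Q
  ∣_∣ = ℚ.∣_∣

  isCommutativeRing : IsCommutativeRing _≡_ _⊕_ _⊗_ ⊝_ 𝟘 𝟙
  isCommutativeRing = ℚ.+-*-isCommutativeRing

Q-ring : CommutativeRing 0ℓ 0ℓ
Q-ring = record { isCommutativeRing = isCommutativeRing }

open CommutativeRing Q-ring public using (semiring)
  renaming ( +-comm to ⊕-comm ; +-assoc to ⊕-assoc ; +-identityˡ to ⊕-idˡ ; +-identityʳ to ⊕-idʳ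
           ; *-comm to ⊗-comm ; *-assoc to ⊗-assoc ; *-identityˡ to ⊗-idˡ ; *-identityʳ to ⊗-idʳ
           ; distribˡ to ⊗-distribˡ ; distribʳ to ⊗-distribʳ ; zeroˡ to ⊗-zeroˡ ; zeroʳ to ⊗-zeroʳ )

import Algebra.Properties.Semiring.Sum semiring as Sum

opaque
  sum : ∀ {n} → (Fin n → Q) → Q
  sum = Sum.sum

  sum-zero : (f : Fin 0 → Q) → sum f ≡ 𝟘
  sum-zero f = refl

  sum-suc : ∀ {n} (f : Fin (suc n) → Q) → sum f ≡ f zero ⊕ sum (f ∘ suc)
  sum-suc f = refl

  sum-cong : ∀ {n} {f g : Fin n → Q} → (∀ i → f i ≡ g i) → sum f ≡ sum g
  sum-cong p = Sum.sum-cong-≗ p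

  ∑-distrib-+ : ∀ {n} (f g : Fin n → Q) → sum (λ i → f i ⊕ g i) ≡ sum f ⊕ sum g
  ∑-distrib-+ = Sum.∑-distrib-+

  ∑-comm : ∀ {m n} (f : Fin m → Fin n → Q) → sum (λ i → sum (f i)) ≡ sum (λ j → sum (λ i → f i j))
  ∑-comm = Sum.∑-comm

  sum-⊗ˡ : ∀ {n} c (f : Fin n → Q) → sum (λ i → c ⊗ f i) ≡ c ⊗ sum f
  sum-⊗ˡ c f = sym (Sum.*-distribˡ-sum c f)

  sum-⊗ʳ : ∀ {n} c (f : Fin n → Q) → sum (λ i → f i ⊗ c) ≡ sum f ⊗ c
  sum-⊗ʳ c f = sym (Sum.*-distribʳ-sum c f)

  sum-bij : ∀ {n} (φ ψ : Fin n → Fin n) → (∀ x → ψ (φ x) ≡ x) → (∀ x → φ (ψ x) ≡ x) →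
            (f : Fin n → Q) → sum (λ i → f (φ i)) ≡ sum f
  sum-bij φ ψ ψφ φψ f = sym (Sum.sum-permute f (permutation φ ψ φψ ψφ))

opaque
  unfolding Q

  ≼-refl : ∀ {a} → a ≼ a
  ≼-refl = ℚ.≤-refl

  ≼-reflexive : ∀ {a b} → a ≡ b → a ≼ b
  ≼-reflexive = ℚ.≤-reflexive

  ≼-trans : ∀ {a b c} → a ≼ b → b ≼ c → a ≼ c
  ≼-trans = ℚ.≤-trans

  ≼-total : ∀ a b → a ≼ b ⊎ b ≼ a
  ≼-total = ℚ.≤-total

  ⊕-mono : ∀ {a b c d} → a ≼ b → c ≼ d → a ⊕ c ≼ b ⊕ d
  ⊕-mono = ℚ.+-mono-≤

  ⊗-monoˡ : ∀ {a b} c → 𝟘 ≼ c → a ≼ b → c ⊗ a ≼ c ⊗ b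
  ⊗-monoˡ c c≥0 = ℚ.*-monoˡ-≤-nonNeg c {{ℚ.nonNegative c≥0}}

  ⊗-monoʳ : ∀ {a b} c → 𝟘 ≼ c → a ≼ b → a ⊗ c ≼ b ⊗ c
  ⊗-monoʳ c c≥0 = ℚ.*-monoʳ-≤-nonNeg c {{ℚ.nonNegative c≥0}}

  𝟘≼𝟙 : 𝟘 ≼ 𝟙
  𝟘≼𝟙 = ℚ.≤ᵇ⇒≤ _

  𝟙⋠𝟘 : 𝟙 ≼ 𝟘 → ⊥
  𝟙⋠𝟘 (ℚ.*≤* (ℤ.+≤+ ()))

  ⊖-def : ∀ a b → a ⊖ b ≡ a ⊕ ⊝ b
  ⊖-def a b = refl

  ⊖≽0 : ∀ {a b} → a ≼ b → 𝟘 ≼ b ⊖ a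
  ⊖≽0 {a} {b} p = ℚ.≤-trans (ℚ.≤-reflexive (sym (ℚ.+-inverseʳ a))) (ℚ.+-monoˡ-≤ (ℚ.- a) p)

  ⊖≽0⁻¹ : ∀ {a b} → 𝟘 ≼ b ⊖ a → a ≼ b
  ⊖≽0⁻¹ {a} {b} p = subst₂ ℚ._≤_ (ℚ.+-identityˡ a)
    (solve 2 (λ a b → (b :- a) :+ a := b) refl a b) (ℚ.+-monoˡ-≤ a p)

  ∣⊕∣ : ∀ a b → ∣ a ⊕ b ∣ ≼ ∣ a ∣ ⊕ ∣ b ∣
  ∣⊕∣ = ℚ.∣p+q∣≤∣p∣+∣q∣

  ∣⊖∣ : ∀ a b → ∣ a ⊖ b ∣ ≼ ∣ a ∣ ⊕ ∣ b ∣
  ∣⊖∣ = ℚ.∣p-q∣≤∣p∣+∣q∣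

  ∣⊗∣ : ∀ a b → ∣ a ⊗ b ∣ ≡ ∣ a ∣ ⊗ ∣ b ∣
  ∣⊗∣ = ℚ.∣p*q∣≡∣p∣*∣q∣

  ∣∣≽0 : ∀ a → 𝟘 ≼ ∣ a ∣
  ∣∣≽0 = ℚ.0≤∣p∣

  ∣∣-nonneg : ∀ {a} → 𝟘 ≼ a → ∣ a ∣ ≡ a
  ∣∣-nonneg = ℚ.0≤p⇒∣p∣≡p

  ≼∣∣ : ∀ a → a ≼ ∣ a ∣
  ≼∣∣ a with ℚ.≤-total ℚ.0ℚ a
  ... | inj₁ p = ℚ.≤-reflexive (sym (ℚ.0≤p⇒∣p∣≡p p))
  ... | inj₂ p = ℚ.≤-trans p (ℚ.0≤∣p∣ a)

  sq≽0 : ∀ a → 𝟘 ≼ a ⊗ a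
  sq≽0 a with ℚ.≤-total ℚ.0ℚ a
  ... | inj₁ p = subst (ℚ._≤ a ℚ.* a) (ℚ.*-zeroʳ a) (ℚ.*-monoˡ-≤-nonNeg a {{ℚ.nonNegative p}} p)
  ... | inj₂ p = subst (ℚ._≤ a ℚ.* a) (ℚ.*-zeroʳ a) (ℚ.*-monoˡ-≤-nonPos a {{ℚ.nonPositive p}} p)

  ι : ℕ → Q
  ι zero = ℚ.0ℚ
  ι (suc n) = ℚ.1ℚ ℚ.+ ι n

  ι0 : ι 0 ≡ 𝟘
  ι0 = refl

  ι-suc : ∀ n → ι (suc n) ≡ 𝟙 ⊕ ι n
  ι-suc n = refl

  private
    1+pos : ∀ p → ℚ.0ℚ ℚ.≤ p → ℚ.0ℚ ℚ.< ℚ.1ℚ ℚ.+ p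
    1+pos p h = ℚ.<-≤-trans (ℚ.positive⁻¹ ℚ.1ℚ) (ℚ.≤-trans (ℚ.≤-reflexive (sym (ℚ.+-identityʳ ℚ.1ℚ))) (ℚ.+-monoʳ-≤ ℚ.1ℚ h))

  ι≽0 : ∀ n → 𝟘 ≼ ι n
  ι≽0 zero = ℚ.≤-refl
  ι≽0 (suc n) = ℚ.<⇒≤ (1+pos (ι n) (ι≽0 n))

  rcp : ℕ → Q
  rcp zero = ℚ.0ℚ
  rcp (suc n) = ℚ.1/_ (ι (suc n)) {{ℚ.pos⇒nonZero (ι (suc n)) {{ℚ.positive (1+pos (ι n) (ι≽0 n))}}}}

  rcp-inv : ∀ n → ι (suc n) ⊗ rcp (suc n) ≡ 𝟙
  rcp-inv n = ℚ.*-inverseʳ (ι (suc n)) {{ℚ.pos⇒nonZero (ι (suc n)) {{ℚ.positive (1+pos (ι n) (ι≽0 n))}}}}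

  ⊗-cancel-ι : ∀ n {a b} → ι (suc n) ⊗ a ≼ ι (suc n) ⊗ b → a ≼ b
  ⊗-cancel-ι n = ℚ.*-cancelˡ-≤-pos (ι (suc n)) {{ℚ.positive (1+pos (ι n) (ι≽0 n))}}

  sq-cancel : ∀ {a b} → 𝟘 ≼ b → a ⊗ a ≼ b ⊗ b → a ≼ b
  sq-cancel {a} {b} b≥0 h with ℚ.≤-total a b
  ... | inj₁ p = p
  ... | inj₂ b≤a with a ℚ.≤? b
  ...   | yes p = p
  ...   | no ¬p = ⊥-elim (ℚ.<-irrefl refl (ℚ.<-≤-trans lt h))
    where
    b<a : b ℚ.< a
    b<a = ℚ.≰⇒> ¬p
    lt : b ℚ.* b ℚ.< a ℚ.* a
    lt = ℚ.≤-<-trans (ℚ.*-monoˡ-≤-nonNeg b {{ℚ.nonNegative b≥0}} b≤a)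
           (ℚ.*-monoˡ-<-pos a {{ℚ.positive (ℚ.≤-<-trans b≥0 b<a)}} b<a)

  _≼?_ : ∀ a b → Dec (a ≼ b)
  _≼?_ = ℚ._≤?_

  sq-⊖ : ∀ a b → (a ⊖ b) ⊗ (a ⊖ b) ≡ (a ⊗ a ⊕ b ⊗ b) ⊖ (a ⊗ b ⊕ a ⊗ b)
  sq-⊖ a b = solve 2 (λ a b → (a :- b) :* (a :- b) := (a :* a :+ b :* b) :- (a :* b :+ a :* b)) refl a b

  ⊖⊕-cancel : ∀ a b → (a ⊖ b) ⊕ b ≡ a
  ⊖⊕-cancel a b = solve 2 (λ a b → (a :- b) :+ b := a) refl a b

  ⊖-self : ∀ a → a ⊖ a ≡ 𝟘
  ⊖-self = ℚ.+-inverseʳ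

  ⊗-⊖-distribˡ : ∀ c a b → c ⊗ (a ⊖ b) ≡ c ⊗ a ⊖ c ⊗ b
  ⊗-⊖-distribˡ c a b = solve 3 (λ c a b → c :* (a :- b) := c :* a :- c :* b) refl c a b

  interchange : ∀ a b c d → (a ⊕ b) ⊕ (c ⊕ d) ≡ (a ⊕ c) ⊕ (b ⊕ d)
  interchange a b c d = solve 4 (λ a b c d → (a :+ b) :+ (c :+ d) := (a :+ c) :+ (b :+ d)) refl a b c d

  ⊖-interchange : ∀ a b c d → (a ⊖ b) ⊕ (c ⊖ d) ≡ (a ⊕ c) ⊖ (b ⊕ d)
  ⊖-interchange a b c d = solve 4 (λ a b c d → (a :- b) :+ (c :- d) := (a :+ c) :- (b :+ d)) refl a b c d

  ⊗-interchange : ∀ a b c d → (a ⊗ b) ⊗ (c ⊗ d) ≡ (a ⊗ c) ⊗ (b ⊗ d)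
  ⊗-interchange a b c d = solve 4 (λ a b c d → (a :* b) :* (c :* d) := (a :* c) :* (b :* d)) refl a b c d

ι1 : ι 1 ≡ 𝟙
ι1 = trans (ι-suc 0) (trans (cong (𝟙 ⊕_) ι0) (⊕-idʳ 𝟙))

ι-+ : ∀ m n → ι (m ℕ.+ n) ≡ ι m ⊕ ι n
ι-+ zero n = sym (trans (cong (_⊕ ι n) ι0) (⊕-idˡ _))
ι-+ (suc m) n = begin
  ι (suc (m ℕ.+ n))   ≡⟨ ι-suc _ ⟩
  𝟙 ⊕ ι (m ℕ.+ n)     ≡⟨ cong (𝟙 ⊕_) (ι-+ m n) ⟩
  𝟙 ⊕ (ι m ⊕ ι n)     ≡⟨ ⊕-assoc _ _ _ ⟨
  (𝟙 ⊕ ι m) ⊕ ι n     ≡⟨ cong (_⊕ ι n) (ι-suc m) ⟨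
  ι (suc m) ⊕ ι n     ∎
  where open ≡-Reasoning

ι-* : ∀ m n → ι (m ℕ.* n) ≡ ι m ⊗ ι n
ι-* zero n = trans ι0 (sym (trans (cong (_⊗ ι n) ι0) (⊗-zeroˡ _)))
ι-* (suc m) n = begin
  ι (n ℕ.+ m ℕ.* n)      ≡⟨ ι-+ n _ ⟩
  ι n ⊕ ι (m ℕ.* n)      ≡⟨ cong₂ _⊕_ (sym (⊗-idˡ _)) (ι-* m n) ⟩
  𝟙 ⊗ ι n ⊕ ι m ⊗ ι n    ≡⟨ ⊗-distribʳ _ _ _ ⟨
  (𝟙 ⊕ ι m) ⊗ ι n        ≡⟨ cong (_⊗ ι n) (ι-suc m) ⟨
  ι (suc m) ⊗ ι n        ∎
  where open ≡-Reasoning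

≼-trans-≡ : ∀ {a b c} → a ≼ b → b ≡ c → a ≼ c
≼-trans-≡ p refl = p

≡-trans-≼ : ∀ {a b c} → a ≡ b → b ≼ c → a ≼ c
≡-trans-≼ refl p = p

⊕≽0 : ∀ {a b} → 𝟘 ≼ a → 𝟘 ≼ b → 𝟘 ≼ a ⊕ b
⊕≽0 p q = ≡-trans-≼ (sym (⊕-idˡ 𝟘)) (⊕-mono p q)

⊗≽0 : ∀ {a b} → 𝟘 ≼ a → 𝟘 ≼ b → 𝟘 ≼ a ⊗ b
⊗≽0 {a} p q = ≡-trans-≼ (sym (⊗-zeroʳ a)) (⊗-monoˡ a p q)

⊗-mono : ∀ {a b c d} → 𝟘 ≼ a → 𝟘 ≼ d → a ≼ b → c ≼ d → a ⊗ c ≼ b ⊗ d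
⊗-mono {a} {d = d} a≥0 d≥0 p q = ≼-trans (⊗-monoˡ a a≥0 q) (⊗-monoʳ d d≥0 p)

≼⊕ʳ : ∀ {a b} → 𝟘 ≼ b → a ≼ a ⊕ b
≼⊕ʳ {a} p = ≡-trans-≼ (sym (⊕-idʳ a)) (⊕-mono ≼-refl p)

≼⊕ˡ : ∀ {a b} → 𝟘 ≼ b → a ≼ b ⊕ a
≼⊕ˡ {a} p = ≡-trans-≼ (sym (⊕-idˡ a)) (⊕-mono p ≼-refl)

ι-mono : ∀ {m n} → m ℕ.≤ n → ι m ≼ ι n
ι-mono {m} {n} m≤n with ℕ.m≤n⇒∃[o]m+o≡n m≤n
... | o , refl = ≼-trans-≡ (≼⊕ʳ (ι≽0 o)) (sym (ι-+ m o))

ι-cancel : ∀ {m n} → ι m ≼ ι n → m ℕ.≤ n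
ι-cancel {m} {n} p with m ℕ.≤? n
... | yes q = q
... | no ¬q = ⊥-elim (𝟙⋠𝟘 (≼-trans-≡ (≡-trans-≼ (sym (⊖⊕-cancel 𝟙 (ι n)))
      (≡-trans-≼ (trans (⊖⊕-cancel 𝟙 (ι n)) (sym (cancel 𝟙 (ι n)))) (⊕-mono step ≼-refl))) (cancel 𝟘 (ι n))))
  where
  cancel : ∀ a b → (a ⊕ b) ⊕ ⊝ b ≡ a
  cancel a b = trans (⊕-assoc a b (⊝ b)) (trans (cong (a ⊕_) (trans (sym (⊖-def b b)) (⊖-self b))) (⊕-idʳ a))
  step : 𝟙 ⊕ ι n ≼ 𝟘 ⊕ ι n
  step = ≡-trans-≼ (sym (ι-suc n)) (≼-trans (ι-mono (ℕ.≰⇒> ¬q)) (≼-trans-≡ p (sym (⊕-idˡ _))))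

rcp≽0 : ∀ n → 𝟘 ≼ rcp (suc n)
rcp≽0 n = ⊗-cancel-ι n (≡-trans-≼ (⊗-zeroʳ _) (≼-trans-≡ 𝟘≼𝟙 (sym (rcp-inv n))))

infixr 9 _^^_
_^^_ : Q → ℕ → Q
a ^^ zero = 𝟙
a ^^ suc n = a ⊗ a ^^ n

^^≽0 : ∀ {a} n → 𝟘 ≼ a → 𝟘 ≼ a ^^ n
^^≽0 zero p = 𝟘≼𝟙
^^≽0 (suc n) p = ⊗≽0 p (^^≽0 n p)

^^-+ : ∀ a m n → a ^^ (m ℕ.+ n) ≡ a ^^ m ⊗ a ^^ n
^^-+ a zero n = sym (⊗-idˡ _)
^^-+ a (suc m) n = trans (cong (a ⊗_) (^^-+ a m n)) (sym (⊗-assoc _ _ _))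

^^-⊗ : ∀ a b n → (a ⊗ b) ^^ n ≡ a ^^ n ⊗ b ^^ n
^^-⊗ a b zero = sym (⊗-idˡ _)
^^-⊗ a b (suc n) = trans (cong ((a ⊗ b) ⊗_) (^^-⊗ a b n)) (⊗-interchange a b _ _)

^^-mono : ∀ {a b} n → 𝟘 ≼ a → a ≼ b → a ^^ n ≼ b ^^ n
^^-mono zero _ _ = ≼-refl
^^-mono (suc n) p q = ⊗-mono p (^^≽0 n (≼-trans p q)) q (^^-mono n p q)

𝟙^^ : ∀ n → 𝟙 ^^ n ≡ 𝟙
𝟙^^ zero = refl
𝟙^^ (suc n) = trans (⊗-idˡ _) (𝟙^^ n)

ι-^ : ∀ m n → ι (m ℕ.^ n) ≡ ι m ^^ n
ι-^ m zero = ι1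
ι-^ m (suc n) = trans (ι-* m _) (cong (ι m ⊗_) (ι-^ m n))

opaque
  unfolding sum

  sum-mono : ∀ {n} {f g : Fin n → Q} → (∀ i → f i ≼ g i) → sum f ≼ sum g
  sum-mono {zero} p = ≼-refl
  sum-mono {suc n} p = ⊕-mono (p zero) (sum-mono (p ∘ suc))

  sum-0 : ∀ n → sum {n} (λ _ → 𝟘) ≡ 𝟘
  sum-0 zero = refl
  sum-0 (suc n) = trans (⊕-idˡ _) (sum-0 n)

  sum≽0 : ∀ {n} {f : Fin n → Q} → (∀ i → 𝟘 ≼ f i) → 𝟘 ≼ sum f
  sum≽0 {n} p = ≡-trans-≼ (sym (sum-0 n)) (sum-mono p)

  sum-const : ∀ n c → sum {n} (λ _ → c) ≡ ι n ⊗ c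
  sum-const zero c = sym (trans (cong (_⊗ c) ι0) (⊗-zeroˡ c))
  sum-const (suc n) c = begin
    c ⊕ sum {n} (λ _ → c)  ≡⟨ cong₂ _⊕_ (sym (⊗-idˡ c)) (sum-const n c) ⟩
    𝟙 ⊗ c ⊕ ι n ⊗ c        ≡⟨ ⊗-distribʳ c 𝟙 (ι n) ⟨
    (𝟙 ⊕ ι n) ⊗ c          ≡⟨ cong (_⊗ c) (ι-suc n) ⟨
    ι (suc n) ⊗ c          ∎
    where open ≡-Reasoning

  sum-⊖ : ∀ {n} (f g : Fin n → Q) → sum (λ i → f i ⊖ g i) ≡ sum f ⊖ sum g
  sum-⊖ {zero} f g = sym (⊖-self 𝟘)
  sum-⊖ {suc n} f g = trans (cong (f zero ⊖ g zero ⊕_) (sum-⊖ (f ∘ suc) (g ∘ suc))) (⊖-interchange _ _ _ _)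

  ∣sum∣ : ∀ {n} (f : Fin n → Q) → ∣ sum f ∣ ≼ sum (λ i → ∣ f i ∣)
  ∣sum∣ {zero} f = ≼-reflexive (∣∣-nonneg ≼-refl)
  ∣sum∣ {suc n} f = ≼-trans (∣⊕∣ _ _) (⊕-mono ≼-refl (∣sum∣ (f ∘ suc)))

  term≼sum : ∀ {n} {f : Fin n → Q} → (∀ i → 𝟘 ≼ f i) → ∀ i → f i ≼ sum f
  term≼sum {suc n} p zero = ≼⊕ʳ (sum≽0 (p ∘ suc))
  term≼sum {suc n} p (suc i) = ≼-trans (term≼sum (p ∘ suc) i) (≼⊕ˡ (p zero))

-- Indicators and the Cauchy-Schwarz inequality.

[[_]] : Bool → Q
[[ true ]] = 𝟙
[[ false ]] = 𝟘

[[]]≽0 : ∀ b → 𝟘 ≼ [[ b ]]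
[[]]≽0 true = 𝟘≼𝟙
[[]]≽0 false = ≼-refl

[[]]≼1 : ∀ b → [[ b ]] ≼ 𝟙
[[]]≼1 true = ≼-refl
[[]]≼1 false = 𝟘≼𝟙

[[]]-idem : ∀ b → [[ b ]] ⊗ [[ b ]] ≡ [[ b ]]
[[]]-idem true = ⊗-idˡ _
[[]]-idem false = ⊗-zeroˡ _

-- Adding a pair uses 2 x s ≤ F₀ G + F G₀, which follows from x² ≤ F₀ G₀ and s² ≤ F G.
cs-step : ∀ x s F₀ G₀ F G → 𝟘 ≼ F₀ → 𝟘 ≼ G₀ → 𝟘 ≼ F → 𝟘 ≼ G → x ⊗ x ≼ F₀ ⊗ G₀ → s ⊗ s ≼ F ⊗ G →
          (x ⊕ s) ⊗ (x ⊕ s) ≼ (F₀ ⊕ F) ⊗ (G₀ ⊕ G)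
cs-step x s F₀ G₀ F G F₀≥0 G₀≥0 F≥0 G≥0 h₀ h = ≡-trans-≼ (e₁ x s) (≼-trans-≡ (⊕-mono (⊕-mono h₀ mid) h) (e₂ F₀ G₀ F G))
  where
  opaque
    unfolding Q
    e₁ : ∀ x s → (x ⊕ s) ⊗ (x ⊕ s) ≡ x ⊗ x ⊕ (x ⊗ s ⊕ x ⊗ s) ⊕ s ⊗ s
    e₁ x s = solve 2 (λ x s → (x :+ s) :* (x :+ s) := x :* x :+ (x :* s :+ x :* s) :+ s :* s) refl x s
    e₂ : ∀ F₀ G₀ F G → F₀ ⊗ G₀ ⊕ (F₀ ⊗ G ⊕ F ⊗ G₀) ⊕ F ⊗ G ≡ (F₀ ⊕ F) ⊗ (G₀ ⊕ G)
    e₂ F₀ G₀ F G = solve 4 (λ F₀ G₀ F G → F₀ :* G₀ :+ (F₀ :* G :+ F :* G₀) :+ F :* G := (F₀ :+ F) :* (G₀ :+ G)) refl F₀ G₀ F G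
    e₃ : ∀ x y → (x ⊕ y) ⊗ (x ⊕ y) ≡ (x ⊖ y) ⊗ (x ⊖ y) ⊕ (x ⊗ y ⊕ x ⊗ y ⊕ (x ⊗ y ⊕ x ⊗ y))
    e₃ x y = solve 2 (λ x y → (x :+ y) :* (x :+ y) := (x :- y) :* (x :- y) :+ (x :* y :+ x :* y :+ (x :* y :+ x :* y))) refl x y
    e₄ : ∀ x s → (x ⊗ s ⊕ x ⊗ s) ⊗ (x ⊗ s ⊕ x ⊗ s) ≡ (x ⊗ x) ⊗ (s ⊗ s) ⊕ (x ⊗ x) ⊗ (s ⊗ s) ⊕ ((x ⊗ x) ⊗ (s ⊗ s) ⊕ (x ⊗ x) ⊗ (s ⊗ s))
    e₄ x s = solve 2 (λ x s → (x :* s :+ x :* s) :* (x :* s :+ x :* s) := (x :* x) :* (s :* s) :+ (x :* x) :* (s :* s) :+ ((x :* x) :* (s :* s) :+ (x :* x) :* (s :* s))) refl x s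
    e₅ : ∀ F₀ G₀ F G → (F₀ ⊗ G₀) ⊗ (F ⊗ G) ≡ (F₀ ⊗ G) ⊗ (F ⊗ G₀)
    e₅ F₀ G₀ F G = solve 4 (λ F₀ G₀ F G → (F₀ :* G₀) :* (F :* G) := (F₀ :* G) :* (F :* G₀)) refl F₀ G₀ F G
  u v : Q
  u = F₀ ⊗ G
  v = F ⊗ G₀
  t : (x ⊗ x) ⊗ (s ⊗ s) ≼ u ⊗ v
  t = ≼-trans-≡ (⊗-mono (sq≽0 x) (⊗≽0 F≥0 G≥0) h₀ h) (e₅ F₀ G₀ F G)
  mid : x ⊗ s ⊕ x ⊗ s ≼ u ⊕ v
  mid = sq-cancel (⊕≽0 (⊗≽0 F₀≥0 G≥0) (⊗≽0 F≥0 G₀≥0))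
    (≡-trans-≼ (e₄ x s) (≼-trans (⊕-mono (⊕-mono t t) (⊕-mono t t))
      (≼-trans-≡ (≼⊕ˡ (sq≽0 (u ⊖ v))) (sym (e₃ u v)))))

opaque
  unfolding sum

  cauchy-schwarz′ : ∀ {n} (x F G : Fin n → Q) → (∀ i → 𝟘 ≼ F i) → (∀ i → 𝟘 ≼ G i) → (∀ i → x i ⊗ x i ≼ F i ⊗ G i) →
    sum x ⊗ sum x ≼ sum F ⊗ sum G
  cauchy-schwarz′ {zero} x F G _ _ _ = ≼-refl
  cauchy-schwarz′ {suc n} x F G F≥0 G≥0 h = cs-step (x zero) _ (F zero) (G zero) _ _ (F≥0 zero) (G≥0 zero)
    (sum≽0 (F≥0 ∘ suc)) (sum≽0 (G≥0 ∘ suc)) (h zero) (cauchy-schwarz′ (x ∘ suc) (F ∘ suc) (G ∘ suc) (F≥0 ∘ suc) (G≥0 ∘ suc) (h ∘ suc))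

cauchy-schwarz : ∀ {n} (f g : Fin n → Q) →
  sum (λ i → f i ⊗ g i) ⊗ sum (λ i → f i ⊗ g i) ≼ sum (λ i → f i ⊗ f i) ⊗ sum (λ i → g i ⊗ g i)
cauchy-schwarz f g = cauchy-schwarz′ _ _ _ (λ i → sq≽0 (f i)) (λ i → sq≽0 (g i)) (λ i → ≼-reflexive (⊗-interchange _ _ _ _))

sq-⊕≼ : ∀ a b → (a ⊕ b) ⊗ (a ⊕ b) ≼ (a ⊗ a ⊕ a ⊗ a) ⊕ (b ⊗ b ⊕ b ⊗ b)
sq-⊕≼ a b = ≼-trans-≡ (≼⊕ʳ (sq≽0 (a ⊖ b))) (e a b)
  where
  opaque
    unfolding Q
    e : ∀ a b → (a ⊕ b) ⊗ (a ⊕ b) ⊕ (a ⊖ b) ⊗ (a ⊖ b) ≡ (a ⊗ a ⊕ a ⊗ a) ⊕ (b ⊗ b ⊕ b ⊗ b)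
    e a b = solve 2 (λ a b → (a :+ b) :* (a :+ b) :+ (a :- b) :* (a :- b) := (a :* a :+ a :* a) :+ (b :* b :+ b :* b)) refl a b

sq-sum≼ : ∀ {n} (f : Fin n → Q) → sum f ⊗ sum f ≼ ι n ⊗ sum (λ i → f i ⊗ f i)
sq-sum≼ {n} f = ≡-trans-≼ (cong (λ z → z ⊗ z) (sum-cong (λ i → sym (⊗-idˡ (f i)))))
  (≼-trans-≡ (cauchy-schwarz (λ _ → 𝟙) f) (cong (_⊗ sum (λ i → f i ⊗ f i))
    (trans (sum-const n (𝟙 ⊗ 𝟙)) (trans (cong (ι n ⊗_) (⊗-idˡ 𝟙)) (⊗-idʳ _)))))

-- Smoothing of sequences and averages over random shifts.

Seq : Set
Seq = ℤ → Q

Bounded : Q → Seq → Set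
Bounded C g = ∀ y → ∣ g y ∣ ≼ C

record Unit (c : ℤ) : Set where
  constructor unit
  field ±1 : c ≡ + 1 ⊎ c ≡ ℤ.- (+ 1)

unit? : ∀ c → Dec (Unit c)
unit? c with c ℤ.≟ + 1 | c ℤ.≟ ℤ.- (+ 1)
... | yes p | _     = yes (unit (inj₁ p))
... | no _  | yes q = yes (unit (inj₂ q))
... | no p  | no q  = no λ { (unit (inj₁ x)) → p x ; (unit (inj₂ x)) → q x }

∣⊖∣-trans : ∀ a b c → ∣ a ⊖ c ∣ ≼ ∣ a ⊖ b ∣ ⊕ ∣ b ⊖ c ∣
∣⊖∣-trans a b c = ≡-trans-≼ (cong ∣_∣ (e a b c)) (∣⊕∣ (a ⊖ b) (b ⊖ c))
  where
  opaque
    unfolding Q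
    e : ∀ a b c → a ⊖ c ≡ (a ⊖ b) ⊕ (b ⊖ c)
    e a b c = solve 3 (λ a b c → a :- c := (a :- b) :+ (b :- c)) refl a b c

opaque
  unfolding Q
  ∣⊖∣-comm : ∀ a b → ∣ a ⊖ b ∣ ≡ ∣ b ⊖ a ∣
  ∣⊖∣-comm a b = trans (sym (ℚ.∣-p∣≡∣p∣ (a ℚ.- b))) (cong ∣_∣ (solve 2 (λ a b → :- (a :- b) := b :- a) refl a b))

∣sum∣≼ : ∀ {n} {f : Fin n → Q} {B} → (∀ i → ∣ f i ∣ ≼ B) → ∣ sum f ∣ ≼ ι n ⊗ B
∣sum∣≼ {n} {f} {B} p = ≼-trans (∣sum∣ f) (≼-trans-≡ (sum-mono p) (sum-const n B))

two⊗ : ∀ C → ι 2 ⊗ C ≡ C ⊕ C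
two⊗ C = trans (cong (_⊗ C) (trans (ι-suc 1) (cong (𝟙 ⊕_) ι1))) (trans (⊗-distribʳ C 𝟙 𝟙) (cong₂ _⊕_ (⊗-idˡ C) (⊗-idˡ C)))

module Window (h : ℕ) where

  h⁻² : Q
  h⁻² = rcp (suc h) ⊗ rcp (suc h)

  mean : (Fin (suc h) → Fin (suc h) → Q) → Q
  mean F = h⁻² ⊗ sum (λ t → sum (F t))

  -- Averaging over the differences t − t′ makes Avg self-adjoint; P = 1 − Avg kills what varies slowly on the scale h.
  off : ℤ → Fin (suc h) → Fin (suc h) → ℤ
  off y t t′ = y ℤ.+ + toℕ t ℤ.- + toℕ t′

  Avg P : Seq → Seq
  Avg g y = mean (λ t t′ → g (off y t t′))
  P g y = g y ⊖ Avg g y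

  mean-cong : ∀ {F G} → (∀ t t′ → F t t′ ≡ G t t′) → mean F ≡ mean G
  mean-cong e = cong (h⁻² ⊗_) (sum-cong λ t → sum-cong (e t))

  private
    h⁻²≽0 : 𝟘 ≼ h⁻²
    h⁻²≽0 = ⊗≽0 (rcp≽0 h) (rcp≽0 h)

    h⁻²-inv : ∀ B → h⁻² ⊗ (ι (suc h) ⊗ (ι (suc h) ⊗ B)) ≡ B
    h⁻²-inv B = begin
      h⁻² ⊗ (ι (suc h) ⊗ (ι (suc h) ⊗ B))    ≡⟨ e (rcp (suc h)) (ι (suc h)) B ⟩
      (ι (suc h) ⊗ rcp (suc h)) ⊗ (ι (suc h) ⊗ rcp (suc h)) ⊗ B  ≡⟨ cong₂ (λ a b → a ⊗ b ⊗ B) (rcp-inv h) (rcp-inv h) ⟩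
      𝟙 ⊗ 𝟙 ⊗ B                               ≡⟨ cong (_⊗ B) (⊗-idˡ 𝟙) ⟩
      𝟙 ⊗ B                                   ≡⟨ ⊗-idˡ B ⟩
      B                                        ∎
      where
      open ≡-Reasoning
      opaque
        unfolding Q
        e : ∀ r i B → (r ⊗ r) ⊗ (i ⊗ (i ⊗ B)) ≡ (i ⊗ r) ⊗ (i ⊗ r) ⊗ B
        e r i B = solve 3 (λ r i B → (r :* r) :* (i :* (i :* B)) := (i :* r) :* (i :* r) :* B) refl r i B

  mean-const : ∀ x → mean (λ _ _ → x) ≡ x
  mean-const x = trans (cong (h⁻² ⊗_) (trans (sum-cong (λ (t : Fin (suc h)) → sum-const (suc h) x)) (sum-const (suc h) _))) (h⁻²-inv x)

  mean-⊖ : ∀ F G → mean (λ t t′ → F t t′ ⊖ G t t′) ≡ mean F ⊖ mean G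
  mean-⊖ F G = trans (cong (h⁻² ⊗_) (trans (sum-cong (λ t → sum-⊖ (F t) (G t))) (sum-⊖ _ _))) (⊗-⊖-distribˡ _ _ _)

  mean-sum : ∀ {n} (F : Fin n → Fin (suc h) → Fin (suc h) → Q) →
             mean (λ t t′ → sum (λ a → F a t t′)) ≡ sum (λ a → mean (F a))
  mean-sum F = trans (cong (h⁻² ⊗_) (trans (sum-cong (λ t → ∑-comm (λ t′ a → F a t t′))) (∑-comm (λ t a → sum (F a t)))))
    (sym (sum-⊗ˡ h⁻² _))

  ∣mean∣ : ∀ {F B} → (∀ t t′ → ∣ F t t′ ∣ ≼ B) → ∣ mean F ∣ ≼ B
  ∣mean∣ {F} {B} p = ≡-trans-≼ (trans (∣⊗∣ h⁻² _) (cong (_⊗ ∣ sum (λ t → sum (F t)) ∣) (∣∣-nonneg h⁻²≽0)))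
    (≼-trans-≡ (⊗-monoˡ h⁻² h⁻²≽0 (∣sum∣≼ (λ t → ∣sum∣≼ (p t)))) (h⁻²-inv B))

  P-as-mean : ∀ g y → P g y ≡ mean (λ t t′ → g y ⊖ g (off y t t′))
  P-as-mean g y = trans (cong (_⊖ Avg g y) (sym (mean-const (g y)))) (sym (mean-⊖ _ _))

  P-cong : ∀ {f g} → (∀ y → f y ≡ g y) → ∀ y → P f y ≡ P g y
  P-cong e y = cong₂ _⊖_ (e y) (mean-cong λ t t′ → e _)

  P-bounded : ∀ {C g} → Bounded C g → Bounded (C ⊕ C) (P g)
  P-bounded b y = ≼-trans (∣⊖∣ _ _) (⊕-mono (b y) (∣mean∣ λ t t′ → b _))

  off-shift : ∀ y k t t′ → off (y ℤ.+ k) t t′ ≡ off y t t′ ℤ.+ k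
  off-shift y k t t′ = e y k (+ toℕ t) (+ toℕ t′)
    where
    e : ∀ y k a b → y ℤ.+ k ℤ.+ a ℤ.- b ≡ y ℤ.+ a ℤ.- b ℤ.+ k
    e = ℤ-Ring.solve-∀

  P-sum : ∀ {n} (G : Fin n → Seq) y → P (λ z → sum (λ a → G a z)) y ≡ sum (λ a → P (G a) y)
  P-sum G y = sym (trans (sum-⊖ _ _) (cong (sum (λ a → G a y) ⊖_) (sym (mean-sum (λ a t t′ → G a (off y t t′))))))

  P-sum-shift : ∀ {n} (g : Seq) (k : Fin n → ℤ) y →
                sum (λ a → P g (y ℤ.+ k a)) ≡ P (λ z → sum (λ a → g (z ℤ.+ k a))) y
  P-sum-shift g k y = trans (sum-⊖ _ _) (cong (sum (λ a → g (y ℤ.+ k a)) ⊖_)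
    (trans (sum-cong (λ a → mean-cong λ t t′ → cong g (off-shift y (k a) t t′))) (sym (mean-sum _))))

  Pow : ℕ → Seq → Seq
  Pow zero g = g
  Pow (suc j) g = Pow j (P g)

  Pow-cong : ∀ j {f g} → (∀ y → f y ≡ g y) → ∀ y → Pow j f y ≡ Pow j g y
  Pow-cong zero e = e
  Pow-cong (suc j) e = Pow-cong j (P-cong e)

  Pow-sum-shift : ∀ {n} j (g : Seq) (k : Fin n → ℤ) y →
                  sum (λ a → Pow j g (y ℤ.+ k a)) ≡ Pow j (λ z → sum (λ a → g (z ℤ.+ k a))) y
  Pow-sum-shift zero g k y = refl
  Pow-sum-shift (suc j) g k y = trans (Pow-sum-shift j (P g) k y) (Pow-cong j (P-sum-shift g k) y)

  Pow-sum : ∀ {n} j (G : Fin n → Seq) y → Pow j (λ z → sum (λ a → G a z)) y ≡ sum (λ a → Pow j (G a) y)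
  Pow-sum zero G y = refl
  Pow-sum (suc j) G y = trans (Pow-cong j (P-sum G) y) (Pow-sum j (λ a → P (G a)) y)

  P-shift : ∀ g k y → P g (y ℤ.+ k) ≡ P (λ z → g (z ℤ.+ k)) y
  P-shift g k y = cong (g (y ℤ.+ k) ⊖_) (mean-cong λ t t′ → cong g (off-shift y k t t′))

  Pow-shift : ∀ j g k y → Pow j g (y ℤ.+ k) ≡ Pow j (λ z → g (z ℤ.+ k)) y
  Pow-shift zero g k y = refl
  Pow-shift (suc j) g k y = trans (Pow-shift j (P g) k y) (Pow-cong j (P-shift g k) y)

  P-⊗ : ∀ c g y → P (λ z → c ⊗ g z) y ≡ c ⊗ P g y
  P-⊗ c g y = trans (cong (c ⊗ g y ⊖_) (trans (cong (h⁻² ⊗_) (trans (sum-cong (λ t → sum-⊗ˡ c _)) (sum-⊗ˡ c _)))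
    (trans (sym (⊗-assoc _ _ _)) (trans (cong (_⊗ _) (⊗-comm h⁻² c)) (⊗-assoc _ _ _))))) (sym (⊗-⊖-distribˡ c _ _))

  Pow-⊗ : ∀ j c g y → Pow j (λ z → c ⊗ g z) y ≡ c ⊗ Pow j g y
  Pow-⊗ zero c g y = refl
  Pow-⊗ (suc j) c g y = trans (Pow-cong j (P-⊗ c g) y) (Pow-⊗ j c (P g) y)

  Pow-bounded : ∀ j {C g} → Bounded C g → Bounded (ι 2 ^^ j ⊗ C) (Pow j g)
  Pow-bounded zero b y = ≼-trans-≡ (b y) (sym (⊗-idˡ _))
  Pow-bounded (suc j) {C} b y = ≼-trans-≡ (Pow-bounded j (P-bounded b) y)
    (trans (cong (ι 2 ^^ j ⊗_) (sym (two⊗ C))) (trans (sym (⊗-assoc _ _ _)) (cong (_⊗ C) (⊗-comm _ _))))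

#units : ∀ {E} → (Fin E → ℤ) → ℕ
#units {zero} c = 0
#units {suc E} c = if does (unit? (c zero)) then suc (#units (c ∘ suc)) else #units (c ∘ suc)

module Average (A : ℕ) where

  U : ℤ → Seq → Seq
  U c g y = sum {A} (λ a → g (y ℤ.+ c ℤ.* + toℕ a))

  U-bounded : ∀ {c C g} → Bounded C g → Bounded (ι A ⊗ C) (U c g)
  U-bounded b y = ∣sum∣≼ λ a → b _

  private
    telescope : ∀ n (g : ℕ → Q) → sum {n} (λ a → g (toℕ a)) ⊖ sum {n} (λ a → g (suc (toℕ a))) ≡ g 0 ⊖ g n
    telescope zero g = trans (cong₂ _⊖_ (sum-zero _) (sum-zero _)) (trans (⊖-self 𝟘) (sym (⊖-self (g 0))))
    telescope (suc n) g = trans (cong₂ _⊖_ (sum-suc {n} _) (sum-suc {n} _)) (trans (e _ _ _ _) (trans (cong ((g 0 ⊖ g 1) ⊕_) (telescope n (g ∘ suc))) (e′ _ _ _)))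
      where
      opaque
        unfolding Q
        e : ∀ a b c d → (a ⊕ b) ⊖ (c ⊕ d) ≡ (a ⊖ c) ⊕ (b ⊖ d)
        e a b c d = solve 4 (λ a b c d → (a :+ b) :- (c :+ d) := (a :- c) :+ (b :- d)) refl a b c d
        e′ : ∀ a b c → (a ⊖ b) ⊕ (b ⊖ c) ≡ a ⊖ c
        e′ a b c = solve 3 (λ a b c → (a :- b) :+ (b :- c) := a :- c) refl a b c

  -- The two sums have all but one term in common, so the difference telescopes to two values of
  -- `g`, whatever the number A of terms.
  U-lip₁ : ∀ {C g} → Bounded C g → ∀ y → ∣ U (+ 1) g y ⊖ U (+ 1) g (y ℤ.+ + 1) ∣ ≼ C ⊕ C
  U-lip₁ {C} {g} b y = ≡-trans-≼ (cong ∣_∣ (trans (cong₂ _⊖_ (sum-cong λ a → cong (λ z → g (y ℤ.+ z)) (ℤ.*-identityˡ (+ toℕ a)))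
      (sum-cong λ a → cong g (e y (toℕ a)))) (telescope A (λ n → g (y ℤ.+ + n)))))
      (≼-trans (∣⊖∣ _ _) (⊕-mono (b _) (b _)))
    where
    e : ∀ y n → y ℤ.+ + 1 ℤ.+ + 1 ℤ.* + n ≡ y ℤ.+ + suc n
    e y n = e′ y (+ n)
      where
      e′ : ∀ y n → y ℤ.+ + 1 ℤ.+ + 1 ℤ.* n ≡ y ℤ.+ (+ 1 ℤ.+ n)
      e′ = ℤ-Ring.solve-∀

  -- The reflection z ↦ -z turns the coefficient -1 into +1.
  U-lip₁⁻ : ∀ {C g} → Bounded C g → ∀ y → ∣ U (ℤ.- + 1) g y ⊖ U (ℤ.- + 1) g (y ℤ.+ + 1) ∣ ≼ C ⊕ C
  U-lip₁⁻ {C} {g} b y = ≡-trans-≼ (trans (cong ∣_∣ (cong₂ _⊖_ (sum-cong λ a → cong g (e y (+ toℕ a))) (sum-cong λ a → cong g (e′ y (+ toℕ a)))))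
      (∣⊖∣-comm _ _)) (U-lip₁ {g = λ z → g (ℤ.- z)} (λ z → b _) (ℤ.- y ℤ.- + 1))
    where
    e : ∀ y n → y ℤ.+ ℤ.- + 1 ℤ.* n ≡ ℤ.- (ℤ.- y ℤ.- + 1 ℤ.+ + 1 ℤ.+ + 1 ℤ.* n)
    e = ℤ-Ring.solve-∀
    e′ : ∀ y n → y ℤ.+ + 1 ℤ.+ ℤ.- + 1 ℤ.* n ≡ ℤ.- (ℤ.- y ℤ.- + 1 ℤ.+ + 1 ℤ.* n)
    e′ = ℤ-Ring.solve-∀

  U-lip : ∀ {c C g} → Unit c → Bounded C g → ∀ n y → ∣ U c g y ⊖ U c g (y ℤ.+ + n) ∣ ≼ ι n ⊗ (C ⊕ C)
  U-lip {c} {C} {g} u b zero y = ≡-trans-≼ (trans (cong ∣_∣ (trans (cong (λ z → U c g y ⊖ U c g z) (ℤ.+-identityʳ y)) (⊖-self _))) (∣∣-nonneg ≼-refl))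
    (≼-reflexive (sym (trans (cong (_⊗ (C ⊕ C)) ι0) (⊗-zeroˡ _))))
  U-lip {c} {C} {g} u b (suc n) y = ≼-trans (∣⊖∣-trans _ (U c g (y ℤ.+ + n)) _)
    (≼-trans-≡ (⊕-mono (U-lip u b n y) (≡-trans-≼ (cong (λ z → ∣ U c g (y ℤ.+ + n) ⊖ U c g z ∣) (e y (+ n))) (one u (y ℤ.+ + n))))
      (trans (⊕-comm _ _) (trans (cong (_⊕ ι n ⊗ (C ⊕ C)) (sym (⊗-idˡ _))) (trans (sym (⊗-distribʳ _ _ _)) (cong (_⊗ (C ⊕ C)) (sym (ι-suc n)))))))
    where
    e : ∀ y n → y ℤ.+ (+ 1 ℤ.+ n) ≡ y ℤ.+ n ℤ.+ + 1
    e = ℤ-Ring.solve-∀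
    one : ∀ {c} → Unit c → ∀ y → ∣ U c g y ⊖ U c g (y ℤ.+ + 1) ∣ ≼ C ⊕ C
    one (unit (inj₁ refl)) = U-lip₁ b
    one (unit (inj₂ refl)) = U-lip₁⁻ b

  ΣS : ∀ E → ((Fin E → Fin A) → Q) → Q
  ΣS zero F = F λ ()
  ΣS (suc E) F = ΣS E λ s → sum λ a → F (a ∷ᶠ s)

  dot : ∀ {E} → (Fin E → ℤ) → (Fin E → Fin A) → ℤ
  dot {zero} c s = + 0
  dot {suc E} c s = c zero ℤ.* + toℕ (s zero) ℤ.+ dot (c ∘ suc) (s ∘ suc)

  ΣS-cong : ∀ E {F G : (Fin E → Fin A) → Q} → (∀ s → F s ≡ G s) → ΣS E F ≡ ΣS E G
  ΣS-cong zero e = e _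
  ΣS-cong (suc E) e = ΣS-cong E λ s → sum-cong λ a → e _

  ΣS-⊗ : ∀ E c (F : (Fin E → Fin A) → Q) → ΣS E (λ s → c ⊗ F s) ≡ c ⊗ ΣS E F
  ΣS-⊗ zero c F = refl
  ΣS-⊗ (suc E) c F = trans (ΣS-cong E λ s → sum-⊗ˡ c _) (ΣS-⊗ E c _)

  ΣS-⊕ : ∀ E (F G : (Fin E → Fin A) → Q) → ΣS E (λ s → F s ⊕ G s) ≡ ΣS E F ⊕ ΣS E G
  ΣS-⊕ zero F G = refl
  ΣS-⊕ (suc E) F G = trans (ΣS-cong E λ s → ∑-distrib-+ _ _) (ΣS-⊕ E _ _)

  ΣS-sum : ∀ E {n} (F : Fin n → (Fin E → Fin A) → Q) → ΣS E (λ s → sum (λ i → F i s)) ≡ sum (λ i → ΣS E (F i))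
  ΣS-sum zero F = refl
  ΣS-sum (suc E) F = trans (ΣS-cong E λ s → ∑-comm (λ a i → F i (a ∷ᶠ s))) (ΣS-sum E _)

  private
    shuffle : ∀ y u v → y ℤ.+ (u ℤ.+ v) ≡ y ℤ.+ v ℤ.+ u
    shuffle = ℤ-Ring.solve-∀

  module _ (h : ℕ) (κ⁻¹ : Q) (κ⁻¹≽0 : 𝟘 ≼ κ⁻¹) (short : ι 4 ⊗ ι (suc h) ≼ ι 2 ⊗ (ι A ⊗ κ⁻¹)) where

    open Window h

    -- `P` averages differences of values at distance at most h in two directions, and `U c g`
    -- changes by at most 2C per unit step. This gives 4(h+1)C, a gain of order κ over the trivial
    -- bound 2AC by the hypothesis `short`.
    PU-bounded : ∀ {c C g} → Unit c → 𝟘 ≼ C → Bounded C g → Bounded (ι 2 ⊗ (ι A ⊗ κ⁻¹) ⊗ C) (P (U c g))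
    PU-bounded {c} {C} {g} u C≥0 b y = ≡-trans-≼ (cong ∣_∣ (P-as-mean (U c g) y))
      (≼-trans (∣mean∣ λ t t′ → ≼-trans (∣⊖∣-trans _ (U c g (y ℤ.- + toℕ t′)) _)
        (⊕-mono (≡-trans-≼ (trans (∣⊖∣-comm _ _) (cong (λ z → ∣ U c g (y ℤ.- + toℕ t′) ⊖ U c g z ∣) (e₁ y (+ toℕ t′))))
                 (≼-trans (U-lip u b (toℕ t′) (y ℤ.- + toℕ t′)) (bnd t′)))
                (≡-trans-≼ (cong (λ z → ∣ U c g (y ℤ.- + toℕ t′) ⊖ U c g z ∣) (e₂ y (+ toℕ t) (+ toℕ t′)))
                 (≼-trans (U-lip u b (toℕ t) (y ℤ.- + toℕ t′)) (bnd t)))))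
        (≡-trans-≼ (four (ι (suc h)) C) (⊗-monoʳ C C≥0 short)))
      where
      e₁ : ∀ y a → y ≡ y ℤ.- a ℤ.+ a
      e₁ = ℤ-Ring.solve-∀
      e₂ : ∀ y a b → y ℤ.+ a ℤ.- b ≡ y ℤ.- b ℤ.+ a
      e₂ = ℤ-Ring.solve-∀
      bnd : ∀ t → ι (toℕ t) ⊗ (C ⊕ C) ≼ ι (suc h) ⊗ (C ⊕ C)
      bnd t = ⊗-monoʳ _ (⊕≽0 C≥0 C≥0) (ι-mono (ℕ.<⇒≤ (Fin.toℕ<n t)))
      four : ∀ i C → i ⊗ (C ⊕ C) ⊕ i ⊗ (C ⊕ C) ≡ ι 4 ⊗ i ⊗ C
      four i C = trans (e i C) (cong (λ z → z ⊗ i ⊗ C) (sym four′))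
        where
        four′ : ι 4 ≡ 𝟙 ⊕ (𝟙 ⊕ (𝟙 ⊕ 𝟙))
        four′ = trans (ι-suc 3) (cong (𝟙 ⊕_) (trans (ι-suc 2) (cong (𝟙 ⊕_) (trans (ι-suc 1) (cong (𝟙 ⊕_) ι1)))))
        opaque
          unfolding Q
          e : ∀ i C → i ⊗ (C ⊕ C) ⊕ i ⊗ (C ⊕ C) ≡ (𝟙 ⊕ (𝟙 ⊕ (𝟙 ⊕ 𝟙))) ⊗ i ⊗ C
          e i C = solve 2 (λ i C → i :* (C :+ C) :+ i :* (C :+ C) := (con ℚ.1ℚ :+ (con ℚ.1ℚ :+ (con ℚ.1ℚ :+ con ℚ.1ℚ))) :* i :* C) refl i C

    -- Each coordinate with coefficient ±1 smooths the integrand and turns one factor P into a gain of κ⁻¹.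
    average-bound : ∀ E (c : Fin E → ℤ) j g y {C} → 𝟘 ≼ C → Bounded C g →
      ∣ ΣS E (λ s → Pow j g (y ℤ.+ dot c s)) ∣ ≼ ι A ^^ E ⊗ ι 2 ^^ j ⊗ κ⁻¹ ^^ (#units c ℕ.⊓ j) ⊗ C
    average-bound zero c j g y {C} C≥0 b = ≼-trans-≡ (Pow-bounded j b _) (trans (cong (_⊗ C) (sym (⊗-idˡ (ι 2 ^^ j)))) (cong (_⊗ C) (sym (⊗-idʳ _))))
    average-bound (suc E) c j g y {C} C≥0 b with unit? (c zero)
    average-bound (suc E) c (suc j) g y {C} C≥0 b | yes u =
      ≡-trans-≼ (cong ∣_∣ (ΣS-cong E λ s → trans (sum-cong λ a → cong (Pow j (P g)) (shuffle y _ _))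
          (Pow-sum-shift (suc j) g (λ a → c zero ℤ.* + toℕ a) _)))
        (≼-trans-≡ (average-bound E (c ∘ suc) j (P (U (c zero) g)) y (⊗≽0 (⊗≽0 (ι≽0 2) (⊗≽0 (ι≽0 A) κ⁻¹≽0)) C≥0) (PU-bounded u C≥0 b))
          (e (ι A) (ι A ^^ E) (ι 2) (ι 2 ^^ j) κ⁻¹ _ C))
      where
      opaque
        unfolding Q
        e : ∀ a aE t tj k kq C → aE ⊗ tj ⊗ kq ⊗ (t ⊗ (a ⊗ k) ⊗ C) ≡ a ⊗ aE ⊗ (t ⊗ tj) ⊗ (k ⊗ kq) ⊗ C
        e a aE t tj k kq C = solve 7 (λ a aE t tj k kq C → aE :* tj :* kq :* (t :* (a :* k) :* C) := a :* aE :* (t :* tj) :* (k :* kq) :* C) refl a aE t tj k kq C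
    average-bound (suc E) c zero g y {C} C≥0 b | yes u =
      ≡-trans-≼ (cong ∣_∣ (ΣS-cong E λ s → sum-cong λ a → cong g (shuffle y _ _)))
        (≼-trans-≡ (average-bound E (c ∘ suc) zero (U (c zero) g) y (⊗≽0 (ι≽0 A) C≥0) (U-bounded {c zero} b))
          (trans (cong (λ n → ι A ^^ E ⊗ 𝟙 ⊗ κ⁻¹ ^^ n ⊗ (ι A ⊗ C)) (ℕ.⊓-zeroʳ (#units (c ∘ suc)))) (e (ι A) (ι A ^^ E) C)))
      where
      opaque
        unfolding Q
        e : ∀ a aE C → aE ⊗ 𝟙 ⊗ 𝟙 ⊗ (a ⊗ C) ≡ a ⊗ aE ⊗ 𝟙 ⊗ 𝟙 ⊗ C
        e a aE C = solve 3 (λ a aE C → aE :* con ℚ.1ℚ :* con ℚ.1ℚ :* (a :* C) := a :* aE :* con ℚ.1ℚ :* con ℚ.1ℚ :* C) refl a aE C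
    average-bound (suc E) c j g y {C} C≥0 b | no _ =
      ≡-trans-≼ (cong ∣_∣ (ΣS-cong E λ s → trans (sum-cong λ a → cong (Pow j g) (shuffle y _ _))
          (Pow-sum-shift j g (λ a → c zero ℤ.* + toℕ a) _)))
        (≼-trans-≡ (average-bound E (c ∘ suc) j (U (c zero) g) y (⊗≽0 (ι≽0 A) C≥0) (U-bounded {c zero} b))
          (e (ι A) (ι A ^^ E) (ι 2 ^^ j) _ C))
      where
      opaque
        unfolding Q
        e : ∀ a aE tj kq C → aE ⊗ tj ⊗ kq ⊗ (a ⊗ C) ≡ a ⊗ aE ⊗ tj ⊗ kq ⊗ C
        e a aE tj kq C = solve 5 (λ a aE tj kq C → aE :* tj :* kq :* (a :* C) := a :* aE :* tj :* kq :* C) refl a aE tj kq C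

  ΣS-bounded : ∀ E (c : Fin E → ℤ) g y {C} → Bounded C g → ∣ ΣS E (λ s → g (y ℤ.+ dot c s)) ∣ ≼ ι A ^^ E ⊗ C
  ΣS-bounded zero c g y b = ≼-trans-≡ (b _) (sym (⊗-idˡ _))
  ΣS-bounded (suc E) c g y {C} b = ≡-trans-≼ (cong ∣_∣ (ΣS-cong E λ s → sum-cong λ a → cong g (shuffle y _ _)))
    (≼-trans-≡ (ΣS-bounded E (c ∘ suc) (U (c zero) g) y (U-bounded {c zero} b))
      (trans (sym (⊗-assoc _ _ _)) (cong (_⊗ C) (⊗-comm _ _))))

  -- A single coefficient ±1 already makes the event dot c s ∈ (sparse set) unlikely.
  hit-bound : ∀ E (c : Fin E → ℤ) g y {C} → 𝟘 ≼ C → Bounded C g → (∀ {u} → Unit u → Bounded C (U u g)) → 1 ℕ.≤ #units c →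
    ι A ⊗ ∣ ΣS E (λ s → g (y ℤ.+ dot c s)) ∣ ≼ ι A ^^ E ⊗ C
  hit-bound (suc E) c g y {C} C≥0 b sp 1≤ with unit? (c zero)
  ... | yes u = ≡-trans-≼ (cong (λ z → ι A ⊗ ∣ z ∣) (ΣS-cong E λ s → sum-cong λ a → cong g (shuffle y _ _)))
        (≼-trans-≡ (⊗-monoˡ (ι A) (ι≽0 A) (ΣS-bounded E (c ∘ suc) (U (c zero) g) y (sp u))) (sym (⊗-assoc _ _ _)))
  -- A coordinate whose coefficient is not ±1 is summed as well. Sums over two coordinates commute,
  -- so the sparseness of `g` passes to `U (c zero) g` with A·C in place of C.
  ... | no _ = ≡-trans-≼ (cong (λ z → ι A ⊗ ∣ z ∣) (ΣS-cong E λ s → sum-cong λ a → cong g (shuffle y _ _)))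
        (≼-trans-≡ (hit-bound E (c ∘ suc) (U (c zero) g) y (⊗≽0 (ι≽0 A) C≥0) (U-bounded {c zero} b)
          (λ {u} uu z → ≡-trans-≼ (cong ∣_∣ (trans (∑-comm (λ b a → g (z ℤ.+ u ℤ.* + toℕ b ℤ.+ c zero ℤ.* + toℕ a)))
              (sum-cong λ a → sum-cong λ b → cong g (e z _ _)))) (∣sum∣≼ λ a → sp uu (z ℤ.+ c zero ℤ.* + toℕ a))) 1≤)
          (trans (sym (⊗-assoc _ _ _)) (cong (_⊗ C) (⊗-comm _ _))))
    where
    e : ∀ z u v → z ℤ.+ u ℤ.+ v ≡ z ℤ.+ v ℤ.+ u
    e = ℤ-Ring.solve-∀

-- Words in the edge colours and their reduction.

∧-true : ∀ {a b} → a ∧ b ≡ true → a ≡ true × b ≡ true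
∧-true {true} {true} _ = refl , refl

does⇒ : ∀ {P : Set} (d : Dec P) → does d ≡ true → P
does⇒ (yes p) _ = p

does-≡ : ∀ {P R : Set} (p : Dec P) (r : Dec R) → (P → R) → (R → P) → does p ≡ does r
does-≡ (yes _) (yes _) _ _ = refl
does-≡ (no _) (no _) _ _ = refl
does-≡ (yes p) (no ¬r) f _ = ⊥-elim (¬r (f p))
does-≡ (no ¬p) (yes r) _ g = ⊥-elim (¬p (g r))

[[≟]] : ∀ {D} → Fin D → Fin D → Q
[[≟]] a b = [[ does (a Fin.≟ b) ]]

sum-≟ : ∀ {D} (b : Fin D) → sum (λ a → [[≟]] a b) ≡ 𝟙
sum-≟ {suc D} zero = trans (sum-suc _) (trans (cong (𝟙 ⊕_) (sum-0 D)) (⊕-idʳ 𝟙))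
sum-≟ {suc D} (suc b) = trans (sum-suc _) (trans (⊕-idˡ _) (trans (sum-cong λ a → refl) (sum-≟ b)))

sum-∈ : ∀ {D} (l : List (Fin D)) (f : Fin D → Bool) → (∀ a → f a ≡ true → a ∈ l) → sum (λ a → [[ f a ]]) ≼ ι (length l)
sum-∈ {D} l f h = ≼-trans (sum-mono pt) (go l)
  where
  w : List (Fin D) → Fin D → Q
  w [] a = 𝟘
  w (b ∷ l) a = [[≟]] a b ⊕ w l a
  w≽0 : ∀ l a → 𝟘 ≼ w l a
  w≽0 [] a = ≼-refl
  w≽0 (b ∷ l) a = ⊕≽0 ([[]]≽0 (does (a Fin.≟ b))) (w≽0 l a)
  ∈⇒ : ∀ {a} l → a ∈ l → 𝟙 ≼ w l a
  ∈⇒ {a} (b ∷ l) (here refl) with a Fin.≟ a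
  ... | yes _ = ≼⊕ʳ (w≽0 l a)
  ... | no ¬p = ⊥-elim (¬p refl)
  ∈⇒ {a} (b ∷ l) (there p) = ≼-trans (∈⇒ l p) (≼⊕ˡ ([[]]≽0 (does (a Fin.≟ b))))
  pt : ∀ a → [[ f a ]] ≼ w l a
  pt a with f a in eq
  ... | true = ∈⇒ l (h a eq)
  ... | false = w≽0 l a
  go : ∀ l → sum (w l) ≼ ι (length l)
  go [] = ≼-reflexive (trans (sum-0 D) (sym ι0))
  go (b ∷ l) = ≼-trans-≡ (≡-trans-≼ (∑-distrib-+ _ _) (⊕-mono (≼-reflexive (sum-≟ b)) (go l))) (sym (ι-suc _))

-- Words are lists of labels, the most recent letter first.

module Words (D : ℕ) where

  Word : Set
  Word = List (Fin D)

  top? : Fin D → Word → Bool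
  top? a [] = false
  top? a (b ∷ u) = does (a Fin.≟ b)

  data Red : Word → Set where
    []  : Red []
    _∷_ : ∀ {a u} → top? a u ≡ false → Red u → Red (a ∷ u)

  Red-++ˡ : ∀ p {u} → Red (p ++ u) → Red p
  Red-++ˡ [] r = []
  Red-++ˡ (a ∷ []) (t ∷ r) = refl ∷ []
  Red-++ˡ (a ∷ b ∷ p) (t ∷ r) = t ∷ Red-++ˡ (b ∷ p) r

  Red-++ʳ : ∀ p {u} → Red (p ++ u) → Red u
  Red-++ʳ [] r = r
  Red-++ʳ (a ∷ p) (t ∷ r) = Red-++ʳ p r

  -- Letters stand for involutions, so reduction cancels equal neighbours.
  push : Fin D → Word → Word
  push a [] = a ∷ []
  push a (b ∷ u) = if does (a Fin.≟ b) then u else (a ∷ b ∷ u)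

  red : Word → Word
  red [] = []
  red (a ∷ w) = push a (red w)

  ΣW : ℕ → (Word → Q) → Q
  ΣW zero F = F []
  ΣW (suc n) F = ΣW n λ w → sum λ a → F (a ∷ w)

  ΣRed : ℕ → (Word → Q) → Q
  ΣRed zero F = F []
  ΣRed (suc n) F = ΣRed n λ u → sum λ a → [[ not (top? a u) ]] ⊗ F (a ∷ u)

  ΣW-mono : ∀ n {F G} → (∀ w → length w ≡ n → F w ≼ G w) → ΣW n F ≼ ΣW n G
  ΣW-mono zero h = h [] refl
  ΣW-mono (suc n) h = ΣW-mono n λ w e → sum-mono λ a → h (a ∷ w) (cong suc e)

  ΣW-cong : ∀ n {F G} → (∀ w → F w ≡ G w) → ΣW n F ≡ ΣW n G
  ΣW-cong zero h = h []
  ΣW-cong (suc n) h = ΣW-cong n λ w → sum-cong λ a → h (a ∷ w)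

  ΣW-⊗ : ∀ n c F → ΣW n (λ w → c ⊗ F w) ≡ c ⊗ ΣW n F
  ΣW-⊗ zero c F = refl
  ΣW-⊗ (suc n) c F = trans (ΣW-cong n λ w → sum-⊗ˡ c _) (ΣW-⊗ n c _)

  ΣRed-mono : ∀ n {F G} → (∀ u → Red u → length u ≡ n → F u ≼ G u) → ΣRed n F ≼ ΣRed n G
  ΣRed-mono zero h = h [] [] refl
  ΣRed-mono (suc n) {F} {G} h = ΣRed-mono n λ u r e → sum-mono λ a → pt a u r e
    where
    pt : ∀ a u → Red u → length u ≡ n → [[ not (top? a u) ]] ⊗ F (a ∷ u) ≼ [[ not (top? a u) ]] ⊗ G (a ∷ u)
    pt a u r e with top? a u in eq
    ... | true = ≼-reflexive (trans (⊗-zeroˡ _) (sym (⊗-zeroˡ _)))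
    ... | false = ⊗-monoˡ 𝟙 𝟘≼𝟙 (h (a ∷ u) (eq ∷ r) (cong suc e))

  ΣRed-cong : ∀ n {F G} → (∀ u → F u ≡ G u) → ΣRed n F ≡ ΣRed n G
  ΣRed-cong zero h = h []
  ΣRed-cong (suc n) h = ΣRed-cong n λ u → sum-cong λ a → cong ([[ not (top? a u) ]] ⊗_) (h (a ∷ u))

  ΣRed-⊕ : ∀ n F G → ΣRed n (λ u → F u ⊕ G u) ≡ ΣRed n F ⊕ ΣRed n G
  ΣRed-⊕ zero F G = refl
  ΣRed-⊕ (suc n) F G = trans (ΣRed-cong n λ u → trans (sum-cong λ a → ⊗-distribˡ _ _ _) (∑-distrib-+ _ _)) (ΣRed-⊕ n _ _)

  ΣRed-⊗ : ∀ n c F → ΣRed n (λ u → c ⊗ F u) ≡ c ⊗ ΣRed n F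
  ΣRed-⊗ zero c F = refl
  ΣRed-⊗ (suc n) c F = trans (ΣRed-cong n λ u → trans (sum-cong λ a → comm _ c _) (sum-⊗ˡ c _)) (ΣRed-⊗ n c _)
    where
    comm : ∀ x c y → x ⊗ (c ⊗ y) ≡ c ⊗ (x ⊗ y)
    comm x c y = trans (sym (⊗-assoc x c y)) (trans (cong (_⊗ y) (⊗-comm x c)) (⊗-assoc c x y))

  ΣRed≽0 : ∀ n {F} → (∀ u → 𝟘 ≼ F u) → 𝟘 ≼ ΣRed n F
  ΣRed≽0 zero h = h []
  ΣRed≽0 (suc n) h = ΣRed≽0 n λ u → sum≽0 λ a → ⊗≽0 ([[]]≽0 (not (top? a u))) (h (a ∷ u))

  ΣRed-1 : ∀ n → ΣRed n (λ _ → 𝟙) ≼ ι D ^^ n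
  ΣRed-1 zero = ≼-refl
  ΣRed-1 (suc n) = ≼-trans (ΣRed-mono n λ u _ _ → ≼-trans-≡ (sum-mono λ a → ≡-trans-≼ (⊗-idʳ _) ([[]]≼1 (not (top? a u)))) (sum-const D 𝟙))
    (≡-trans-≼ (ΣRed-⊗ n (ι D) (λ _ → 𝟙)) (⊗-monoˡ (ι D) (ι≽0 D) (ΣRed-1 n)))

  term≼ΣRed : ∀ {F} → (∀ u → 𝟘 ≼ F u) → ∀ {u} → Red u → F u ≼ ΣRed (length u) F
  term≼ΣRed h [] = ≼-refl
  term≼ΣRed {F} h {a ∷ u} (t ∷ r) = ≼-trans (≼-trans (≡-trans-≼ (sym (trans (cong (λ b → [[ not b ]] ⊗ F (a ∷ u)) t) (⊗-idˡ _)))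
      (term≼sum {f = λ a → [[ not (top? a u) ]] ⊗ F (a ∷ u)} (λ a → ⊗≽0 ([[]]≽0 (not (top? a u))) (h (a ∷ u))) a))
    (term≼ΣRed (λ u → sum≽0 λ a → ⊗≽0 ([[]]≽0 (not (top? a u))) (h (a ∷ u))) r)) ≼-refl

  module Reduction (κ : Q) (κ≽0 : 𝟘 ≼ κ) (D≡κ² : ι D ≡ κ ⊗ κ) where

    -- Unfolded, this is the sum over r ≤ n of κ^(n-r) times the sum of `Θ` over the reduced words
    -- of length r. The n - r cancelled letters come in pairs; a pair has D = κ² choices, so each of
    -- its letters is charged κ.
    T : ℕ → (Word → Q) → Q
    T zero Θ = ΣRed 0 Θ
    T (suc n) Θ = κ ⊗ T n Θ ⊕ ΣRed (suc n) Θ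

    T≽0 : ∀ n {Θ} → (∀ u → 𝟘 ≼ Θ u) → 𝟘 ≼ T n Θ
    T≽0 zero h = h []
    T≽0 (suc n) h = ⊕≽0 (⊗≽0 κ≽0 (T≽0 n h)) (ΣRed≽0 (suc n) h)

    T-⊕ : ∀ n F G → T n (λ u → F u ⊕ G u) ≡ T n F ⊕ T n G
    T-⊕ zero F G = refl
    T-⊕ (suc n) F G = trans (cong₂ _⊕_ (trans (cong (κ ⊗_) (T-⊕ n F G)) (⊗-distribˡ _ _ _)) (ΣRed-⊕ (suc n) F G)) (interchange _ _ _ _)

    private
      extend pop : (Word → Q) → Word → Q
      extend Θ u = sum λ a → [[ not (top? a u) ]] ⊗ Θ (a ∷ u)
      pop Θ [] = 𝟘
      pop Θ (a ∷ u) = Θ u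

      T-extend : ∀ n {Θ} → (∀ u → 𝟘 ≼ Θ u) → T n (extend Θ) ≼ T (suc n) Θ
      T-extend zero h = ≼⊕ˡ (⊗≽0 κ≽0 (h []))
      T-extend (suc n) h = ⊕-mono (⊗-monoˡ κ κ≽0 (T-extend n h)) ≼-refl

      -- A word arises by popping from at most D = κ² longer words.
      ΣRed-pop : ∀ n {Θ} → (∀ u → 𝟘 ≼ Θ u) → ΣRed (suc n) (pop Θ) ≼ κ ⊗ κ ⊗ ΣRed n Θ
      ΣRed-pop n {Θ} h = ≼-trans (ΣRed-mono n λ u _ _ → ≡-trans-≼ (sum-⊗ʳ (Θ u) _) (⊗-monoʳ (Θ u) (h u)
          (≼-trans-≡ (sum-mono λ a → [[]]≼1 (not (top? a u))) (trans (sum-const D 𝟙) (trans (⊗-idʳ _) D≡κ²)))))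
        (≼-reflexive (ΣRed-⊗ n (κ ⊗ κ) Θ))

      T-pop : ∀ n {Θ} → (∀ u → 𝟘 ≼ Θ u) → T (suc n) (pop Θ) ≼ κ ⊗ κ ⊗ T n Θ
      T-pop zero {Θ} h = ≼-trans (⊕-mono (≼-reflexive (⊗-zeroʳ κ)) (ΣRed-pop zero h)) (≼-reflexive (⊕-idˡ _))
      T-pop (suc n) {Θ} h = ≼-trans-≡ (⊕-mono (⊗-monoˡ κ κ≽0 (T-pop n h)) (ΣRed-pop (suc n) h)) (e κ (T n Θ) (ΣRed (suc n) Θ))
        where
        opaque
          unfolding Q
          e : ∀ k t r → k ⊗ (k ⊗ k ⊗ t) ⊕ k ⊗ k ⊗ r ≡ k ⊗ k ⊗ (k ⊗ t ⊕ r)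
          e k t r = solve 3 (λ k t r → k :* (k :* k :* t) :+ k :* k :* r := k :* k :* (k :* t :+ r)) refl k t r

      T-pop′ : ∀ n {Θ} → (∀ u → 𝟘 ≼ Θ u) → T n (pop Θ) ≼ T (suc n) Θ
      T-pop′ zero h = T≽0 1 h
      T-pop′ (suc n) {Θ} h = ≼-trans (T-pop n h) (≼-trans (≡-trans-≼ (⊗-assoc κ κ _) (⊗-monoˡ κ κ≽0 (≼⊕ʳ (ΣRed≽0 (suc n) h)))) (≼⊕ʳ (ΣRed≽0 (suc (suc n)) h)))

      push-sum : ∀ Θ u → sum (λ a → Θ (push a u)) ≡ extend Θ u ⊕ pop Θ u
      push-sum Θ [] = trans (sum-cong λ a → sym (⊗-idˡ _)) (sym (⊕-idʳ _))
      push-sum Θ (b ∷ u) = trans (sum-cong pt) (trans (∑-distrib-+ _ _) (cong (extend Θ (b ∷ u) ⊕_)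
          (trans (sum-⊗ʳ (Θ u) _) (trans (cong (_⊗ Θ u) (sum-≟ b)) (⊗-idˡ _)))))
        where
        pt : ∀ a → Θ (push a (b ∷ u)) ≡ [[ not (does (a Fin.≟ b)) ]] ⊗ Θ (a ∷ b ∷ u) ⊕ [[≟]] a b ⊗ Θ u
        pt a with a Fin.≟ b
        ... | yes _ = sym (trans (cong₂ _⊕_ (⊗-zeroˡ _) (⊗-idˡ _)) (⊕-idˡ _))
        ... | no _  = sym (trans (cong₂ _⊕_ (⊗-idˡ _) (⊗-zeroˡ _)) (⊕-idʳ _))

    -- Adding a letter either extends the reduced word or pops it, and a popped letter had at most D = κ² choices.
    ΣW-red : ∀ n {Θ} → (∀ u → 𝟘 ≼ Θ u) → ΣW n (Θ ∘ red) ≼ ι 2 ^^ n ⊗ T n Θ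
    ΣW-red zero h = ≼-reflexive (sym (⊗-idˡ _))
    ΣW-red (suc n) {Θ} h = ≡-trans-≼ (ΣW-cong n λ w → push-sum Θ (red w))
      (≼-trans (ΣW-red n {λ u → extend Θ u ⊕ pop Θ u} (λ u → ⊕≽0 (sum≽0 λ a → ⊗≽0 ([[]]≽0 (not (top? a u))) (h (a ∷ u))) (pop≽0 u)))
        (≡-trans-≼ (cong (ι 2 ^^ n ⊗_) (T-⊕ n _ _))
          (≼-trans (⊗-monoˡ _ (^^≽0 n (ι≽0 2)) (⊕-mono (T-extend n h) (T-pop′ n h)))
            (≼-reflexive (trans (cong (ι 2 ^^ n ⊗_) (sym (two⊗ _))) (trans (sym (⊗-assoc _ _ _)) (cong (_⊗ T (suc n) Θ) (⊗-comm (ι 2 ^^ n) (ι 2)))))))))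
      where
      pop≽0 : ∀ u → 𝟘 ≼ pop Θ u
      pop≽0 [] = ≼-refl
      pop≽0 (a ∷ u) = h u

-- Walks in a coloured graph and the shifts collected along them.

#units-cong : ∀ {E} {c c′ : Fin E → ℤ} → (∀ i → c i ≡ c′ i) → #units c ≡ #units c′
#units-cong {zero} h = refl
#units-cong {suc E} {c} {c′} h = cong₂ (λ x n → if does (unit? x) then suc n else n) (h zero) (#units-cong (h ∘ suc))

#units-drop : ∀ {E} (c c′ : Fin E → ℤ) e → (∀ i → i ≢ e → c′ i ≡ c i) → #units c ℕ.≤ suc (#units c′)
#units-drop {suc E} c c′ zero h = ℕ.≤-trans (if-≤ (does (unit? (c zero))) (#units (c ∘ suc)))
  (ℕ.s≤s (ℕ.≤-trans (ℕ.≤-reflexive (#units-cong {c = c ∘ suc} {c′ ∘ suc} λ i → sym (h (suc i) λ ()))) (≤-if (does (unit? (c′ zero))) _)))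
  where
  if-≤ : ∀ b n → (if b then suc n else n) ℕ.≤ suc n
  if-≤ true n = ℕ.≤-refl
  if-≤ false n = ℕ.n≤1+n n
  ≤-if : ∀ b n → n ℕ.≤ (if b then suc n else n)
  ≤-if true n = ℕ.n≤1+n n
  ≤-if false n = ℕ.≤-refl
#units-drop {suc E} c c′ (suc e) h rewrite h zero (λ ()) with unit? (c zero)
... | yes _ = ℕ.s≤s (#units-drop (c ∘ suc) (c′ ∘ suc) e λ i ne → h (suc i) (ne ∘ Fin.suc-injective))
... | no _  = #units-drop (c ∘ suc) (c′ ∘ suc) e λ i ne → h (suc i) (ne ∘ Fin.suc-injective)

#units-gain : ∀ {E} (c c′ : Fin E → ℤ) e → (∀ i → i ≢ e → c′ i ≡ c i) → ¬ Unit (c e) → Unit (c′ e) → suc (#units c) ℕ.≤ #units c′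
#units-gain {suc E} c c′ zero h ¬u u with unit? (c zero) | unit? (c′ zero)
... | yes v | _     = ⊥-elim (¬u v)
... | no _  | yes _ = ℕ.s≤s (ℕ.≤-reflexive (#units-cong {c = c ∘ suc} {c′ ∘ suc} λ i → sym (h (suc i) λ ())))
... | no _  | no ¬v = ⊥-elim (¬v u)
#units-gain {suc E} c c′ (suc e) h ¬u u rewrite h zero (λ ()) with unit? (c zero)
... | yes _ = ℕ.s≤s (#units-gain (c ∘ suc) (c′ ∘ suc) e (λ i ne → h (suc i) (ne ∘ Fin.suc-injective)) ¬u u)
... | no _  = #units-gain (c ∘ suc) (c′ ∘ suc) e (λ i ne → h (suc i) (ne ∘ Fin.suc-injective)) ¬u u

-- A D-regular edge-coloured graph: step a is the involution along the edges of colour a.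

record ColouredGraph (V : Set) (D E : ℕ) : Set where
  field
    _≟_       : (x y : V) → Dec (x ≡ y)
    step      : Fin D → V → V
    step²     : ∀ a v → step a (step a v) ≡ v
    edge      : Fin D → V → Fin E
    edge-step : ∀ a v → edge a (step a v) ≡ edge a v
    edge-inj  : ∀ {a b v w} → edge a v ≡ edge b w → a ≡ b × (w ≡ v ⊎ w ≡ step a v)
    -- The sign orients the edges: an edge shifts the fibre by opposite amounts in its two
    -- directions, so that the lift is again a graph of involutions.
    sgn       : V → ℤ
    sgn-unit  : ∀ v → Unit (sgn v)
    sgn-step  : ∀ a v → sgn (step a v) ≡ ℤ.- sgn v

module Walks {V : Set} {D E : ℕ} (𝒢 : ColouredGraph V D E) (good : V → Bool) where

  open ColouredGraph 𝒢
  open Words D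

  end : V → Word → V
  end v [] = v
  end v (a ∷ u) = step a (end v u)

  inside : V → Word → Bool
  inside v [] = good v
  inside v (a ∷ u) = inside v u ∧ good (step a (end v u))

  -- The signed number of passages through `e`. The fibre coordinate of the lifted walk moves by the
  -- linear form in the shifts with these coefficients.
  coef : V → Word → Fin E → ℤ
  coef v [] e = + 0
  coef v (a ∷ u) e = coef v u e ℤ.+ (if does (e Fin.≟ edge a (end v u)) then sgn (end v u) else + 0)

  seen : V → Word → Fin E → Bool
  seen v [] e = false
  seen v (a ∷ u) e = does (e Fin.≟ edge a (end v u)) ∨ seen v u e

  fresh : V → Word → ℕ
  fresh v [] = 0
  fresh v (a ∷ u) = if seen v u (edge a (end v u)) then fresh v u else suc (fresh v u)

  -- Bad vertices are not deleted from the graph: a short closed walk is allowed as long as it meets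
  -- one of them. The permutations thus remain total.
  Girth : ℕ → Set
  Girth g = ∀ x p → Red p → 0 ℕ.< length p → inside x p ≡ true → end x p ≡ x → g ℕ.≤ length p

  end-++ : ∀ v p u → end v (p ++ u) ≡ end (end v u) p
  end-++ v [] u = refl
  end-++ v (a ∷ p) u = cong (step a) (end-++ v p u)

  inside-++ʳ : ∀ v p u → inside v (p ++ u) ≡ true → inside v u ≡ true
  inside-++ʳ v [] u h = h
  inside-++ʳ v (a ∷ p) u h = inside-++ʳ v p u (proj₁ (∧-true h))

  inside-end : ∀ v u → inside v u ≡ true → good (end v u) ≡ true
  inside-end v [] h = h
  inside-end v (a ∷ u) h = proj₂ (∧-true h)

  inside-++ˡ : ∀ v p u → inside v (p ++ u) ≡ true → inside (end v u) p ≡ true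
  inside-++ˡ v [] u h = inside-end v u h
  inside-++ˡ v (a ∷ p) u h = cong₂ _∧_ (inside-++ˡ v p u (proj₁ (∧-true h)))
    (trans (cong (λ z → good (step a z)) (sym (end-++ v p u))) (proj₂ (∧-true h)))

  end-push : ∀ v a u → end v (push a u) ≡ step a (end v u)
  end-push v a [] = refl
  end-push v a (b ∷ u) with a Fin.≟ b
  ... | yes refl = sym (step² a _)
  ... | no _ = refl

  end-red : ∀ v w → end v (red w) ≡ end v w
  end-red v [] = refl
  end-red v (a ∷ w) = trans (end-push v a (red w)) (cong (step a) (end-red v w))

  inside-push : ∀ v a u → inside v u ≡ true → good (step a (end v u)) ≡ true → inside v (push a u) ≡ true
  inside-push v a [] h g = cong₂ _∧_ h g
  inside-push v a (b ∷ u) h g with a Fin.≟ b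
  ... | yes refl = proj₁ (∧-true h)
  ... | no _ = cong₂ _∧_ h g

  inside-red : ∀ v w → inside v w ≡ true → inside v (red w) ≡ true
  inside-red v [] h = h
  inside-red v (a ∷ w) h = inside-push v a (red w) (inside-red v w (proj₁ (∧-true h)))
    (trans (cong (λ z → good (step a z)) (end-red v w)) (proj₂ (∧-true h)))

  -- Going back along the edge just used enters it from the other side, so the cancelled pair
  -- contributes x - x to its coefficient.
  coef-push : ∀ v a u e → coef v (push a u) e ≡ coef v (a ∷ u) e
  coef-push v a [] e = refl
  coef-push v a (b ∷ u) e with a Fin.≟ b
  ... | no _ = refl
  ... | yes refl rewrite edge-step a (end v u) | sgn-step a (end v u) with does (e Fin.≟ edge a (end v u))
  ...   | true  = c (coef v u e) (sgn (end v u))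
    where
    c : ∀ x y → x ≡ x ℤ.+ y ℤ.+ ℤ.- y
    c = ℤ-Ring.solve-∀
  ...   | false = sym (trans (ℤ.+-identityʳ _) (ℤ.+-identityʳ _))

  coef-red : ∀ v w e → coef v (red w) e ≡ coef v w e
  coef-red v [] e = refl
  coef-red v (a ∷ w) e = trans (coef-push v a (red w) e) (cong₂ ℤ._+_ (coef-red v w e)
    (cong (λ z → if does (e Fin.≟ edge a z) then sgn z else + 0) (end-red v w)))

  unseen-coef : ∀ v u e → seen v u e ≡ false → coef v u e ≡ + 0
  unseen-coef v [] e h = refl
  unseen-coef v (a ∷ u) e h with does (e Fin.≟ edge a (end v u))
  ... | false = trans (ℤ.+-identityʳ _) (unseen-coef v u e h)

  coef-off : ∀ v a u i → i ≢ edge a (end v u) → coef v (a ∷ u) i ≡ coef v u i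
  coef-off v a u i ne with i Fin.≟ edge a (end v u)
  ... | yes p = ⊥-elim (ne p)
  ... | no _ = ℤ.+-identityʳ _

  coef-on : ∀ v a u → coef v (a ∷ u) (edge a (end v u)) ≡ coef v u (edge a (end v u)) ℤ.+ sgn (end v u)
  coef-on v a u with edge a (end v u) Fin.≟ edge a (end v u)
  ... | yes _ = refl
  ... | no ¬p = ⊥-elim (¬p refl)

  fresh≤length : ∀ v u → fresh v u ℕ.≤ length u
  fresh≤length v [] = ℕ.z≤n
  fresh≤length v (a ∷ u) with seen v u (edge a (end v u))
  ... | true = ℕ.≤-trans (fresh≤length v u) (ℕ.n≤1+n _)
  ... | false = ℕ.s≤s (fresh≤length v u)

  fresh-++ : ∀ v p u → fresh v u ℕ.≤ fresh v (p ++ u)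
  fresh-++ v [] u = ℕ.≤-refl
  fresh-++ v (a ∷ p) u with seen v (p ++ u) (edge a (end v (p ++ u)))
  ... | true = fresh-++ v p u
  ... | false = ℕ.≤-trans (fresh-++ v p u) (ℕ.n≤1+n _)

  -- A fresh edge has coefficient ±1, and a later step changes only one coefficient.
  fresh-units : ∀ v u → fresh v u ℕ.+ fresh v u ℕ.≤ #units (coef v u) ℕ.+ length u
  fresh-units v [] = ℕ.z≤n
  fresh-units v (a ∷ u) with seen v u (edge a (end v u)) in eq
  ... | true = ℕ.≤-trans (fresh-units v u) (ℕ.≤-trans (ℕ.+-monoˡ-≤ (length u)
          (#units-drop (coef v u) (coef v (a ∷ u)) (edge a (end v u)) (coef-off v a u)))
          (ℕ.≤-reflexive (sym (ℕ.+-suc _ _))))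
  ... | false = ℕ.≤-trans (ℕ.≤-reflexive (cong suc (ℕ.+-suc _ _))) (ℕ.≤-trans (ℕ.s≤s (ℕ.s≤s (fresh-units v u)))
          (ℕ.≤-trans (ℕ.s≤s (ℕ.+-monoˡ-≤ (length u) (#units-gain (coef v u) (coef v (a ∷ u)) (edge a (end v u)) (coef-off v a u)
             (λ x → ¬Unit0 (subst Unit zero-coef x))
             (subst Unit (sym (trans (coef-on v a u) (trans (cong (ℤ._+ sgn (end v u)) zero-coef) (ℤ.+-identityˡ _)))) (sgn-unit (end v u))))))
           (ℕ.≤-reflexive (sym (ℕ.+-suc _ _)))))
    where
    zero-coef : coef v u (edge a (end v u)) ≡ + 0
    zero-coef = unseen-coef v u _ eq
    ¬Unit0 : ¬ Unit (+ 0)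
    ¬Unit0 (unit (inj₁ ()))
    ¬Unit0 (unit (inj₂ ()))

  private
    seen-split : ∀ v u e → seen v u e ≡ true → ∃ λ p → ∃₂ λ b u″ → u ≡ p ++ b ∷ u″ × e ≡ edge b (end v u″)
    seen-split v (a ∷ u) e h with e Fin.≟ edge a (end v u)
    ... | yes q = [] , a , u , refl , q
    ... | no _ with seen-split v u e h
    ...   | p , b , u″ , refl , q = a ∷ p , b , u″ , refl , q

  module _ {g : ℕ} (girth : Girth g) where

    -- Using an edge again closes a reduced walk: from the earlier start of that edge if both
    -- passages have the same direction, from its earlier end otherwise. In the second case the
    -- closed walk is not empty, since the word does not backtrack.
    old-step-long : ∀ v a u → Red (a ∷ u) → inside v u ≡ true → seen v u (edge a (end v u)) ≡ true → g ℕ.≤ length u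
    old-step-long v a u (t ∷ r) ins s with seen-split v u _ s
    ... | p , b , u″ , refl , q with edge-inj q
    ... | refl , inj₁ same = ℕ.≤-trans (girth (end v u″) (p ++ a ∷ []) (Red-++ˡ (p ++ a ∷ []) (subst Red (sym (List.++-assoc p _ u″)) r))
            (ℕ.≤-trans (ℕ.s≤s ℕ.z≤n) (ℕ.≤-trans (ℕ.m≤n+m 1 (length p)) (ℕ.≤-reflexive (sym (List.length-++ p)))))
            (inside-++ˡ v (p ++ a ∷ []) u″ (subst (λ z → inside v z ≡ true) (sym (List.++-assoc p _ u″)) ins))
            (trans (sym (end-++ v (p ++ a ∷ []) u″)) (trans (cong (end v) (List.++-assoc p _ u″)) (sym same))))
          (ℕ.≤-trans (ℕ.m≤m+n _ (length u″)) (ℕ.≤-reflexive (trans (sym (List.length-++ (p ++ a ∷ []))) (cong length (List.++-assoc p _ u″)))))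
    old-step-long v a u (t ∷ r) ins s | [] , b , u″ , refl , q | refl , inj₂ other with a Fin.≟ a
    old-step-long v a u (() ∷ r) ins s | [] , b , u″ , refl , q | refl , inj₂ other | yes _
    ... | no ¬p = ⊥-elim (¬p refl)
    old-step-long v a u (t ∷ r) ins s | c ∷ p , b , u″ , refl , q | refl , inj₂ other =
      ℕ.≤-trans (girth (end v (a ∷ u″)) (c ∷ p) (Red-++ˡ (c ∷ p) r) (ℕ.s≤s ℕ.z≤n) (inside-++ˡ v (c ∷ p) (a ∷ u″) ins)
          (trans (sym (end-++ v (c ∷ p) (a ∷ u″))) (trans (sym (step² a _)) (cong (step a) (sym other)))))
        (ℕ.≤-trans (ℕ.m≤m+n _ (length (a ∷ u″))) (ℕ.≤-reflexive (sym (List.length-++ (c ∷ p)))))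

    fresh-short : ∀ v u → Red u → inside v u ≡ true → length u ℕ.≤ g → fresh v u ≡ length u
    fresh-short v [] r ins l = refl
    fresh-short v (a ∷ u) (t ∷ r) ins l with seen v u (edge a (end v u)) in eq
    ... | true = ⊥-elim (ℕ.<-irrefl refl (ℕ.<-≤-trans l (old-step-long v a u (t ∷ r) (proj₁ (∧-true ins)) eq)))
    ... | false = cong suc (fresh-short v u r (proj₁ (∧-true ins)) (ℕ.<⇒≤ l))

    private
      drop-to : ∀ n (u : Word) → n ℕ.≤ length u → ∃₂ λ p u″ → u ≡ p ++ u″ × length u″ ≡ n
      drop-to n [] l = [] , [] , refl , sym (ℕ.n≤0⇒n≡0 l)
      drop-to n (a ∷ u) l with ℕ.m≤n⇒m<n∨m≡n l
      ... | inj₂ e = [] , a ∷ u , refl , sym e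
      ... | inj₁ (ℕ.s≤s l′) with drop-to n u l′
      ...   | p , u″ , refl , e = a ∷ p , u″ , refl , e

    -- The first g steps are fresh, so `fresh-units` gives 2g ≤ #units + length, while the length is
    -- below 2g.
    units-positive : ∀ v u → Red u → inside v u ≡ true → g ℕ.≤ length u → length u ℕ.< g ℕ.+ g → 1 ℕ.≤ #units (coef v u)
    units-positive v u r ins l₁ l₂ with drop-to g u l₁
    ... | p , u″ , refl , e = ℕ.+-cancelʳ-≤ (length u) 1 _ (ℕ.≤-trans l₂ (ℕ.≤-trans (ℕ.+-mono-≤ fg fg) (fresh-units v u)))
      where
      fg : g ℕ.≤ fresh v (p ++ u″)
      fg = ℕ.≤-trans (ℕ.≤-reflexive (sym (trans (fresh-short v u″ (Red-++ʳ p r) (inside-++ʳ v p u″ ins) (ℕ.≤-reflexive e)) e))) (fresh-++ v p u″)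

    visits : V → V → Word → ℕ
    visits x v [] = if does (x ≟ v) then 1 else 0
    visits x v (a ∷ u) = (if does (x ≟ end v (a ∷ u)) then 1 else 0) ℕ.+ visits x v u

    private
      -- The colours by which the walk has left or entered x; an old edge at x has one of these
      -- colours.
      candidates : V → V → Word → Word
      candidates x v [] = []
      candidates x v (b ∷ u) = (if does (x ≟ end v u) then b ∷ [] else []) ++ (if does (x ≟ end v (b ∷ u)) then b ∷ [] else []) ++ candidates x v u

      -- A visit accounts for one letter in and one letter out. The summand on the left records that
      -- a visit at the current end has no letter out yet.
      candidates-length : ∀ x v u → length (candidates x v u) ℕ.+ (if does (x ≟ end v u) then 1 else 0) ℕ.≤ 2 ℕ.* visits x v u
      candidates-length x v [] with does (x ≟ v)
      ... | true = ℕ.s≤s ℕ.z≤n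
      ... | false = ℕ.z≤n
      candidates-length x v (b ∷ u) with does (x ≟ end v u) | does (x ≟ end v (b ∷ u)) | candidates-length x v u
      ... | false | false | ih = ih
      ... | true  | false | ih = ℕ.≤-trans (ℕ.≤-reflexive (e _)) ih
        where
        e : ∀ n → suc n ℕ.+ 0 ≡ n ℕ.+ 1
        e = ℕ-Ring.solve-∀
      ... | false | true | ih = ℕ.≤-trans (ℕ.≤-reflexive (e _)) (ℕ.≤-trans (ℕ.+-monoʳ-≤ 2 ih) (ℕ.≤-reflexive (e′ (visits x v u))))
        where
        e : ∀ n → suc n ℕ.+ 1 ≡ 2 ℕ.+ (n ℕ.+ 0)
        e = ℕ-Ring.solve-∀
        e′ : ∀ n → 2 ℕ.+ 2 ℕ.* n ≡ 2 ℕ.* (1 ℕ.+ n)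
        e′ = ℕ-Ring.solve-∀
      ... | true | true | ih = ℕ.≤-trans (ℕ.≤-reflexive (e _)) (ℕ.≤-trans (ℕ.+-monoʳ-≤ 2 ih) (ℕ.≤-reflexive (e′ (visits x v u))))
        where
        e : ∀ n → suc (suc n) ℕ.+ 1 ≡ 2 ℕ.+ (n ℕ.+ 1)
        e = ℕ-Ring.solve-∀
        e′ : ∀ n → 2 ℕ.+ 2 ℕ.* n ≡ 2 ℕ.* (1 ℕ.+ n)
        e′ = ℕ-Ring.solve-∀

      ∈-++ʳ : ∀ {a : Fin D} l {l′} → a ∈ l′ → a ∈ l ++ l′
      ∈-++ʳ [] p = p
      ∈-++ʳ (x ∷ l) p = there (∈-++ʳ l p)

      seen-candidate : ∀ a x v u → seen v u (edge a x) ≡ true → a ∈ candidates x v u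
      seen-candidate a x v (b ∷ u) s with edge a x Fin.≟ edge b (end v u)
      ... | no _ = ∈-++ʳ (if does (x ≟ end v u) then b ∷ [] else []) (∈-++ʳ (if does (x ≟ end v (b ∷ u)) then b ∷ [] else []) (seen-candidate a x v u s))
      ... | yes q with edge-inj q
      ...   | refl , inj₁ same with x ≟ end v u
      ...     | yes _ = here refl
      ...     | no ¬p = ⊥-elim (¬p (sym same))
      seen-candidate a x v (b ∷ u) s | yes q | refl , inj₂ other with x ≟ end v (a ∷ u)
      ...     | yes _ = ∈-++ʳ (if does (x ≟ end v u) then b ∷ [] else []) (here refl)
      ...     | no ¬p = ⊥-elim (¬p (trans (sym (step² a x)) (cong (step a) (sym other))))

    -- Consecutive visits enclose a reduced closed walk and are therefore at least g steps apart.
    -- The word `p` is the stretch since the last visit, which the induction needs in order to pay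
    -- for the next one.
    visits-spread : ∀ x v u → Red u → inside v u ≡ true →
      visits x v u ≡ 0 ⊎ ∃₂ λ p u″ → u ≡ p ++ u″ × end v u″ ≡ x × g ℕ.* visits x v u ℕ.+ length p ℕ.≤ length u ℕ.+ g
    visits-spread x v [] r ins with x ≟ v
    ... | yes refl = inj₂ ([] , [] , refl , refl , ℕ.≤-reflexive (trans (ℕ.+-identityʳ _) (ℕ.*-identityʳ g)))
    ... | no _ = inj₁ refl
    visits-spread x v (a ∷ u) (t ∷ r) ins with x ≟ end v (a ∷ u) | visits-spread x v u r (proj₁ (∧-true ins))
    ... | yes refl | inj₁ e = inj₂ ([] , a ∷ u , refl , refl , ℕ.≤-trans (ℕ.≤-reflexive (trans (ℕ.+-identityʳ _)
            (trans (cong (λ z → g ℕ.* suc z) e) (ℕ.*-identityʳ g)))) (ℕ.m≤n+m g (suc (length u))))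
    ... | no _     | inj₁ e = inj₁ e
    ... | no _     | inj₂ (p , u″ , refl , q , l) = inj₂ (a ∷ p , u″ , refl , q , ℕ.≤-trans (ℕ.≤-reflexive (ℕ.+-suc _ _)) (ℕ.s≤s l))
    ... | yes refl | inj₂ (p , u″ , refl , q , l) = inj₂ ([] , a ∷ p ++ u″ , refl , refl , (begin
        g ℕ.* suc n ℕ.+ 0                 ≡⟨ ℕ.+-identityʳ _ ⟩
        g ℕ.* suc n                       ≡⟨ ℕ.*-suc g n ⟩
        g ℕ.+ g ℕ.* n                     ≤⟨ ℕ.+-monoˡ-≤ (g ℕ.* n) far ⟩
        suc (length p) ℕ.+ g ℕ.* n        ≡⟨ cong suc (ℕ.+-comm (length p) (g ℕ.* n)) ⟩
        suc (g ℕ.* n ℕ.+ length p)        ≤⟨ ℕ.s≤s l ⟩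
        suc (length (p ++ u″) ℕ.+ g)      ∎))
      where
      open ℕ.≤-Reasoning
      n = visits x v (p ++ u″)
      far : g ℕ.≤ suc (length p)
      far = girth x (a ∷ p) (Red-++ˡ (a ∷ p) (t ∷ r)) (ℕ.s≤s ℕ.z≤n)
        (subst (λ z → inside z (a ∷ p) ≡ true) q (inside-++ˡ v (a ∷ p) u″ ins))
        (trans (cong (λ z → end z (a ∷ p)) (sym q)) (sym (end-++ v (a ∷ p) u″)))

    module _ {n c : ℕ} (0<g : 0 ℕ.< g) (n+g≤ : n ℕ.+ g ℕ.≤ g ℕ.* c) where

      visits-bound : ∀ x v u → Red u → inside v u ≡ true → length u ℕ.≤ n → visits x v u ℕ.≤ c
      visits-bound x v u r ins l with visits-spread x v u r ins
      ... | inj₁ e = ℕ.≤-trans (ℕ.≤-reflexive e) ℕ.z≤n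
      ... | inj₂ (p , _ , _ , _ , b) = ℕ.*-cancelˡ-≤ g {{ℕ.>-nonZero 0<g}}
              (ℕ.≤-trans (ℕ.m≤m+n _ (length p)) (ℕ.≤-trans b (ℕ.≤-trans (ℕ.+-monoˡ-≤ g l) n+g≤)))

      few-old : ∀ v u → Red u → inside v u ≡ true → length u ℕ.≤ n →
                sum (λ a → [[ seen v u (edge a (end v u)) ]]) ≼ ι (2 ℕ.* c)
      few-old v u r ins l = ≼-trans (sum-∈ (candidates (end v u) v u) _ (λ a → seen-candidate a (end v u) v u))
        (ι-mono (ℕ.≤-trans (ℕ.m≤m+n _ _) (ℕ.≤-trans (candidates-length (end v u) v u) (ℕ.*-monoʳ-≤ 2 (visits-bound (end v u) v u r ins l)))))

-- Weighted counts of walks and of short returns.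

module WalkSums {V : Set} {D E : ℕ} (𝒢 : ColouredGraph V D E) (good : V → Bool) where

  open ColouredGraph 𝒢
  open Words D
  open Walks 𝒢 good

  module _ (K : ℕ) (D≡K² : D ≡ suc K ℕ.* suc K) {g : ℕ} (girth : Girth g) {n c : ℕ} (0<g : 0 ℕ.< g) (n+g≤ : n ℕ.+ g ℕ.≤ g ℕ.* c) where

    private
      κ κ⁻¹ r B : Q
      κ = ι (suc K)
      κ⁻¹ = rcp (suc K)
      r = κ⁻¹ ⊗ κ⁻¹
      B = 𝟙 ⊕ ι (2 ℕ.* c)

      κ≽0 : 𝟘 ≼ κ
      κ≽0 = ι≽0 (suc K)

      κ⁻¹≽0 : 𝟘 ≼ κ⁻¹
      κ⁻¹≽0 = rcp≽0 K

      r≽0 : 𝟘 ≼ r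
      r≽0 = ⊗≽0 κ⁻¹≽0 κ⁻¹≽0

      B≽1 : 𝟙 ≼ B
      B≽1 = ≼⊕ʳ (ι≽0 _)

      B≽0 : 𝟘 ≼ B
      B≽0 = ≼-trans 𝟘≼𝟙 B≽1

      D≡κ² : ι D ≡ κ ⊗ κ
      D≡κ² = trans (cong ι D≡K²) (ι-* (suc K) (suc K))

      κ⁻¹≼1 : κ⁻¹ ≼ 𝟙
      κ⁻¹≼1 = ⊗-cancel-ι K (≡-trans-≼ (rcp-inv K) (≼-trans-≡ (≡-trans-≼ (sym ι1) (ι-mono (ℕ.s≤s ℕ.z≤n))) (sym (⊗-idʳ κ))))

      κκ⁻¹ : ∀ l → κ ^^ l ⊗ κ⁻¹ ^^ l ≡ 𝟙
      κκ⁻¹ l = trans (sym (^^-⊗ κ κ⁻¹ l)) (trans (cong (_^^ l) (rcp-inv K)) (𝟙^^ l))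

      Dr≡1 : ι D ⊗ r ≡ 𝟙
      Dr≡1 = trans (cong (_⊗ r) D≡κ²) (trans (⊗-interchange κ κ κ⁻¹ κ⁻¹) (trans (cong (λ z → z ⊗ z) (rcp-inv K)) (⊗-idˡ 𝟙)))

      κ⁻¹-anti : ∀ {a b} → a ℕ.≤ b → κ⁻¹ ^^ b ≼ κ⁻¹ ^^ a
      κ⁻¹-anti {a} {b} a≤b with ℕ.m≤n⇒∃[o]m+o≡n a≤b
      ... | o , refl = ≡-trans-≼ (^^-+ κ⁻¹ a o) (≼-trans-≡ (⊗-monoˡ _ (^^≽0 a κ⁻¹≽0)
              (≼-trans-≡ (^^-mono o κ⁻¹≽0 κ⁻¹≼1) (𝟙^^ o))) (⊗-idʳ _))

      weight : V → Word → Q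
      weight v u = [[ inside v u ]] ⊗ r ^^ fresh v u

      -- A fresh continuation multiplies the weight by r = 1/D, and all D of them together
      -- contribute at most 1. The continuations along old edges keep the weight, but there are at
      -- most 2c of them.
      weight-extend : ∀ v u → Red u → length u ℕ.≤ n →
        sum (λ a → [[ not (top? a u) ]] ⊗ weight v (a ∷ u)) ≼ B ⊗ weight v u
      weight-extend v u ru l with inside v u in eq
      ... | false = ≼-reflexive (trans (trans (sum-cong λ a → trans (cong ([[ not (top? a u) ]] ⊗_) (⊗-zeroˡ _)) (⊗-zeroʳ _)) (sum-0 D))
                      (sym (trans (cong (B ⊗_) (⊗-zeroˡ _)) (⊗-zeroʳ B))))
      ... | true = ≼-trans (sum-mono term)
            (≡-trans-≼ (sum-⊗ˡ (r ^^ f) _) (≼-trans-≡ (⊗-monoˡ (r ^^ f) (^^≽0 f r≽0)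
              (≡-trans-≼ (∑-distrib-+ _ _) (⊕-mono (≼-reflexive (trans (sum-const D r) Dr≡1)) (few-old girth 0<g n+g≤ v u ru eq l))))
              (trans (⊗-comm _ B) (cong (B ⊗_) (sym (⊗-idˡ _))))))
        where
        f : ℕ
        f = fresh v u
        drop : ∀ (x y : Bool) {z} → 𝟘 ≼ z → [[ x ]] ⊗ ([[ y ]] ⊗ z) ≼ z
        drop x y {z} h = ≼-trans (⊗-monoʳ _ (⊗≽0 ([[]]≽0 y) h) ([[]]≼1 x)) (≡-trans-≼ (⊗-idˡ _) (≼-trans-≡ (⊗-monoʳ z h ([[]]≼1 y)) (⊗-idˡ z)))
        term : ∀ a → [[ not (top? a u) ]] ⊗ ([[ good (step a (end v u)) ]] ⊗ r ^^ fresh v (a ∷ u)) ≼ r ^^ f ⊗ (r ⊕ [[ seen v u (edge a (end v u)) ]])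
        term a with seen v u (edge a (end v u))
        ... | true = ≼-trans (drop (not (top? a u)) (good (step a (end v u))) (^^≽0 f r≽0)) (≡-trans-≼ (sym (⊗-idʳ _)) (⊗-monoˡ _ (^^≽0 f r≽0) (≼⊕ˡ r≽0)))
        ... | false = ≼-trans (drop (not (top? a u)) (good (step a (end v u))) (^^≽0 (suc f) r≽0)) (≡-trans-≼ (⊗-comm r _) (⊗-monoˡ _ (^^≽0 f r≽0) (≼-reflexive (sym (⊕-idʳ r)))))

      ΣRed-weight : ∀ v k → k ℕ.≤ n → ΣRed k (weight v) ≼ B ^^ k
      ΣRed-weight v zero l = ≡-trans-≼ (⊗-idʳ _) ([[]]≼1 (good v))
      ΣRed-weight v (suc k) l = ≼-trans (ΣRed-mono k λ u ru e → weight-extend v u ru (ℕ.≤-trans (ℕ.≤-reflexive e) (ℕ.<⇒≤ l)))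
        (≡-trans-≼ (ΣRed-⊗ k B _) (⊗-monoˡ B B≽0 (ΣRed-weight v k (ℕ.<⇒≤ l))))

      Θ : V → Word → Q
      Θ v u = [[ inside v u ]] ⊗ κ⁻¹ ^^ (#units (coef v u) ℕ.⊓ n)

      Θ≽0 : ∀ v u → 𝟘 ≼ Θ v u
      Θ≽0 v u = ⊗≽0 ([[]]≽0 (inside v u)) (^^≽0 (#units (coef v u) ℕ.⊓ n) κ⁻¹≽0)

      -- By `fresh-units`, 2·fresh ≤ length + #units, which is the exponent form of the claim
      -- because r = κ⁻². Truncating #units at n does no harm, since fresh ≤ length ≤ n.
      Θ≼weight : ∀ v u → length u ℕ.≤ n → Θ v u ≼ κ ^^ length u ⊗ weight v u
      Θ≼weight v u l = ≼-trans-≡ (⊗-monoˡ _ ([[]]≽0 (inside v u)) (begin≼))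
        (trans (sym (⊗-assoc _ _ _)) (trans (cong (_⊗ r ^^ fresh v u) (⊗-comm _ _)) (⊗-assoc _ _ _)))
        where
        m = #units (coef v u) ℕ.⊓ n
        f = fresh v u
        len : f ℕ.+ f ℕ.≤ length u ℕ.+ m
        len with ℕ.⊓-sel (#units (coef v u)) n
        ... | inj₁ e rewrite e = ℕ.≤-trans (fresh-units v u) (ℕ.≤-reflexive (ℕ.+-comm (#units (coef v u)) _))
        ... | inj₂ e rewrite e = ℕ.+-mono-≤ (fresh≤length v u) (ℕ.≤-trans (fresh≤length v u) l)
        begin≼ : κ⁻¹ ^^ m ≼ κ ^^ length u ⊗ r ^^ f
        begin≼ = ≡-trans-≼ (trans (sym (⊗-idˡ _)) (trans (cong (_⊗ κ⁻¹ ^^ m) (sym (κκ⁻¹ (length u)))) (⊗-assoc _ _ _)))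
          (⊗-monoˡ _ (^^≽0 (length u) κ≽0) (≡-trans-≼ (sym (^^-+ κ⁻¹ (length u) m))
            (≼-trans-≡ (κ⁻¹-anti len) (trans (^^-+ κ⁻¹ f f) (sym (^^-⊗ κ⁻¹ κ⁻¹ f))))))

      open Reduction κ κ≽0 D≡κ²

      ΣRed-Θ : ∀ v k → k ℕ.≤ n → ΣRed k (Θ v) ≼ κ ^^ k ⊗ B ^^ k
      ΣRed-Θ v k l = ≼-trans (ΣRed-mono k λ { u ru refl → Θ≼weight v u l })
        (≡-trans-≼ (ΣRed-⊗ k (κ ^^ k) (weight v)) (⊗-monoˡ _ (^^≽0 k κ≽0) (ΣRed-weight v k l)))

      T-Θ : ∀ v k → k ℕ.≤ n → T k (Θ v) ≼ κ ^^ k ⊗ ι (suc k) ⊗ B ^^ k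
      T-Θ v zero l = ≼-trans-≡ (ΣRed-Θ v 0 l) (cong (_⊗ 𝟙) (sym (trans (⊗-idˡ _) ι1)))
      T-Θ v (suc k) l = ≼-trans (⊕-mono (⊗-monoˡ κ κ≽0 (T-Θ v k (ℕ.<⇒≤ l))) (ΣRed-Θ v (suc k) l))
        (≼-trans (⊕-mono (⊗-monoˡ κ κ≽0 (⊗-monoˡ _ (⊗≽0 (^^≽0 k κ≽0) (ι≽0 (suc k))) (≡-trans-≼ (sym (⊗-idˡ _)) (⊗-monoʳ _ (^^≽0 k B≽0) B≽1)))) ≼-refl)
          (≼-reflexive (trans (e κ (κ ^^ k) (ι (suc k)) (B ⊗ B ^^ k)) (cong (λ z → κ ⊗ κ ^^ k ⊗ z ⊗ (B ⊗ B ^^ k)) (sym (ι-suc (suc k)))))))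
        where
        opaque
          unfolding Q
          e : ∀ k kk i b → k ⊗ (kk ⊗ i ⊗ b) ⊕ k ⊗ kk ⊗ b ≡ k ⊗ kk ⊗ (𝟙 ⊕ i) ⊗ b
          e k kk i b = solve 4 (λ k kk i b → k :* (kk :* i :* b) :+ k :* kk :* b := k :* kk :* (con ℚ.1ℚ :+ i) :* b) refl k kk i b

    -- The square-root gain: apart from the factor n + 1 and a base that depends only on c, the
    -- walks count as κ^n = D^(n/2) instead of D^n.
    walk-total : ∀ v → ΣW n (λ w → [[ inside v w ]] ⊗ rcp (suc K) ^^ (#units (coef v w) ℕ.⊓ n))
                       ≼ ι 2 ^^ n ⊗ (ι (suc K) ^^ n ⊗ ι (suc n) ⊗ (𝟙 ⊕ ι (2 ℕ.* c)) ^^ n)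
    walk-total v = ≼-trans (ΣW-mono n λ w _ → pt w) (≼-trans (ΣW-red n (Θ≽0 v)) (⊗-monoˡ _ (^^≽0 n (ι≽0 2)) (T-Θ v n ℕ.≤-refl)))
      where
      pt : ∀ w → [[ inside v w ]] ⊗ κ⁻¹ ^^ (#units (coef v w) ℕ.⊓ n) ≼ Θ v (red w)
      pt w = ≼-trans-≡ (⊗-monoʳ _ (^^≽0 (#units (coef v w) ℕ.⊓ n) κ⁻¹≽0) ins)
        (cong (λ z → [[ inside v (red w) ]] ⊗ κ⁻¹ ^^ (z ℕ.⊓ n)) (#units-cong λ e → sym (coef-red v w e)))
        where
        ins : [[ inside v w ]] ≼ [[ inside v (red w) ]]
        ins with inside v w in eq
        ... | false = [[]]≽0 (inside v (red w))
        ... | true = ≼-reflexive (cong [[_]] (sym (inside-red v w eq)))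

  nonempty : Word → Bool
  nonempty [] = false
  nonempty (_ ∷ _) = true

  returns? : V → Word → Bool
  returns? v u = inside v u ∧ nonempty u ∧ does (end v u ≟ v)

  module _ (A : ℕ) (δ : Seq) where
    open Average A

    -- With `δ` the indicator of the multiples of N this counts the nonempty reduced closed walks at
    -- v, shorter than 2g, whose lift closes up too.
    returns : ℕ → V → (Fin E → Fin A) → Q
    returns g v s = sum {g ℕ.+ g} λ r → ΣRed (toℕ r) λ u → [[ returns? v u ]] ⊗ δ (+ 0 ℤ.+ dot (coef v u) s)

    module _ (δ≽0 : ∀ y → 𝟘 ≼ δ y) where

      returns≽0 : ∀ g v s → 𝟘 ≼ returns g v s
      returns≽0 g v s = sum≽0 λ r → ΣRed≽0 (toℕ r) λ u → ⊗≽0 ([[]]≽0 (returns? v u)) (δ≽0 _)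

      no-return : ∀ g v s → returns g v s ≡ 𝟘 → ∀ u → Red u → 0 ℕ.< length u → length u ℕ.< g ℕ.+ g →
                  inside v u ≡ true → end v u ≡ v → δ (+ 0 ℤ.+ dot (coef v u) s) ≡ 𝟙 → ⊥
      no-return g v s z u ru 0< < ins e d1 = 𝟙⋠𝟘 (≡-trans-≼ (sym t≡1) (≼-trans-≡ (≼-trans
          (subst (λ k → F u ≼ ΣRed k F) (sym (Fin.toℕ-fromℕ< <)) (term≼ΣRed F≽0 ru))
          (term≼sum {f = λ r → ΣRed (toℕ r) F} (λ r → ΣRed≽0 (toℕ r) F≽0) (Fin.fromℕ< <))) z))
        where
        F : Word → Q
        F u = [[ returns? v u ]] ⊗ δ (+ 0 ℤ.+ dot (coef v u) s)
        F≽0 : ∀ u → 𝟘 ≼ F u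
        F≽0 u = ⊗≽0 ([[]]≽0 (returns? v u)) (δ≽0 _)
        ret : ∀ u → 0 ℕ.< length u → inside v u ≡ true → end v u ≡ v → returns? v u ≡ true
        ret (a ∷ u) _ ins e with end v (a ∷ u) ≟ v
        ... | yes _ rewrite ins = refl
        ... | no ¬p = ⊥-elim (¬p e)
        t≡1 : F u ≡ 𝟙
        t≡1 = trans (cong₂ (λ b x → [[ b ]] ⊗ x) (ret u 0< ins e) d1) (⊗-idˡ 𝟙)

      ΣS-ΣRed : ∀ n (F : Word → (Fin E → Fin A) → Q) → ΣS E (λ s → ΣRed n (λ u → F u s)) ≡ ΣRed n (λ u → ΣS E (F u))
      ΣS-ΣRed zero F = refl
      ΣS-ΣRed (suc n) F = trans (ΣS-ΣRed n (λ u s → sum (λ a → [[ not (top? a u) ]] ⊗ F (a ∷ u) s)))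
        (ΣRed-cong n λ u → trans (ΣS-sum E _) (sum-cong λ a → ΣS-⊗ E _ _))

      module _ (δ-bounded : Bounded 𝟙 δ) (δ-sparse : ∀ {u} → Unit u → Bounded 𝟙 (U u δ)) where

        -- By the girth such a walk has at least g letters, and fewer than 2g, so some edge has
        -- coefficient ±1 and its lift closes for at most a fraction 1/A of all shifts. There are at
        -- most D^r words of length r.
        rare-returns : ∀ {g} → Girth g → ∀ v → ι A ⊗ ΣS E (returns g v) ≼ ι A ^^ E ⊗ sum {g ℕ.+ g} (λ r → ι D ^^ toℕ r)
        rare-returns {g} girth v = ≡-trans-≼ (cong (ι A ⊗_) (ΣS-sum E _)) (≡-trans-≼ (sym (sum-⊗ˡ (ι A) _))
          (≼-trans-≡ (sum-mono λ r → ≡-trans-≼ (cong (ι A ⊗_) (ΣS-ΣRed (toℕ r) _)) (≡-trans-≼ (sym (ΣRed-⊗ (toℕ r) (ι A) _))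
             (≼-trans (ΣRed-mono (toℕ r) λ u ru l → pt u ru (ℕ.≤-trans (ℕ.≤-reflexive (cong suc l)) (Fin.toℕ<n r)))
               (≡-trans-≼ (trans (ΣRed-cong (toℕ r) λ u → sym (⊗-idʳ _)) (ΣRed-⊗ (toℕ r) (ι A ^^ E) (λ _ → 𝟙))) (⊗-monoˡ _ (^^≽0 E (ι≽0 A)) (ΣRed-1 (toℕ r)))))))
            (sum-⊗ˡ (ι A ^^ E) _)))
          where
          pt : ∀ u → Red u → length u ℕ.< g ℕ.+ g → ι A ⊗ ΣS E (λ s → [[ returns? v u ]] ⊗ δ (+ 0 ℤ.+ dot (coef v u) s)) ≼ ι A ^^ E
          pt u ru l = ≡-trans-≼ (cong (ι A ⊗_) (ΣS-⊗ E _ _)) (go (returns? v u) refl)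
            where
            X : Q
            X = ΣS E (λ s → δ (+ 0 ℤ.+ dot (coef v u) s))
            split : ∀ u → returns? v u ≡ true → inside v u ≡ true × 0 ℕ.< length u × end v u ≡ v
            split u h with ∧-true {inside v u} h
            split (a ∷ u) h | i , h′ with end v (a ∷ u) ≟ v
            ... | yes p = i , ℕ.s≤s ℕ.z≤n , p
            split (a ∷ u) h | i , () | no _
            go : ∀ b → returns? v u ≡ b → ι A ⊗ ([[ b ]] ⊗ X) ≼ ι A ^^ E
            go false _ = ≡-trans-≼ (trans (cong (ι A ⊗_) (⊗-zeroˡ X)) (⊗-zeroʳ _)) (^^≽0 E (ι≽0 A))
            go true h with split u h
            ... | i , 0< , e = ≡-trans-≼ (cong (ι A ⊗_) (⊗-idˡ X)) (≼-trans (⊗-monoˡ (ι A) (ι≽0 A) (≼∣∣ X))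
                    (≼-trans-≡ (hit-bound E (coef v u) δ (+ 0) 𝟘≼𝟙 δ-bounded δ-sparse
                       (units-positive girth v u ru i (girth v u ru 0< i e) l)) (⊗-idʳ _)))

-- Linear forms in the shifts; periodic sequences.

dot-+ : ∀ {A E} (c c′ : Fin E → ℤ) s → Average.dot A (λ e → c e ℤ.+ c′ e) s ≡ Average.dot A c s ℤ.+ Average.dot A c′ s
dot-+ {A} {zero} c c′ s = refl
dot-+ {A} {suc E} c c′ s = trans (cong (λ z → (c zero ℤ.+ c′ zero) ℤ.* + toℕ (s zero) ℤ.+ z) (dot-+ (c ∘ suc) (c′ ∘ suc) (s ∘ suc)))
    (e (c zero) (c′ zero) (+ toℕ (s zero)) _ _)
  where
  e : ∀ a b x p q → (a ℤ.+ b) ℤ.* x ℤ.+ (p ℤ.+ q) ≡ a ℤ.* x ℤ.+ p ℤ.+ (b ℤ.* x ℤ.+ q)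
  e = ℤ-Ring.solve-∀

dot-0 : ∀ {A E} s → Average.dot A {E} (λ _ → + 0) s ≡ + 0
dot-0 {A} {zero} s = refl
dot-0 {A} {suc E} s = trans (ℤ.+-identityˡ _) (dot-0 (s ∘ suc))

dot-indicator : ∀ {A E} (k : Fin E) x s → Average.dot A (λ e → if does (e Fin.≟ k) then x else + 0) s ≡ x ℤ.* + toℕ (s k)
dot-indicator {A} {suc E} zero x s = trans (cong (λ z → x ℤ.* + toℕ (s zero) ℤ.+ z) (dot-0 (s ∘ suc))) (ℤ.+-identityʳ _)
dot-indicator {A} {suc E} (suc k) x s = trans (ℤ.+-identityˡ _) (dot-indicator k x (s ∘ suc))

Periodic : ℕ → Seq → Set
Periodic N g = ∀ y → g (y ℤ.+ + N) ≡ g y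

module Period (N : ℕ) where

  Σₚ : Seq → Q
  Σₚ g = sum {N} λ z → g (+ toℕ z)

  private
    shift-1 : ∀ {g} → Periodic N g → Σₚ (λ z → g (z ℤ.+ + 1)) ≡ Σₚ g
    shift-1 {g} p = ⊖-zero (trans (cong (_⊖ Σₚ g) (sum-cong λ z → cong g (ℤ.+-comm (+ toℕ z) (+ 1)))) (trans (flip N (λ n → g (+ n)))
        (trans (cong (_⊖ g (+ 0)) (trans (cong g (sym (ℤ.+-identityˡ (+ N)))) (p (+ 0)))) (⊖-self _))))
      where
      ⊖-zero : ∀ {a b} → a ⊖ b ≡ 𝟘 → a ≡ b
      ⊖-zero {a} {b} e = trans (sym (⊖⊕-cancel a b)) (trans (cong (_⊕ b) e) (⊕-idˡ b))
      flip : ∀ n (g : ℕ → Q) → sum {n} (λ a → g (suc (toℕ a))) ⊖ sum {n} (λ a → g (toℕ a)) ≡ g n ⊖ g 0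
      flip zero g = trans (cong₂ _⊖_ (sum-zero _) (sum-zero _)) (trans (⊖-self 𝟘) (sym (⊖-self (g 0))))
      flip (suc n) g = trans (cong₂ _⊖_ (sum-suc {n} _) (sum-suc {n} _)) (trans (e _ _ _ _) (trans (cong ((g 1 ⊖ g 0) ⊕_) (flip n (g ∘ suc))) (e′ _ _ _)))
        where
        opaque
          unfolding Q
          e : ∀ a b c d → (a ⊕ b) ⊖ (c ⊕ d) ≡ (a ⊖ c) ⊕ (b ⊖ d)
          e a b c d = solve 4 (λ a b c d → (a :+ b) :- (c :+ d) := (a :- c) :+ (b :- d)) refl a b c d
          e′ : ∀ a b c → (a ⊖ b) ⊕ (c ⊖ a) ≡ c ⊖ b
          e′ a b c = solve 3 (λ a b c → (a :- b) :+ (c :- a) := c :- b) refl a b c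

    swapʳ : ∀ y k l → y ℤ.+ k ℤ.+ l ≡ y ℤ.+ l ℤ.+ k
    swapʳ = ℤ-Ring.solve-∀

  shift-periodic : ∀ {g} k → Periodic N g → Periodic N (λ y → g (y ℤ.+ k))
  shift-periodic {g} k p y = trans (cong g (swapʳ y (+ N) k)) (p _)

  private
    shift-n : ∀ n {g} → Periodic N g → Σₚ (λ z → g (z ℤ.+ + n)) ≡ Σₚ g
    shift-n zero {g} p = sum-cong λ z → cong g (ℤ.+-identityʳ _)
    shift-n (suc n) {g} p = trans (sum-cong λ z → cong g (e (+ toℕ z) (+ n))) (trans (shift-1 (shift-periodic (+ n) p)) (shift-n n p))
      where
      e : ∀ z n → z ℤ.+ (+ 1 ℤ.+ n) ≡ z ℤ.+ + 1 ℤ.+ n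
      e = ℤ-Ring.solve-∀

  Σₚ-shift : ∀ k {g} → Periodic N g → Σₚ (λ z → g (z ℤ.+ k)) ≡ Σₚ g
  Σₚ-shift (+ n) p = shift-n n p
  Σₚ-shift -[1+ n ] {g} p = trans (sym (shift-n (suc n) (shift-periodic -[1+ n ] p)))
    (sum-cong λ z → cong g (e (+ toℕ z) (+ suc n)))
    where
    e : ∀ z n → z ℤ.+ n ℤ.+ ℤ.- n ≡ z
    e = ℤ-Ring.solve-∀

  module _ {h : ℕ} where
    open Window h

    P-periodic : ∀ {g} → Periodic N g → Periodic N (P g)
    P-periodic {g} p y = trans (P-shift g (+ N) y) (P-cong p y)

    P-adjoint : ∀ {f g} → Periodic N f → Periodic N g → Σₚ (λ z → P f z ⊗ g z) ≡ Σₚ (λ z → f z ⊗ P g z)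
    P-adjoint {f} {g} pf pg = trans (trans (sum-cong λ z → e₁ _ _ _) (sum-⊖ _ _))
        (trans (cong (Σₚ (λ z → f z ⊗ g z) ⊖_) avg) (sym (trans (sum-cong λ z → ⊗-⊖-distribˡ _ _ _) (sum-⊖ _ _))))
      where
      opaque
        unfolding Q
        e₁ : ∀ a b c → (a ⊖ b) ⊗ c ≡ a ⊗ c ⊖ b ⊗ c
        e₁ a b c = solve 3 (λ a b c → (a :- b) :* c := a :* c :- b :* c) refl a b c
      mean-⊗ʳ : ∀ F c → mean F ⊗ c ≡ mean (λ t t′ → F t t′ ⊗ c)
      mean-⊗ʳ F c = trans (⊗-assoc _ _ _) (cong (h⁻² ⊗_) (trans (sym (sum-⊗ʳ c _)) (sum-cong λ t → sym (sum-⊗ʳ c _))))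
      mean-swap : ∀ F → mean F ≡ mean (λ t t′ → F t′ t)
      mean-swap F = cong (h⁻² ⊗_) (∑-comm F)
      e₂ : ∀ z a b → z ℤ.+ (b ℤ.- a) ≡ z ℤ.+ b ℤ.- a
      e₂ = ℤ-Ring.solve-∀
      e₃ : ∀ z a b → z ℤ.+ (b ℤ.- a) ℤ.+ a ℤ.- b ≡ z
      e₃ = ℤ-Ring.solve-∀
      per : ∀ t t′ → Periodic N (λ z → f (off z t t′) ⊗ g z)
      per t t′ y = cong₂ _⊗_ (trans (cong f (off-shift y (+ N) t t′)) (pf _)) (pg y)
      avg : Σₚ (λ z → Avg f z ⊗ g z) ≡ Σₚ (λ z → f z ⊗ Avg g z)
      avg = begin
        Σₚ (λ z → Avg f z ⊗ g z)                                   ≡⟨ sum-cong (λ z → mean-⊗ʳ _ _) ⟩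
        Σₚ (λ z → mean (λ t t′ → f (off z t t′) ⊗ g z))            ≡⟨ mean-sum {N} (λ z t t′ → f (off (+ toℕ z) t t′) ⊗ g (+ toℕ z)) ⟨
        mean (λ t t′ → Σₚ (λ z → f (off z t t′) ⊗ g z))            ≡⟨ mean-cong (λ t t′ → sym (Σₚ-shift (+ toℕ t′ ℤ.- + toℕ t) (per t t′))) ⟩
        mean (λ t t′ → Σₚ (λ z → f (off (z ℤ.+ (+ toℕ t′ ℤ.- + toℕ t)) t t′) ⊗ g (z ℤ.+ (+ toℕ t′ ℤ.- + toℕ t))))
          ≡⟨ mean-cong (λ t t′ → sum-cong λ z → cong₂ _⊗_ (cong f (e₃ (+ toℕ z) (+ toℕ t) (+ toℕ t′))) (cong g (e₂ (+ toℕ z) (+ toℕ t) (+ toℕ t′)))) ⟩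
        mean (λ t t′ → Σₚ (λ z → f z ⊗ g (off z t′ t)))            ≡⟨ mean-swap _ ⟩
        mean (λ t t′ → Σₚ (λ z → f z ⊗ g (off z t t′)))            ≡⟨ mean-sum {N} (λ z t t′ → f (+ toℕ z) ⊗ g (off (+ toℕ z) t t′)) ⟩
        Σₚ (λ z → mean (λ t t′ → f z ⊗ g (off z t t′)))            ≡⟨ sum-cong (λ z → trans (mean-cong λ t t′ → ⊗-comm _ _) (trans (sym (mean-⊗ʳ _ _)) (⊗-comm _ _))) ⟩
        Σₚ (λ z → f z ⊗ Avg g z)                                   ∎
        where open ≡-Reasoning

  δ : Seq
  δ y = [[ does (N divs? ℤ.∣ y ∣) ]]

  δ≽0 : ∀ y → 𝟘 ≼ δ y
  δ≽0 y = [[]]≽0 (does (N divs? ℤ.∣ y ∣))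

  δ-bounded : Bounded 𝟙 δ
  δ-bounded y = ≡-trans-≼ (∣∣-nonneg (δ≽0 y)) ([[]]≼1 (does (N divs? ℤ.∣ y ∣)))

  δ-periodic : Periodic N δ
  δ-periodic y = cong [[_]] (does-≡ (N divs? ℤ.∣ y ℤ.+ + N ∣) (N divs? ℤ.∣ y ∣)
    (λ d → ℤD.∣⇒∣ᵤ (ℤD.∣m+n∣n⇒∣m {+ N} {y} {+ N} (ℤD.∣ᵤ⇒∣ d) N∣N))
    (λ d → ℤD.∣⇒∣ᵤ (ℤD.∣m∣n⇒∣m+n {+ N} {y} {+ N} (ℤD.∣ᵤ⇒∣ d) N∣N)))
    where
    N∣N : + N ℤD.∣ + N
    N∣N = ℤD.∣ᵤ⇒∣ ∣-refl

  sum-single : ∀ {n} (f : Fin n → Bool) → (∀ i j → f i ≡ true → f j ≡ true → i ≡ j) → sum (λ i → [[ f i ]]) ≼ 𝟙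
  sum-single {zero} f h = ≡-trans-≼ (sum-zero _) 𝟘≼𝟙
  sum-single {suc n} f h with f zero in eq
  ... | false = ≡-trans-≼ (trans (sum-suc _) (trans (cong (λ b → [[ b ]] ⊕ sum (λ i → [[ f (suc i) ]])) eq) (⊕-idˡ _)))
                  (sum-single (f ∘ suc) λ i j p q → Fin.suc-injective (h (suc i) (suc j) p q))
  ... | true = ≼-reflexive (trans (sum-suc _) (trans (cong₂ _⊕_ (cong [[_]] eq) (trans (sum-cong rest) (sum-0 n))) (⊕-idʳ 𝟙)))
    where
    rest : ∀ i → [[ f (suc i) ]] ≡ 𝟘
    rest i with f (suc i) in eq′
    ... | false = refl
    ... | true with () ← h zero (suc i) eq eq′

  close-multiples : ∀ {a b} → a ℕ.< N → b ℕ.< N → ∀ d → ℤ.∣ d ∣ ≡ ℤ.∣ + a ℤ.- + b ∣ → N divs ℤ.∣ d ∣ → a ≡ b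
  close-multiples {a} {b} a< b< d e dv = ℤ.+-injective (ℤ.i-j≡0⇒i≡j (+ a) (+ b) (ℤ.∣i∣≡0⇒i≡0 (small _ lt (subst (N divs_) e dv))))
    where
    small : ∀ n → n ℕ.< N → N divs n → n ≡ 0
    small zero _ _ = refl
    small (suc n) l d = ⊥-elim (ℕ.<⇒≱ l (∣⇒≤ d))
    lt : ℤ.∣ + a ℤ.- + b ∣ ℕ.< N
    lt with ℕ.≤-total b a
    ... | inj₁ b≤a = ℕ.≤-<-trans (ℕ.≤-trans (ℕ.≤-reflexive (cong ℤ.∣_∣ (trans (ℤ.m-n≡m⊖n a b) (ℤ.⊖-≥ b≤a)))) (ℕ.m∸n≤m a b)) a<
    ... | inj₂ a≤b = ℕ.≤-<-trans (ℕ.≤-trans (ℕ.≤-reflexive (trans (cong ℤ.∣_∣ (trans (ℤ.m-n≡m⊖n a b) (ℤ.⊖-≤ a≤b))) (ℤ.∣-i∣≡∣i∣ (+ (b ℕ.∸ a))))) (ℕ.m∸n≤m b a)) b<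

  δ-sparse : ∀ {A} → A ℕ.≤ N → ∀ {u} → Unit u → Bounded 𝟙 (Average.U A u δ)
  δ-sparse {A} A≤N {u} un y = ≡-trans-≼ (∣∣-nonneg (sum≽0 λ a → δ≽0 (y ℤ.+ u ℤ.* + toℕ a))) (sum-single (λ a → does (N divs? ℤ.∣ y ℤ.+ u ℤ.* + toℕ a ∣)) uniq)
    where
    uniq : ∀ i j → does (N divs? ℤ.∣ y ℤ.+ u ℤ.* + toℕ i ∣) ≡ true → does (N divs? ℤ.∣ y ℤ.+ u ℤ.* + toℕ j ∣) ≡ true → i ≡ j
    uniq i j p q = Fin.toℕ-injective (close-multiples (ℕ.<-≤-trans (Fin.toℕ<n i) A≤N) (ℕ.<-≤-trans (Fin.toℕ<n j) A≤N)
        (x ℤ.- x′) (abs un) (ℤD.∣⇒∣ᵤ (ℤD.∣m∣n⇒∣m-n {+ N} {x} {x′} (ℤD.∣ᵤ⇒∣ (does⇒ (N divs? ℤ.∣ x ∣) p)) (ℤD.∣ᵤ⇒∣ (does⇒ (N divs? ℤ.∣ x′ ∣) q)))))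
      where
      x = y ℤ.+ u ℤ.* + toℕ i
      x′ = y ℤ.+ u ℤ.* + toℕ j
      e₁ : ∀ y a b → y ℤ.+ + 1 ℤ.* a ℤ.- (y ℤ.+ + 1 ℤ.* b) ≡ a ℤ.- b
      e₁ = ℤ-Ring.solve-∀
      e₂ : ∀ y a b → y ℤ.+ ℤ.- + 1 ℤ.* a ℤ.- (y ℤ.+ ℤ.- + 1 ℤ.* b) ≡ ℤ.- (a ℤ.- b)
      e₂ = ℤ-Ring.solve-∀
      abs : ∀ {u} → Unit u → ℤ.∣ y ℤ.+ u ℤ.* + toℕ i ℤ.- (y ℤ.+ u ℤ.* + toℕ j) ∣ ≡ ℤ.∣ + toℕ i ℤ.- + toℕ j ∣
      abs (unit (inj₁ refl)) = cong ℤ.∣_∣ (e₁ y (+ toℕ i) (+ toℕ j))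
      abs (unit (inj₂ refl)) = trans (cong ℤ.∣_∣ (e₂ y (+ toℕ i) (+ toℕ j))) (ℤ.∣-i∣≡∣i∣ (+ toℕ i ℤ.- + toℕ j))

  δ-select : ∀ (g : Seq) (z₀ : Fin N) → Σₚ (λ z → g z ⊗ δ (z ℤ.- + toℕ z₀)) ≡ g (+ toℕ z₀)
  δ-select g z₀ = trans (sum-cong pt) (trans (sum-⊗ˡ (g (+ toℕ z₀)) _) (trans (cong (g (+ toℕ z₀) ⊗_) (sum-≟ z₀)) (⊗-idʳ _)))
    where
    pt : ∀ z → g (+ toℕ z) ⊗ δ (+ toℕ z ℤ.- + toℕ z₀) ≡ g (+ toℕ z₀) ⊗ [[≟]] z z₀
    pt z with z Fin.≟ z₀ | N divs? ℤ.∣ + toℕ z ℤ.- + toℕ z₀ ∣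
    ... | yes refl | yes _ = refl
    ... | no _     | no _  = trans (⊗-zeroʳ _) (sym (⊗-zeroʳ _))
    ... | yes refl | no ¬d = ⊥-elim (¬d (subst (N divs_) (sym (cong ℤ.∣_∣ (ℤ.+-inverseʳ (+ toℕ z)))) (N divs0)))
    ... | no ¬p    | yes d = ⊥-elim (¬p (Fin.toℕ-injective (close-multiples (Fin.toℕ<n z) (Fin.toℕ<n z₀) (+ toℕ z ℤ.- + toℕ z₀) refl d)))

  δ-1 : ∀ y → N divs ℤ.∣ y ∣ → δ y ≡ 𝟙
  δ-1 y d with N divs? ℤ.∣ y ∣
  ... | yes _ = refl
  ... | no ¬d = ⊥-elim (¬d d)

-- The trace method.

dbl : ℕ → ℕ
dbl zero = 2
dbl (suc k) = dbl k ℕ.+ dbl k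

dbl>0 : ∀ k → 0 ℕ.< dbl k
dbl>0 zero = ℕ.s≤s ℕ.z≤n
dbl>0 (suc k) = ℕ.≤-trans (dbl>0 k) (ℕ.m≤m+n _ _)

module Operators {V : Set} {D E : ℕ} (𝒢 : ColouredGraph V D E) (good : V → Bool)
  {M : ℕ} (vs : Fin M → V)
  (step-sum : ∀ a (F : V → Q) → sum (λ i → F (ColouredGraph.step 𝒢 a (vs i))) ≡ sum (λ i → F (vs i)))
  (select : ∀ v (F : V → Q) → sum (λ i → [[ does (ColouredGraph._≟_ 𝒢 (vs i) v) ]] ⊗ F (vs i)) ≡ F v)
  (A N h : ℕ) where

  open ColouredGraph 𝒢
  open Words D
  open Walks 𝒢 good
  open WalkSums 𝒢 good
  open Window h
  open Period N
  open Average A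

  Fun : Set
  Fun = V → Seq

  Per : Fun → Set
  Per f = ∀ v → Periodic N (f v)

  ip : Fun → Fun → Q
  ip f g = sum λ i → Σₚ λ z → f (vs i) z ⊗ g (vs i) z

  nrm : Fun → Q
  nrm f = ip f f

  infix 4 _≗₂_
  _≗₂_ : Fun → Fun → Set
  f ≗₂ g = ∀ v y → f v y ≡ g v y

  ip-cong : ∀ {f f′ g g′} → f ≗₂ f′ → g ≗₂ g′ → ip f g ≡ ip f′ g′
  ip-cong p q = sum-cong λ i → sum-cong λ z → cong₂ _⊗_ (p _ _) (q _ _)

  nrm≽0 : ∀ f → 𝟘 ≼ nrm f
  nrm≽0 f = sum≽0 λ i → sum≽0 λ z → sq≽0 _

  ip-cs : ∀ f g → ip f g ⊗ ip f g ≼ nrm f ⊗ nrm g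
  ip-cs f g = cauchy-schwarz′ _ _ _ (λ i → sum≽0 λ z → sq≽0 _) (λ i → sum≽0 λ z → sq≽0 _) λ i → cauchy-schwarz _ _

  traceTerm : ℕ → V → Word → (Fin E → Fin A) → Q
  traceTerm n v w s = [[ inside v w ]] ⊗ ([[ does (end v w ≟ v) ]] ⊗ Pow n δ (+ 0 ℤ.+ dot (coef v w) s))

  -- The trace of the n-th power of `M𝒜`, expanded into closed walks. Since `P` commutes with the
  -- graph operator, all n smoothings act on the point mass `δ`; the factor N stands for the N equal
  -- diagonal entries over a vertex.
  trace : ℕ → (Fin E → Fin A) → Q
  trace n s = ι N ⊗ sum λ i → ΣW n λ w → traceTerm n (vs i) w s

  ΣS-ΣW : ∀ n (F : Word → (Fin E → Fin A) → Q) → ΣS E (λ s → ΣW n (λ w → F w s)) ≡ ΣW n (λ w → ΣS E (F w))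
  ΣS-ΣW zero F = refl
  ΣS-ΣW (suc n) F = trans (ΣS-ΣW n (λ u s → sum (λ a → F (a ∷ u) s))) (ΣW-cong n λ w → ΣS-sum E _)

  module _ (K : ℕ) (D≡K² : D ≡ suc K ℕ.* suc K) {g : ℕ} (girth : Girth g) {n c : ℕ} (0<g : 0 ℕ.< g) (n+g≤ : n ℕ.+ g ℕ.≤ g ℕ.* c)
           (short : ι 4 ⊗ ι (suc h) ≼ ι 2 ⊗ (ι A ⊗ rcp (suc K))) where

    trace-average : ΣS E (trace n) ≼ ι A ^^ E ⊗ (ι N ⊗ (ι M ⊗ (ι 2 ^^ n ⊗ (ι 2 ^^ n ⊗ (ι (suc K) ^^ n ⊗ ι (suc n) ⊗ (𝟙 ⊕ ι (2 ℕ.* c)) ^^ n)))))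
    trace-average = ≡-trans-≼ (trans (ΣS-⊗ E (ι N) _) (cong (ι N ⊗_) (trans (ΣS-sum E _) (sum-cong λ i → ΣS-ΣW n _))))
      (≼-trans (⊗-monoˡ (ι N) (ι≽0 N) (≼-trans-≡ (sum-mono λ i → per-vertex (vs i)) (sum-const M X)))
        (≼-reflexive (e (ι N) (ι M) (ι A ^^ E) (ι 2 ^^ n) Y)))
      where
      Y X : Q
      Y = ι 2 ^^ n ⊗ (ι (suc K) ^^ n ⊗ ι (suc n) ⊗ (𝟙 ⊕ ι (2 ℕ.* c)) ^^ n)
      X = ι A ^^ E ⊗ ι 2 ^^ n ⊗ Y
      opaque
        unfolding Q
        e : ∀ n m a t y → n ⊗ (m ⊗ (a ⊗ t ⊗ y)) ≡ a ⊗ (n ⊗ (m ⊗ (t ⊗ y)))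
        e n m a t y = solve 5 (λ n m a t y → n :* (m :* (a :* t :* y)) := a :* (n :* (m :* (t :* y)))) refl n m a t y
      q : V → Word → ℕ
      q v w = #units (coef v w) ℕ.⊓ n
      term : ∀ v w → ΣS E (traceTerm n v w) ≼ ι A ^^ E ⊗ ι 2 ^^ n ⊗ ([[ inside v w ]] ⊗ rcp (suc K) ^^ q v w)
      term v w = ≡-trans-≼ (trans (ΣS-⊗ E _ _) (cong ([[ inside v w ]] ⊗_) (ΣS-⊗ E _ _)))
        (≼-trans (⊗-monoˡ _ ([[]]≽0 (inside v w)) (drop (does (end v w ≟ v)) S (average-bound h (rcp (suc K)) (rcp≽0 K) short E (coef v w) n δ (+ 0) 𝟘≼𝟙 δ-bounded)))
          (≼-reflexive (e′ [[ inside v w ]] (ι A ^^ E) (ι 2 ^^ n) (rcp (suc K) ^^ q v w))))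
        where
        S : Q
        S = ΣS E λ s → Pow n δ (+ 0 ℤ.+ dot (coef v w) s)
        drop : ∀ b x {y} → ∣ x ∣ ≼ y → [[ b ]] ⊗ x ≼ y
        drop true x h = ≡-trans-≼ (⊗-idˡ x) (≼-trans (≼∣∣ x) h)
        drop false x h = ≡-trans-≼ (⊗-zeroˡ x) (≼-trans (∣∣≽0 x) h)
        opaque
          unfolding Q
          e′ : ∀ i a t r → i ⊗ (a ⊗ t ⊗ r ⊗ 𝟙) ≡ a ⊗ t ⊗ (i ⊗ r)
          e′ i a t r = solve 4 (λ i a t r → i :* (a :* t :* r :* con ℚ.1ℚ) := a :* t :* (i :* r)) refl i a t r
      per-vertex : ∀ v → ΣW n (λ w → ΣS E (traceTerm n v w)) ≼ X
      per-vertex v = ≼-trans (ΣW-mono n λ w _ → term v w) (≡-trans-≼ (ΣW-⊗ n _ _)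
        (⊗-monoˡ _ (⊗≽0 (^^≽0 E (ι≽0 A)) (^^≽0 n (ι≽0 2))) (walk-total K D≡K² girth 0<g n+g≤ v)))

  module Twisted (s : Fin E → Fin A) where

    σ : Fin D → V → ℤ
    σ a v = sgn v ℤ.* + toℕ (s (edge a v))

    σ-step : ∀ a v → σ a (step a v) ≡ ℤ.- σ a v
    σ-step a v = trans (cong₂ (λ x e → x ℤ.* + toℕ (s e)) (sgn-step a v) (edge-step a v)) (sym (ℤ.neg-distribˡ-* (sgn v) _))

    on : Fin D → V → Bool
    on a v = good v ∧ good (step a v)

    on-step : ∀ a v → on a (step a v) ≡ on a v
    on-step a v = trans (cong (good (step a v) ∧_) (cong good (step² a v))) (∧-comm (good (step a v)) (good v))

    𝒜 M𝒜 : Fun → Fun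
    𝒜 f v y = sum λ a → [[ on a v ]] ⊗ f (step a v) (y ℤ.+ σ a v)
    M𝒜 f = 𝒜 λ v → P (f v)

    pow : ℕ → Fun → Fun
    pow zero f = f
    pow (suc n) f = pow n (M𝒜 f)

    𝒜-per : ∀ {f} → Per f → Per (𝒜 f)
    𝒜-per p v y = sum-cong λ a → cong ([[ on a v ]] ⊗_) (shift-periodic (σ a v) (p (step a v)) y)

    P-per : ∀ {f} → Per f → Per (λ v → P (f v))
    P-per p v = P-periodic (p v)

    M-per : ∀ {f} → Per f → Per (M𝒜 f)
    M-per p = 𝒜-per (P-per p)

    pow-per : ∀ n {f} → Per f → Per (pow n f)
    pow-per zero p = p
    pow-per (suc n) p = pow-per n (M-per p)

    -- Substituting the other end of each edge negates its shift, and a translation of z moves the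
    -- shift from `f` to `g`.
    𝒜-adjoint : ∀ {f g} → Per f → Per g → ip (𝒜 f) g ≡ ip f (𝒜 g)
    𝒜-adjoint {f} {g} pf pg = begin
      ip (𝒜 f) g                                  ≡⟨ sum-cong (λ i → trans (sum-cong λ z → sym (sum-⊗ʳ _ _)) (∑-comm {N} _)) ⟩
      sum (λ i → sum λ a → Y a (vs i))            ≡⟨ ∑-comm (λ i a → Y a (vs i)) ⟩
      sum (λ a → sum λ i → Y a (vs i))            ≡⟨ sum-cong (λ a → sym (step-sum a (Y a))) ⟩
      sum (λ a → sum λ i → Y a (step a (vs i)))   ≡⟨ sum-cong (λ a → sum-cong λ i → flip a (vs i)) ⟩
      sum (λ a → sum λ i → Z a (vs i))            ≡⟨ ∑-comm (λ i a → Z a (vs i)) ⟨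
      sum (λ i → sum λ a → Z a (vs i))            ≡⟨ sum-cong (λ i → trans (sum-cong λ z → sym (sum-⊗ˡ _ _)) (∑-comm {N} _)) ⟨
      ip f (𝒜 g)                                  ∎
      where
      open ≡-Reasoning
      Y Z : Fin D → V → Q
      Y a v = Σₚ λ z → ([[ on a v ]] ⊗ f (step a v) (z ℤ.+ σ a v)) ⊗ g v z
      Z a v = Σₚ λ z → f v z ⊗ ([[ on a v ]] ⊗ g (step a v) (z ℤ.+ σ a v))
      e : ∀ z k → z ℤ.+ k ℤ.+ ℤ.- k ≡ z
      e = ℤ-Ring.solve-∀
      flip : ∀ a v → Y a (step a v) ≡ Z a v
      flip a v = trans (sym (Σₚ-shift (σ a v) λ y → cong₂ (λ p q → ([[ on a (step a v) ]] ⊗ p) ⊗ q) (shift-periodic (σ a (step a v)) (pf _) y) (pg _ y)))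
        (sum-cong λ z → trans (cong₂ (λ b x → ([[ b ]] ⊗ x) ⊗ g (step a v) (+ toℕ z ℤ.+ σ a v)) (on-step a v)
            (cong₂ f (step² a v) (trans (cong (λ k → + toℕ z ℤ.+ σ a v ℤ.+ k) (σ-step a v)) (e (+ toℕ z) (σ a v)))))
          (trans (cong (_⊗ g (step a v) (+ toℕ z ℤ.+ σ a v)) (⊗-comm _ _)) (⊗-assoc _ _ _)))

    P-𝒜 : ∀ f v y → P (𝒜 f v) y ≡ 𝒜 (λ v → P (f v)) v y
    P-𝒜 f v y = trans (P-sum (λ a y → [[ on a v ]] ⊗ f (step a v) (y ℤ.+ σ a v)) y)
      (sum-cong λ a → trans (P-⊗ [[ on a v ]] (λ y → f (step a v) (y ℤ.+ σ a v)) y) (cong ([[ on a v ]] ⊗_) (sym (P-shift (f (step a v)) (σ a v) y))))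

    M-adjoint : ∀ {f g} → Per f → Per g → ip (M𝒜 f) g ≡ ip f (M𝒜 g)
    M-adjoint {f} {g} pf pg = trans (𝒜-adjoint (P-per pf) pg) (trans (sum-cong λ i → P-adjoint (pf _) (𝒜-per pg _))
      (sum-cong λ i → sum-cong λ z → cong (f (vs i) (+ toℕ z) ⊗_) (P-𝒜 g (vs i) (+ toℕ z))))

    M-pow : ∀ n f → M𝒜 (pow n f) ≗₂ pow n (M𝒜 f)
    M-pow zero f v y = refl
    M-pow (suc n) f = M-pow n (M𝒜 f)

    pow-adjoint : ∀ n {f g} → Per f → Per g → ip (pow n f) g ≡ ip f (pow n g)
    pow-adjoint zero pf pg = refl
    pow-adjoint (suc n) {f} {g} pf pg = trans (pow-adjoint n (M-per pf) pg) (trans (M-adjoint pf (pow-per n pg))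
      (ip-cong {f} {f} (λ _ _ → refl) (M-pow n g)))

    pow-+ : ∀ m n f → pow (m ℕ.+ n) f ≡ pow n (pow m f)
    pow-+ zero n f = refl
    pow-+ (suc m) n f = pow-+ m n (M𝒜 f)

    x : ℕ → Fun → Q
    x n f = ip (pow n f) f

    x-double : ∀ n {f} → Per f → x (n ℕ.+ n) f ≡ nrm (pow n f)
    x-double n {f} pf = trans (cong (λ F → ip F f) (pow-+ n n f)) (pow-adjoint n (pow-per n pf) pf)

    -- Cauchy-Schwarz gives (x n f)² ≤ |pow n f|²·|f|², and |pow n f|² = x (2n) f because the
    -- operator is self-adjoint. This takes the place of a spectral decomposition.
    descend : ∀ n {r} → 𝟘 ≼ r → (∀ {f} → Per f → x (n ℕ.+ n) f ≼ (r ⊗ r) ⊗ nrm f) → ∀ {f} → Per f → x n f ≼ r ⊗ nrm f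
    descend n {r} r≽0 hyp {f} pf = sq-cancel (⊗≽0 r≽0 (nrm≽0 f)) (≼-trans (ip-cs (pow n f) f)
      (≼-trans (⊗-monoʳ _ (nrm≽0 f) (≡-trans-≼ (sym (x-double n pf)) (hyp pf)))
        (≼-reflexive (trans (⊗-assoc _ _ _) (⊗-interchange r r (nrm f) (nrm f))))))

    descend* : ∀ k {ρ} → 𝟘 ≼ ρ → (∀ {f} → Per f → x (dbl k) f ≼ ρ ^^ dbl k ⊗ nrm f) → ∀ {f} → Per f → x 2 f ≼ ρ ^^ 2 ⊗ nrm f
    descend* zero ρ≽0 hyp = hyp
    descend* (suc k) {ρ} ρ≽0 hyp = descend* k ρ≽0 (descend (dbl k) (^^≽0 (dbl k) ρ≽0)
      λ {f} pf → ≼-trans-≡ (hyp pf) (cong (_⊗ nrm f) (^^-+ ρ (dbl k) (dbl k))))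

    δat : V → Fin N → Fun
    δat v₀ z₀ v y = [[ does (v ≟ v₀) ]] ⊗ δ (y ℤ.- + toℕ z₀)

    δat-per : ∀ v₀ z₀ → Per (δat v₀ z₀)
    δat-per v₀ z₀ v y = cong ([[ does (v ≟ v₀) ]] ⊗_) (shift-periodic (ℤ.- + toℕ z₀) δ-periodic y)

    ip-δat : ∀ g v₀ z₀ → ip g (δat v₀ z₀) ≡ g v₀ (+ toℕ z₀)
    ip-δat g v₀ z₀ = trans (sum-cong λ i → trans (sum-cong λ z → e _ _ _) (trans (sum-⊗ˡ [[ does (vs i ≟ v₀) ]] _) (cong ([[ does (vs i ≟ v₀) ]] ⊗_) (δ-select (g (vs i)) z₀))))
      (select v₀ (λ v → g v (+ toℕ z₀)))
      where
      e : ∀ a b c → a ⊗ (b ⊗ c) ≡ b ⊗ (a ⊗ c)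
      e a b c = trans (sym (⊗-assoc a b c)) (trans (cong (_⊗ c) (⊗-comm a b)) (⊗-assoc b a c))

    good-M : ∀ f v y → [[ good v ]] ⊗ M𝒜 f v y ≡ M𝒜 f v y
    good-M f v y = trans (sym (sum-⊗ˡ [[ good v ]] _)) (sum-cong λ a → trans (sym (⊗-assoc _ _ _)) (cong (_⊗ P (f (step a v)) (y ℤ.+ σ a v)) (abs (good v) (good (step a v)))))
      where
      abs : ∀ p q → [[ p ]] ⊗ [[ p ∧ q ]] ≡ [[ p ∧ q ]]
      abs true q = ⊗-idˡ _
      abs false q = ⊗-zeroˡ _

    net : V → Word → ℤ
    net v w = dot (coef v w) s

    net-∷ : ∀ v a w → net v (a ∷ w) ≡ net v w ℤ.+ σ a (end v w)
    net-∷ v a w = trans (dot-+ (coef v w) _ s) (cong (λ k → net v w ℤ.+ k) (dot-indicator (edge a (end v w)) (sgn (end v w)) s))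

    expand : ∀ n f v y → [[ good v ]] ⊗ pow n f v y ≡ ΣW n (λ w → [[ inside v w ]] ⊗ Pow n (f (end v w)) (y ℤ.+ net v w))
    expand zero f v y = cong (λ z → [[ good v ]] ⊗ f v z) (sym (trans (cong (λ k → y ℤ.+ k) (dot-0 s)) (ℤ.+-identityʳ y)))
    expand (suc n) f v y = trans (expand n (M𝒜 f) v y) (ΣW-cong n λ w → trans (cong ([[ inside v w ]] ⊗_) (inner w)) (trans (sym (sum-⊗ˡ [[ inside v w ]] _))
        (sum-cong λ a → trans (sym (⊗-assoc _ _ _)) (cong₂ _⊗_ (ins w a (inside v w) refl) (cong (Pow (suc n) (f (step a (end v w)))) (sym (trans (cong (λ k → y ℤ.+ k) (net-∷ v a w)) (sym (ℤ.+-assoc y _ _)))))))))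
      where
      inner : ∀ w → Pow n (M𝒜 f (end v w)) (y ℤ.+ net v w) ≡ sum (λ a → [[ on a (end v w) ]] ⊗ Pow (suc n) (f (step a (end v w))) (y ℤ.+ net v w ℤ.+ σ a (end v w)))
      inner w = trans (Pow-sum n (λ a y → [[ on a (end v w) ]] ⊗ P (f (step a (end v w))) (y ℤ.+ σ a (end v w))) _)
        (sum-cong λ a → trans (Pow-⊗ n [[ on a (end v w) ]] (λ y → P (f (step a (end v w))) (y ℤ.+ σ a (end v w))) _)
          (cong ([[ on a (end v w) ]] ⊗_) (sym (Pow-shift n (P (f (step a (end v w)))) (σ a (end v w)) _))))
      ins : ∀ w a b → inside v w ≡ b → [[ inside v w ]] ⊗ [[ on a (end v w) ]] ≡ [[ inside v (a ∷ w) ]]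
      ins w a false e rewrite e = ⊗-zeroˡ _
      ins w a true e rewrite e | inside-end v w e = ⊗-idˡ _

    pow-suc-good : ∀ n f v y → [[ good v ]] ⊗ pow (suc n) f v y ≡ pow (suc n) f v y
    pow-suc-good n f v y = trans (cong ([[ good v ]] ⊗_) (sym (M-pow n f v y))) (trans (good-M (pow n f) v y) (M-pow n f v y))

    -- The exponent must be positive: one application already vanishes at bad vertices, as `inside`
    -- demands, whereas the power 0 is the identity everywhere.
    trace-eq : ∀ n → sum (λ i → sum λ z → pow (suc n) (δat (vs i) z) (vs i) (+ toℕ z)) ≡ trace (suc n) s
    trace-eq n = trans (sum-cong λ i → trans (sum-cong λ z → at (vs i) z) (sum-const N _)) (sum-⊗ˡ (ι N) _)
      where
      e : ∀ z k → z ℤ.+ k ℤ.- z ≡ + 0 ℤ.+ k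
      e = ℤ-Ring.solve-∀
      at : ∀ v (z : Fin N) → pow (suc n) (δat v z) v (+ toℕ z) ≡ ΣW (suc n) (λ w → traceTerm (suc n) v w s)
      at v z = trans (sym (pow-suc-good n (δat v z) v (+ toℕ z))) (trans (expand (suc n) (δat v z) v (+ toℕ z)) (ΣW-cong (suc n) λ w → cong ([[ inside v w ]] ⊗_)
        (trans (Pow-⊗ (suc n) [[ does (end v w ≟ v) ]] (λ y → δ (y ℤ.- + toℕ z)) (+ toℕ z ℤ.+ net v w)) (cong ([[ does (end v w ≟ v) ]] ⊗_)
          (trans (sym (Pow-shift (suc n) δ (ℤ.- + toℕ z) (+ toℕ z ℤ.+ net v w))) (cong (Pow (suc n) δ) (e (+ toℕ z) (net v w))))))))

    -- A value of the power at a point is the inner product of `f` with the image of the point mass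
    -- there. The squared norms of these images add up to the trace of the doubled power.
    hilbert-schmidt : ∀ n {f} → Per f → nrm (pow (suc n) f) ≼ trace (suc n ℕ.+ suc n) s ⊗ nrm f
    hilbert-schmidt n {f} pf = ≼-trans-≡ (sum-mono λ i → sum-mono λ z → ≡-trans-≼ (cong (λ q → q ⊗ q)
        (trans (sym (ip-δat (pow (suc n) f) (vs i) z)) (pow-adjoint (suc n) pf (δat-per (vs i) z))))
        (≼-trans-≡ (ip-cs f (pow (suc n) (δat (vs i) z))) (trans (⊗-comm _ _) (cong (_⊗ nrm f) (trans (sym (x-double (suc n) (δat-per (vs i) z))) (ip-δat (pow (suc n ℕ.+ suc n) (δat (vs i) z)) (vs i) z))))))
      (trans (sum-cong λ i → sum-⊗ʳ {N} (nrm f) _) (trans (sum-⊗ʳ (nrm f) _) (cong (_⊗ nrm f) (trace-eq (n ℕ.+ suc n)))))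

    -- The trace controls the quadratic form of a high power, and halving the exponent leads down to
    -- 2, where the form is the squared norm of `M𝒜 f`.
    contraction : ∀ k {ρ} → 𝟘 ≼ ρ → trace (dbl (suc k)) s ≼ ρ ^^ dbl (suc k) → ∀ {f} → Per f → nrm (M𝒜 f) ≼ ρ ^^ 2 ⊗ nrm f
    contraction k {ρ} ρ≽0 tr {f} pf = ≡-trans-≼ (sym (x-double 1 pf)) (descend* (suc k) ρ≽0 (λ {g} pg → ≡-trans-≼ (x-double (dbl k) pg) (go (dbl k) (dbl>0 k) tr pg)) pf)
      where
      go : ∀ n → 0 ℕ.< n → trace (n ℕ.+ n) s ≼ ρ ^^ (n ℕ.+ n) → ∀ {g} → Per g → nrm (pow n g) ≼ ρ ^^ (n ℕ.+ n) ⊗ nrm g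
      go (suc n) _ tr {g} pg = ≼-trans (hilbert-schmidt n pg) (⊗-monoʳ (nrm g) (nrm≽0 g) tr)

-- From the smoothed operator to functions with zero sums over blocks.

sq-⊖≼ : ∀ a b → (a ⊖ b) ⊗ (a ⊖ b) ≼ ι 2 ⊗ (a ⊗ a ⊕ b ⊗ b)
sq-⊖≼ a b = ≼-trans-≡ (≼⊕ʳ (sq≽0 (a ⊕ b))) (trans (e a b) (sym (two⊗ _)))
  where
  opaque
    unfolding Q
    e : ∀ a b → (a ⊖ b) ⊗ (a ⊖ b) ⊕ (a ⊕ b) ⊗ (a ⊕ b) ≡ (a ⊗ a ⊕ b ⊗ b) ⊕ (a ⊗ a ⊕ b ⊗ b)
    e a b = solve 2 (λ a b → (a :- b) :* (a :- b) :+ (a :+ b) :* (a :+ b) := (a :* a :+ b :* b) :+ (a :* a :+ b :* b)) refl a b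

sum-telescope : ∀ n (g : ℕ → Q) → sum {n} (λ a → g (suc (toℕ a)) ⊖ g (toℕ a)) ≡ g n ⊖ g 0
sum-telescope zero g = trans (sum-zero _) (sym (⊖-self (g 0)))
sum-telescope (suc n) g = trans (sum-suc {n} _) (trans (cong ((g 1 ⊖ g 0) ⊕_) (sum-telescope n (g ∘ suc))) (e _ _ _))
  where
  opaque
    unfolding Q
    e : ∀ a b c → (a ⊖ b) ⊕ (c ⊖ a) ≡ c ⊖ b
    e a b c = solve 3 (λ a b c → (a :- b) :+ (c :- a) := c :- b) refl a b c

module Contraction {V : Set} {D E : ℕ} (𝒢 : ColouredGraph V D E) (good : V → Bool)
  {M : ℕ} (vs : Fin M → V)
  (step-sum : ∀ a (F : V → Q) → sum (λ i → F (ColouredGraph.step 𝒢 a (vs i))) ≡ sum (λ i → F (vs i)))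
  (select : ∀ v (F : V → Q) → sum (λ i → [[ does (ColouredGraph._≟_ 𝒢 (vs i) v) ]] ⊗ F (vs i)) ≡ F v)
  (A N h : ℕ) (s : Fin E → Fin A) where

  open ColouredGraph 𝒢
  open Operators 𝒢 good vs step-sum select A N h
  open Twisted s
  open Window h
  open Period N

  private
    H H⁻¹ : Q
    H = ι (suc h)
    H⁻¹ = rcp (suc h)

  𝒜-norm : ∀ {f} → Per f → nrm (𝒜 f) ≼ (ι D ⊗ ι D) ⊗ nrm f
  𝒜-norm {f} pf = ≼-trans (sum-mono λ i → sum-mono λ z → ≼-trans (sq-sum≼ _) (⊗-monoˡ (ι D) (ι≽0 D) (sum-mono λ a → drop (on a (vs i)) _)))
      (≼-reflexive (begin
        sum (λ i → Σₚ λ z → ι D ⊗ sum (λ a → X a (vs i) z))  ≡⟨ sum-cong (λ i → sum-⊗ˡ (ι D) _) ⟩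
        sum (λ i → ι D ⊗ Σₚ λ z → sum (λ a → X a (vs i) z))  ≡⟨ sum-⊗ˡ (ι D) _ ⟩
        ι D ⊗ sum (λ i → Σₚ λ z → sum (λ a → X a (vs i) z))  ≡⟨ cong (ι D ⊗_) (sum-cong λ i → ∑-comm {N} (λ z a → X a (vs i) (+ toℕ z))) ⟩
        ι D ⊗ sum (λ i → sum λ a → Σₚ (X a (vs i)))          ≡⟨ cong (ι D ⊗_) (∑-comm (λ i a → Σₚ (X a (vs i)))) ⟩
        ι D ⊗ sum (λ a → sum λ i → Σₚ (X a (vs i)))          ≡⟨ cong (ι D ⊗_) (sum-cong λ a → trans (sum-cong λ i → Σₚ-shift (σ a (vs i)) λ y → cong₂ _⊗_ (pf _ y) (pf _ y)) (step-sum a (λ v → Σₚ λ z → f v z ⊗ f v z))) ⟩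
        ι D ⊗ sum {D} (λ a → nrm f)                          ≡⟨ cong (ι D ⊗_) (sum-const D (nrm f)) ⟩
        ι D ⊗ (ι D ⊗ nrm f)                                  ≡⟨ ⊗-assoc _ _ _ ⟨
        (ι D ⊗ ι D) ⊗ nrm f                                  ∎))
    where
    open ≡-Reasoning
    X : Fin D → V → Seq
    X a v y = f (step a v) (y ℤ.+ σ a v) ⊗ f (step a v) (y ℤ.+ σ a v)
    drop : ∀ b x → ([[ b ]] ⊗ x) ⊗ ([[ b ]] ⊗ x) ≼ x ⊗ x
    drop true x = ≼-reflexive (cong₂ _⊗_ (⊗-idˡ x) (⊗-idˡ x))
    drop false x = ≡-trans-≼ (trans (cong (_⊗ (𝟘 ⊗ x)) (⊗-zeroˡ x)) (⊗-zeroˡ _)) (sq≽0 x)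

  nrm-⊗ : ∀ c f → nrm (λ v y → c ⊗ f v y) ≡ (c ⊗ c) ⊗ nrm f
  nrm-⊗ c f = trans (sum-cong λ i → trans (sum-cong λ z → ⊗-interchange _ _ _ _) (sum-⊗ˡ {N} (c ⊗ c) _)) (sum-⊗ˡ (c ⊗ c) _)

  nrm-⊕ : ∀ f g → nrm (λ v y → f v y ⊕ g v y) ≼ ι 2 ⊗ (nrm f ⊕ nrm g)
  nrm-⊕ f g = ≼-trans-≡ (sum-mono λ i → ≼-trans-≡ (sum-mono λ z → ≼-trans-≡ (sq-⊕≼ (f (vs i) (+ toℕ z)) (g (vs i) (+ toℕ z))) (trans (cong₂ _⊕_ (sym (two⊗ _)) (sym (two⊗ _))) (sym (⊗-distribˡ _ _ _))))
      (trans (sum-⊗ˡ {N} (ι 2) _) (cong (ι 2 ⊗_) (∑-distrib-+ {N} _ _))))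
    (trans (sum-⊗ˡ (ι 2) _) (cong (ι 2 ⊗_) (∑-distrib-+ _ _)))

  module _ {f G : Fun} (pG : Per G) (fG : ∀ v y → f v y ≡ G v (y ℤ.+ + 1) ⊖ G v y) where

    window-sum : ∀ v u → sum {suc h} (λ t → f v (u ℤ.+ + toℕ t)) ≡ G v (u ℤ.+ + suc h) ⊖ G v u
    window-sum v u = trans (sum-cong λ t → trans (fG v _) (cong (λ y → G v y ⊖ G v (u ℤ.+ + toℕ t)) (e u (+ toℕ t))))
      (trans (sum-telescope (suc h) (λ n → G v (u ℤ.+ + n))) (cong (λ y → G v (u ℤ.+ + suc h) ⊖ G v y) (ℤ.+-identityʳ u)))
      where
      e : ∀ u t → u ℤ.+ t ℤ.+ + 1 ≡ u ℤ.+ (+ 1 ℤ.+ t)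
      e = ℤ-Ring.solve-∀

    private
      Δ : V → ℤ → Fin (suc h) → Q
      Δ v y t = G v (y ℤ.- + toℕ t ℤ.+ + suc h) ⊖ G v (y ℤ.- + toℕ t)

    Avg-telescope : ∀ v y → Avg (f v) y ≡ h⁻² ⊗ sum (Δ v y)
    Avg-telescope v y = cong (h⁻² ⊗_) (trans (∑-comm (λ t t′ → f v (off y t t′))) (sum-cong λ t′ →
        trans (sum-cong λ t → cong (f v) (e y (+ toℕ t) (+ toℕ t′))) (window-sum v (y ℤ.- + toℕ t′))))
      where
      e : ∀ y a b → y ℤ.+ a ℤ.- b ≡ y ℤ.- b ℤ.+ a
      e = ℤ-Ring.solve-∀

    -- Since `f` is the difference sequence of `G`, one of the two sums in the window average
    -- telescopes. What remains is a mean of differences of `G` divided by the window length h + 1.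
    Avg-norm : nrm (λ v → Avg (f v)) ≼ ι 4 ⊗ ((H⁻¹ ⊗ H⁻¹) ⊗ nrm G)
    Avg-norm = ≡-trans-≼ (trans (ip-cong (λ v y → Avg-telescope v y) (λ v y → Avg-telescope v y)) (nrm-⊗ h⁻² (λ v y → sum (Δ v y))))
      (≼-trans (⊗-monoˡ _ (sq≽0 h⁻²) (sum-mono λ i → ≼-trans (sum-mono λ z → sq-sum≼ (Δ (vs i) (+ toℕ z))) (≡-trans-≼ (sum-⊗ˡ {N} H _) (⊗-monoˡ H (ι≽0 (suc h)) (inner (vs i))))))
        (≼-reflexive final))
      where
      four : ∀ x → ι 2 ⊗ (x ⊕ x) ≡ ι 4 ⊗ x
      four x = trans (cong (ι 2 ⊗_) (sym (two⊗ x))) (trans (sym (⊗-assoc _ _ _)) (cong (_⊗ x) (sym (ι-* 2 2))))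
      S : V → Q
      S v = Σₚ λ z → G v z ⊗ G v z
      per : ∀ v k → Σₚ (λ z → G v (z ℤ.+ k) ⊗ G v (z ℤ.+ k)) ≡ S v
      per v k = Σₚ-shift k λ y → cong₂ _⊗_ (pG v y) (pG v y)
      e : ∀ a b c → a ℤ.+ b ℤ.+ c ≡ a ℤ.+ (b ℤ.+ c)
      e = ℤ-Ring.solve-∀
      inner : ∀ v → Σₚ (λ z → sum (λ t → Δ v z t ⊗ Δ v z t)) ≼ H ⊗ (ι 4 ⊗ S v)
      inner v = ≡-trans-≼ (∑-comm {N} (λ z t → Δ v (+ toℕ z) t ⊗ Δ v (+ toℕ z) t)) (≼-trans-≡ (sum-mono λ t →
          ≼-trans (sum-mono λ z → sq-⊖≼ _ _) (≼-reflexive (trans (sum-⊗ˡ {N} (ι 2) _) (trans (cong (ι 2 ⊗_) (trans (∑-distrib-+ {N} _ _)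
            (cong₂ _⊕_ (trans (sum-cong λ z → cong (λ y → G v y ⊗ G v y) (e (+ toℕ z) (ℤ.- + toℕ t) (+ suc h))) (per v (ℤ.- + toℕ t ℤ.+ + suc h))) (per v (ℤ.- + toℕ t))))) (four (S v))))))
        (sum-const (suc h) _))
      final : h⁻² ⊗ h⁻² ⊗ sum (λ i → H ⊗ (H ⊗ (ι 4 ⊗ S (vs i)))) ≡ ι 4 ⊗ ((H⁻¹ ⊗ H⁻¹) ⊗ nrm G)
      final = trans (cong (h⁻² ⊗ h⁻² ⊗_) (trans (sum-⊗ˡ H _) (cong (H ⊗_) (trans (sum-⊗ˡ H _) (cong (H ⊗_) (sum-⊗ˡ (ι 4) _))))))
        (trans (e′ H⁻¹ H (ι 4) (nrm G)) (trans (cong (λ x → (x ⊗ x) ⊗ (ι 4 ⊗ ((H⁻¹ ⊗ H⁻¹) ⊗ nrm G))) (rcp-inv h)) (trans (cong (_⊗ (ι 4 ⊗ ((H⁻¹ ⊗ H⁻¹) ⊗ nrm G))) (⊗-idˡ 𝟙)) (⊗-idˡ _))))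
        where
        opaque
          unfolding Q
          e′ : ∀ r h f g → (r ⊗ r) ⊗ (r ⊗ r) ⊗ (h ⊗ (h ⊗ (f ⊗ g))) ≡ ((h ⊗ r) ⊗ (h ⊗ r)) ⊗ (f ⊗ ((r ⊗ r) ⊗ g))
          e′ r h f g = solve 4 (λ r h f g → (r :* r) :* (r :* r) :* (h :* (h :* (f :* g))) := ((h :* r) :* (h :* r)) :* (f :* ((r :* r) :* g))) refl r h f g

    module _ {ρ} (ρ≽0 : 𝟘 ≼ ρ) {W : ℕ} (pf : Per f) (M-bound : nrm (M𝒜 f) ≼ ρ ^^ 2 ⊗ nrm f)
             (G-bound : nrm G ≼ (ι W ⊗ ι W) ⊗ nrm f) (wide : ι D ⊗ ι W ≼ ρ ⊗ H) where

      private
        wide′ : (ι D ⊗ ι W) ⊗ H⁻¹ ≼ ρ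
        wide′ = ≼-trans-≡ (⊗-monoʳ H⁻¹ (rcp≽0 h) wide) (trans (⊗-assoc _ _ _) (trans (cong (ρ ⊗_) (rcp-inv h)) (⊗-idʳ ρ)))

        Avg-per : Per (λ v → Avg (f v))
        Avg-per v y = mean-cong λ t t′ → trans (cong (f v) (off-shift y (+ N) t t′)) (pf v _)

        slow : nrm (𝒜 (λ v → Avg (f v))) ≼ ι 4 ⊗ ((ρ ⊗ ρ) ⊗ nrm f)
        slow = ≼-trans (𝒜-norm Avg-per) (≼-trans (⊗-monoˡ _ (sq≽0 (ι D)) (≼-trans Avg-norm (⊗-monoˡ (ι 4) (ι≽0 4) (⊗-monoˡ _ (sq≽0 H⁻¹) G-bound))))
          (≡-trans-≼ (e (ι D) (ι W) H⁻¹ (ι 4) (nrm f)) (⊗-monoˡ (ι 4) (ι≽0 4) (⊗-monoʳ _ (nrm≽0 f) (⊗-mono (⊗≽0 (⊗≽0 (ι≽0 D) (ι≽0 W)) (rcp≽0 h)) ρ≽0 wide′ wide′)))))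
          where
          opaque
            unfolding Q
            e : ∀ d w r f x → (d ⊗ d) ⊗ (f ⊗ ((r ⊗ r) ⊗ ((w ⊗ w) ⊗ x))) ≡ f ⊗ ((((d ⊗ w) ⊗ r) ⊗ ((d ⊗ w) ⊗ r)) ⊗ x)
            e d w r f x = solve 5 (λ d w r f x → (d :* d) :* (f :* ((r :* r) :* ((w :* w) :* x))) := f :* ((((d :* w) :* r) :* ((d :* w) :* r)) :* x)) refl d w r f x

        split : 𝒜 f ≗₂ λ v y → M𝒜 f v y ⊕ 𝒜 (λ v → Avg (f v)) v y
        split v y = trans (sum-cong λ a → trans (cong ([[ on a v ]] ⊗_) (sym (⊖⊕-cancel _ _))) (⊗-distribˡ _ _ _)) (∑-distrib-+ _ _)

      -- `f` is its smoothed part plus its window average. The operator maps the first to squared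
      -- norm at most ρ² and the second to at most 4ρ², times that of `f`; 2(1 + 4) = 10 is rounded
      -- up to the square 16.
      𝒜-contracts : nrm (𝒜 f) ≼ (ι 4 ⊗ ρ) ⊗ (ι 4 ⊗ ρ) ⊗ nrm f
      𝒜-contracts = ≡-trans-≼ (ip-cong split split) (≼-trans (nrm-⊕ (M𝒜 f) (𝒜 (λ v → Avg (f v)))) (≼-trans (⊗-monoˡ (ι 2) (ι≽0 2) (⊕-mono M-bound slow))
        (≡-trans-≼ (trans (cong (λ x → ι 2 ⊗ (ρ ⊗ x ⊗ nrm f ⊕ ι 4 ⊗ ((ρ ⊗ ρ) ⊗ nrm f))) (⊗-idʳ ρ)) (trans (cong (λ x → ι 2 ⊗ (x ⊕ ι 4 ⊗ R)) (sym (trans (cong (_⊗ R) ι1) (⊗-idˡ R)))) (trans (cong (ι 2 ⊗_) (sym (⊗-distribʳ R _ _))) (trans (sym (⊗-assoc _ _ _)) (cong (_⊗ R) (trans (cong (ι 2 ⊗_) (sym (ι-+ 1 4))) (sym (ι-* 2 5))))))))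
          (≼-trans-≡ (⊗-monoʳ R (⊗≽0 (sq≽0 ρ) (nrm≽0 f)) (ι-mono {10} {16} (ℕ.m≤m+n 10 6))) (trans (cong (_⊗ R) (ι-* 4 4)) (e (ι 4) ρ (nrm f)))))))
        where
        R : Q
        R = (ρ ⊗ ρ) ⊗ nrm f
        opaque
          unfolding Q
          e : ∀ f r x → (f ⊗ f) ⊗ ((r ⊗ r) ⊗ x) ≡ (f ⊗ r) ⊗ (f ⊗ r) ⊗ x
          e f r x = solve 3 (λ f r x → (f :* f) :* ((r :* r) :* x) := (f :* r) :* (f :* r) :* x) refl f r x

-- Choice of the shifts and the girth of the lift.

opaque
  unfolding Q

  ⊗-cancel⁺ : ∀ {a b} c → ¬ (c ≼ 𝟘) → c ⊗ a ≼ c ⊗ b → a ≼ b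
  ⊗-cancel⁺ c c>0 = ℚ.*-cancelˡ-≤-pos c {{ℚ.positive (ℚ.≰⇒> c>0)}}

1≼⇒pos : ∀ {a} → 𝟙 ≼ a → ¬ (a ≼ 𝟘)
1≼⇒pos p q = 𝟙⋠𝟘 (≼-trans p q)

1≼ι : ∀ n → 𝟙 ≼ ι (suc n)
1≼ι n = ≡-trans-≼ (sym ι1) (ι-mono {1} {suc n} (ℕ.s≤s ℕ.z≤n))

1≼^^ : ∀ {a} n → 𝟙 ≼ a → 𝟙 ≼ a ^^ n
1≼^^ zero p = ≼-refl
1≼^^ {a} (suc n) p = ≡-trans-≼ (sym (⊗-idˡ 𝟙)) (⊗-mono 𝟘≼𝟙 (^^≽0 n (≼-trans 𝟘≼𝟙 p)) p (1≼^^ n p))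

minimum : ∀ {n} (f : Fin (suc n) → Q) → ∃ λ i → ∀ j → f i ≼ f j
minimum {zero} f = zero , λ { zero → ≼-refl }
minimum {suc n} f with minimum (f ∘ suc)
... | i , p with ≼-total (f zero) (f (suc i))
...   | inj₁ q = zero , λ { zero → ≼-refl ; (suc j) → ≼-trans q (p j) }
...   | inj₂ q = suc i , λ { zero → q ; (suc j) → p j }

pigeonhole : ∀ {n} (f : Fin (suc n) → Q) c → sum f ≼ ι (suc n) ⊗ c → ∃ λ i → f i ≼ c
pigeonhole {n} f c h with minimum f
... | i , p = i , ⊗-cancel-ι n (≼-trans (≡-trans-≼ (sym (sum-const (suc n) (f i))) (sum-mono p)) h)

pigeonhole-ΣS : ∀ A E (F : (Fin E → Fin (suc A)) → Q) c → Average.ΣS (suc A) E F ≼ ι (suc A) ^^ E ⊗ c → ∃ λ s → F s ≼ c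
pigeonhole-ΣS A zero F c h = (λ ()) , ≼-trans-≡ h (⊗-idˡ c)
pigeonhole-ΣS A (suc E) F c h with pigeonhole-ΣS A E (λ s → sum λ a → F (a ∷ᶠ s)) (ι (suc A) ⊗ c) (≼-trans-≡ h (trans (cong (_⊗ c) (⊗-comm _ _)) (⊗-assoc _ _ _)))
... | s , p with pigeonhole (λ a → F (a ∷ᶠ s)) c p
...   | a , q = _ , q

-- A property of counts, kept because they are handled as rationals. It makes the vertices with
-- count at least 1 the only ones with any return, so the total count bounds the number of vertices
-- to be removed.
Gap : Q → Set
Gap x = x ≡ 𝟘 ⊎ 𝟙 ≼ x

Gap≽0 : ∀ {x} → Gap x → 𝟘 ≼ x
Gap≽0 (inj₁ p) = ≼-reflexive (sym p)
Gap≽0 (inj₂ p) = ≼-trans 𝟘≼𝟙 p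

Gap-⊕ : ∀ {x y} → Gap x → Gap y → Gap (x ⊕ y)
Gap-⊕ (inj₁ p) (inj₁ q) = inj₁ (trans (cong₂ _⊕_ p q) (⊕-idˡ 𝟘))
Gap-⊕ (inj₂ p) q = inj₂ (≼-trans p (≼⊕ʳ (Gap≽0 q)))
Gap-⊕ p (inj₂ q) = inj₂ (≼-trans q (≼⊕ˡ (Gap≽0 p)))

Gap-[[]]⊗ : ∀ b {x} → Gap x → Gap ([[ b ]] ⊗ x)
Gap-[[]]⊗ true p = subst Gap (sym (⊗-idˡ _)) p
Gap-[[]]⊗ false p = inj₁ (⊗-zeroˡ _)

Gap-[[]] : ∀ b → Gap [[ b ]]
Gap-[[]] true = inj₂ ≼-refl
Gap-[[]] false = inj₁ refl

Gap-sum : ∀ {n} {f : Fin n → Q} → (∀ i → Gap (f i)) → Gap (sum f)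
Gap-sum {zero} p = inj₁ (sum-zero _)
Gap-sum {suc n} p = subst Gap (sym (sum-suc _)) (Gap-⊕ (p zero) (Gap-sum (p ∘ suc)))

module Choice {V : Set} {D E : ℕ} (𝒢 : ColouredGraph V D E) (good : V → Bool)
  {M : ℕ} (vs : Fin M → V)
  (step-sum : ∀ a (F : V → Q) → sum (λ i → F (ColouredGraph.step 𝒢 a (vs i))) ≡ sum (λ i → F (vs i)))
  (select : ∀ v (F : V → Q) → sum (λ i → [[ does (ColouredGraph._≟_ 𝒢 (vs i) v) ]] ⊗ F (vs i)) ≡ F v)
  (A′ N h : ℕ) where

  A : ℕ
  A = suc A′

  open ColouredGraph 𝒢
  open Operators 𝒢 good vs step-sum select A N h
  open Words D
  open Walks 𝒢 good
  open WalkSums 𝒢 good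
  open Period N
  open Average A

  -- The exponent is even, so the trace is a sum of squared norms. Without a sign, a bound on trace
  -- and returns combined would not bound each of them.
  trace≽0 : ∀ k s → 𝟘 ≼ trace (dbl (suc k)) s
  trace≽0 k s = go (dbl k) (dbl>0 k)
    where
    open Twisted s
    go : ∀ n → 0 ℕ.< n → 𝟘 ≼ trace (n ℕ.+ n) s
    go (suc n) _ = ≼-trans-≡ (sum≽0 λ i → sum≽0 λ z → ≼-trans-≡ (nrm≽0 (pow (suc n) (δat (vs i) z)))
      (trans (sym (x-double (suc n) (δat-per (vs i) z))) (ip-δat (pow (suc n ℕ.+ suc n) (δat (vs i) z)) (vs i) z))) (trace-eq (n ℕ.+ suc n))

  total-returns : ℕ → (Fin E → Fin A) → Q
  total-returns g s = sum λ i → returns A δ g (vs i) s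

  module _ (K : ℕ) (D≡K² : D ≡ suc K ℕ.* suc K) {g : ℕ} (girth : Girth g) (0<g : 0 ℕ.< g) (A≤N : A ℕ.≤ N)
           (short : ι 4 ⊗ ι (suc h) ≼ ι 2 ⊗ (ι A ⊗ rcp (suc K))) where

    average-trace : ℕ → ℕ → Q
    average-trace n c = ι N ⊗ (ι M ⊗ (ι 2 ^^ n ⊗ (ι 2 ^^ n ⊗ (ι (suc K) ^^ n ⊗ ι (suc n) ⊗ (𝟙 ⊕ ι (2 ℕ.* c)) ^^ n))))

    -- One averaging serves both goals. In `F s` each summand has average at most half of M·ρ^n, by
    -- the factors 2 in the hypotheses; some `s` has `F s` at most M·ρ^n, and both summands are
    -- nonnegative.
    good-shifts : 0 ℕ.< M → ∀ k {c} r b → let n = dbl (suc k) in n ℕ.+ g ℕ.≤ g ℕ.* c →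
      ι 2 ⊗ average-trace n c ≼ ι (suc r) ^^ n →
      ι 2 ⊗ (ι b ⊗ sum {g ℕ.+ g} (λ r → ι D ^^ toℕ r)) ≼ ι A →
      ∃ λ s → trace n s ≼ ι (suc r) ^^ n × ι b ⊗ total-returns g s ≼ ι M
    good-shifts 0<M k {c} r b n+g≤ small-trace few = s , tr , re
      where
      n = dbl (suc k)
      ρ R aE : Q
      ρ = ι (suc r) ^^ n
      R = sum {g ℕ.+ g} (λ r → ι D ^^ toℕ r)
      aE = ι A ^^ E
      F : (Fin E → Fin A) → Q
      F s = ι M ⊗ trace n s ⊕ ρ ⊗ (ι b ⊗ total-returns g s)
      ρ≽0 : 𝟘 ≼ ρ
      ρ≽0 = ^^≽0 n (ι≽0 (suc r))
      M>0 : ¬ (ι M ≼ 𝟘)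
      M>0 = 1≼⇒pos (≡-trans-≼ (sym ι1) (ι-mono 0<M))
      tr-avg : ι 2 ⊗ ΣS E (trace n) ≼ aE ⊗ ρ
      tr-avg = ≼-trans (⊗-monoˡ (ι 2) (ι≽0 2) (trace-average K D≡K² girth 0<g n+g≤ short))
        (≡-trans-≼ (trans (sym (⊗-assoc _ _ _)) (trans (cong (_⊗ average-trace n c) (⊗-comm _ _)) (⊗-assoc _ _ _))) (⊗-monoˡ aE (^^≽0 E (ι≽0 A)) small-trace))
      ret-avg : ι A ⊗ ΣS E (total-returns g) ≼ ι M ⊗ (aE ⊗ R)
      ret-avg = ≡-trans-≼ (trans (cong (ι A ⊗_) (ΣS-sum E _)) (sym (sum-⊗ˡ (ι A) _)))
        (≼-trans-≡ (sum-mono λ i → rare-returns A δ δ≽0 δ-bounded (δ-sparse A≤N) girth (vs i)) (sum-const M _))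
      ret-avg′ : ι 2 ⊗ (ι b ⊗ ΣS E (total-returns g)) ≼ ι M ⊗ aE
      ret-avg′ = ⊗-cancel-ι A′ (≡-trans-≼ (e₁ (ι A) (ι 2) (ι b) _) (≼-trans (⊗-monoˡ _ (⊗≽0 (ι≽0 2) (ι≽0 b)) ret-avg)
        (≡-trans-≼ (e₂ (ι 2) (ι b) (ι M) aE R) (≼-trans-≡ (⊗-monoˡ _ (⊗≽0 (ι≽0 M) (^^≽0 E (ι≽0 A))) few) (⊗-comm _ _)))))
        where
        opaque
          unfolding Q
          e₁ : ∀ a t b x → a ⊗ (t ⊗ (b ⊗ x)) ≡ (t ⊗ b) ⊗ (a ⊗ x)
          e₁ a t b x = solve 4 (λ a t b x → a :* (t :* (b :* x)) := (t :* b) :* (a :* x)) refl a t b x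
          e₂ : ∀ t b m a r → (t ⊗ b) ⊗ (m ⊗ (a ⊗ r)) ≡ (m ⊗ a) ⊗ (t ⊗ (b ⊗ r))
          e₂ t b m a r = solve 5 (λ t b m a r → (t :* b) :* (m :* (a :* r)) := (m :* a) :* (t :* (b :* r))) refl t b m a r
      F-avg : ΣS E F ≼ aE ⊗ (ι M ⊗ ρ)
      F-avg = ⊗-cancel-ι 1 (≡-trans-≼ (trans (cong (ι 2 ⊗_) (trans (ΣS-⊕ E _ _) (cong₂ _⊕_ (ΣS-⊗ E _ _) (trans (ΣS-⊗ E _ _) (cong (ρ ⊗_) (ΣS-⊗ E _ _))))))
          (e₁ (ι 2) (ι M) ρ (ΣS E (trace n)) (ι b ⊗ ΣS E (total-returns g))))
        (≼-trans-≡ (⊕-mono (⊗-monoˡ (ι M) (ι≽0 M) tr-avg) (⊗-monoˡ ρ ρ≽0 ret-avg′)) (trans (e₂ (ι M) ρ aE) (sym (two⊗ _)))))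
        where
        opaque
          unfolding Q
          e₁ : ∀ t m r x y → t ⊗ (m ⊗ x ⊕ r ⊗ y) ≡ m ⊗ (t ⊗ x) ⊕ r ⊗ (t ⊗ y)
          e₁ t m r x y = solve 5 (λ t m r x y → t :* (m :* x :+ r :* y) := m :* (t :* x) :+ r :* (t :* y)) refl t m r x y
          e₂ : ∀ m r a → m ⊗ (a ⊗ r) ⊕ r ⊗ (m ⊗ a) ≡ a ⊗ (m ⊗ r) ⊕ a ⊗ (m ⊗ r)
          e₂ m r a = solve 3 (λ m r a → m :* (a :* r) :+ r :* (m :* a) := a :* (m :* r) :+ a :* (m :* r)) refl m r a
      picked : ∃ λ s → F s ≼ ι M ⊗ ρ
      picked = pigeonhole-ΣS A′ E F _ F-avg
      s : Fin E → Fin A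
      s = proj₁ picked
      Fs : F s ≼ ι M ⊗ ρ
      Fs = proj₂ picked
      ret≽0 : 𝟘 ≼ ι b ⊗ total-returns g s
      ret≽0 = ⊗≽0 (ι≽0 b) (sum≽0 λ i → returns≽0 A δ δ≽0 g (vs i) s)
      tr : trace n s ≼ ρ
      tr = ⊗-cancel⁺ (ι M) M>0 (≼-trans (≼⊕ʳ (⊗≽0 ρ≽0 ret≽0)) Fs)
      re : ι b ⊗ total-returns g s ≼ ι M
      re = ⊗-cancel⁺ ρ (1≼⇒pos (1≼^^ n (1≼ι r))) (≼-trans-≡ (≼-trans (≼⊕ˡ (⊗≽0 (ι≽0 M) (trace≽0 k s))) Fs) (⊗-comm _ _))

  module Lifted (s : Fin E → Fin A) (g : ℕ) where

    open Twisted s using (σ; net; net-∷)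

    good′ : V → Bool
    good′ v = good v ∧ not (does (𝟙 ≼? returns A δ g v s))

    good′⇒good : ∀ {v} → good′ v ≡ true → good v ≡ true
    good′⇒good p = proj₁ (∧-true p)

    Gap-ΣRed : ∀ n {F} → (∀ u → Gap (F u)) → Gap (ΣRed n F)
    Gap-ΣRed zero p = p []
    Gap-ΣRed (suc n) p = Gap-ΣRed n λ u → Gap-sum λ a → Gap-[[]]⊗ (not (top? a u)) (p (a ∷ u))

    Gap-returns : ∀ v → Gap (returns A δ g v s)
    Gap-returns v = Gap-sum λ r → Gap-ΣRed (toℕ r) λ u → Gap-[[]]⊗ (returns? v u) (Gap-[[]] (does (N divs? ℤ.∣ + 0 ℤ.+ dot (coef v u) s ∣)))

    good′⇒no-returns : ∀ {v} → good′ v ≡ true → returns A δ g v s ≡ 𝟘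
    good′⇒no-returns {v} p with 𝟙 ≼? returns A δ g v s | Gap-returns v | proj₂ (∧-true {good v} p)
    ... | no _ | inj₁ z | _ = z
    ... | no ¬q | inj₂ q | _ = ⊥-elim (¬q q)

    bad≼ : ∀ v → [[ not (good′ v) ]] ≼ [[ not (good v) ]] ⊕ returns A δ g v s
    bad≼ v with good v
    ... | false = ≼⊕ʳ (returns≽0 A δ δ≽0 g v s)
    ... | true with 𝟙 ≼? returns A δ g v s
    ...   | no _ = ≼-trans-≡ (returns≽0 A δ δ≽0 g v s) (sym (⊕-idˡ _))
    ...   | yes q = ≼-trans-≡ q (sym (⊕-idˡ _))

    module _ {V′ : Set} {E′ : ℕ} (𝒢′ : ColouredGraph V′ D E′) (good″ : V′ → Bool) (π : V′ → V) (pos : V′ → ℤ)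
      (good-π : ∀ v → good″ v ≡ true → good′ (π v) ≡ true)
      (π-step : ∀ a v → π (ColouredGraph.step 𝒢′ a v) ≡ step a (π v))
      (pos-step : ∀ a v → ∃ λ k → pos (ColouredGraph.step 𝒢′ a v) ≡ pos v ℤ.+ σ a (π v) ℤ.+ k ℤ.* + N) where

      private module W′ = Walks 𝒢′ good″

      π-end : ∀ v u → π (W′.end v u) ≡ end (π v) u
      π-end v [] = refl
      π-end v (a ∷ u) = trans (π-step a _) (cong (step a) (π-end v u))

      π-inside : ∀ v u → W′.inside v u ≡ true → inside (π v) u ≡ true
      π-inside v [] p = good′⇒good (good-π v p)
      π-inside v (a ∷ u) p with ∧-true p
      ... | q , r = cong₂ _∧_ (π-inside v u q) (trans (cong good (sym (trans (π-step a _) (cong (step a) (π-end v u))))) (good′⇒good (good-π _ r)))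

      pos-end : ∀ v u → ∃ λ k → pos (W′.end v u) ≡ pos v ℤ.+ net (π v) u ℤ.+ k ℤ.* + N
      pos-end v [] = + 0 , sym (trans (ℤ.+-identityʳ _) (trans (cong (λ z → pos v ℤ.+ z) (dot-0 s)) (ℤ.+-identityʳ _)))
      pos-end v (a ∷ u) with pos-end v u | pos-step a (W′.end v u)
      ... | k , p | l , q = l ℤ.+ k , trans q (trans (cong₂ (λ x y → x ℤ.+ σ a y ℤ.+ l ℤ.* + N) p (π-end v u))
            (trans (e (pos v) (net (π v) u) (σ a (end (π v) u)) k l (+ N)) (cong (λ z → pos v ℤ.+ z ℤ.+ (l ℤ.+ k) ℤ.* + N) (sym (net-∷ (π v) a u)))))
        where
        e : ∀ p n t k l N → p ℤ.+ n ℤ.+ k ℤ.* N ℤ.+ t ℤ.+ l ℤ.* N ≡ p ℤ.+ (n ℤ.+ t) ℤ.+ (l ℤ.+ k) ℤ.* N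
        e = ℤ-Ring.solve-∀

      -- A closed walk of the lift projects to a closed walk with the same word whose total shift is
      -- a multiple of N. If it were shorter than 2g, it would be counted by `returns` at a vertex
      -- where that count is zero.
      girth-doubles : W′.Girth (g ℕ.+ g)
      girth-doubles v u ru 0<u ins closed with g ℕ.+ g ℕ.≤? length u
      ... | yes p = p
      ... | no ¬p with pos-end v u
      ...   | k , q = ⊥-elim (no-return A δ δ≽0 g (π v) s (good′⇒no-returns (good-π v (start u ins))) u ru 0<u (ℕ.≰⇒> ¬p) (π-inside v u ins)
                (trans (sym (π-end v u)) (cong π closed)) (δ-1 (+ 0 ℤ.+ net (π v) u) (ℤD.∣⇒∣ᵤ (ℤD.divides (ℤ.- k) eq))))
        where
        start : ∀ u → W′.inside v u ≡ true → good″ v ≡ true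
        start [] p = p
        start (a ∷ u) p = start u (proj₁ (∧-true p))
        e : ∀ p n k N → + 0 ℤ.+ n ≡ p ℤ.+ n ℤ.+ k ℤ.* N ℤ.- p ℤ.+ ℤ.- k ℤ.* N
        e = ℤ-Ring.solve-∀
        e′ : ∀ p x → p ℤ.- p ℤ.+ x ≡ x
        e′ = ℤ-Ring.solve-∀
        eq : + 0 ℤ.+ net (π v) u ≡ ℤ.- k ℤ.* + N
        eq = trans (e (pos v) (net (π v) u) k (+ N)) (trans (cong (λ z → z ℤ.- pos v ℤ.+ ℤ.- k ℤ.* + N) (trans (sym q) (cong pos closed))) (e′ (pos v) _))

-- Bipartite graphs from permutations, residues, and partial sums over blocks.

opaque
  unfolding sum

  sum-splitAt : ∀ m {n} (f : Fin (m ℕ.+ n) → Q) → sum f ≡ sum (λ i → f (i Fin.↑ˡ n)) ⊕ sum (λ j → f (m Fin.↑ʳ j))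
  sum-splitAt zero f = sym (⊕-idˡ _)
  sum-splitAt (suc m) f = trans (cong (f zero ⊕_) (sum-splitAt m (f ∘ suc))) (sym (⊕-assoc _ _ _))

  sum-combine : ∀ m {n} (f : Fin (m ℕ.* n) → Q) → sum f ≡ sum λ i → sum λ j → f (Fin.combine {m} i j)
  sum-combine zero f = refl
  sum-combine (suc m) {n} f = trans (sum-splitAt n f) (cong (sum (λ j → f (j Fin.↑ˡ (m ℕ.* n))) ⊕_) (sum-combine m (λ j → f (n Fin.↑ʳ j))))

sum-select : ∀ {n} (x₀ : Fin n) (f : Fin n → Q) → sum (λ x → [[≟]] x x₀ ⊗ f x) ≡ f x₀
sum-select x₀ f = trans (sum-cong pt) (trans (sum-⊗ʳ (f x₀) _) (trans (cong (_⊗ f x₀) (sum-≟ x₀)) (⊗-idˡ _)))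
  where
  pt : ∀ x → [[≟]] x x₀ ⊗ f x ≡ [[≟]] x x₀ ⊗ f x₀
  pt x with x Fin.≟ x₀
  ... | yes refl = refl
  ... | no _ = trans (⊗-zeroˡ _) (sym (⊗-zeroˡ _))

module Bipartite {D m : ℕ} (φ ψ : Fin D → Fin m → Fin m)
  (ψφ : ∀ a x → ψ a (φ a x) ≡ x) (φψ : ∀ a y → φ a (ψ a y) ≡ y) where

  V : Set
  V = Bool × Fin m

  vs : Fin (m ℕ.+ m) → V
  vs i with Fin.splitAt m i
  ... | inj₁ x = false , x
  ... | inj₂ y = true , y

  sum-vs : (F : V → Q) → sum (λ i → F (vs i)) ≡ sum (λ x → F (false , x)) ⊕ sum (λ y → F (true , y))
  sum-vs F = trans (sum-splitAt m _) (cong₂ _⊕_ (sum-cong λ x → cong F (l x)) (sum-cong λ y → cong F (r y)))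
    where
    l : ∀ x → vs (x Fin.↑ˡ m) ≡ (false , x)
    l x rewrite Fin.splitAt-↑ˡ m x m = refl
    r : ∀ y → vs (m Fin.↑ʳ y) ≡ (true , y)
    r y rewrite Fin.splitAt-↑ʳ m m y = refl

  _≟V_ : (v w : V) → Dec (v ≡ w)
  (false , x) ≟V (false , y) = map′ (cong (false ,_)) (cong proj₂) (x Fin.≟ y)
  (false , x) ≟V (true , y) = no λ ()
  (true , x) ≟V (false , y) = no λ ()
  (true , x) ≟V (true , y) = map′ (cong (true ,_)) (cong proj₂) (x Fin.≟ y)

  stepV : Fin D → V → V
  stepV a (false , x) = true , φ a x
  stepV a (true , y) = false , ψ a y

  base : Fin D → V → Fin m
  base a (false , x) = x
  base a (true , y) = ψ a y

  sgnV : V → ℤ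
  sgnV (false , _) = + 1
  sgnV (true , _) = ℤ.- + 1

  𝒢 : ColouredGraph V D (D ℕ.* m)
  𝒢 = record
    { _≟_ = _≟V_
    ; step = stepV
    ; step² = λ { a (false , x) → cong (false ,_) (ψφ a x) ; a (true , y) → cong (true ,_) (φψ a y) }
    ; edge = λ a v → Fin.combine a (base a v)
    ; edge-step = λ { a (false , x) → cong (Fin.combine a) (ψφ a x) ; a (true , y) → refl }
    ; edge-inj = λ {a} {b} {v} {w} e → inj a b v w (Fin.combine-injectiveˡ a (base a v) b (base b w) e) (Fin.combine-injectiveʳ a (base a v) b (base b w) e)
    ; sgn = sgnV
    ; sgn-unit = λ { (false , _) → unit (inj₁ refl) ; (true , _) → unit (inj₂ refl) }
    ; sgn-step = λ { a (false , _) → refl ; a (true , _) → refl }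
    }
    where
    inj : ∀ a b v w → a ≡ b → base a v ≡ base b w → a ≡ b × (w ≡ v ⊎ w ≡ stepV a v)
    inj a .a (false , x) (false , .x) refl refl = refl , inj₁ refl
    inj a .a (false , .(ψ a y)) (true , y) refl refl = refl , inj₂ (cong (true ,_) (sym (φψ a y)))
    inj a .a (true , y) (false , .(ψ a y)) refl refl = refl , inj₂ refl
    inj a .a (true , y) (true , y′) refl e = refl , inj₁ (cong (true ,_) (trans (sym (φψ a y′)) (trans (cong (φ a) (sym e)) (φψ a y))))

  step-sum : ∀ a (F : V → Q) → sum (λ i → F (stepV a (vs i))) ≡ sum (λ i → F (vs i))
  step-sum a F = begin
    sum (λ i → F (stepV a (vs i)))                                     ≡⟨ sum-vs (λ v → F (stepV a v)) ⟩
    sum (λ x → F (true , φ a x)) ⊕ sum (λ y → F (false , ψ a y))       ≡⟨ cong₂ _⊕_ (sum-bij (φ a) (ψ a) (ψφ a) (φψ a) _) (sum-bij (ψ a) (φ a) (φψ a) (ψφ a) _) ⟩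
    sum (λ y → F (true , y)) ⊕ sum (λ x → F (false , x))               ≡⟨ ⊕-comm _ _ ⟩
    sum (λ x → F (false , x)) ⊕ sum (λ y → F (true , y))               ≡⟨ sum-vs F ⟨
    sum (λ i → F (vs i))                                               ∎
    where open ≡-Reasoning

  select : ∀ v (F : V → Q) → sum (λ i → [[ does (vs i ≟V v) ]] ⊗ F (vs i)) ≡ F v
  select v F = trans (sum-vs (λ u → [[ does (u ≟V v) ]] ⊗ F u)) (go v)
    where
    go : ∀ v → sum (λ x → [[ does ((false , x) ≟V v) ]] ⊗ F (false , x)) ⊕ sum (λ x → [[ does ((true , x) ≟V v) ]] ⊗ F (true , x)) ≡ F v
    go (false , x₀) = trans (cong₂ _⊕_ (sum-select x₀ (λ x → F (false , x))) (trans (sum-cong λ x → ⊗-zeroˡ _) (sum-0 m))) (⊕-idʳ _)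
    go (true , x₀) = trans (cong₂ _⊕_ (trans (sum-cong λ x → ⊗-zeroˡ _) (sum-0 m)) (sum-select x₀ (λ x → F (true , x)))) (⊕-idˡ _)

module Cyclic (N : ℕ) .{{_ : NonZero N}} where

  open Period N

  infixl 6 _⊞_
  _⊞_ : Fin N → ℕ → Fin N
  z ⊞ n = Fin.fromℕ< (m%n<n (toℕ z ℕ.+ n) N)

  toℕ-⊞ : ∀ z n → toℕ (z ⊞ n) ≡ (toℕ z ℕ.+ n) % N
  toℕ-⊞ z n = Fin.toℕ-fromℕ< _

  ⊞-cancel : ∀ z {m n} → m ℕ.+ n ≡ N → z ⊞ m ⊞ n ≡ z
  ⊞-cancel z {m} {n} e = Fin.toℕ-injective (begin
    toℕ (z ⊞ m ⊞ n)                     ≡⟨ toℕ-⊞ (z ⊞ m) n ⟩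
    (toℕ (z ⊞ m) ℕ.+ n) % N             ≡⟨ cong (λ k → (k ℕ.+ n) % N) (toℕ-⊞ z m) ⟩
    ((toℕ z ℕ.+ m) % N ℕ.+ n) % N       ≡⟨ %-distribˡ-+ ((toℕ z ℕ.+ m) % N) n N ⟩
    ((toℕ z ℕ.+ m) % N % N ℕ.+ n % N) % N ≡⟨ cong (λ k → (k ℕ.+ n % N) % N) (m%n%n≡m%n (toℕ z ℕ.+ m) N) ⟩
    ((toℕ z ℕ.+ m) % N ℕ.+ n % N) % N   ≡⟨ %-distribˡ-+ (toℕ z ℕ.+ m) n N ⟨
    (toℕ z ℕ.+ m ℕ.+ n) % N             ≡⟨ cong (_% N) (trans (ℕ.+-assoc (toℕ z) m n) (cong (toℕ z ℕ.+_) e)) ⟩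
    (toℕ z ℕ.+ N) % N                   ≡⟨ [m+n]%n≡m%n (toℕ z) N ⟩
    toℕ z % N                           ≡⟨ m<n⇒m%n≡m (Fin.toℕ<n z) ⟩
    toℕ z                               ∎)
    where open ≡-Reasoning

  ⊞-small : ∀ z n → toℕ z ℕ.+ n ℕ.< N → toℕ (z ⊞ n) ≡ toℕ z ℕ.+ n
  ⊞-small z n l = trans (toℕ-⊞ z n) (m<n⇒m%n≡m l)

  periodic-* : ∀ {g} → Periodic N g → ∀ k y → g (y ℤ.+ + (k ℕ.* N)) ≡ g y
  periodic-* {g} p zero y = cong g (ℤ.+-identityʳ y)
  periodic-* {g} p (suc k) y = trans (cong g (e y (+ N) (+ (k ℕ.* N)))) (trans (p _) (periodic-* p k y))
    where
    e : ∀ y n k → y ℤ.+ (n ℤ.+ k) ≡ y ℤ.+ k ℤ.+ n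
    e = ℤ-Ring.solve-∀

  periodic-⊞ : ∀ {g} → Periodic N g → ∀ z n → g (+ toℕ z ℤ.+ + n) ≡ g (+ toℕ (z ⊞ n))
  periodic-⊞ {g} p z n = trans (cong (g ∘ +_) (m≡m%n+[m/n]*n (toℕ z ℕ.+ n) N))
    (trans (periodic-* p ((toℕ z ℕ.+ n) ℕ./ N) (+ ((toℕ z ℕ.+ n) % N))) (cong (g ∘ +_) (sym (toℕ-⊞ z n))))

  ext : (Fin N → Q) → Seq
  ext g y = sum λ z → g z ⊗ δ (y ℤ.- + toℕ z)

  ext-per : ∀ g → Periodic N (ext g)
  ext-per g y = sum-cong λ z → cong (g z ⊗_) (shift-periodic (ℤ.- + toℕ z) δ-periodic y)

  ext-at : ∀ g z → ext g (+ toℕ z) ≡ g z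
  ext-at g z₀ = trans (sum-cong pt) (sum-select z₀ g)
    where
    pt : ∀ z → g z ⊗ δ (+ toℕ z₀ ℤ.- + toℕ z) ≡ [[≟]] z z₀ ⊗ g z
    pt z with z Fin.≟ z₀ | N divs? ℤ.∣ + toℕ z₀ ℤ.- + toℕ z ∣
    ... | yes refl | yes _ = ⊗-comm _ _
    ... | no _     | no _  = trans (⊗-zeroʳ _) (sym (⊗-zeroˡ _))
    ... | yes refl | no ¬d = ⊥-elim (¬d (subst (N divs_) (sym (cong ℤ.∣_∣ (ℤ.+-inverseʳ (+ toℕ z)))) (N divs0)))
    ... | no ¬p    | yes d = ⊥-elim (¬p (sym (Fin.toℕ-injective (close-multiples (Fin.toℕ<n z₀) (Fin.toℕ<n z) (+ toℕ z₀ ℤ.- + toℕ z) refl d))))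

  ext-⊞ : ∀ g z n → ext g (+ toℕ z ℤ.+ + n) ≡ g (z ⊞ n)
  ext-⊞ g z n = trans (periodic-⊞ (ext-per g) z n) (ext-at g (z ⊞ n))

  ext-unique : ∀ {f g} → Periodic N f → Periodic N g → (∀ (z : Fin N) → f (+ toℕ z) ≡ g (+ toℕ z)) → ∀ y → f y ≡ g y
  ext-unique {f} {g} pf pg e (+ n) = go n
    where
    go : ∀ n → f (+ n) ≡ g (+ n)
    go n = trans (cong (f ∘ +_) eq′) (trans (periodic-* pf (n ℕ./ N) (+ toℕ z)) (trans (e z) (sym (trans (cong (g ∘ +_) eq′) (periodic-* pg (n ℕ./ N) (+ toℕ z))))))
      where
      z : Fin N
      z = Fin.fromℕ< (m%n<n n N)
      eq′ : n ≡ toℕ z ℕ.+ n ℕ./ N ℕ.* N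
      eq′ = trans (m≡m%n+[m/n]*n n N) (cong (ℕ._+ n ℕ./ N ℕ.* N) (sym (Fin.toℕ-fromℕ< _)))
  ext-unique {f} {g} pf pg e -[1+ n ] = trans (sym (periodic-* pf (suc n) _)) (trans (cong f shift) (trans (ext-unique pf pg e (+ (suc n ℕ.* N ℕ.∸ suc n)))
      (trans (cong g (sym shift)) (periodic-* pg (suc n) _))))
    where
    shift : -[1+ n ] ℤ.+ + (suc n ℕ.* N) ≡ + (suc n ℕ.* N ℕ.∸ suc n)
    shift = ℤ.⊖-≥ (ℕ.m≤m*n (suc n) N)

opaque
  _≺?_ : ∀ m n → Dec (m ℕ.< n)
  _≺?_ = ℕ._<?_

sum-only : ∀ {n} (p : Fin n) (X : Fin n → Q) → (∀ i → i ≢ p → X i ≡ 𝟘) → sum X ≡ X p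
sum-only p X z = trans (sum-cong pt) (sum-select p X)
  where
  pt : ∀ i → X i ≡ [[≟]] i p ⊗ X i
  pt i with i Fin.≟ p
  ... | yes _ = sym (⊗-idˡ _)
  ... | no ¬q = trans (z i ¬q) (sym (⊗-zeroˡ _))

module PartialSums {P W : ℕ} .{{_ : NonZero (P ℕ.* W)}} (w : Fin (P ℕ.* W) → Q)
  (block : ∀ p → sum (λ q → w (Fin.combine {P} p q)) ≡ 𝟘) where

  N : ℕ
  N = P ℕ.* W

  open Period N
  open Cyclic N

  prefix : ℕ → Q
  prefix n = sum λ j → [[ does (toℕ j ≺? n) ]] ⊗ w j

  G : Fin N → Q
  G z = prefix (toℕ z)

  prefix-suc : ∀ (z : Fin N) → prefix (suc (toℕ z)) ≡ prefix (toℕ z) ⊕ w z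
  prefix-suc z = trans (sum-cong pt) (trans (∑-distrib-+ _ _) (cong (prefix (toℕ z) ⊕_) (sum-select z w)))
    where
    ind : ∀ j → [[ does (toℕ j ≺? suc (toℕ z)) ]] ≡ [[ does (toℕ j ≺? toℕ z) ]] ⊕ [[≟]] j z
    ind j with toℕ j ≺? suc (toℕ z) | toℕ j ≺? toℕ z | j Fin.≟ z
    ... | yes _ | yes _ | no _ = sym (⊕-idʳ 𝟙)
    ... | yes _ | no _ | yes _ = sym (⊕-idˡ 𝟙)
    ... | no _ | no _ | no _ = sym (⊕-idˡ 𝟘)
    ... | yes _ | yes l | yes refl = ⊥-elim (ℕ.<-irrefl refl l)
    ... | yes l | no ¬l | no ¬e = ⊥-elim (¬e (Fin.toℕ-injective (ℕ.≤-antisym (ℕ.≤-pred l) (ℕ.≮⇒≥ ¬l))))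
    ... | no ¬l | yes l | _ = ⊥-elim (¬l (ℕ.m≤n⇒m≤1+n l))
    ... | no ¬l | no _ | yes refl = ⊥-elim (¬l ℕ.≤-refl)
    pt : ∀ j → [[ does (toℕ j ≺? suc (toℕ z)) ]] ⊗ w j ≡ [[ does (toℕ j ≺? toℕ z) ]] ⊗ w j ⊕ [[≟]] j z ⊗ w j
    pt j = trans (cong (_⊗ w j) (ind j)) (⊗-distribʳ _ _ _)

  prefix-0 : prefix 0 ≡ 𝟘
  prefix-0 = trans (sum-cong λ j → trans (cong (λ b → [[ b ]] ⊗ w j) (dec-false (toℕ j ≺? 0) λ ())) (⊗-zeroˡ (w j))) (sum-0 N)

  prefix-N : prefix N ≡ 𝟘
  prefix-N = trans (sum-cong λ j → trans (cong (λ b → [[ b ]] ⊗ w j) (dec-true (toℕ j ≺? N) (Fin.toℕ<n j))) (⊗-idˡ _))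
    (trans (sum-combine P w) (trans (sum-cong block) (sum-0 P)))

  G-⊞ : ∀ z → G (z ⊞ 1) ≡ prefix (suc (toℕ z))
  G-⊞ z with suc (toℕ z) ≺? N
  ... | yes l = cong prefix (trans (⊞-small z 1 (subst (ℕ._< N) (ℕ.+-comm 1 _) l)) (ℕ.+-comm _ 1))
  ... | no ¬l = trans (cong prefix (trans (toℕ-⊞ z 1) (trans (cong (_% N) (trans (ℕ.+-comm _ 1) N≡)) (ℕD.n%n≡0 N)))) (trans prefix-0 (trans (sym prefix-N) (cong prefix (sym N≡))))
    where
    N≡ : suc (toℕ z) ≡ N
    N≡ = ℕ.≤-antisym (Fin.toℕ<n z) (ℕ.≮⇒≥ ¬l)

  ext-difference : ∀ y → ext w y ≡ ext G (y ℤ.+ + 1) ⊖ ext G y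
  ext-difference = ext-unique (ext-per w) (λ y → cong₂ _⊖_ (shift-periodic (+ 1) (ext-per G) y) (ext-per G y)) λ z →
    trans (ext-at w z) (sym (trans (cong₂ _⊖_ (trans (ext-⊞ G z 1) (trans (G-⊞ z) (prefix-suc z))) (ext-at G z)) (e (G z) (w z))))
    where
    opaque
      unfolding Q
      e : ∀ a b → (a ⊕ b) ⊖ a ≡ b
      e a b = solve 2 (λ a b → (a :+ b) :- a := b) refl a b

  G-block : ∀ p q → G (Fin.combine p q) ≡ sum (λ j → [[ does (toℕ j ≺? toℕ q) ]] ⊗ w (Fin.combine p j))
  G-block p q = trans (sum-combine P _) (trans (sum-only p _ other) (sum-cong λ j → cong (λ b → [[ b ]] ⊗ w (Fin.combine p j))
      (does-≡ (toℕ (Fin.combine p j) ≺? toℕ (Fin.combine p q)) (toℕ j ≺? toℕ q)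
        (λ l → ℕ.+-cancelˡ-< (W ℕ.* toℕ p) _ _ (subst₂ ℕ._<_ (Fin.toℕ-combine p j) (Fin.toℕ-combine p q) l))
        (λ l → subst₂ ℕ._<_ (sym (Fin.toℕ-combine p j)) (sym (Fin.toℕ-combine p q)) (ℕ.+-monoʳ-< (W ℕ.* toℕ p) l)))))
    where
    other : ∀ i → i ≢ p → sum (λ j → [[ does (toℕ (Fin.combine i j) ≺? toℕ (Fin.combine p q)) ]] ⊗ w (Fin.combine i j)) ≡ 𝟘
    other i i≢p with Fin.<-cmp i p
    ... | tri< i<p _ _ = trans (sum-cong λ j → trans (cong (λ b → [[ b ]] ⊗ w (Fin.combine i j)) (dec-true (toℕ (Fin.combine i j) ≺? toℕ (Fin.combine p q)) (Fin.combine-monoˡ-< j q i<p))) (⊗-idˡ _)) (block i)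
    ... | tri≈ _ e _ = ⊥-elim (i≢p e)
    ... | tri> _ _ p<i = trans (sum-cong λ j → trans (cong (λ b → [[ b ]] ⊗ w (Fin.combine i j)) (dec-false (toℕ (Fin.combine i j) ≺? toℕ (Fin.combine p q)) (ℕ.<-asym (Fin.combine-monoˡ-< q j p<i)))) (⊗-zeroˡ _)) (sum-0 W)

  -- Each block of length W has sum zero, so a prefix sum involves only the current block.
  -- Cauchy-Schwarz costs one factor W, and each block contains W prefix sums.
  G-norm : sum (λ z → G z ⊗ G z) ≼ (ι W ⊗ ι W) ⊗ sum (λ z → w z ⊗ w z)
  G-norm = ≡-trans-≼ (sum-combine P _) (≼-trans-≡ (sum-mono λ p → ≼-trans-≡ (sum-mono λ q → bound p q) (sum-const W _))
      (trans (trans (sum-⊗ˡ {P} (ι W) _) (cong (ι W ⊗_) (sum-⊗ˡ {P} (ι W) _))) (trans (sym (⊗-assoc _ _ _)) (cong ((ι W ⊗ ι W) ⊗_) (sym (sum-combine P _))))))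
    where
    drop : ∀ b x → ([[ b ]] ⊗ x) ⊗ ([[ b ]] ⊗ x) ≼ x ⊗ x
    drop true x = ≼-reflexive (cong₂ _⊗_ (⊗-idˡ x) (⊗-idˡ x))
    drop false x = ≡-trans-≼ (trans (cong (_⊗ (𝟘 ⊗ x)) (⊗-zeroˡ x)) (⊗-zeroˡ _)) (sq≽0 x)
    bound : ∀ p q → G (Fin.combine p q) ⊗ G (Fin.combine p q) ≼ ι W ⊗ sum (λ j → w (Fin.combine p j) ⊗ w (Fin.combine p j))
    bound p q = ≡-trans-≼ (cong₂ _⊗_ (G-block p q) (G-block p q)) (≼-trans (sq-sum≼ _) (⊗-monoˡ (ι W) (ι≽0 W) (sum-mono λ j → drop (does (toℕ j ≺? toℕ q)) _)))

twice-cs : ∀ {n} (f g : Fin n → Q) (l : Q) → ι 2 ⊗ (l ⊗ sum (λ i → f i ⊗ g i)) ≼ (l ⊗ l) ⊗ sum (λ i → f i ⊗ f i) ⊕ sum (λ i → g i ⊗ g i)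
twice-cs {n} f g l = ≡-trans-≼ (trans (cong (ι 2 ⊗_) (sym (sum-⊗ˡ l _))) (sym (sum-⊗ˡ (ι 2) _)))
  (≼-trans-≡ (sum-mono λ i → ⊖≽0⁻¹ (≼-trans-≡ (sq≽0 (l ⊗ f i ⊖ g i)) (trans (e l (f i) (g i)) (cong (λ t → ((l ⊗ l) ⊗ (f i ⊗ f i) ⊕ g i ⊗ g i) ⊖ t) (sym (two⊗ _))))))
    (trans (∑-distrib-+ _ _) (cong (_⊕ sum (λ i → g i ⊗ g i)) (sum-⊗ˡ (l ⊗ l) _))))
  where
  opaque
    unfolding Q
    e : ∀ l a b → (l ⊗ a ⊖ b) ⊗ (l ⊗ a ⊖ b) ≡ ((l ⊗ l) ⊗ (a ⊗ a) ⊕ b ⊗ b) ⊖ (l ⊗ (a ⊗ b) ⊕ l ⊗ (a ⊗ b))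
    e l a b = solve 3 (λ l a b → (l :* a :- b) :* (l :* a :- b) := ((l :* l) :* (a :* a) :+ b :* b) :- (l :* (a :* b) :+ l :* (a :* b))) refl l a b

module LevelContraction {D m : ℕ} (φ ψ : Fin D → Fin m → Fin m)
  (ψφ : ∀ a x → ψ a (φ a x) ≡ x) (φψ : ∀ a y → φ a (ψ a y) ≡ y) (good : Bool × Fin m → Bool)
  {P W : ℕ} .{{_ : NonZero (P ℕ.* W)}} (A h : ℕ) (s : Fin (D ℕ.* m) → Fin A) (ρ : Q) (ρ≽0 : 𝟘 ≼ ρ) (ρ>0 : ¬ (ρ ≼ 𝟘)) where

  N : ℕ
  N = P ℕ.* W

  open Bipartite φ ψ ψφ φψ
  open ColouredGraph 𝒢
  open Operators 𝒢 good vs step-sum select A N h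
  open Twisted s
  open Contraction 𝒢 good vs step-sum select A N h s
  open Period N
  open Cyclic N

  twist : (Fin m → Fin N → Q) → Fin m → Fin N → Q
  twist w x z = sum λ a → w (φ a x) (z ⊞ toℕ (s (Fin.combine a x)))

  module _ (M-bound : ∀ {f} → Per f → nrm (M𝒜 f) ≼ ρ ^^ 2 ⊗ nrm f) (wide : ι D ⊗ ι W ≼ ρ ⊗ ι (suc h))
    (a w : Fin m → Fin N → Q)
    (a-good : ∀ x z → good (false , x) ≡ false → a x z ≡ 𝟘) (w-good : ∀ y z → good (true , y) ≡ false → w y z ≡ 𝟘)
    (block : ∀ y p → sum (λ q → w y (Fin.combine {P} p q)) ≡ 𝟘) where

    private
      f G : Fun
      f (false , x) y = 𝟘
      f (true , x) = ext (w x)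
      G (false , x) y = 𝟘
      G (true , x) = ext (PartialSums.G {P} {W} (w x) (block x))

      pf : Per f
      pf (false , x) y = refl
      pf (true , x) = ext-per (w x)

      pG : Per G
      pG (false , x) y = refl
      pG (true , x) = ext-per (PartialSums.G {P} {W} (w x) (block x))

      fG : ∀ v y → f v y ≡ G v (y ℤ.+ + 1) ⊖ G v y
      fG (false , x) y = sym (⊖-self 𝟘)
      fG (true , x) y = PartialSums.ext-difference {P} {W} (w x) (block x) y

      Σ² : (Fin m → Fin N → Q) → Q
      Σ² g = sum λ x → sum λ z → g x z ⊗ g x z

      nrm-true : ∀ (g : Fun) → (∀ x z → g (false , x) z ≡ 𝟘) → nrm g ≡ sum (λ x → Σₚ λ z → g (true , x) z ⊗ g (true , x) z)
      nrm-true g z0 = trans (sum-vs (λ v → Σₚ λ z → g v z ⊗ g v z)) (trans (cong (_⊕ sum (λ x → Σₚ λ z → g (true , x) z ⊗ g (true , x) z))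
        (trans (sum-cong λ x → trans (sum-cong λ z → trans (cong (_⊗ g (false , x) (+ toℕ z)) (z0 x (+ toℕ z))) (⊗-zeroˡ _)) (sum-0 N)) (sum-0 m))) (⊕-idˡ _))

      nrm-f : nrm f ≡ Σ² w
      nrm-f = trans (nrm-true f λ x z → refl) (sum-cong λ x → sum-cong λ z → cong₂ _⊗_ (ext-at (w x) z) (ext-at (w x) z))

      nrm-G : nrm G ≼ (ι W ⊗ ι W) ⊗ nrm f
      nrm-G = ≡-trans-≼ (trans (nrm-true G λ x z → refl) (sum-cong λ x → sum-cong λ z → cong₂ _⊗_ (ext-at _ z) (ext-at _ z)))
        (≼-trans-≡ (sum-mono λ x → PartialSums.G-norm {P} {W} (w x) (block x)) (trans (sum-⊗ˡ _ _) (cong ((ι W ⊗ ι W) ⊗_) (sym nrm-f))))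

      b : Fin m → Fin N → Q
      b x z = 𝒜 f (false , x) (+ toℕ z)

      nrm-b : Σ² b ≼ (ι 4 ⊗ ρ) ⊗ (ι 4 ⊗ ρ) ⊗ Σ² w
      nrm-b = ≼-trans (≼-trans-≡ (≼⊕ʳ (sum≽0 λ y → sum≽0 λ z → sq≽0 (𝒜 f (true , y) (+ toℕ z)))) (sym (sum-vs (λ v → Σₚ λ z → 𝒜 f v z ⊗ 𝒜 f v z))))
        (≼-trans-≡ (𝒜-contracts {f} {G} pG fG ρ≽0 {W} pf (M-bound pf) nrm-G wide) (cong ((ι 4 ⊗ ρ) ⊗ (ι 4 ⊗ ρ) ⊗_) nrm-f))

      -- `a` and `w` vanish at bad vertices, so restricting the operator to good edges changes
      -- nothing in the product.
      pointwise : ∀ x z → a x z ⊗ twist w x z ≡ a x z ⊗ b x z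
      pointwise x z = trans (sym (sum-⊗ˡ (a x z) _)) (trans (sum-cong term) (sum-⊗ˡ (a x z) _))
        where
        term : ∀ c → a x z ⊗ w (φ c x) (z ⊞ toℕ (s (Fin.combine c x))) ≡ a x z ⊗ ([[ on c (false , x) ]] ⊗ f (true , φ c x) (+ toℕ z ℤ.+ σ c (false , x)))
        term c = trans (go (good (false , x)) (good (true , φ c x)) refl refl) (cong (λ t → a x z ⊗ ([[ on c (false , x) ]] ⊗ t))
            (sym (trans (cong (λ k → ext (w (φ c x)) (+ toℕ z ℤ.+ k)) (ℤ.*-identityˡ (+ toℕ (s (Fin.combine c x))))) (ext-⊞ (w (φ c x)) z (toℕ (s (Fin.combine c x)))))))
          where
          t : Q
          t = w (φ c x) (z ⊞ toℕ (s (Fin.combine c x)))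
          go : ∀ g₁ g₂ → good (false , x) ≡ g₁ → good (true , φ c x) ≡ g₂ → a x z ⊗ t ≡ a x z ⊗ ([[ good (false , x) ∧ good (true , φ c x) ]] ⊗ t)
          go false g₂ p _ = trans (cong (_⊗ t) (a-good x z p)) (trans (⊗-zeroˡ _) (sym (trans (cong (_⊗ ([[ good (false , x) ∧ good (true , φ c x) ]] ⊗ t)) (a-good x z p)) (⊗-zeroˡ _))))
          go true false p q rewrite p | q = cong (a x z ⊗_) (trans (w-good _ _ q) (sym (⊗-zeroˡ t)))
          go true true p q rewrite p | q = cong (a x z ⊗_) (sym (⊗-idˡ t))

    -- 2l⟨a, b⟩ ≤ l²|a|² + |b|² with l = 4ρ, where |b|² ≤ l²|w|²; division by l then avoids square
    -- roots.
    twist-contracts : ι 2 ⊗ sum (λ x → sum λ z → a x z ⊗ twist w x z) ≼ (ι 4 ⊗ ρ) ⊗ (Σ² a ⊕ Σ² w)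
    twist-contracts = ⊗-cancel⁺ l l>0 (≡-trans-≼ (trans (e₁ l (ι 2) _) (cong (λ t → ι 2 ⊗ (l ⊗ t)) (sum-cong λ x → sum-cong λ z → pointwise x z)))
      (≼-trans (≡-trans-≼ (trans (cong (ι 2 ⊗_) (sym (sum-⊗ˡ l _))) (sym (sum-⊗ˡ (ι 2) _))) (sum-mono λ x → twice-cs (a x) (b x) l))
        (≡-trans-≼ (trans (∑-distrib-+ _ _) (cong (_⊕ Σ² b) (sum-⊗ˡ (l ⊗ l) _)))
          (≼-trans-≡ (⊕-mono ≼-refl nrm-b) (e₂ l (Σ² a) (Σ² w))))))
      where
      l : Q
      l = ι 4 ⊗ ρ
      l>0 : ¬ (l ≼ 𝟘)
      l>0 p = ρ>0 (⊗-cancel-ι 3 (≼-trans-≡ p (sym (⊗-zeroʳ _))))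
      opaque
        unfolding Q
        e₁ : ∀ l t x → l ⊗ (t ⊗ x) ≡ t ⊗ (l ⊗ x)
        e₁ l t x = solve 3 (λ l t x → l :* (t :* x) := t :* (l :* x)) refl l t x
        e₂ : ∀ l x y → (l ⊗ l) ⊗ x ⊕ l ⊗ l ⊗ y ≡ l ⊗ (l ⊗ (x ⊕ y))
        e₂ l x y = solve 3 (λ l x y → (l :* l) :* x :+ l :* l :* y := l :* (l :* (x :+ y))) refl l x y

-- Digits, averages and innovations.

rcp-inv′ : ∀ n .{{_ : NonZero n}} → ι n ⊗ rcp n ≡ 𝟙
rcp-inv′ (suc n) = rcp-inv n

rcp⊗ι⊗ : ∀ n .{{_ : NonZero n}} x → rcp n ⊗ (ι n ⊗ x) ≡ x
rcp⊗ι⊗ n x = trans (sym (⊗-assoc _ _ _)) (trans (cong (_⊗ x) (trans (⊗-comm _ _) (rcp-inv′ n))) (⊗-idˡ x))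

ι⊗rcp⊗ : ∀ n .{{_ : NonZero n}} x → ι n ⊗ (rcp n ⊗ x) ≡ x
ι⊗rcp⊗ n x = trans (sym (⊗-assoc _ _ _)) (trans (cong (_⊗ x) (rcp-inv′ n)) (⊗-idˡ x))

quotient-combine : ∀ {m n} (i : Fin m) (j : Fin n) → Fin.quotient n (Fin.combine i j) ≡ i
quotient-combine {m} {n} i j = cong proj₁ (Fin.remQuot-combine {m} {n} i j)

remainder-combine : ∀ {m n} (i : Fin m) (j : Fin n) → Fin.remainder {m} n (Fin.combine i j) ≡ j
remainder-combine {m} {n} i j = cong proj₂ (Fin.remQuot-combine {m} {n} i j)

average : ∀ {m} n → (Fin (m ℕ.* n) → Q) → Fin m → Q
average {m} n f x = rcp n ⊗ sum λ j → f (Fin.combine {m} x j)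

lift : ∀ {m} n → (Fin m → Q) → Fin (m ℕ.* n) → Q
lift {m} n u i = u (Fin.quotient {m} n i)

-- A martingale difference: `average` is the conditional expectation given all digits but the last,
-- and the innovation is what the last digit adds.
innovation : ∀ {m} n → (Fin (m ℕ.* n) → Q) → Fin (m ℕ.* n) → Q
innovation {m} n f i = f i ⊖ lift {m} n (average {m} n f) i

innovation-block : ∀ {m} n .{{_ : NonZero n}} (f : Fin (m ℕ.* n) → Q) x → sum (λ j → innovation {m} n f (Fin.combine {m} x j)) ≡ 𝟘
innovation-block {m} n f x = trans (sum-⊖ _ _) (trans (cong (sum (λ j → f (Fin.combine x j)) ⊖_)
    (trans (sum-cong λ j → cong (average {m} n f) (quotient-combine x j)) (trans (sum-const n _) (ι⊗rcp⊗ n _)))) (⊖-self _))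

module _ {m P W : ℕ} where

  coordˣ : Fin (m ℕ.* P ℕ.* W) → Fin m
  coordˣ i = Fin.quotient {m} P (Fin.quotient {m ℕ.* P} W i)

  coordᶻ : Fin (m ℕ.* P ℕ.* W) → Fin (P ℕ.* W)
  coordᶻ i = Fin.combine (Fin.remainder {m} P (Fin.quotient {m ℕ.* P} W i)) (Fin.remainder {m ℕ.* P} W i)

  point : Fin m → Fin (P ℕ.* W) → Fin (m ℕ.* P ℕ.* W)
  point x z = Fin.combine (Fin.combine x (Fin.quotient {P} W z)) (Fin.remainder {P} W z)

  point-combine : ∀ x p q → point x (Fin.combine p q) ≡ Fin.combine (Fin.combine x p) q
  point-combine x p q = cong₂ (λ p q → Fin.combine (Fin.combine x p) q) (quotient-combine p q) (remainder-combine p q)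

  coordˣ-point : ∀ x z → coordˣ (point x z) ≡ x
  coordˣ-point x z = trans (cong (Fin.quotient {m} P) (quotient-combine _ _)) (quotient-combine _ _)

  coordᶻ-point : ∀ x z → coordᶻ (point x z) ≡ z
  coordᶻ-point x z = trans (cong₂ Fin.combine (trans (cong (Fin.remainder {m} P) (quotient-combine (Fin.combine x (Fin.quotient {P} W z)) _)) (remainder-combine x _)) (remainder-combine (Fin.combine x (Fin.quotient {P} W z)) (Fin.remainder {P} W z)))
    (Fin.combine-remQuot {P} W z)

  point-coord : ∀ i → point (coordˣ i) (coordᶻ i) ≡ i
  point-coord i = trans (point-combine _ _ _) (trans (cong (λ y → Fin.combine y (Fin.remainder {m ℕ.* P} W i)) (Fin.combine-remQuot {m} P (Fin.quotient {m ℕ.* P} W i)))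
    (Fin.combine-remQuot {m ℕ.* P} W i))

  toℕ-point : ∀ x z → toℕ (point x z) ≡ P ℕ.* W ℕ.* toℕ x ℕ.+ toℕ z
  toℕ-point x z = trans (Fin.toℕ-combine (Fin.combine x _) _) (trans (cong (λ k → W ℕ.* k ℕ.+ toℕ (Fin.remainder {P} W z)) (Fin.toℕ-combine x _))
    (trans (e W P (toℕ x) _ _) (cong (P ℕ.* W ℕ.* toℕ x ℕ.+_) (trans (sym (Fin.toℕ-combine (Fin.quotient {P} W z) _)) (cong toℕ (Fin.combine-remQuot {P} W z))))))
    where
    e : ∀ W P x p q → W ℕ.* (P ℕ.* x ℕ.+ p) ℕ.+ q ≡ P ℕ.* W ℕ.* x ℕ.+ (W ℕ.* p ℕ.+ q)
    e = ℕ-Ring.solve-∀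

  point-mono : ∀ {x y} (z w : Fin (P ℕ.* W)) → x Fin.< y → point x z Fin.< point y w
  point-mono {x} {y} z w l = subst₂ ℕ._<_ (sym (toℕ-point x z)) (sym (toℕ-point y w))
    (ℕ.<-≤-trans (ℕ.+-monoʳ-< (P ℕ.* W ℕ.* toℕ x) (Fin.toℕ<n z)) (ℕ.≤-trans (ℕ.≤-reflexive (e (P ℕ.* W) (toℕ x)))
      (ℕ.≤-trans (ℕ.*-monoʳ-≤ (P ℕ.* W) l) (ℕ.m≤m+n _ _))))
    where
    e : ∀ n x → n ℕ.* x ℕ.+ n ≡ n ℕ.* suc x
    e = ℕ-Ring.solve-∀

  point-mono′ : ∀ x {z w : Fin (P ℕ.* W)} → z Fin.< w → point x z Fin.< point x w
  point-mono′ x {z} {w} l = subst₂ ℕ._<_ (sym (toℕ-point x z)) (sym (toℕ-point x w)) (ℕ.+-monoʳ-< (P ℕ.* W ℕ.* toℕ x) l)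

  sum-point : (f : Fin (m ℕ.* P ℕ.* W) → Q) → sum f ≡ sum λ x → sum λ z → f (point x z)
  sum-point f = trans (sum-combine (m ℕ.* P) f) (trans (sum-combine m _) (sum-cong λ x → sym (trans (sum-combine P _)
    (sum-cong λ p → sum-cong λ q → cong f (point-combine x p q)))))

-- The points counted are those that a shift below A might carry past N.
sum-tail : ∀ {N A} → A ℕ.≤ N → sum {N} (λ z → [[ not (does (toℕ z ℕ.+ A ℕ.≤? N)) ]]) ≼ ι A
sum-tail {N} {A} A≤N = go (N ℕ.∸ A) (sym (ℕ.m∸n+n≡m A≤N))
  where
  go : ∀ B {N} → N ≡ B ℕ.+ A → sum {N} (λ z → [[ not (does (toℕ z ℕ.+ A ℕ.≤? N)) ]]) ≼ ι A
  go B refl = ≡-trans-≼ (trans (sum-splitAt B _) (trans (cong (_⊕ sum λ j → [[ not (does (toℕ (B Fin.↑ʳ j) ℕ.+ A ℕ.≤? B ℕ.+ A)) ]])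
      (trans (sum-cong λ i → cong (λ b → [[ not b ]]) (dec-true (toℕ (i Fin.↑ˡ A) ℕ.+ A ℕ.≤? B ℕ.+ A)
        (ℕ.+-monoˡ-≤ A (ℕ.≤-trans (ℕ.≤-reflexive (Fin.toℕ-↑ˡ i A)) (ℕ.<⇒≤ (Fin.toℕ<n i)))))) (sum-0 B))) (⊕-idˡ _)))
    (≼-trans-≡ (sum-mono λ j → [[]]≼1 (not (does (toℕ (B Fin.↑ʳ j) ℕ.+ A ℕ.≤? B ℕ.+ A)))) (trans (sum-const A 𝟙) (⊗-idʳ _)))

parity : ℕ → Bool
parity zero = false
parity (suc t) = not (parity t)

same : Bool → Bool → Bool
same false b = not b
same true b = b

module Tower (dg : ℕ → ℕ) (dg-nz : ∀ t → NonZero (dg t)) where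

  size : ℕ → ℕ
  size zero = 1
  size (suc t) = size t ℕ.* dg t

  -- The sum of the innovations of the digits of parity b.
  part : Bool → ∀ t → (Fin (size t) → Q) → Fin (size t) → Q
  part b zero f i = 𝟘
  part b (suc t) f i = lift {size t} (dg t) (part b t (average {size t} (dg t) f)) i ⊕ [[ same b (parity t) ]] ⊗ innovation {size t} (dg t) f i

  -- Only the second of the two digits t, t + 1 has the parity of t + 1.
  part-two : ∀ t f x z → let i = point {size t} {dg t} {dg (suc t)} x z in
    part (parity (suc t)) (suc (suc t)) f i ≡ part (parity (suc t)) t (average {size t} (dg t) (average {size (suc t)} (dg (suc t)) f)) x ⊕ innovation {size (suc t)} (dg (suc t)) f i
  part-two t f x z = trans (cong₂ (λ y b → part (parity (suc t)) (suc t) F y ⊕ [[ b ]] ⊗ innovation {size (suc t)} (dg (suc t)) f i)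
      (quotient-combine (Fin.combine x (Fin.quotient {dg t} (dg (suc t)) z)) (Fin.remainder {dg t} (dg (suc t)) z)) (same-refl (parity (suc t))))
    (cong₂ _⊕_ (trans (cong₂ (λ y b → part (parity (suc t)) t (average {size t} (dg t) F) y ⊕ [[ b ]] ⊗ innovation {size t} (dg t) F xp)
      (quotient-combine x (Fin.quotient {dg t} (dg (suc t)) z)) (same-not (parity t))) (trans (cong (part (parity (suc t)) t (average {size t} (dg t) F) x ⊕_) (⊗-zeroˡ _)) (⊕-idʳ _))) (⊗-idˡ _))
    where
    F = average {size (suc t)} (dg (suc t)) f
    i = point {size t} {dg t} {dg (suc t)} x z
    xp = Fin.combine x (Fin.quotient {dg t} (dg (suc t)) z)
    same-refl : ∀ b → same b b ≡ true
    same-refl false = refl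
    same-refl true = refl
    same-not : ∀ b → same (not b) b ≡ false
    same-not false = refl
    same-not true = refl

not∧≼ : ∀ a b → [[ not (a ∧ b) ]] ≼ [[ not a ]] ⊕ [[ not b ]]
not∧≼ true b = ≼⊕ˡ ≼-refl
not∧≼ false b = ≼⊕ʳ ([[]]≽0 (not b))

pythagoras : ∀ {n} (f d : Fin n → Q) c → (∀ z → f z ≡ c ⊕ d z) → sum d ≡ 𝟘 → sum (λ z → f z ⊗ f z) ≡ ι n ⊗ (c ⊗ c) ⊕ sum (λ z → d z ⊗ d z)
pythagoras {n} f d c p q = trans (sum-cong λ z → trans (cong₂ _⊗_ (p z) (p z)) (e c (d z))) (trans (∑-distrib-+ _ _) (cong₂ _⊕_
    (trans (∑-distrib-+ _ _) (trans (cong₂ _⊕_ (sum-const n _) (trans (sum-⊗ˡ (c ⊕ c) d) (trans (cong ((c ⊕ c) ⊗_) q) (⊗-zeroʳ _)))) (⊕-idʳ _))) refl))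
  where
  opaque
    unfolding Q
    e : ∀ c d → (c ⊕ d) ⊗ (c ⊕ d) ≡ (c ⊗ c ⊕ (c ⊕ c) ⊗ d) ⊕ d ⊗ d
    e c d = solve 2 (λ c d → (c :+ d) :* (c :+ d) := (c :* c :+ (c :+ c) :* d) :+ d :* d) refl c d

losses : ∀ {m} → (Fin m → Bool) → (Bool × Fin m → Bool) → Q
losses kept good = sum (λ x → [[ not (kept x) ]]) ⊕ (sum (λ x → [[ not (good (false , x)) ]]) ⊕ sum (λ y → [[ not (good (true , y)) ]]))

-- One step of the tower.

module Families (D K W₀ r : ℕ) (D≡K² : D ≡ suc K ℕ.* suc K) where

  ρ Λ : Q
  ρ = ι (suc r)
  Λ = ι 4 ⊗ ρ

  -- Points that are not kept have wrapped around in some lift, and vertices that are not good were removed to keep the girth;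
  -- φ a is increasing on the kept points of each of its two pieces.
  record Family (g m : ℕ) (part : (Fin m → Q) → Fin m → Q) : Set where
    field
      φ ψ   : Fin D → Fin m → Fin m
      ψφ    : ∀ a x → ψ a (φ a x) ≡ x
      φψ    : ∀ a y → φ a (ψ a y) ≡ y
      good  : Bool × Fin m → Bool
      kept  : Fin m → Bool
      piece : Fin D → Fin m → Bool
      girth : Walks.Girth (Bipartite.𝒢 φ ψ ψφ φψ) good g
      mono  : ∀ a x y → kept x ≡ true → kept y ≡ true → piece a x ≡ piece a y → x Fin.< y → φ a x Fin.< φ a y
      -- In other words losses ≤ (1 - 1/g)·m/W₀. Passing from g to 2g frees a share m/(2·W₀·g),
      -- spent equally on wrapping and on short closed walks, and the total always stays below m/W₀.
      loss-bound : ι W₀ ⊗ (ι g ⊗ losses kept good) ⊕ ι m ≼ ι g ⊗ ι m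
      -- In this additive form the estimates for different digits can simply be added up.
      contracts : ∀ (e f : Fin m → Q) → (∀ x → good (false , x) ≡ false → e x ≡ 𝟘) → (∀ y → good (true , y) ≡ false → f y ≡ 𝟘) →
        ι 2 ⊗ sum (λ x → e x ⊗ sum λ a → part f (φ a x)) ≼ Λ ⊗ (sum (λ x → e x ⊗ e x) ⊕ sum (λ x → part f x ⊗ part f x))

  -- Conditions under which digits of sizes P and W can be appended: the shifts are smaller than A = PW/G, h + 1 is the width
  -- of the averaging window and dbl (suc k) the length of the closed walks in the trace estimate.
  record Scale (g m P W : ℕ) : Set where
    field
      A′ h k c G : ℕ
      A≤N   : suc A′ ℕ.≤ P ℕ.* W
      N≡GA  : P ℕ.* W ≡ G ℕ.* suc A′
      large : 4 ℕ.* (W₀ ℕ.* g) ℕ.≤ G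
      -- `short` keeps the window below A/(2κ), so that smoothing gains κ; `wide` keeps it above
      -- D·W/ρ, so that window averages of functions with zero block sums are negligible. Hence A
      -- must exceed W by a large factor, and P makes this possible.
      short : ι 4 ⊗ ι (suc h) ≼ ι 2 ⊗ (ι (suc A′) ⊗ rcp (suc K))
      wide  : ι D ⊗ ι W ≼ ρ ⊗ ι (suc h)
      n+g≤  : dbl (suc k) ℕ.+ g ℕ.≤ g ℕ.* c
      small : ι 2 ⊗ (ι (P ℕ.* W) ⊗ (ι (m ℕ.+ m) ⊗ (ι 2 ^^ dbl (suc k) ⊗ (ι 2 ^^ dbl (suc k) ⊗ (ι (suc K) ^^ dbl (suc k) ⊗ ι (suc (dbl (suc k))) ⊗ (𝟙 ⊕ ι (2 ℕ.* c)) ^^ dbl (suc k)))))) ≼ ρ ^^ dbl (suc k)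
      few   : ι 2 ⊗ (ι (8 ℕ.* (W₀ ℕ.* g)) ⊗ sum {g ℕ.+ g} (λ r → ι D ^^ toℕ r)) ≼ ι (suc A′)

  module Step {g m P W part} (𝓕 : Family g m part) (𝓢 : Scale g m P W) {{_ : NonZero P}} {{_ : NonZero W}} (s : Fin (D ℕ.* m) → Fin (suc (Scale.A′ 𝓢))) where

    open Family 𝓕
    open Scale 𝓢

    N A : ℕ
    N = P ℕ.* W
    A = suc A′

    instance
      nz : NonZero N
      nz = ℕ.m*n≢0 P W

    open Bipartite φ ψ ψφ φψ
    open ColouredGraph 𝒢 using (step; sgn; edge)
    open Cyclic N
    private
      module Ch = Choice 𝒢 good vs step-sum select A′ N h

    open Ch.Lifted s g

    sh : Fin D → Fin m → ℕ
    sh a x = toℕ (s (Fin.combine a x))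

    sh<A : ∀ a x → sh a x ℕ.< A
    sh<A a x = Fin.toℕ<n (s (Fin.combine a x))

    private
      Ω′ : Set
      Ω′ = Fin (m ℕ.* P ℕ.* W)
      X : Ω′ → Fin m
      X = coordˣ {m} {P} {W}
      Z : Ω′ → Fin N
      Z = coordᶻ {m} {P} {W}
      pt : Fin m → Fin N → Ω′
      pt = point {m} {P} {W}
      X-pt : ∀ x z → X (pt x z) ≡ x
      X-pt = coordˣ-point {m} {P} {W}
      Z-pt : ∀ x z → Z (pt x z) ≡ z
      Z-pt = coordᶻ-point {m} {P} {W}

    -- The last two digits form one number z < PW, to which the lift adds a shift modulo PW.
    φ′ ψ′ : Fin D → Ω′ → Ω′
    φ′ a i = pt (φ a (X i)) (Z i ⊞ sh a (X i))
    ψ′ a i = pt (ψ a (X i)) (Z i ⊞ (N ℕ.∸ sh a (ψ a (X i))))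

    sh≤N : ∀ a x → sh a x ℕ.≤ N
    sh≤N a x = ℕ.≤-trans (ℕ.<⇒≤ (sh<A a x)) A≤N

    ψφ′ : ∀ a i → ψ′ a (φ′ a i) ≡ i
    ψφ′ a i = trans (cong₂ (λ x z → pt (ψ a x) (z ⊞ (N ℕ.∸ sh a (ψ a x)))) (X-pt _ _) (Z-pt (φ a (X i)) _))
      (trans (cong₂ (λ x y → pt x (Z i ⊞ sh a (X i) ⊞ (N ℕ.∸ sh a y))) (ψφ a (X i)) (ψφ a (X i)))
        (trans (cong (pt (X i)) (⊞-cancel (Z i) (ℕ.m+[n∸m]≡n (sh≤N a (X i))))) (point-coord {m} {P} {W} i)))

    φψ′ : ∀ a i → φ′ a (ψ′ a i) ≡ i
    φψ′ a i = trans (cong₂ (λ x z → pt (φ a x) (z ⊞ sh a x)) (X-pt _ _) (Z-pt (ψ a (X i)) _))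
      (trans (cong₂ pt (φψ a (X i)) (⊞-cancel (Z i) (ℕ.m∸n+n≡m (sh≤N a (ψ a (X i)))))) (point-coord {m} {P} {W} i))

    good″ : Bool × Ω′ → Bool
    good″ (b , i) = good′ (b , X i)

    kept′ : Ω′ → Bool
    kept′ i = kept (X i) ∧ does (toℕ (Z i) ℕ.+ A ℕ.≤? N)

    private
      module B′ = Bipartite φ′ ψ′ ψφ′ φψ′

      π : B′.V → V
      π (b , i) = b , X i
      pos : B′.V → ℤ
      pos (b , i) = + toℕ (Z i)

      π-step : ∀ a v → π (ColouredGraph.step B′.𝒢 a v) ≡ step a (π v)
      π-step a (false , i) = cong (true ,_) (X-pt _ _)
      π-step a (true , i) = cong (false ,_) (X-pt _ _)

      open Operators.Twisted 𝒢 good vs step-sum select A N h s using (σ)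

      rem : ∀ z n → ∃ λ k → + toℕ (z ⊞ n) ≡ + toℕ z ℤ.+ + n ℤ.+ k ℤ.* + N
      rem z n = ℤ.- + q , trans (e (+ r′) (+ (q ℕ.* N))) (cong₂ ℤ._+_ (sym (cong +_ (trans (m≡m%n+[m/n]*n (toℕ z ℕ.+ n) N) (cong (ℕ._+ q ℕ.* N) (sym (toℕ-⊞ z n))))))
          (trans (cong ℤ.-_ (ℤ.pos-* q N)) (ℤ.neg-distribˡ-* (+ q) (+ N))))
        where
        q r′ : ℕ
        q = (toℕ z ℕ.+ n) ℕ./ N
        r′ = toℕ (z ⊞ n)
        e : ∀ r x → r ≡ r ℤ.+ x ℤ.+ ℤ.- x
        e = ℤ-Ring.solve-∀

      pos-step : ∀ a v → ∃ λ k → pos (ColouredGraph.step B′.𝒢 a v) ≡ pos v ℤ.+ σ a (π v) ℤ.+ k ℤ.* + N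
      pos-step a (false , i) with rem (Z i) (sh a (X i))
      ... | k , p = k , trans (cong (λ z → + toℕ z) (Z-pt (φ a (X i)) _)) (trans p (cong (λ y → + toℕ (Z i) ℤ.+ y ℤ.+ k ℤ.* + N) (sym (ℤ.*-identityˡ (+ sh a (X i))))))
      pos-step a (true , i) with rem (Z i) (N ℕ.∸ sh a (ψ a (X i)))
      ... | k , p = + 1 ℤ.+ k , trans (cong (λ z → + toℕ z) (Z-pt (ψ a (X i)) _)) (trans p (trans (cong (λ y → + toℕ (Z i) ℤ.+ y ℤ.+ k ℤ.* + N)
            (trans (sym (ℤ.⊖-≥ (sh≤N a (ψ a (X i))))) (sym (ℤ.m-n≡m⊖n N (sh a (ψ a (X i))))))) (e (+ toℕ (Z i)) (+ N) (+ sh a (ψ a (X i))) k)))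
        where
        e : ∀ z n s k → z ℤ.+ (n ℤ.- s) ℤ.+ k ℤ.* n ≡ z ℤ.+ ℤ.- + 1 ℤ.* s ℤ.+ (+ 1 ℤ.+ k) ℤ.* n
        e = ℤ-Ring.solve-∀

    girth′ : Walks.Girth B′.𝒢 good″ (g ℕ.+ g)
    girth′ = girth-doubles B′.𝒢 good″ π pos (λ v p → p) π-step pos-step

    -- Between different fibres the old permutation decides. Two points of one fibre receive the
    -- same shift, and neither of them wraps around since both are kept.
    mono′ : ∀ a i j → kept′ i ≡ true → kept′ j ≡ true → piece a (X i) ≡ piece a (X j) → i Fin.< j → φ′ a i Fin.< φ′ a j
    mono′ a i j ki kj pij i<j with ∧-true {kept (X i)} ki | ∧-true {kept (X j)} kj
    ... | kxi , kzi | kxj , kzj with Fin.<-cmp (X i) (X j)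
    ...   | tri< l _ _ = point-mono {m} {P} {W} _ _ (mono a (X i) (X j) kxi kxj pij l)
    ...   | tri> _ _ l = ⊥-elim (ℕ.<-asym i<j (subst₂ Fin._<_ (point-coord {m} {P} {W} j) (point-coord {m} {P} {W} i) (point-mono {m} {P} {W} (Z j) (Z i) l)))
    ...   | tri≈ _ e _ = subst (λ x → φ′ a i Fin.< pt (φ a x) (Z j ⊞ sh a x)) e (point-mono′ {m} {P} {W} (φ a (X i))
              (subst₂ ℕ._<_ (sym (⊞-small (Z i) _ (fits i kzi))) (sym (⊞-small (Z j) _ (fits j kzj))) (ℕ.+-monoˡ-< (sh a (X i)) zlt)))
      where
      fits : ∀ j → does (toℕ (Z j) ℕ.+ A ℕ.≤? N) ≡ true → toℕ (Z j) ℕ.+ sh a (X i) ℕ.< N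
      fits j k = ℕ.<-≤-trans (ℕ.+-monoʳ-< (toℕ (Z j)) (sh<A a (X i))) (does⇒ (toℕ (Z j) ℕ.+ A ℕ.≤? N) k)
      zlt : toℕ (Z i) ℕ.< toℕ (Z j)
      zlt = ℕ.+-cancelˡ-< (N ℕ.* toℕ (X i)) _ _ (subst₂ ℕ._<_ (eq i refl) (eq j (sym e)) i<j)
        where
        eq : ∀ j → X j ≡ X i → toℕ j ≡ N ℕ.* toℕ (X i) ℕ.+ toℕ (Z j)
        eq j q = trans (cong toℕ (sym (point-coord {m} {P} {W} j))) (trans (toℕ-point {m} {P} {W} (X j) (Z j)) (cong (λ x → N ℕ.* toℕ x ℕ.+ toℕ (Z j)) q))

    sum-X : (F : Fin m → Q) → sum (λ i → F (X i)) ≡ ι N ⊗ sum F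
    sum-X F = trans (sum-point {m} {P} {W} _) (trans (sum-cong λ x → trans (sum-cong λ z → cong F (X-pt x z)) (sum-const N (F x))) (sum-⊗ˡ (ι N) F))

    private
      R : Q
      R = Ch.total-returns g s

    loss-step : losses kept′ good″ ≼ (ι N ⊗ losses kept good ⊕ ι m ⊗ ι A) ⊕ ι N ⊗ R
    loss-step = ≼-trans (⊕-mono lost (⊕-mono (bad false) (bad true))) (≼-reflexive (trans (e (ι N) _ _ _ _ _ _) (cong (λ r → (ι N ⊗ losses kept good ⊕ ι m ⊗ ι A) ⊕ ι N ⊗ r) (sym (sum-vs (λ v → ret v))))))
      where
      ret : V → Q
      ret v = WalkSums.returns 𝒢 good A (Period.δ N) g v s
      lost : sum (λ i → [[ not (kept′ i) ]]) ≼ ι N ⊗ sum (λ x → [[ not (kept x) ]]) ⊕ ι m ⊗ ι A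
      lost = ≼-trans (sum-mono λ i → not∧≼ (kept (X i)) (does (toℕ (Z i) ℕ.+ A ℕ.≤? N)))
        (≡-trans-≼ (trans (∑-distrib-+ _ _) (cong₂ _⊕_ (sum-X (λ x → [[ not (kept x) ]])) (trans (sum-point {m} {P} {W} _)
            (sum-cong λ x → sum-cong λ z → cong (λ w → [[ not (does (toℕ w ℕ.+ A ℕ.≤? N)) ]]) (Z-pt x z)))))
          (⊕-mono ≼-refl (≼-trans-≡ (sum-mono {m} λ x → sum-tail A≤N) (sum-const m (ι A)))))
      bad : ∀ b → sum (λ i → [[ not (good″ (b , i)) ]]) ≼ ι N ⊗ (sum (λ x → [[ not (good (b , x)) ]]) ⊕ sum (λ x → ret (b , x)))
      bad b = ≡-trans-≼ (sum-X (λ x → [[ not (good′ (b , x)) ]])) (⊗-monoˡ (ι N) (ι≽0 N) (≼-trans-≡ (sum-mono λ x → bad≼ (b , x)) (∑-distrib-+ _ _)))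
      opaque
        unfolding Q
        e : ∀ n k a p q r t → (n ⊗ k ⊕ a) ⊕ (n ⊗ (p ⊕ q) ⊕ n ⊗ (r ⊕ t)) ≡ (n ⊗ (k ⊕ (p ⊕ r)) ⊕ a) ⊕ n ⊗ (q ⊕ t)
        e n k a p q r t = solve 7 (λ n k a p q r t → (n :* k :+ a) :+ (n :* (p :+ q) :+ n :* (r :+ t)) := (n :* (k :+ (p :+ r)) :+ a) :+ n :* (q :+ t)) refl n k a p q r t

    module _ (few-returns : ι (8 ℕ.* (W₀ ℕ.* g)) ⊗ R ≼ ι (m ℕ.+ m)) where

      -- `large` gives 4·W₀·g·A ≤ N, and the hypothesis gives 4·W₀·g·R ≤ m. So the two new kinds of
      -- loss use up exactly the gain of 1 - 1/(2g) over 1 - 1/g.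
      loss-bound′ : ι W₀ ⊗ (ι (g ℕ.+ g) ⊗ losses kept′ good″) ⊕ ι (m ℕ.* P ℕ.* W) ≼ ι (g ℕ.+ g) ⊗ ι (m ℕ.* P ℕ.* W)
      loss-bound′ = ≡-trans-≼ (cong₂ (λ γ n → ι W₀ ⊗ (γ ⊗ losses kept′ good″) ⊕ n) 2g mPW) (≼-trans-≡ (⊗-cancel-ι 1 (≼-trans (⊗-monoˡ (ι 2) (ι≽0 2)
          (⊕-mono (⊗-monoˡ (ι W₀) (ι≽0 W₀) (⊗-monoˡ _ (⊗≽0 (ι≽0 2) (ι≽0 g)) loss-step)) ≼-refl))
          (≡-trans-≼ (trans (two⊗ _) (trans (cong (λ t → let z = ι W₀ ⊗ (t ⊗ ι g ⊗ ((ι N ⊗ L ⊕ ι m ⊗ ι A) ⊕ ι N ⊗ R)) ⊕ ι m ⊗ ι N in z ⊕ z) ι2) (e₁ (ι W₀) (ι g) L (ι m) (ι N) (ι A) R)))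
            (≼-trans (⊕-mono (⊕-mono ≼-refl (⊗-monoˡ (ι m) (ι≽0 m) (≡-trans-≼ (sym (four⊗ _)) H1))) (⊗-monoˡ (ι N) (ι≽0 N) (≡-trans-≼ (sym (four⊗ _)) H2)))
              (≡-trans-≼ (e₂ (ι W₀ ⊗ (ι g ⊗ L)) (ι m) (ι N)) (≼-trans (⊗-monoˡ _ (⊗≽0 four≽0 (ι≽0 N)) loss-bound)
                (≼-reflexive (trans (e₃ (ι N) (ι g) (ι m)) (trans (cong₂ (λ t u → t ⊗ ((u ⊗ ι g) ⊗ (ι m ⊗ ι N))) (sym ι2) (sym ι2)) refl)))))))))
          (cong₂ _⊗_ (sym 2g) (sym mPW)))
        where
        L : Q
        L = losses kept good
        ι2 : ι 2 ≡ 𝟙 ⊕ 𝟙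
        ι2 = trans (ι-suc 1) (cong (𝟙 ⊕_) ι1)
        ι4 : ι 4 ≡ (𝟙 ⊕ 𝟙) ⊗ (𝟙 ⊕ 𝟙)
        ι4 = trans (ι-* 2 2) (cong₂ _⊗_ ι2 ι2)
        four≽0 : 𝟘 ≼ (𝟙 ⊕ 𝟙) ⊗ (𝟙 ⊕ 𝟙)
        four≽0 = ≼-trans-≡ (ι≽0 4) ι4
        four⊗ : ∀ x → ι 4 ⊗ x ≡ (𝟙 ⊕ 𝟙) ⊗ (𝟙 ⊕ 𝟙) ⊗ x
        four⊗ x = cong (_⊗ x) ι4
        2g : ι (g ℕ.+ g) ≡ ι 2 ⊗ ι g
        2g = trans (ι-+ g g) (sym (two⊗ _))
        mPW : ι (m ℕ.* P ℕ.* W) ≡ ι m ⊗ ι N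
        mPW = trans (cong ι (ℕ.*-assoc m P W)) (ι-* m N)
        wg : ι 4 ⊗ (ι W₀ ⊗ ι g) ≡ ι (4 ℕ.* (W₀ ℕ.* g))
        wg = sym (trans (ι-* 4 (W₀ ℕ.* g)) (cong (ι 4 ⊗_) (ι-* W₀ g)))
        H1 : ι 4 ⊗ ((ι W₀ ⊗ ι g) ⊗ ι A) ≼ ι N
        H1 = ≡-trans-≼ (trans (sym (⊗-assoc _ _ _)) (trans (cong (_⊗ ι A) wg) (sym (ι-* _ A)))) (≼-trans-≡ (ι-mono (ℕ.*-monoˡ-≤ A large)) (cong ι (sym N≡GA)))
        H2 : ι 4 ⊗ ((ι W₀ ⊗ ι g) ⊗ R) ≼ ι m
        H2 = ⊗-cancel-ι 1 (≡-trans-≼ (trans (sym (⊗-assoc _ _ _)) (trans (cong (_⊗ ((ι W₀ ⊗ ι g) ⊗ R)) (sym (ι-* 2 4))) (trans (sym (⊗-assoc _ _ _)) (cong (_⊗ R) (trans (cong (ι 8 ⊗_) (sym (ι-* W₀ g))) (sym (ι-* 8 _)))))))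
          (≼-trans-≡ few-returns (trans (ι-+ m m) (sym (two⊗ _)))))
        opaque
          unfolding Q
          e₁ : ∀ w γ x m n a r → let z = w ⊗ ((𝟙 ⊕ 𝟙) ⊗ γ ⊗ ((n ⊗ x ⊕ m ⊗ a) ⊕ n ⊗ r)) ⊕ m ⊗ n in
               z ⊕ z ≡ ((𝟙 ⊕ 𝟙) ⊗ (𝟙 ⊕ 𝟙) ⊗ n ⊗ (w ⊗ (γ ⊗ x)) ⊕ (𝟙 ⊕ 𝟙) ⊗ (m ⊗ n) ⊕ m ⊗ ((𝟙 ⊕ 𝟙) ⊗ (𝟙 ⊕ 𝟙) ⊗ ((w ⊗ γ) ⊗ a))) ⊕ n ⊗ ((𝟙 ⊕ 𝟙) ⊗ (𝟙 ⊕ 𝟙) ⊗ ((w ⊗ γ) ⊗ r))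
          e₁ w γ x m n a r = solve 7 (λ w γ x m n a r → let o = con ℚ.1ℚ ; z = w :* ((o :+ o) :* γ :* ((n :* x :+ m :* a) :+ n :* r)) :+ m :* n in
               z :+ z := ((o :+ o) :* (o :+ o) :* n :* (w :* (γ :* x)) :+ (o :+ o) :* (m :* n) :+ m :* ((o :+ o) :* (o :+ o) :* ((w :* γ) :* a))) :+ n :* ((o :+ o) :* (o :+ o) :* ((w :* γ) :* r))) refl w γ x m n a r
          e₂ : ∀ x m n → ((𝟙 ⊕ 𝟙) ⊗ (𝟙 ⊕ 𝟙) ⊗ n ⊗ x ⊕ (𝟙 ⊕ 𝟙) ⊗ (m ⊗ n) ⊕ m ⊗ n) ⊕ n ⊗ m ≡ ((𝟙 ⊕ 𝟙) ⊗ (𝟙 ⊕ 𝟙) ⊗ n) ⊗ (x ⊕ m)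
          e₂ x m n = solve 3 (λ x m n → let o = con ℚ.1ℚ in ((o :+ o) :* (o :+ o) :* n :* x :+ (o :+ o) :* (m :* n) :+ m :* n) :+ n :* m := ((o :+ o) :* (o :+ o) :* n) :* (x :+ m)) refl x m n
          e₃ : ∀ n γ m → ((𝟙 ⊕ 𝟙) ⊗ (𝟙 ⊕ 𝟙) ⊗ n) ⊗ (γ ⊗ m) ≡ (𝟙 ⊕ 𝟙) ⊗ (((𝟙 ⊕ 𝟙) ⊗ γ) ⊗ (m ⊗ n))
          e₃ n γ m = solve 3 (λ n γ m → let o = con ℚ.1ℚ in ((o :+ o) :* (o :+ o) :* n) :* (γ :* m) := (o :+ o) :* (((o :+ o) :* γ) :* (m :* n))) refl n γ m

    module _ (part′ : (Ω′ → Q) → Ω′ → Q)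
      (trace-bound : Operators.trace 𝒢 good vs step-sum select A N h (dbl (suc k)) s ≼ ρ ^^ dbl (suc k))
      (part′-eq : ∀ f x z → part′ f (pt x z) ≡ part (average {m} P (average {m ℕ.* P} W f)) x ⊕ innovation {m ℕ.* P} W f (pt x z)) where

      -- Both functions split into fibre means and mean-free rests. The means obey the old estimate
      -- with weight N, the rests obey `twist-contracts`, and the mixed terms vanish because the
      -- lift permutes each fibre.
      contracts′ : ∀ (e f : Ω′ → Q) → (∀ i → good″ (false , i) ≡ false → e i ≡ 𝟘) → (∀ i → good″ (true , i) ≡ false → f i ≡ 𝟘) →
        ι 2 ⊗ sum (λ i → e i ⊗ sum λ a → part′ f (φ′ a i)) ≼ Λ ⊗ (sum (λ i → e i ⊗ e i) ⊕ sum (λ i → part′ f i ⊗ part′ f i))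
      contracts′ e f e-good f-good = ≡-trans-≼ (cong (ι 2 ⊗_) lhs) (≡-trans-≼ (e₃ (ι 2) (ι N) _ _)
          (≼-trans (⊕-mono (⊗-monoˡ (ι N) (ι≽0 N) (contracts e₀ F e₀-good F-good)) (LC.twist-contracts (λ pf → M-bound pf) wide e₁ w e₁-good w-good w-block))
            (≼-reflexive (trans (e₄ (ι N) Λ _ _ _ _) (sym (cong (Λ ⊗_) (cong₂ _⊕_ rhs-e rhs-f)))))))
        where
        module LC = LevelContraction φ ψ ψφ φψ good {P} {W} A h s ρ (ι≽0 (suc r)) (1≼⇒pos (1≼ι r))
        M-bound : ∀ {f} → Operators.Per 𝒢 good vs step-sum select A N h f →
          Operators.nrm 𝒢 good vs step-sum select A N h (Operators.Twisted.M𝒜 𝒢 good vs step-sum select A N h s f) ≼ ρ ^^ 2 ⊗ Operators.nrm 𝒢 good vs step-sum select A N h f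
        M-bound = Operators.Twisted.contraction 𝒢 good vs step-sum select A N h s k (ι≽0 (suc r)) trace-bound
        F u e₀ : Fin m → Q
        F = average {m} P (average {m ℕ.* P} W f)
        u = part F
        e₀ x = rcp N ⊗ sum λ z → e (pt x z)
        w e₁ : Fin m → Fin N → Q
        w x z = innovation {m ℕ.* P} W f (pt x z)
        e₁ x z = e (pt x z) ⊖ e₀ x
        not-good : ∀ b x z → good (b , x) ≡ false → good″ (b , pt x z) ≡ false
        not-good b x z p rewrite X-pt x z | p = refl
        e-0 : ∀ x → good (false , x) ≡ false → ∀ z → e (pt x z) ≡ 𝟘
        e-0 x p z = e-good (pt x z) (not-good false x z p)
        f-0 : ∀ y → good (true , y) ≡ false → ∀ p q → f (Fin.combine (Fin.combine y p) q) ≡ 𝟘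
        f-0 y gy p q = trans (cong f (sym (point-combine {m} {P} {W} y p q))) (f-good (pt y (Fin.combine p q)) (not-good true y _ gy))
        zero-mean : ∀ {n} r {f : Fin n → Q} → (∀ z → f z ≡ 𝟘) → r ⊗ sum f ≡ 𝟘
        zero-mean {n} r p = trans (cong (r ⊗_) (trans (sum-cong p) (sum-0 n))) (⊗-zeroʳ r)
        e₀-good : ∀ x → good (false , x) ≡ false → e₀ x ≡ 𝟘
        e₀-good x p = zero-mean (rcp N) (e-0 x p)
        e₁-good : ∀ x z → good (false , x) ≡ false → e₁ x z ≡ 𝟘
        e₁-good x z p = trans (cong₂ _⊖_ (e-0 x p z) (e₀-good x p)) (⊖-self 𝟘)
        avg-0 : ∀ y → good (true , y) ≡ false → ∀ p → average {m ℕ.* P} W f (Fin.combine y p) ≡ 𝟘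
        avg-0 y gy p = zero-mean (rcp W) (f-0 y gy p)
        F-good : ∀ y → good (true , y) ≡ false → F y ≡ 𝟘
        F-good y gy = zero-mean (rcp P) (avg-0 y gy)
        w-good : ∀ y z → good (true , y) ≡ false → w y z ≡ 𝟘
        w-good y z gy = trans (cong₂ _⊖_ (f-0 y gy _ _) (trans (cong (average {m ℕ.* P} W f) (quotient-combine (Fin.combine y (Fin.quotient {P} W z)) (Fin.remainder {P} W z))) (avg-0 y gy _))) (⊖-self 𝟘)
        w-block : ∀ y p → sum (λ q → w y (Fin.combine {P} p q)) ≡ 𝟘
        w-block y p = trans (sum-cong λ q → cong (innovation {m ℕ.* P} W f) (point-combine {m} {P} {W} y p q)) (innovation-block {m ℕ.* P} W f (Fin.combine y p))
        w-sum : ∀ y → sum (w y) ≡ 𝟘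
        w-sum y = trans (sum-combine P (w y)) (trans (sum-cong (w-block y)) (sum-0 P))
        e₀-sum : ∀ x → sum (λ z → e (pt x z)) ≡ ι N ⊗ e₀ x
        e₀-sum x = sym (ι⊗rcp⊗ N _)
        e₁-sum : ∀ x → sum (e₁ x) ≡ 𝟘
        e₁-sum x = trans (sum-⊖ _ _) (trans (cong₂ _⊖_ (e₀-sum x) (sum-const N (e₀ x))) (⊖-self _))
        T : Fin m → Q
        T x = sum λ a → u (φ a x)
        tw : Fin m → Fin N → Q
        tw = LC.twist w
        tw-sum : ∀ x → sum (tw x) ≡ 𝟘
        tw-sum x = trans (∑-comm {N} (λ z a → w (φ a x) (z ⊞ sh a x))) (trans (sum-cong λ a →
            trans (sum-bij (_⊞ sh a x) (_⊞ (N ℕ.∸ sh a x)) (λ z → ⊞-cancel z (ℕ.m+[n∸m]≡n (sh≤N a x))) (λ z → ⊞-cancel z (ℕ.m∸n+n≡m (sh≤N a x))) (w (φ a x))) (w-sum (φ a x))) (sum-0 D))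
        Tf : ∀ x z → sum (λ a → part′ f (φ′ a (pt x z))) ≡ T x ⊕ tw x z
        Tf x z = trans (sum-cong λ a → trans (cong (part′ f) (cong₂ (λ x z → pt (φ a x) (z ⊞ sh a x)) (X-pt x z) (Z-pt x z))) (part′-eq f (φ a x) (z ⊞ sh a x))) (∑-distrib-+ _ _)
        row : ∀ x → sum (λ z → e (pt x z) ⊗ sum λ a → part′ f (φ′ a (pt x z))) ≡ ι N ⊗ (e₀ x ⊗ T x) ⊕ sum (λ z → e₁ x z ⊗ tw x z)
        row x = trans (sum-cong λ z → trans (cong₂ _⊗_ (sym (⊖⊕-cancel (e (pt x z)) (e₀ x))) (Tf x z)) (e₂ (e₁ x z) (e₀ x) (T x) (tw x z)))
          (trans (∑-distrib-+ _ _) (cong (_⊕ sum (λ z → e₁ x z ⊗ tw x z)) (trans (∑-distrib-+ _ _) (trans (cong₂ _⊕_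
            (trans (∑-distrib-+ _ _) (trans (cong₂ _⊕_ (trans (sum-⊗ʳ (T x) _) (trans (cong (_⊗ T x) (e₁-sum x)) (⊗-zeroˡ _))) (sum-const N _)) (⊕-idˡ _)))
            (trans (sum-⊗ˡ (e₀ x) _) (trans (cong (e₀ x ⊗_) (tw-sum x)) (⊗-zeroʳ _)))) (⊕-idʳ _)))))
          where
          opaque
            unfolding Q
            e₂ : ∀ d c t w → (d ⊕ c) ⊗ (t ⊕ w) ≡ (d ⊗ t ⊕ c ⊗ t ⊕ c ⊗ w) ⊕ d ⊗ w
            e₂ d c t w = solve 4 (λ d c t w → (d :+ c) :* (t :+ w) := (d :* t :+ c :* t :+ c :* w) :+ d :* w) refl d c t w
        lhs : sum (λ i → e i ⊗ sum λ a → part′ f (φ′ a i)) ≡ ι N ⊗ sum (λ x → e₀ x ⊗ T x) ⊕ sum (λ x → sum λ z → e₁ x z ⊗ tw x z)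
        lhs = trans (sum-point {m} {P} {W} _) (trans (sum-cong row) (trans (∑-distrib-+ _ _) (cong (_⊕ sum (λ x → sum λ z → e₁ x z ⊗ tw x z)) (sum-⊗ˡ (ι N) _))))
        rhs : ∀ (f : Ω′ → Q) c (d : Fin m → Fin N → Q) → (∀ x z → f (pt x z) ≡ c x ⊕ d x z) → (∀ x → sum (d x) ≡ 𝟘) →
              sum (λ i → f i ⊗ f i) ≡ ι N ⊗ sum (λ x → c x ⊗ c x) ⊕ sum (λ x → sum λ z → d x z ⊗ d x z)
        rhs f c d p q = trans (sum-point {m} {P} {W} _) (trans (sum-cong λ x → pythagoras (λ z → f (pt x z)) (d x) (c x) (p x) (q x))
          (trans (∑-distrib-+ _ _) (cong (_⊕ sum (λ x → sum λ z → d x z ⊗ d x z)) (sum-⊗ˡ (ι N) _))))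
        rhs-e : sum (λ i → e i ⊗ e i) ≡ ι N ⊗ sum (λ x → e₀ x ⊗ e₀ x) ⊕ sum (λ x → sum λ z → e₁ x z ⊗ e₁ x z)
        rhs-e = rhs e e₀ e₁ (λ x z → sym (trans (⊕-comm _ _) (⊖⊕-cancel _ _))) e₁-sum
        rhs-f : sum (λ i → part′ f i ⊗ part′ f i) ≡ ι N ⊗ sum (λ x → u x ⊗ u x) ⊕ sum (λ x → sum λ z → w x z ⊗ w x z)
        rhs-f = rhs (part′ f) u w (part′-eq f) w-sum
        opaque
          unfolding Q
          e₃ : ∀ t n x y → t ⊗ (n ⊗ x ⊕ y) ≡ n ⊗ (t ⊗ x) ⊕ t ⊗ y
          e₃ t n x y = solve 4 (λ t n x y → t :* (n :* x :+ y) := n :* (t :* x) :+ t :* y) refl t n x y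
          e₄ : ∀ n l a b c d → n ⊗ (l ⊗ (a ⊕ b)) ⊕ l ⊗ (c ⊕ d) ≡ l ⊗ ((n ⊗ a ⊕ c) ⊕ (n ⊗ b ⊕ d))
          e₄ n l a b c d = solve 6 (λ n l a b c d → n :* (l :* (a :+ b)) :+ l :* (c :+ d) := l :* ((n :* a :+ c) :+ (n :* b :+ d))) refl n l a b c d

      result : ι (8 ℕ.* (W₀ ℕ.* g)) ⊗ R ≼ ι (m ℕ.+ m) → Family (g ℕ.+ g) (m ℕ.* P ℕ.* W) part′
      result few-returns = record
        { φ = φ′ ; ψ = ψ′ ; ψφ = ψφ′ ; φψ = φψ′ ; good = good″ ; kept = kept′ ; piece = λ a i → piece a (X i)
        ; girth = girth′ ; mono = mono′ ; loss-bound = loss-bound′ few-returns ; contracts = contracts′ }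

  step : ∀ {g m P W part part′} {{_ : NonZero P}} {{_ : NonZero W}} → Family g m part → Scale g m P W → 0 ℕ.< g → 0 ℕ.< m →
    (∀ f x z → part′ f (point {m} {P} {W} x z) ≡ part (average {m} P (average {m ℕ.* P} W f)) x ⊕ innovation {m ℕ.* P} W f (point {m} {P} {W} x z)) →
    Family (g ℕ.+ g) (m ℕ.* P ℕ.* W) part′
  step {g} {m} {P} {W} {part} {part′} 𝓕 𝓢 0<g 0<m part′-eq =
    let s , trace-bound , few-returns = Choice.good-shifts 𝒢 good vs step-sum select A′ (P ℕ.* W) h K D≡K² girth 0<g A≤N short (ℕ.≤-trans 0<m (ℕ.m≤m+n m m)) k {c} r (8 ℕ.* (W₀ ℕ.* g)) n+g≤ small few
    in Step.result 𝓕 𝓢 s part′ trace-bound part′-eq few-returns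
    where
    open Family 𝓕
    open Scale 𝓢
    open Bipartite φ ψ ψφ φψ

-- Orthogonal decomposition of a function by its digits.

sum-single-point : (f : Fin 1 → Q) → sum f ≡ f zero
sum-single-point f = trans (sum-suc f) (trans (cong (f zero ⊕_) (sum-zero _)) (⊕-idʳ _))

module Decomposition (dg : ℕ → ℕ) (dg-nz : ∀ t → NonZero (dg t)) where

  open Tower dg dg-nz

  private
    instance
      nz : ∀ {t} → NonZero (dg t)
      nz {t} = dg-nz t

  size-nz : ∀ t → NonZero (size t)
  size-nz zero = _
  size-nz (suc t) = ℕ.m*n≢0 (size t) (dg t) {{size-nz t}}

  private
    flag : Bool → ℕ → Q
    flag b t = [[ same b (parity t) ]]

    inn : ∀ t → (Fin (size (suc t)) → Q) → Fin (size (suc t)) → Q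
    inn t = innovation {size t} (dg t)

    av : ∀ t → (Fin (size (suc t)) → Q) → Fin (size t) → Q
    av t = average {size t} (dg t)

  sum-average : ∀ t f → sum f ≡ ι (dg t) ⊗ sum (av t f)
  sum-average t f = trans (sum-combine (size t) f) (trans (sum-cong λ x → sym (ι⊗rcp⊗ (dg t) _)) (sum-⊗ˡ (ι (dg t)) _))

  part-combine : ∀ b t f x j → part b (suc t) f (Fin.combine x j) ≡ part b t (av t f) x ⊕ flag b t ⊗ inn t f (Fin.combine x j)
  part-combine b t f x j = cong (λ y → part b t (av t f) y ⊕ flag b t ⊗ inn t f (Fin.combine x j)) (quotient-combine x j)

  flag-inn-sum : ∀ b t f x → sum (λ j → flag b t ⊗ inn t f (Fin.combine x j)) ≡ 𝟘
  flag-inn-sum b t f x = trans (sum-⊗ˡ (flag b t) _) (trans (cong (flag b t ⊗_) (innovation-block {size t} (dg t) f x)) (⊗-zeroʳ _))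

  part-sum : ∀ b t f → sum (part b t f) ≡ 𝟘
  part-sum b zero f = sum-0 1
  part-sum b (suc t) f = trans (sum-combine (size t) _) (trans (sum-cong λ x → trans (sum-cong (part-combine b t f x)) (trans (∑-distrib-+ _ _)
      (trans (cong₂ _⊕_ (sum-const (dg t) _) (flag-inn-sum b t f x)) (⊕-idʳ _)))) (trans (sum-⊗ˡ (ι (dg t)) _) (trans (cong (ι (dg t) ⊗_) (part-sum b t (av t f))) (⊗-zeroʳ _))))

  part-norm : ∀ b t f → sum (λ i → part b (suc t) f i ⊗ part b (suc t) f i)
    ≡ ι (dg t) ⊗ sum (λ x → part b t (av t f) x ⊗ part b t (av t f) x) ⊕ flag b t ⊗ sum (λ i → inn t f i ⊗ inn t f i)
  part-norm b t f = trans (sum-combine (size t) _) (trans (sum-cong λ x → pythagoras _ _ (part b t (av t f) x) (part-combine b t f x) (flag-inn-sum b t f x))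
    (trans (∑-distrib-+ _ _) (cong₂ _⊕_ (sum-⊗ˡ (ι (dg t)) _) (trans (sum-cong λ x → trans (sum-cong λ j → trans (⊗-interchange _ _ _ _) (cong (_⊗ _) ([[]]-idem (same b (parity t)))))
      (sum-⊗ˡ (flag b t) _)) (trans (sum-⊗ˡ (flag b t) _) (cong (flag b t ⊗_) (sym (sum-combine (size t) _))))))))

  mean : ∀ t → (Fin (size t) → Q) → Q
  mean t f = rcp (size t) ⊗ sum f

  mean-eq : ∀ t f → sum f ≡ ι (size t) ⊗ mean t f
  mean-eq t f = sym (ι⊗rcp⊗ (size t) {{size-nz t}} (sum f))

  mean-average : ∀ t f → mean (suc t) f ≡ mean t (av t f)
  mean-average t f = trans (cong (rcp (size (suc t)) ⊗_) (trans (sum-average t f) (trans (cong (ι (dg t) ⊗_) (mean-eq t (av t f)))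
      (trans (sym (⊗-assoc _ _ _)) (cong (_⊗ mean t (av t f)) (trans (⊗-comm _ _) (sym (ι-* (size t) (dg t)))))))))
    (rcp⊗ι⊗ (size (suc t)) {{size-nz (suc t)}} _)

  private
    flags : ∀ t → flag true t ⊕ flag false t ≡ 𝟙
    flags t with parity t
    ... | true = ⊕-idʳ 𝟙
    ... | false = ⊕-idˡ 𝟙

  decompose : ∀ t f i → f i ≡ mean t f ⊕ (part true t f i ⊕ part false t f i)
  decompose zero f zero = sym (trans (cong₂ _⊕_ (trans (cong₂ _⊗_ refl (trans (sum-single-point f) (sym (trans (cong (_⊗ f zero) ι1) (⊗-idˡ _))))) (rcp⊗ι⊗ 1 (f zero))) (⊕-idˡ 𝟘)) (⊕-idʳ _))
  decompose (suc t) f i = begin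
    f i                                  ≡⟨ trans (⊕-comm _ _) (⊖⊕-cancel (f i) (av t f q)) ⟨
    av t f q ⊕ inn t f i                 ≡⟨ cong₂ _⊕_ (decompose t (av t f) q) (trans (sym (⊗-idˡ _)) (cong (_⊗ inn t f i) (sym (flags t)))) ⟩
    (mean t (av t f) ⊕ (part true t (av t f) q ⊕ part false t (av t f) q)) ⊕ (flag true t ⊕ flag false t) ⊗ inn t f i
                                         ≡⟨ e _ _ _ _ _ _ ⟩
    mean t (av t f) ⊕ (part true (suc t) f i ⊕ part false (suc t) f i)
                                         ≡⟨ cong (_⊕ (part true (suc t) f i ⊕ part false (suc t) f i)) (mean-average t f) ⟨
    mean (suc t) f ⊕ (part true (suc t) f i ⊕ part false (suc t) f i) ∎
    where
    open ≡-Reasoning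
    q : Fin (size t)
    q = Fin.quotient {size t} (dg t) i
    opaque
      unfolding Q
      e : ∀ m a b p q x → (m ⊕ (a ⊕ b)) ⊕ (p ⊕ q) ⊗ x ≡ m ⊕ ((a ⊕ p ⊗ x) ⊕ (b ⊕ q ⊗ x))
      e m a b p q x = solve 6 (λ m a b p q x → (m :+ (a :+ b)) :+ (p :+ q) :* x := m :+ ((a :+ p :* x) :+ (b :+ q :* x))) refl m a b p q x

  -- Innovations of different digits are orthogonal, so the norms split along the recursion that
  -- defines `part`.
  norms : ∀ t f → sum (λ i → f i ⊗ f i) ≡ ι (size t) ⊗ (mean t f ⊗ mean t f) ⊕ (sum (λ i → part true t f i ⊗ part true t f i) ⊕ sum (λ i → part false t f i ⊗ part false t f i))
  norms zero f = trans (sum-single-point _) (sym (trans (cong₂ _⊕_ (trans (cong₂ _⊗_ ι1 (cong₂ _⊗_ μ μ)) (⊗-idˡ _)) (trans (cong₂ _⊕_ z z) (⊕-idˡ 𝟘))) (⊕-idʳ _)))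
    where
    μ : mean 0 f ≡ f zero
    μ = trans (cong₂ _⊗_ refl (trans (sum-single-point f) (sym (trans (cong (_⊗ f zero) ι1) (⊗-idˡ _))))) (rcp⊗ι⊗ 1 (f zero))
    z : sum {1} (λ i → 𝟘 ⊗ 𝟘) ≡ 𝟘
    z = trans (sum-cong λ i → ⊗-zeroˡ 𝟘) (sum-0 1)
  norms (suc t) f = begin
    sum (λ i → f i ⊗ f i)                                     ≡⟨ trans (sum-combine (size t) _) (sum-cong λ x → pythagoras _ _ (av t f x) (λ j → sym (trans (⊕-comm _ _) (trans (cong (λ y → inn t f (Fin.combine x j) ⊕ av t f y) (sym (quotient-combine x j))) (⊖⊕-cancel _ _)))) (innovation-block {size t} (dg t) f x)) ⟩
    sum (λ x → ι (dg t) ⊗ (av t f x ⊗ av t f x) ⊕ sum (λ j → inn t f (Fin.combine x j) ⊗ inn t f (Fin.combine x j)))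
                                                              ≡⟨ trans (∑-distrib-+ _ _) (cong₂ _⊕_ (sum-⊗ˡ (ι (dg t)) _) (sym (sum-combine (size t) _))) ⟩
    ι (dg t) ⊗ sum (λ x → av t f x ⊗ av t f x) ⊕ I            ≡⟨ cong₂ (λ s i → ι (dg t) ⊗ s ⊕ i) (norms t (av t f)) (trans (sym (⊗-idˡ I)) (cong (_⊗ I) (sym (flags t)))) ⟩
    ι (dg t) ⊗ (ι (size t) ⊗ (mean t (av t f) ⊗ mean t (av t f)) ⊕ (A ⊕ B)) ⊕ (flag true t ⊕ flag false t) ⊗ I
                                                              ≡⟨ e _ _ _ _ _ _ _ _ ⟩
    (ι (size t) ⊗ ι (dg t)) ⊗ (mean t (av t f) ⊗ mean t (av t f)) ⊕ ((ι (dg t) ⊗ A ⊕ flag true t ⊗ I) ⊕ (ι (dg t) ⊗ B ⊕ flag false t ⊗ I))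
                                                              ≡⟨ cong₂ _⊕_ (cong₂ _⊗_ (ι-* (size t) (dg t)) (cong₂ _⊗_ (mean-average t f) (mean-average t f))) (cong₂ _⊕_ (part-norm true t f) (part-norm false t f)) ⟨
    ι (size (suc t)) ⊗ (mean (suc t) f ⊗ mean (suc t) f) ⊕ (sum (λ i → part true (suc t) f i ⊗ part true (suc t) f i) ⊕ sum (λ i → part false (suc t) f i ⊗ part false (suc t) f i)) ∎
    where
    open ≡-Reasoning
    I A B : Q
    I = sum (λ i → inn t f i ⊗ inn t f i)
    A = sum (λ x → part true t (av t f) x ⊗ part true t (av t f) x)
    B = sum (λ x → part false t (av t f) x ⊗ part false t (av t f) x)
    opaque
      unfolding Q
      e : ∀ n s μ a b p q i → n ⊗ (s ⊗ μ ⊕ (a ⊕ b)) ⊕ (p ⊕ q) ⊗ i ≡ (s ⊗ n) ⊗ μ ⊕ ((n ⊗ a ⊕ p ⊗ i) ⊕ (n ⊗ b ⊕ q ⊗ i))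
      e n s μ a b p q i = solve 8 (λ n s μ a b p q i → n :* (s :* μ :+ (a :+ b)) :+ (p :+ q) :* i := (s :* n) :* μ :+ ((n :* a :+ p :* i) :+ (n :* b :+ q :* i))) refl n s μ a b p q i

-- Initial families, and cores that no longer carry the girth.

module Ends (D K W₀ r : ℕ) (D≡K² : D ≡ suc K ℕ.* suc K) where

  open Families D K W₀ r D≡K²

  Λ≽0 : 𝟘 ≼ Λ
  Λ≽0 = ⊗≽0 (ι≽0 4) (ι≽0 (suc r))

  private
    no-losses : ∀ m → losses {m} (λ _ → true) (λ _ → true) ≡ 𝟘
    no-losses m = trans (cong₂ _⊕_ (sum-0 m) (cong₂ _⊕_ (sum-0 m) (sum-0 m))) (trans (⊕-idˡ _) (⊕-idˡ 𝟘))

    no-loss-bound : ∀ m → ι W₀ ⊗ (ι 1 ⊗ losses {m} (λ _ → true) (λ _ → true)) ⊕ ι m ≼ ι 1 ⊗ ι m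
    no-loss-bound m = ≼-reflexive (trans (cong₂ _⊕_ (trans (cong (λ x → ι W₀ ⊗ (ι 1 ⊗ x)) (no-losses m)) (trans (cong (ι W₀ ⊗_) (⊗-zeroʳ _)) (⊗-zeroʳ _))) (sym (trans (cong (_⊗ ι m) ι1) (⊗-idˡ _)))) (⊕-idˡ _))

    vanishing : ∀ {m} {part : (Fin m → Q) → Fin m → Q} {φ : Fin D → Fin m → Fin m} → (∀ f x → sum (λ a → part f (φ a x)) ≡ 𝟘) → ∀ (e f : Fin m → Q) →
      ι 2 ⊗ sum (λ x → e x ⊗ sum λ a → part f (φ a x)) ≼ Λ ⊗ (sum (λ x → e x ⊗ e x) ⊕ sum (λ x → part f x ⊗ part f x))
    vanishing {m} p e f = ≡-trans-≼ (trans (cong (ι 2 ⊗_) (trans (sum-cong λ x → trans (cong (e x ⊗_) (p f x)) (⊗-zeroʳ _)) (sum-0 m))) (⊗-zeroʳ _))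
      (⊗≽0 Λ≽0 (⊕≽0 (sum≽0 λ x → sq≽0 _) (sum≽0 λ x → sq≽0 _)))

  -- The start of the tower for the odd digits, where `part` is still zero. Girth 1 only asks closed
  -- walks to be nonempty.
  identity-family : ∀ {m part} → (∀ f x → part f x ≡ 𝟘) → Family 1 m part
  identity-family {m} {part} z = record
    { φ = λ _ x → x ; ψ = λ _ x → x ; ψφ = λ _ _ → refl ; φψ = λ _ _ → refl ; good = λ _ → true ; kept = λ _ → true ; piece = λ _ _ → true
    ; girth = λ x p _ l _ _ → l ; mono = λ _ _ _ _ _ _ l → l ; loss-bound = no-loss-bound m
    ; contracts = λ e f _ _ → vanishing {part = part} {φ = λ _ x → x} (λ f x → trans (sum-cong λ _ → z f x) (sum-0 D)) e f }

  -- The start for the even digits: a first digit of size D with all D rotations, whose images sweep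
  -- out every point once and thus sum `part f` to zero. A rotation is increasing on the points that
  -- wrap and on those that do not, whence the two pieces.
  rotation-family : ∀ {m part} → m ≡ D → (∀ f → sum (part f) ≡ 𝟘) → Family 1 m part
  rotation-family {part = part} refl part-sum = record
    { φ = λ a x → x ⊞ toℕ a ; ψ = λ a y → y ⊞ (D ℕ.∸ toℕ a)
    ; ψφ = λ a x → ⊞-cancel x (ℕ.m+[n∸m]≡n (≤D a)) ; φψ = λ a y → ⊞-cancel y (ℕ.m∸n+n≡m (≤D a))
    ; good = λ _ → true ; kept = λ _ → true ; piece = λ a x → does ((toℕ x ℕ.+ toℕ a) ≺? D)
    ; girth = λ x p _ l _ _ → l ; mono = λ a x y _ _ → mono a x y ; loss-bound = no-loss-bound D
    ; contracts = λ e f _ _ → vanishing {part = part} {φ = λ a x → x ⊞ toℕ a} rotated e f }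
    where
    instance
      nz : NonZero D
      nz = subst NonZero (sym D≡K²) _
    open Cyclic D
    ≤D : ∀ a → toℕ a ℕ.≤ D
    ≤D a = ℕ.<⇒≤ (Fin.toℕ<n a)
    rotated : ∀ f x → sum (λ a → part f (x ⊞ toℕ a)) ≡ 𝟘
    rotated f x = trans (sum-cong λ a → cong (part f) (Fin.toℕ-injective (trans (toℕ-⊞ x (toℕ a)) (trans (cong (_% D) (ℕ.+-comm (toℕ x) (toℕ a))) (sym (toℕ-⊞ a (toℕ x)))))))
      (trans (sum-bij (_⊞ toℕ x) (_⊞ (D ℕ.∸ toℕ x)) (λ z → ⊞-cancel z (ℕ.m+[n∸m]≡n (≤D x))) (λ z → ⊞-cancel z (ℕ.m∸n+n≡m (≤D x))) (part f)) (part-sum f))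
    wrap : ∀ a x → ¬ (toℕ x ℕ.+ toℕ a ℕ.< D) → toℕ (x ⊞ toℕ a) ≡ toℕ x ℕ.+ toℕ a ℕ.∸ D
    wrap a x ¬l = trans (toℕ-⊞ x (toℕ a)) (trans (ℕD.m≤n⇒[n∸m]%m≡n%m (ℕ.≮⇒≥ ¬l) ⟨trans-sym⟩ m<n⇒m%n≡m small) refl)
      where
      _⟨trans-sym⟩_ : ∀ {a b c : ℕ} → a ≡ b → a ≡ c → b ≡ c
      p ⟨trans-sym⟩ q = trans (sym p) q
      small : toℕ x ℕ.+ toℕ a ℕ.∸ D ℕ.< D
      small = ℕ.+-cancelʳ-< D _ D (subst (ℕ._< D ℕ.+ D) (sym (ℕ.m∸n+n≡m (ℕ.≮⇒≥ ¬l))) (ℕ.+-mono-< (Fin.toℕ<n x) (Fin.toℕ<n a)))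
    mono : ∀ a x y → does ((toℕ x ℕ.+ toℕ a) ≺? D) ≡ does ((toℕ y ℕ.+ toℕ a) ≺? D) → x Fin.< y → x ⊞ toℕ a Fin.< y ⊞ toℕ a
    mono a x y p l with (toℕ x ℕ.+ toℕ a) ≺? D | (toℕ y ℕ.+ toℕ a) ≺? D
    ... | yes lx | yes ly = subst₂ ℕ._<_ (sym (⊞-small x _ lx)) (sym (⊞-small y _ ly)) (ℕ.+-monoˡ-< (toℕ a) l)
    ... | no ¬x | no ¬y = subst₂ ℕ._<_ (sym (wrap a x ¬x)) (sym (wrap a y ¬y)) (ℕ.∸-monoˡ-< (ℕ.+-monoˡ-< (toℕ a) l) (ℕ.≮⇒≥ ¬x))

  -- What the expansion argument needs of a family; the girth serves only to continue the tower.
  record Core (m : ℕ) (part : (Fin m → Q) → Fin m → Q) : Set where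
    field
      φ ψ   : Fin D → Fin m → Fin m
      ψφ    : ∀ a x → ψ a (φ a x) ≡ x
      φψ    : ∀ a y → φ a (ψ a y) ≡ y
      good  : Bool × Fin m → Bool
      kept  : Fin m → Bool
      piece : Fin D → Fin m → Bool
      mono  : ∀ a x y → kept x ≡ true → kept y ≡ true → piece a x ≡ piece a y → x Fin.< y → φ a x Fin.< φ a y
      few-losses : ι W₀ ⊗ losses kept good ≼ ι m
      contracts : ∀ (e f : Fin m → Q) → (∀ x → good (false , x) ≡ false → e x ≡ 𝟘) → (∀ y → good (true , y) ≡ false → f y ≡ 𝟘) →
        ι 2 ⊗ sum (λ x → e x ⊗ sum λ a → part f (φ a x)) ≼ Λ ⊗ (sum (λ x → e x ⊗ e x) ⊕ sum (λ x → part f x ⊗ part f x))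

  core : ∀ {g m part} → 0 ℕ.< g → Family g m part → Core m part
  core {suc g} {m} _ F = record
    { φ = φ ; ψ = ψ ; ψφ = ψφ ; φψ = φψ ; good = good ; kept = kept ; piece = piece ; mono = mono ; contracts = contracts
    ; few-losses = ⊗-cancel-ι g (≡-trans-≼ (trans (sym (⊗-assoc _ _ _)) (trans (cong (_⊗ losses kept good) (⊗-comm _ _)) (⊗-assoc _ _ _))) (≼-trans (≼⊕ʳ (ι≽0 m)) loss-bound)) }
    where open Family F

  -- Appends a digit on which the permutations act trivially. The two towers have numbers of digits
  -- of different parity, and this brings them to the same vertex set.
  core-× : ∀ {m part} n {part′ : (Fin (m ℕ.* n) → Q) → Fin (m ℕ.* n) → Q} .{{_ : NonZero n}} → (∀ f x j → part′ f (Fin.combine x j) ≡ part (average {m} n f) x) → Core m part → Core (m ℕ.* n) part′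
  core-× {m} {part} n {part′} part-eq C = record
    { φ = λ a → map₁ (φ a) ; ψ = λ a → map₁ (ψ a)
    ; ψφ = λ a i → trans (cong₂ (λ x j → Fin.combine (ψ a x) j) (quotient-combine _ _) (remainder-combine (φ a (q i)) _)) (trans (cong (λ x → Fin.combine x (r′ i)) (ψφ a (q i))) (Fin.combine-remQuot {m} n i))
    ; φψ = λ a i → trans (cong₂ (λ x j → Fin.combine (φ a x) j) (quotient-combine _ _) (remainder-combine (ψ a (q i)) _)) (trans (cong (λ x → Fin.combine x (r′ i)) (φψ a (q i))) (Fin.combine-remQuot {m} n i))
    ; good = λ { (b , i) → good (b , q i) } ; kept = kept ∘ q ; piece = λ a → piece a ∘ q
    ; mono = mono′
    ; few-losses = ≡-trans-≼ (trans (cong (ι W₀ ⊗_) (trans (cong₂ _⊕_ (sum-q _) (cong₂ _⊕_ (sum-q _) (sum-q _))) (e (ι n) _ _ _))) (trans (sym (⊗-assoc _ _ _)) (trans (cong (_⊗ losses kept good) (⊗-comm _ _)) (⊗-assoc _ _ _))))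
        (≼-trans-≡ (⊗-monoˡ (ι n) (ι≽0 n) few-losses) (trans (⊗-comm _ _) (sym (ι-* m n))))
    ; contracts = λ e f e-good f-good → contracts′ e f e-good f-good }
    where
    open Core C
    q : Fin (m ℕ.* n) → Fin m
    q = Fin.quotient {m} n
    r′ : Fin (m ℕ.* n) → Fin n
    r′ = Fin.remainder {m} n
    map₁ : (Fin m → Fin m) → Fin (m ℕ.* n) → Fin (m ℕ.* n)
    map₁ f i = Fin.combine (f (q i)) (r′ i)
    sum-q : (F : Fin m → Q) → sum (F ∘ q) ≡ ι n ⊗ sum F
    sum-q F = trans (sum-combine m _) (trans (sum-cong λ x → trans (sum-cong λ j → cong F (quotient-combine x j)) (sum-const n _)) (sum-⊗ˡ (ι n) F))
    opaque
      unfolding Q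
      e : ∀ n a b c → n ⊗ a ⊕ (n ⊗ b ⊕ n ⊗ c) ≡ n ⊗ (a ⊕ (b ⊕ c))
      e n a b c = solve 4 (λ n a b c → n :* a :+ (n :* b :+ n :* c) := n :* (a :+ (b :+ c))) refl n a b c
    toℕ-i : ∀ i → toℕ i ≡ n ℕ.* toℕ (q i) ℕ.+ toℕ (r′ i)
    toℕ-i i = trans (cong toℕ (sym (Fin.combine-remQuot {m} n i))) (Fin.toℕ-combine (q i) (r′ i))
    mono′ : ∀ a i j → kept (q i) ≡ true → kept (q j) ≡ true → piece a (q i) ≡ piece a (q j) → i Fin.< j → map₁ (φ a) i Fin.< map₁ (φ a) j
    mono′ a i j ki kj p l with Fin.<-cmp (q i) (q j)
    ... | tri< l′ _ _ = Fin.combine-monoˡ-< (r′ i) (r′ j) (mono a (q i) (q j) ki kj p l′)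
    ... | tri> _ _ l′ = ⊥-elim (ℕ.<-asym l (subst₂ Fin._<_ (Fin.combine-remQuot {m} n j) (Fin.combine-remQuot {m} n i) (Fin.combine-monoˡ-< (r′ j) (r′ i) l′)))
    ... | tri≈ _ e _ = subst₂ ℕ._<_ (sym (Fin.toℕ-combine (φ a (q i)) (r′ i))) (sym (trans (Fin.toℕ-combine (φ a (q j)) (r′ j)) (cong (λ x → n ℕ.* toℕ (φ a x) ℕ.+ toℕ (r′ j)) (sym e))))
        (ℕ.+-monoʳ-< (n ℕ.* toℕ (φ a (q i))) (ℕ.+-cancelˡ-< (n ℕ.* toℕ (q i)) _ _ (subst₂ ℕ._<_ (toℕ-i i) (trans (toℕ-i j) (cong (λ x → n ℕ.* toℕ x ℕ.+ toℕ (r′ j)) (sym e))) l)))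
    -- The new digit is averaged out. Averaging can only shrink the norm of `e`, and `part′ f` does
    -- not depend on that digit.
    contracts′ : ∀ (e f : Fin (m ℕ.* n) → Q) → (∀ i → good (false , q i) ≡ false → e i ≡ 𝟘) → (∀ i → good (true , q i) ≡ false → f i ≡ 𝟘) →
      ι 2 ⊗ sum (λ i → e i ⊗ sum λ a → part′ f (map₁ (φ a) i)) ≼ Λ ⊗ (sum (λ i → e i ⊗ e i) ⊕ sum (λ i → part′ f i ⊗ part′ f i))
    contracts′ e f e-good f-good = ≡-trans-≼ (trans (cong (ι 2 ⊗_) lhs) (e₁ (ι 2) (ι n) _)) (≼-trans (⊗-monoˡ (ι n) (ι≽0 n) (contracts e₀ f₀
        (λ x p → zero-mean λ j → e-good _ (trans (cong (λ y → good (false , y)) (quotient-combine x j)) p)) (λ y p → zero-mean λ j → f-good _ (trans (cong (λ x → good (true , x)) (quotient-combine y j)) p))))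
        (≡-trans-≼ (e₂ (ι n) Λ _ _) (⊗-monoˡ Λ Λ≽0 (⊕-mono norm-e (≼-reflexive (sym norm-f))))))
      where
      e₀ f₀ : Fin m → Q
      e₀ = average {m} n e
      f₀ = average {m} n f
      zero-mean : ∀ {g : Fin n → Q} → (∀ j → g j ≡ 𝟘) → rcp n ⊗ sum g ≡ 𝟘
      zero-mean p = trans (cong (rcp n ⊗_) (trans (sum-cong p) (sum-0 n))) (⊗-zeroʳ _)
      lhs : sum (λ i → e i ⊗ sum λ a → part′ f (map₁ (φ a) i)) ≡ ι n ⊗ sum (λ x → e₀ x ⊗ sum λ a → part f₀ (φ a x))
      lhs = trans (sum-combine m _) (trans (sum-cong λ x → trans (sum-cong λ j → cong (e (Fin.combine x j) ⊗_) (sum-cong λ a →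
          trans (cong₂ (λ y k → part′ f (Fin.combine (φ a y) k)) (quotient-combine x j) (remainder-combine x j)) (part-eq f (φ a x) j)))
          (trans (sum-⊗ʳ _ _) (trans (cong (_⊗ sum (λ a → part f₀ (φ a x))) (sym (ι⊗rcp⊗ n _))) (⊗-assoc _ _ _)))) (sum-⊗ˡ (ι n) _))
      norm-f : sum (λ i → part′ f i ⊗ part′ f i) ≡ ι n ⊗ sum (λ x → part f₀ x ⊗ part f₀ x)
      norm-f = trans (sum-combine m _) (trans (sum-cong λ x → trans (sum-cong λ j → cong₂ _⊗_ (part-eq f x j) (part-eq f x j)) (sum-const n _)) (sum-⊗ˡ (ι n) _))
      norm-e : ι n ⊗ sum (λ x → e₀ x ⊗ e₀ x) ≼ sum (λ i → e i ⊗ e i)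
      norm-e = ≡-trans-≼ (sym (sum-⊗ˡ (ι n) _)) (≼-trans-≡ (sum-mono λ x → ≼-trans-≡ (≼⊕ʳ (sum≽0 λ j → sq≽0 (e (Fin.combine x j) ⊖ e₀ x)))
          (sym (pythagoras (λ j → e (Fin.combine x j)) (λ j → e (Fin.combine x j) ⊖ e₀ x) (e₀ x) (λ j → sym (trans (⊕-comm _ _) (⊖⊕-cancel _ _)))
            (trans (sum-⊖ _ _) (trans (cong₂ _⊖_ (sym (ι⊗rcp⊗ n _)) (sum-const n (e₀ x))) (⊖-self _)))))) (sym (sum-combine m _)))
      opaque
        unfolding Q
        e₁ : ∀ t n x → t ⊗ (n ⊗ x) ≡ n ⊗ (t ⊗ x)
        e₁ t n x = solve 3 (λ t n x → t :* (n :* x) := n :* (t :* x)) refl t n x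
        e₂ : ∀ n l x y → n ⊗ (l ⊗ (x ⊕ y)) ≡ l ⊗ (n ⊗ x ⊕ n ⊗ y)
        e₂ n l x y = solve 4 (λ n l x y → n :* (l :* (x :+ y)) := l :* (n :* x :+ n :* y)) refl n l x y

-- The numerical parameters.

geometric : ∀ n {D} → 2 ℕ.≤ D → sum {suc n} (λ r → ι D ^^ toℕ r) ⊕ 𝟙 ≼ ι 2 ⊗ ι D ^^ n
geometric zero _ = ≼-reflexive (trans (cong (_⊕ 𝟙) (sum-single-point _)) (trans (sym (two⊗ 𝟙)) refl))
geometric (suc n) {D} 2≤D = ≡-trans-≼ (trans (cong (_⊕ 𝟙) (trans (sum-suc _) (cong (𝟙 ⊕_) (sum-⊗ˡ (ι D) _)))) (trans (e (ι D ⊗ S)) (cong (ι D ⊗ S ⊕_) (sym (trans (two⊗ 𝟙) refl)))))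
  (≼-trans (⊕-mono ≼-refl (≼-trans-≡ (≡-trans-≼ (⊗-idʳ _) (ι-mono 2≤D)) (sym (⊗-idʳ _)))) (≡-trans-≼ (sym (⊗-distribˡ (ι D) S 𝟙))
    (≼-trans-≡ (⊗-monoˡ (ι D) (ι≽0 D) (geometric n 2≤D)) (trans (sym (⊗-assoc _ _ _)) (trans (cong (_⊗ ι D ^^ n) (⊗-comm _ _)) (⊗-assoc _ _ _))))))
  where
  S : Q
  S = sum {suc n} (λ r → ι D ^^ toℕ r)
  opaque
    unfolding Q
    e : ∀ x → (𝟙 ⊕ x) ⊕ 𝟙 ≡ x ⊕ (𝟙 ⊕ 𝟙)
    e x = solve 1 (λ x → (con ℚ.1ℚ :+ x) :+ con ℚ.1ℚ := x :+ (con ℚ.1ℚ :+ con ℚ.1ℚ)) refl x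

opaque

  -- Opaque, since powers with such exponents must not be evaluated.
  pow2 : ℕ → ℕ
  pow2 n = 2 ℕ.^ n

  pow2-≡ : ∀ n → 2 ℕ.^ n ≡ pow2 n
  pow2-≡ n = refl

  pow2-suc : ∀ n → pow2 (suc n) ≡ pow2 n ℕ.+ pow2 n
  pow2-suc n = cong (2 ℕ.^ n ℕ.+_) (ℕ.+-identityʳ _)

  pow2-+ : ∀ a b → pow2 (a ℕ.+ b) ≡ pow2 a ℕ.* pow2 b
  pow2-+ = ℕ.^-distribˡ-+-* 2

  pow2-* : ∀ a n → pow2 a ℕ.^ n ≡ pow2 (a ℕ.* n)
  pow2-* = ℕ.^-*-assoc 2

  pow2-mono : ∀ {a b} → a ℕ.≤ b → pow2 a ℕ.≤ pow2 b
  pow2-mono p = ℕ.^-monoʳ-≤ 2 p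

  pow2-nz : ∀ n → NonZero (pow2 n)
  pow2-nz n = ℕ.m^n≢0 2 n

  pow2>0 : ∀ n → 0 ℕ.< pow2 n
  pow2>0 n = ℕ.m^n>0 2 n

  n<pow2 : ∀ n → n ℕ.< pow2 n
  n<pow2 zero = ℕ.s≤s ℕ.z≤n
  n<pow2 (suc n) = ℕ.≤-trans (ℕ.+-mono-≤ (ℕ.m^n>0 2 n) (n<pow2 n)) (ℕ.≤-reflexive (cong (2 ℕ.^ n ℕ.+_) (sym (ℕ.+-identityʳ _))))

suc-pred-pow2 : ∀ n → suc (ℕ.pred (pow2 n)) ≡ pow2 n
suc-pred-pow2 n = ℕ.suc-pred (pow2 n) {{pow2-nz n}}

dbl-pow2 : ∀ k → dbl k ≡ pow2 (suc k)
dbl-pow2 zero = pow2-≡ 1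
dbl-pow2 (suc k) = trans (cong₂ ℕ._+_ (dbl-pow2 k) (dbl-pow2 k)) (sym (pow2-suc (suc k)))

-- Digit t takes bits t · 80 bits, and girthAt t = 2 ^ logGirth t is the girth of a family with t digits.

bits girthAt logGirth totalBits : ℕ → ℕ
bits 0 = 1
bits 1 = 1
bits (suc (suc t)) = suc (bits t ℕ.+ bits t)
girthAt 0 = 1
girthAt 1 = 1
girthAt (suc (suc t)) = girthAt t ℕ.+ girthAt t
logGirth 0 = 0
logGirth 1 = 0
logGirth (suc (suc t)) = suc (logGirth t)
totalBits zero = 0
totalBits (suc t) = totalBits t ℕ.+ bits t

private
  s≤s² : ∀ {a b} → a ℕ.≤ b → suc (a ℕ.+ a) ℕ.≤ suc (b ℕ.+ b)
  s≤s² p = ℕ.s≤s (ℕ.+-mono-≤ p p)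

-- With D = 2^80 the digit `dg t` equals D^(2g-1), which up to a constant factor is the number of
-- words shorter than 2g.
suc-bits : ∀ t → suc (bits t) ≡ girthAt t ℕ.+ girthAt t
suc-bits 0 = refl
suc-bits 1 = refl
suc-bits (suc (suc t)) = trans (sym (ℕ.+-suc (suc (bits t)) (bits t))) (cong₂ ℕ._+_ (suc-bits t) (suc-bits t))

girthAt-^ : ∀ t → girthAt t ≡ pow2 (logGirth t)
girthAt-^ 0 = pow2-≡ 0
girthAt-^ 1 = pow2-≡ 0
girthAt-^ (suc (suc t)) = trans (cong₂ ℕ._+_ (girthAt-^ t) (girthAt-^ t)) (sym (pow2-suc (logGirth t)))

girthAt>0 : ∀ t → 0 ℕ.< girthAt t
girthAt>0 t = subst (0 ℕ.<_) (sym (girthAt-^ t)) (pow2>0 (logGirth t))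

logGirth<bits : ∀ t → logGirth t ℕ.< bits t
logGirth<bits 0 = ℕ.≤-refl
logGirth<bits 1 = ℕ.≤-refl
logGirth<bits (suc (suc t)) = ℕ.s≤s (ℕ.≤-trans (logGirth<bits t) (ℕ.m≤m+n _ _))

bits≤bits : ∀ t → bits t ℕ.≤ bits (suc t)
bits≤bits 0 = ℕ.≤-refl
bits≤bits 1 = ℕ.s≤s ℕ.z≤n
bits≤bits (suc (suc t)) = s≤s² (bits≤bits t)

bits-suc≤ : ∀ t → bits (suc t) ℕ.≤ suc (bits t ℕ.+ bits t)
bits-suc≤ 0 = ℕ.s≤s ℕ.z≤n
bits-suc≤ 1 = ℕ.≤-refl
bits-suc≤ (suc (suc t)) = s≤s² (bits-suc≤ t)

totalBits≤3bits : ∀ t → totalBits t ℕ.≤ 3 ℕ.* bits t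
totalBits≤3bits 0 = ℕ.z≤n
totalBits≤3bits 1 = ℕ.s≤s ℕ.z≤n
totalBits≤3bits (suc (suc t)) = ℕ.≤-trans (ℕ.+-mono-≤ (ℕ.+-monoˡ-≤ (bits t) (totalBits≤3bits t)) (bits-suc≤ t)) (ℕ.≤-trans (ℕ.m≤m+n _ 2) (ℕ.≤-reflexive (ring (bits t))))
  where
  ring : ∀ x → 3 ℕ.* x ℕ.+ x ℕ.+ suc (x ℕ.+ x) ℕ.+ 2 ≡ 3 ℕ.* suc (x ℕ.+ x)
  ring = ℕ-Ring.solve-∀

-- The logarithm of the number of points, the next two digits included, is linear in the girth, so
-- walks of length proportional to g suffice for the trace method.
totalBits≤12girth : ∀ t → totalBits (suc (suc t)) ℕ.≤ 12 ℕ.* girthAt t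
totalBits≤12girth t = ℕ.≤-trans (totalBits≤3bits (suc (suc t))) (ℕ.≤-trans (ℕ.m≤n+m _ 3) (ℕ.≤-reflexive (trans (r₁ (bits t)) (trans (cong (6 ℕ.*_) (suc-bits t)) (r₂ (girthAt t))))))
  where
  r₁ : ∀ x → 3 ℕ.+ 3 ℕ.* suc (x ℕ.+ x) ≡ 6 ℕ.* suc x
  r₁ = ℕ-Ring.solve-∀
  r₂ : ∀ x → 6 ℕ.* (x ℕ.+ x) ≡ 12 ℕ.* x
  r₂ = ℕ-Ring.solve-∀

t≤totalBits : ∀ t → t ℕ.≤ totalBits t
t≤totalBits zero = ℕ.z≤n
t≤totalBits (suc t) = ℕ.≤-trans (ℕ.≤-reflexive (ℕ.+-comm 1 t)) (ℕ.+-mono-≤ (t≤totalBits t) (ℕ.≤-trans (ℕ.s≤s ℕ.z≤n) (logGirth<bits t)))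

dg : ℕ → ℕ
dg t = pow2 (bits t ℕ.* 80)

dg-nz : ∀ t → NonZero (dg t)
dg-nz t = pow2-nz (bits t ℕ.* 80)

open Tower dg dg-nz

size-^ : ∀ t → size t ≡ pow2 (totalBits t ℕ.* 80)
size-^ zero = pow2-≡ 0
size-^ (suc t) = trans (cong (ℕ._* dg t) (size-^ t)) (trans (sym (pow2-+ (totalBits t ℕ.* 80) (bits t ℕ.* 80))) (cong pow2 (sym (ℕ.*-distribʳ-+ 80 (totalBits t) (bits t)))))

t≤size : ∀ t → t ℕ.≤ size t
t≤size t = ℕ.≤-trans (t≤totalBits t) (ℕ.≤-trans (ℕ.m≤m*n (totalBits t) 80) (ℕ.≤-trans (ℕ.<⇒≤ (n<pow2 _)) (ℕ.≤-reflexive (sym (size-^ t)))))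

-- The parameters are variables tied to powers of two by equations, so that only exponents are ever
-- computed with.
module Numbers (K D W₀ r : ℕ) (K-^ : suc K ≡ pow2 40) (D-^ : D ≡ pow2 80) (W₀-^ : W₀ ≡ pow2 10) (r-^ : suc r ≡ pow2 56) where

  D≡K² : D ≡ suc K ℕ.* suc K
  D≡K² = trans D-^ (trans (pow2-+ 40 40) (sym (cong₂ ℕ._*_ K-^ K-^)))

  open Families D K W₀ r D≡K²
  open Ends D K W₀ r D≡K²

  module _ (t : ℕ) where

    private
      E E′ y y′ j g G H A n : ℕ
      E = bits t ℕ.* 80
      E′ = bits (suc t) ℕ.* 80
      j = logGirth t
      g = girthAt t
      -- Chosen so that the fibre has exactly G·A points, with G = 2^(12+j) = 4·W₀·g and A = 2^41·H
      -- = 2·κ·H; hence 53 = 12 + 41.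
      y = E ℕ.∸ (53 ℕ.+ j)
      y′ = y ℕ.+ E′
      G = pow2 (12 ℕ.+ j)
      H = pow2 y′
      A = pow2 (41 ℕ.+ y′)
      -- This is 1024·g: long enough for 2^n to absorb the number of points, while c = 1025 keeps 1
      -- + 2c below 2^12.
      n = dbl (suc (j ℕ.+ 8))

      E≥ : 80 ℕ.+ j ℕ.* 80 ℕ.≤ E
      E≥ = ℕ.*-monoˡ-≤ 80 (logGirth<bits t)

      E′≥ : 80 ℕ.+ j ℕ.* 80 ℕ.≤ E′
      E′≥ = ℕ.≤-trans E≥ (ℕ.*-monoˡ-≤ 80 (bits≤bits t))

      j≤80 : j ℕ.≤ j ℕ.* 80
      j≤80 = ℕ.m≤m*n j 80

      room : 24 ℕ.+ (53 ℕ.+ j) ℕ.≤ E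
      room = ℕ.≤-trans (ℕ.≤-reflexive (sym (ℕ.+-assoc 24 53 j))) (ℕ.≤-trans (ℕ.+-mono-≤ (ℕ.m≤m+n 77 3) j≤80) E≥)

      y≡ : y ℕ.+ (53 ℕ.+ j) ≡ E
      y≡ = ℕ.m∸n+n≡m (ℕ.≤-trans (ℕ.m≤n+m _ 24) room)

      -- Here 24 = 80 - 56: since H is 2^y times the last digit, `wide` asks for D ≤ ρ·2^y.
      24≤y : 24 ℕ.≤ y
      24≤y = ℕ.m+n≤o⇒m≤o∸n 24 room

      N≡GA : dg t ℕ.* dg (suc t) ≡ G ℕ.* A
      N≡GA = trans (sym (pow2-+ E E′)) (trans (cong pow2 (trans (cong (ℕ._+ E′) (sym y≡)) (ring y j E′ 12 41))) (pow2-+ (12 ℕ.+ j) (41 ℕ.+ y′)))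
        where
        ring : ∀ y j z p q → y ℕ.+ ((p ℕ.+ q) ℕ.+ j) ℕ.+ z ≡ p ℕ.+ j ℕ.+ (q ℕ.+ (y ℕ.+ z))
        ring = ℕ-Ring.solve-∀

      large : 4 ℕ.* (W₀ ℕ.* g) ≡ G
      large = trans (cong₂ (λ w g → 4 ℕ.* (w ℕ.* g)) W₀-^ (girthAt-^ t)) (sym (trans (pow2-+ 12 j) (trans (cong (ℕ._* pow2 j) (pow2-+ 2 10)) (trans (ℕ.*-assoc (pow2 2) (pow2 10) (pow2 j)) (cong (ℕ._* (pow2 10 ℕ.* pow2 j)) (sym (pow2-≡ 2)))))))

      short : ι 4 ⊗ ι H ≼ ι 2 ⊗ (ι A ⊗ rcp (suc K))
      short = ≼-reflexive (sym (trans (cong (ι 2 ⊗_) (trans (cong (λ a → a ⊗ rcp (suc K)) (trans (cong ι A≡) (ι-* (suc K) (2 ℕ.* H)))) (trans (⊗-comm _ _) (rcp⊗ι⊗ (suc K) _))))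
          (trans (cong (ι 2 ⊗_) (ι-* 2 H)) (trans (sym (⊗-assoc _ _ _)) (cong (_⊗ ι H) (sym (ι-* 2 2)))))))
        where
        A≡ : A ≡ suc K ℕ.* (2 ℕ.* H)
        A≡ = trans (pow2-+ 41 y′) (trans (cong (ℕ._* H) (trans (pow2-+ 40 1) (cong (pow2 40 ℕ.*_) (sym (pow2-≡ 1))))) (trans (ℕ.*-assoc (pow2 40) 2 H) (cong (ℕ._* (2 ℕ.* H)) (sym K-^))))

      wide : ι D ⊗ ι (dg (suc t)) ≼ ρ ⊗ ι H
      wide = ≡-trans-≼ (sym (ι-* D _)) (≼-trans-≡ (ι-mono (ℕ.≤-trans (ℕ.≤-reflexive (trans (cong (ℕ._* dg (suc t)) D-^) (sym (pow2-+ 80 E′))))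
          (ℕ.≤-trans (pow2-mono (ℕ.≤-trans (ℕ.≤-reflexive (ℕ.+-assoc 56 24 E′)) (ℕ.+-monoʳ-≤ 56 (ℕ.+-monoˡ-≤ E′ 24≤y)))) (ℕ.≤-reflexive (trans (pow2-+ 56 y′) (cong (ℕ._* H) (sym r-^))))))) (ι-* (suc r) H))

      n≡ : n ≡ g ℕ.* 1024
      n≡ = trans (dbl-pow2 (suc (j ℕ.+ 8))) (trans (cong pow2 (ring j)) (trans (pow2-+ j 10) (cong₂ ℕ._*_ (sym (girthAt-^ t)) (sym (pow2-≡ 10)))))
        where
        ring : ∀ j → suc (suc (j ℕ.+ 8)) ≡ j ℕ.+ 10
        ring = ℕ-Ring.solve-∀

      n+g≤ : n ℕ.+ g ℕ.≤ g ℕ.* 1025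
      n+g≤ = ℕ.≤-reflexive (trans (cong₂ ℕ._+_ n≡ (sym (ℕ.*-identityʳ g))) (sym (ℕ.*-distribˡ-+ g 1024 1)))

      few : ι 2 ⊗ (ι (8 ℕ.* (W₀ ℕ.* g)) ⊗ sum {g ℕ.+ g} (λ r → ι D ^^ toℕ r)) ≼ ι A
      few = ≼-trans (⊗-monoˡ (ι 2) (ι≽0 2) (⊗-monoˡ _ (ι≽0 (8 ℕ.* (W₀ ℕ.* g))) sum≤))
        (≡-trans-≼ (trans (cong (λ d → ι 2 ⊗ (ι (8 ℕ.* (W₀ ℕ.* g)) ⊗ (ι 2 ⊗ d))) (sym (ι-^ D (bits t)))) (trans (cong (λ x → ι 2 ⊗ (ι (8 ℕ.* (W₀ ℕ.* g)) ⊗ x)) (sym (ι-* 2 _))) (trans (cong (ι 2 ⊗_) (sym (ι-* (8 ℕ.* (W₀ ℕ.* g)) _))) (sym (ι-* 2 _)))))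
          (ι-mono (ℕ.≤-trans (ℕ.≤-reflexive total) (pow2-mono fits))))
        where
        2≤D : 2 ℕ.≤ D
        2≤D = subst₂ ℕ._≤_ (sym (pow2-≡ 1)) (sym D-^) (pow2-mono {1} {80} (ℕ.s≤s ℕ.z≤n))
        sum≤ : sum {g ℕ.+ g} (λ r → ι D ^^ toℕ r) ≼ ι 2 ⊗ ι D ^^ bits t
        sum≤ = subst (λ k → sum {k} (λ r → ι D ^^ toℕ r) ≼ ι 2 ⊗ ι D ^^ bits t) (suc-bits t) (≼-trans (≼⊕ʳ 𝟘≼𝟙) (geometric (bits t) 2≤D))
        D^e : D ℕ.^ bits t ≡ pow2 E
        D^e = trans (cong (ℕ._^ bits t) D-^) (trans (pow2-* 80 (bits t)) (cong pow2 (ℕ.*-comm 80 (bits t))))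
        total : 2 ℕ.* (8 ℕ.* (W₀ ℕ.* g) ℕ.* (2 ℕ.* D ℕ.^ bits t)) ≡ pow2 (3 ℕ.+ (12 ℕ.+ j) ℕ.+ E)
        total = trans (cong (λ d → 2 ℕ.* (8 ℕ.* (W₀ ℕ.* g) ℕ.* (2 ℕ.* d))) D^e) (trans (ring (W₀ ℕ.* g) (pow2 E)) (trans (cong (λ G → 8 ℕ.* G ℕ.* pow2 E) large)
            (sym (trans (pow2-+ (3 ℕ.+ (12 ℕ.+ j)) E) (cong (ℕ._* pow2 E) (trans (pow2-+ 3 (12 ℕ.+ j)) (cong (ℕ._* G) (sym (pow2-≡ 3)))))))))
          where
          ring : ∀ x d → 2 ℕ.* (8 ℕ.* x ℕ.* (2 ℕ.* d)) ≡ 8 ℕ.* (4 ℕ.* x) ℕ.* d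
          ring = ℕ-Ring.solve-∀
        fits : 3 ℕ.+ (12 ℕ.+ j) ℕ.+ E ℕ.≤ 41 ℕ.+ y′
        fits = ℕ.≤-trans (ℕ.≤-reflexive (trans (cong (3 ℕ.+ (12 ℕ.+ j) ℕ.+_) (sym y≡)) (r₁ j y 15 12 41))) (ℕ.≤-trans (ℕ.+-monoʳ-≤ (41 ℕ.+ y)
            (ℕ.≤-trans (ℕ.+-mono-≤ (ℕ.m≤m+n 27 53) (ℕ.≤-trans (ℕ.≤-reflexive (r₂ j)) (ℕ.*-monoʳ-≤ j (ℕ.m≤m+n 2 78)))) E′≥)) (ℕ.≤-reflexive (ℕ.+-assoc 41 y E′)))
          where
          r₁ : ∀ j y p s a → (p ℕ.+ j) ℕ.+ (y ℕ.+ ((s ℕ.+ a) ℕ.+ j)) ≡ a ℕ.+ y ℕ.+ ((p ℕ.+ s) ℕ.+ (j ℕ.+ j))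
          r₁ = ℕ-Ring.solve-∀
          r₂ : ∀ j → j ℕ.+ j ≡ j ℕ.* 2
          r₂ = ℕ-Ring.solve-∀

      ^* : ∀ {a b x} → a ℕ.≤ pow2 b → a ℕ.^ x ℕ.≤ pow2 (b ℕ.* x)
      ^* {a} {b} {x} p = ℕ.≤-trans (ℕ.^-monoˡ-≤ x p) (ℕ.≤-reflexive (pow2-* b x))

      infixr 5 _⊠_
      _⊠_ : ∀ {a b x y} → a ℕ.≤ pow2 x → b ℕ.≤ pow2 y → a ℕ.* b ℕ.≤ pow2 (x ℕ.+ y)
      _⊠_ {x = x} {y} p q = ℕ.≤-trans (ℕ.*-mono-≤ p q) (ℕ.≤-reflexive (sym (pow2-+ x y)))

      -- The bits per step of the walk: 2 for the two powers of 2, 40 for κ, 1 for n + 1, 12 for 1 +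
      -- 2c, and 1 for the number of points and the remaining factors. They add up to 56, which
      -- determines ρ = 2^56.
      small-ℕ : 2 ℕ.* (dg t ℕ.* dg (suc t) ℕ.* ((size t ℕ.+ size t) ℕ.* (2 ℕ.^ n ℕ.* (2 ℕ.^ n ℕ.* (suc K ℕ.^ n ℕ.* suc n ℕ.* suc (2 ℕ.* 1025) ℕ.^ n))))) ℕ.≤ suc r ℕ.^ n
      small-ℕ = ℕ.≤-trans (two ⊠ (ℕ.≤-refl {dg t} ⊠ ℕ.≤-refl {dg (suc t)}) ⊠ two-sizes ⊠ pow-n ⊠ pow-n ⊠ ((^* {b = 40} {x = n} (ℕ.≤-reflexive K-^) ⊠ n<pow2 n) ⊠ ^* {b = 12} {x = n} (ℕ.≤-trans (ℕ.≤ᵇ⇒≤ 2051 4096 _) (ℕ.≤-reflexive (pow2-≡ 12)))))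
        (ℕ.≤-trans (pow2-mono exponent) (ℕ.≤-reflexive (trans (sym (pow2-* 56 n)) (cong (ℕ._^ n) (sym r-^)))))
        where
        two : 2 ℕ.≤ pow2 1
        two = ℕ.≤-reflexive (pow2-≡ 1)
        pow-n : 2 ℕ.^ n ℕ.≤ pow2 n
        pow-n = ℕ.≤-reflexive (pow2-≡ n)
        two-sizes : size t ℕ.+ size t ℕ.≤ pow2 (1 ℕ.+ totalBits t ℕ.* 80)
        two-sizes = ℕ.≤-reflexive (trans (cong₂ ℕ._+_ (size-^ t) (size-^ t)) (sym (pow2-suc (totalBits t ℕ.* 80))))
        enough-bits : 2 ℕ.+ (totalBits t ℕ.+ bits t ℕ.+ bits (suc t)) ℕ.* 80 ℕ.≤ n
        enough-bits = ℕ.≤-trans (ℕ.+-mono-≤ (ℕ.≤-trans (ℕ.s≤s (ℕ.s≤s ℕ.z≤n)) (ℕ.*-monoˡ-≤ 64 (girthAt>0 t))) (ℕ.*-monoˡ-≤ 80 (totalBits≤12girth t))) (ℕ.≤-reflexive (trans (cong (g ℕ.* 64 ℕ.+_) (trans (cong (ℕ._* 80) (ℕ.*-comm 12 g)) (ℕ.*-assoc g 12 80))) (trans (sym (ℕ.*-distribˡ-+ g 64 960)) (sym n≡))))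
        exponent : 1 ℕ.+ ((E ℕ.+ E′) ℕ.+ ((1 ℕ.+ totalBits t ℕ.* 80) ℕ.+ (n ℕ.+ (n ℕ.+ ((40 ℕ.* n ℕ.+ n) ℕ.+ 12 ℕ.* n))))) ℕ.≤ 56 ℕ.* n
        exponent = ℕ.≤-trans (ℕ.≤-reflexive (ring (bits t) (bits (suc t)) (totalBits t) n 80 40 12)) (ℕ.+-monoˡ-≤ (55 ℕ.* n) enough-bits)
          where
          ring : ∀ a b l n c p q → 1 ℕ.+ ((a ℕ.* c ℕ.+ b ℕ.* c) ℕ.+ ((1 ℕ.+ l ℕ.* c) ℕ.+ (n ℕ.+ (n ℕ.+ ((p ℕ.* n ℕ.+ n) ℕ.+ q ℕ.* n))))) ≡ 2 ℕ.+ (l ℕ.+ a ℕ.+ b) ℕ.* c ℕ.+ (p ℕ.+ q ℕ.+ 3) ℕ.* n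
          ring = ℕ-Ring.solve-∀

      small : ι 2 ⊗ (ι (dg t ℕ.* dg (suc t)) ⊗ (ι (size t ℕ.+ size t) ⊗ (ι 2 ^^ n ⊗ (ι 2 ^^ n ⊗ (ι (suc K) ^^ n ⊗ ι (suc n) ⊗ (𝟙 ⊕ ι (2 ℕ.* 1025)) ^^ n))))) ≼ ρ ^^ n
      small = ≡-trans-≼ (sym (trans (ι-* 2 _) (cong (ι 2 ⊗_) (trans (ι-* (dg t ℕ.* dg (suc t)) _) (cong (ι (dg t ℕ.* dg (suc t)) ⊗_) (trans (ι-* (size t ℕ.+ size t) _) (cong (ι (size t ℕ.+ size t) ⊗_)
          (trans (ι-* (2 ℕ.^ n) _) (cong₂ _⊗_ (ι-^ 2 n) (trans (ι-* (2 ℕ.^ n) _) (cong₂ _⊗_ (ι-^ 2 n) (trans (ι-* (suc K ℕ.^ n ℕ.* suc n) _) (cong₂ _⊗_ (trans (ι-* (suc K ℕ.^ n) (suc n)) (cong (_⊗ ι (suc n)) (ι-^ (suc K) n)))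
            (trans (ι-^ (suc (2 ℕ.* 1025)) n) (cong (_^^ n) (ι-suc (2 ℕ.* 1025)))))))))))))))))
        (≼-trans-≡ (ι-mono small-ℕ) (ι-^ (suc r) n))

    scale : Scale (girthAt t) (size t) (dg t) (dg (suc t))
    scale = record
      { A′ = ℕ.pred A ; h = ℕ.pred H ; k = j ℕ.+ 8 ; c = 1025 ; G = G
      ; A≤N = subst (ℕ._≤ dg t ℕ.* dg (suc t)) (sym sA) (ℕ.≤-trans (ℕ.m≤n*m A G {{pow2-nz (12 ℕ.+ j)}}) (ℕ.≤-reflexive (sym N≡GA)))
      ; N≡GA = trans N≡GA (cong (G ℕ.*_) (sym sA))
      ; large = ℕ.≤-reflexive large
      ; short = subst₂ (λ h a → ι 4 ⊗ ι h ≼ ι 2 ⊗ (ι a ⊗ rcp (suc K))) (sym sH) (sym sA) short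
      ; wide = subst (λ h → ι D ⊗ ι (dg (suc t)) ≼ ρ ⊗ ι h) (sym sH) wide
      ; n+g≤ = n+g≤ ; small = small
      ; few = subst (λ a → ι 2 ⊗ (ι (8 ℕ.* (W₀ ℕ.* g)) ⊗ sum {g ℕ.+ g} (λ r → ι D ^^ toℕ r)) ≼ ι a) (sym sA) few }
      where
      sA : suc (ℕ.pred A) ≡ A
      sA = suc-pred-pow2 (41 ℕ.+ y′)
      sH : suc (ℕ.pred H) ≡ H
      sH = suc-pred-pow2 y′

  size>0 : ∀ t → 0 ℕ.< size t
  size>0 t = subst (0 ℕ.<_) (sym (size-^ t)) (pow2>0 (totalBits t ℕ.* 80))

  two-digits : ∀ t b → b ≡ parity (suc t) → Family (girthAt t) (size t) (part b t) → Family (girthAt (suc (suc t))) (size (suc (suc t))) (part b (suc (suc t)))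
  two-digits t b refl F = step {{dg-nz t}} {{dg-nz (suc t)}} F (scale t) (girthAt>0 t) (size>0 t) (part-two t)

  twice : ℕ → ℕ
  twice zero = zero
  twice (suc j) = suc (suc (twice j))

  parity-twice : ∀ j → parity (twice j) ≡ false
  parity-twice zero = refl
  parity-twice (suc j) = cong (λ b → not (not b)) (parity-twice j)

  odd-digits : ∀ j → Family (girthAt (twice j)) (size (twice j)) (part true (twice j))
  odd-digits zero = identity-family λ f x → refl
  odd-digits (suc j) = two-digits (twice j) true (sym (cong not (parity-twice j))) (odd-digits j)

  even-digits : ∀ j → Family (girthAt (suc (twice j))) (size (suc (twice j))) (part false (suc (twice j)))
  even-digits zero = rotation-family (trans (ℕ.*-identityˡ (dg 0)) (sym D-^)) (Decomposition.part-sum dg dg-nz false 1)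
  even-digits (suc j) = two-digits (suc (twice j)) false (sym (cong (λ b → not (not b)) (parity-twice j))) (even-digits j)

  levels : ℕ → ℕ
  levels j = suc (twice j)

  core-even : ∀ j → Core (size (levels j)) (part false (levels j))
  core-even j = core (girthAt>0 (levels j)) (even-digits j)

  core-odd : ∀ j → Core (size (levels j)) (part true (levels j))
  core-odd j = core-× (dg (twice j)) {{dg-nz (twice j)}} (λ f x i → trans (Decomposition.part-combine dg dg-nz true (twice j) f x i)
    (trans (cong (λ b → part true (twice j) (average {size (twice j)} (dg (twice j)) f) x ⊕ [[ b ]] ⊗ innovation {size (twice j)} (dg (twice j)) f (Fin.combine x i)) (parity-twice j)) (trans (cong (part true (twice j) (average {size (twice j)} (dg (twice j)) f) x ⊕_) (⊗-zeroˡ _)) (⊕-idʳ _))))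
    (core (girthAt>0 (twice j)) (odd-digits j))

-- Expansion of sets of linear size.

module CoreInequality (D K W₀ r : ℕ) (D≡K² : D ≡ suc K ℕ.* suc K) where

  open Families D K W₀ r D≡K²
  open Ends D K W₀ r D≡K²

  private
    D>0 : ¬ (ι D ≼ 𝟘)
    D>0 = 1≼⇒pos (subst (λ d → 𝟙 ≼ ι d) (sym D≡K²) (1≼ι (K ℕ.+ K ℕ.* suc K)))

    2ab≼ : ∀ a b → ι 2 ⊗ (a ⊗ b) ≼ a ⊗ a ⊕ b ⊗ b
    2ab≼ a b = ⊖≽0⁻¹ (≼-trans-≡ (sq≽0 (a ⊖ b)) (trans (sq-⊖ a b) (cong (a ⊗ a ⊕ b ⊗ b ⊖_) (sym (two⊗ _)))))

  -- Splitting f = μ + p + q, the part p is contracted and q only sees the mean-free part of e.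
  core-inequality : ∀ {m part} .{{_ : NonZero m}} (C : Core m part) (let open Core C) (e? f? : Fin m → Bool) (l τ μ : Q) (q : Fin m → Q) →
    (∀ x → good (false , x) ≡ false → e? x ≡ false) → (∀ y → good (true , y) ≡ false → f? y ≡ false) →
    (∀ a → sum (λ x → [[ e? x ]] ⊗ [[ not (f? (φ a x)) ]]) ≼ l) →
    (let p = part (λ y → [[ f? y ]]) ; s = sum (λ x → [[ e? x ]]) ; v = sum (λ y → [[ f? y ]]) ; M = ι m) →
    (∀ y → [[ f? y ]] ≡ μ ⊕ (p y ⊕ q y)) → sum q ≡ 𝟘 → M ⊗ μ ≡ v → sum (λ y → p y ⊗ p y) ≼ M →
    ι 2 ⊗ sum (λ y → q y ⊗ q y) ⊕ M ⊗ (μ ⊗ μ) ≼ v → Λ ⊗ M ≼ ι D ⊗ τ →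
    ι 4 ⊗ (s ⊗ M) ⊕ ι 2 ⊗ (s ⊗ s) ⊕ v ⊗ v ≼ ι 4 ⊗ (l ⊗ M) ⊕ ι 4 ⊗ (v ⊗ s) ⊕ ι 4 ⊗ (τ ⊗ M) ⊕ ι 2 ⊗ (s ⊗ M) ⊕ M ⊗ v
  core-inequality {m} {part} C e? f? l τ μ q e-good f-good miss split q-sum Mμ X≼ Y≼ Λ≼ = ⊗-cancel⁺ d D>0 final
    where
    open Core C
    d M s v E X Y : Q
    d = ι D
    M = ι m
    s = sum (λ x → [[ e? x ]])
    v = sum (λ y → [[ f? y ]])
    e f p e′ : Fin m → Q
    e x = [[ e? x ]]
    f y = [[ f? y ]]
    p = part f
    c : Q
    c = rcp m ⊗ s
    e′ x = e x ⊖ c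
    E = sum (λ x → e′ x ⊗ e′ x)
    X = sum (λ y → p y ⊗ p y)
    Y = sum (λ y → q y ⊗ q y)
    T : (Fin m → Q) → Fin m → Q
    T g x = sum λ a → g (φ a x)
    T-sum : ∀ g → sum (T g) ≡ d ⊗ sum g
    T-sum g = trans (∑-comm (λ x a → g (φ a x))) (trans (sum-cong λ a → sum-bij (φ a) (ψ a) (ψφ a) (φψ a) g) (sum-const D _))
    M≽0 : 𝟘 ≼ M
    M≽0 = ι≽0 m
    d≽0 : 𝟘 ≼ d
    d≽0 = ι≽0 D
    s≼M : s ≼ M
    s≼M = ≼-trans-≡ (sum-mono λ x → [[]]≼1 (e? x)) (trans (sum-const m 𝟙) (⊗-idʳ M))
    e-norm : sum (λ x → e x ⊗ e x) ≡ s
    e-norm = sum-cong λ x → [[]]-idem (e? x)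
    Mc : M ⊗ c ≡ s
    Mc = ι⊗rcp⊗ m s
    e′-sum : sum e′ ≡ 𝟘
    e′-sum = trans (sum-⊖ e _) (trans (cong (s ⊖_) (trans (sum-const m c) Mc)) (⊖-self s))
    s-split : s ≡ M ⊗ (c ⊗ c) ⊕ E
    s-split = trans (sym e-norm) (pythagoras e e′ c (λ x → sym (trans (⊕-comm _ _) (⊖⊕-cancel _ _))) e′-sum)
    most : d ⊗ s ≼ sum (λ x → e x ⊗ T f x) ⊕ d ⊗ l
    most = ≡-trans-≼ (begin
        d ⊗ s                                                             ≡⟨ sum-⊗ˡ d e ⟨
        sum (λ x → d ⊗ e x)                                               ≡⟨ sum-cong (λ x → sym (sum-const D (e x))) ⟩
        sum (λ x → sum {D} λ a → e x)                                     ≡⟨ sum-cong (λ x → sum-cong λ a → one (e x) (f? (φ a x))) ⟩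
        sum (λ x → sum λ a → e x ⊗ f (φ a x) ⊕ e x ⊗ [[ not (f? (φ a x)) ]]) ≡⟨ sum-cong (λ x → ∑-distrib-+ _ _) ⟩
        sum (λ x → sum (λ a → e x ⊗ f (φ a x)) ⊕ sum (λ a → e x ⊗ [[ not (f? (φ a x)) ]])) ≡⟨ ∑-distrib-+ _ _ ⟩
        sum (λ x → sum λ a → e x ⊗ f (φ a x)) ⊕ sum (λ x → sum λ a → e x ⊗ [[ not (f? (φ a x)) ]])
          ≡⟨ cong₂ _⊕_ (sum-cong λ x → sum-⊗ˡ (e x) _) (∑-comm (λ x a → e x ⊗ [[ not (f? (φ a x)) ]])) ⟩
        sum (λ x → e x ⊗ T f x) ⊕ sum (λ a → sum λ x → e x ⊗ [[ not (f? (φ a x)) ]]) ∎)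
      (⊕-mono ≼-refl (≼-trans-≡ (sum-mono miss) (sum-const D l)))
      where
      open ≡-Reasoning
      one : ∀ x b → x ≡ x ⊗ [[ b ]] ⊕ x ⊗ [[ not b ]]
      one x true = sym (trans (cong₂ _⊕_ (⊗-idʳ x) (⊗-zeroʳ x)) (⊕-idʳ x))
      one x false = sym (trans (cong₂ _⊕_ (⊗-zeroʳ x) (⊗-idʳ x)) (⊕-idˡ x))
    P R : Q
    P = sum (λ x → e x ⊗ T p x)
    R = sum (λ x → e x ⊗ T q x)
    Tf-split : sum (λ x → e x ⊗ T f x) ≡ (d ⊗ μ) ⊗ s ⊕ (P ⊕ R)
    Tf-split = trans (sum-cong λ x → trans (cong (e x ⊗_) (trans (sum-cong λ a → split (φ a x)) (trans (∑-distrib-+ _ _) (cong₂ _⊕_ (sum-const D μ) (∑-distrib-+ _ _)))))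
        (trans (⊗-distribˡ _ _ _) (cong₂ _⊕_ (⊗-comm _ _) (⊗-distribˡ _ _ _)))) (trans (∑-distrib-+ _ _) (cong₂ _⊕_ (sum-⊗ˡ (d ⊗ μ) e) (∑-distrib-+ _ _)))
    P≼ : ι 2 ⊗ P ≼ ι 2 ⊗ (d ⊗ τ)
    P≼ = ≼-trans (contracts e f (λ x g → cong [[_]] (e-good x g)) (λ y g → cong [[_]] (f-good y g)))
      (≼-trans (⊗-monoˡ Λ Λ≽0 (⊕-mono (≡-trans-≼ e-norm s≼M) X≼)) (≡-trans-≼ (trans (⊗-distribˡ Λ M M) (sym (two⊗ _))) (⊗-monoˡ (ι 2) (ι≽0 2) Λ≼)))
    -- No contraction is used for `q`. The trivial bound 2ab ≤ a² + b² is enough because the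
    -- hypothesis lets `q` carry at most half of the variance of `f?`.
    R≼ : ι 2 ⊗ R ≼ d ⊗ (E ⊕ Y)
    R≼ = ≡-trans-≼ (trans (cong (ι 2 ⊗_) centred) (trans (sym (sum-⊗ˡ (ι 2) _)) (sum-cong λ x → trans (cong (ι 2 ⊗_) (sym (sum-⊗ˡ (e′ x) _))) (sym (sum-⊗ˡ (ι 2) _)))))
      (≼-trans (sum-mono λ x → sum-mono λ a → 2ab≼ (e′ x) (q (φ a x)))
        (≼-reflexive (trans (sum-cong λ x → trans (∑-distrib-+ _ _) (cong (_⊕ T (λ y → q y ⊗ q y) x) (sum-const D _))) (trans (∑-distrib-+ _ _)
          (trans (cong₂ _⊕_ (sum-⊗ˡ d _) (T-sum (λ y → q y ⊗ q y))) (sym (⊗-distribˡ d E Y)))))))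
      where
      centred : R ≡ sum (λ x → e′ x ⊗ T q x)
      centred = trans (sum-cong λ x → trans (cong (_⊗ T q x) (sym (⊖⊕-cancel (e x) c))) (⊗-distribʳ _ _ _)) (trans (∑-distrib-+ _ _)
        (trans (cong (sum (λ x → e′ x ⊗ T q x) ⊕_) (trans (sum-⊗ˡ c _) (trans (cong (c ⊗_) (trans (T-sum q) (trans (cong (d ⊗_) q-sum) (⊗-zeroʳ d)))) (⊗-zeroʳ c)))) (⊕-idʳ _)))
    total : ι 2 ⊗ (d ⊗ s) ≼ ι 2 ⊗ (d ⊗ l) ⊕ ι 2 ⊗ ((d ⊗ μ) ⊗ s) ⊕ ι 2 ⊗ (d ⊗ τ) ⊕ d ⊗ (E ⊕ Y)
    total = ≼-trans (⊗-monoˡ (ι 2) (ι≽0 2) most) (≡-trans-≼ (trans (cong (λ z → ι 2 ⊗ (z ⊕ d ⊗ l)) Tf-split) (e₀ (ι 2) ((d ⊗ μ) ⊗ s) P R (d ⊗ l)))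
        (⊕-mono (⊕-mono ≼-refl P≼) R≼))
      where
      opaque
        unfolding Q
        e₀ : ∀ t a p r l → t ⊗ ((a ⊕ (p ⊕ r)) ⊕ l) ≡ t ⊗ l ⊕ t ⊗ a ⊕ t ⊗ p ⊕ t ⊗ r
        e₀ t a p r l = solve 5 (λ t a p r l → t :* ((a :+ (p :+ r)) :+ l) := t :* l :+ t :* a :+ t :* p :+ t :* r) refl t a p r l
    final : d ⊗ (ι 4 ⊗ (s ⊗ M) ⊕ ι 2 ⊗ (s ⊗ s) ⊕ v ⊗ v) ≼ d ⊗ (ι 4 ⊗ (l ⊗ M) ⊕ ι 4 ⊗ (v ⊗ s) ⊕ ι 4 ⊗ (τ ⊗ M) ⊕ ι 2 ⊗ (s ⊗ M) ⊕ M ⊗ v)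
    -- Multiplication by 2M clears the means: M·μ = v and M·E = s·M - s².
    final = ≡-trans-≼ (e₁ d s M v) (≼-trans (⊕-mono (⊗-monoˡ (ι 2 ⊗ M) (⊗≽0 (ι≽0 2) M≽0) total) ≼-refl)
        (≡-trans-≼ (e₂ d M l μ s τ E Y v) (≼-trans (⊕-mono (≼-reflexive (cong₂ (λ u w → d ⊗ (ι 4 ⊗ (l ⊗ M) ⊕ ι 4 ⊗ (u ⊗ s) ⊕ ι 4 ⊗ (τ ⊗ M)) ⊕ ι 2 ⊗ (d ⊗ w)) Mμ Ms))
            (⊗-monoˡ d d≽0 (≡-trans-≼ (trans (cong (λ z → M ⊗ (ι 2 ⊗ Y) ⊕ z ⊗ z) (sym Mμ)) (e₅ M μ Y)) (⊗-monoˡ M M≽0 Y≼))))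
          (≼-reflexive (e₃ d M l v s τ)))))
      where
      Ms : M ⊗ E ⊕ s ⊗ s ≡ s ⊗ M
      Ms = trans (cong (λ z → M ⊗ E ⊕ z ⊗ z) (sym Mc)) (trans (e₄ M E c) (trans (cong (M ⊗_) (sym s-split)) (⊗-comm M s)))
        where
        opaque
          unfolding Q
          e₄ : ∀ M E c → M ⊗ E ⊕ (M ⊗ c) ⊗ (M ⊗ c) ≡ M ⊗ (M ⊗ (c ⊗ c) ⊕ E)
          e₄ M E c = solve 3 (λ M E c → M :* E :+ (M :* c) :* (M :* c) := M :* (M :* (c :* c) :+ E)) refl M E c
      opaque
        unfolding Q ι
        e₁ : ∀ d s M v → d ⊗ (ι 4 ⊗ (s ⊗ M) ⊕ ι 2 ⊗ (s ⊗ s) ⊕ v ⊗ v) ≡ ι 2 ⊗ M ⊗ (ι 2 ⊗ (d ⊗ s)) ⊕ d ⊗ (ι 2 ⊗ (s ⊗ s) ⊕ v ⊗ v)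
        e₁ d s M v = solve 4 (λ d s M v → d :* (con (+ 4 ℚ./ 1) :* (s :* M) :+ con (+ 2 ℚ./ 1) :* (s :* s) :+ v :* v) := con (+ 2 ℚ./ 1) :* M :* (con (+ 2 ℚ./ 1) :* (d :* s)) :+ d :* (con (+ 2 ℚ./ 1) :* (s :* s) :+ v :* v)) refl d s M v
        e₃ : ∀ d M l v s τ → d ⊗ (ι 4 ⊗ (l ⊗ M) ⊕ ι 4 ⊗ (v ⊗ s) ⊕ ι 4 ⊗ (τ ⊗ M)) ⊕ ι 2 ⊗ (d ⊗ (s ⊗ M)) ⊕ d ⊗ (M ⊗ v) ≡ d ⊗ (ι 4 ⊗ (l ⊗ M) ⊕ ι 4 ⊗ (v ⊗ s) ⊕ ι 4 ⊗ (τ ⊗ M) ⊕ ι 2 ⊗ (s ⊗ M) ⊕ M ⊗ v)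
        e₃ d M l v s τ = solve 6 (λ d M l v s τ → let 4′ = con (+ 4 ℚ./ 1) ; 2′ = con (+ 2 ℚ./ 1) in
          d :* (4′ :* (l :* M) :+ 4′ :* (v :* s) :+ 4′ :* (τ :* M)) :+ 2′ :* (d :* (s :* M)) :+ d :* (M :* v) := d :* (4′ :* (l :* M) :+ 4′ :* (v :* s) :+ 4′ :* (τ :* M) :+ 2′ :* (s :* M) :+ M :* v)) refl d M l v s τ
      opaque
        unfolding Q ι
        e₂′ : ∀ d M l μ s τ E Y w → ι 2 ⊗ M ⊗ (ι 2 ⊗ (d ⊗ l) ⊕ ι 2 ⊗ ((d ⊗ μ) ⊗ s) ⊕ ι 2 ⊗ (d ⊗ τ) ⊕ d ⊗ (E ⊕ Y)) ⊕ d ⊗ (ι 2 ⊗ (s ⊗ s) ⊕ w)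
          ≡ d ⊗ (ι 4 ⊗ (l ⊗ M) ⊕ ι 4 ⊗ ((M ⊗ μ) ⊗ s) ⊕ ι 4 ⊗ (τ ⊗ M)) ⊕ ι 2 ⊗ (d ⊗ (M ⊗ E ⊕ s ⊗ s)) ⊕ d ⊗ (M ⊗ (ι 2 ⊗ Y) ⊕ w)
        e₂′ d M l μ s τ E Y w = solve 9 (λ d M l μ s τ E Y w → let 4′ = con (+ 4 ℚ./ 1) ; 2′ = con (+ 2 ℚ./ 1) in
          2′ :* M :* (2′ :* (d :* l) :+ 2′ :* ((d :* μ) :* s) :+ 2′ :* (d :* τ) :+ d :* (E :+ Y)) :+ d :* (2′ :* (s :* s) :+ w)
          := d :* (4′ :* (l :* M) :+ 4′ :* ((M :* μ) :* s) :+ 4′ :* (τ :* M)) :+ 2′ :* (d :* (M :* E :+ s :* s)) :+ d :* (M :* (2′ :* Y) :+ w)) refl d M l μ s τ E Y w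
        e₅ : ∀ M μ Y → M ⊗ (ι 2 ⊗ Y) ⊕ (M ⊗ μ) ⊗ (M ⊗ μ) ≡ M ⊗ (ι 2 ⊗ Y ⊕ M ⊗ (μ ⊗ μ))
        e₅ M μ Y = solve 3 (λ M μ Y → M :* (con (+ 2 ℚ./ 1) :* Y) :+ (M :* μ) :* (M :* μ) := M :* (con (+ 2 ℚ./ 1) :* Y :+ M :* (μ :* μ))) refl M μ Y
      e₂ : ∀ d M l μ s τ E Y v → ι 2 ⊗ M ⊗ (ι 2 ⊗ (d ⊗ l) ⊕ ι 2 ⊗ ((d ⊗ μ) ⊗ s) ⊕ ι 2 ⊗ (d ⊗ τ) ⊕ d ⊗ (E ⊕ Y)) ⊕ d ⊗ (ι 2 ⊗ (s ⊗ s) ⊕ v ⊗ v)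
          ≡ d ⊗ (ι 4 ⊗ (l ⊗ M) ⊕ ι 4 ⊗ ((M ⊗ μ) ⊗ s) ⊕ ι 4 ⊗ (τ ⊗ M)) ⊕ ι 2 ⊗ (d ⊗ (M ⊗ E ⊕ s ⊗ s)) ⊕ d ⊗ (M ⊗ (ι 2 ⊗ Y) ⊕ v ⊗ v)
      e₂ d M l μ s τ E Y v = e₂′ d M l μ s τ E Y (v ⊗ v)

bit : Bool → ℕ
bit true = 1
bit false = 0

count : ∀ {n} → (Fin n → Bool) → ℕ
count {zero} S = 0
count {suc n} S = bit (S zero) ℕ.+ count (S ∘ suc)

ι-count : ∀ {n} (S : Fin n → Bool) → ι (count S) ≡ sum λ x → [[ S x ]]
ι-count {zero} S = trans ι0 (sym (sum-zero _))
ι-count {suc n} S = trans (ι-+ (bit (S zero)) _) (trans (cong₂ _⊕_ (ι-bit (S zero)) (ι-count (S ∘ suc))) (sym (sum-suc _)))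
  where
  ι-bit : ∀ b → ι (bit b) ≡ [[ b ]]
  ι-bit true = ι1
  ι-bit false = ι0

⊕-cancelʳ : ∀ {a b} c → a ⊕ c ≼ b ⊕ c → a ≼ b
⊕-cancelʳ {a} {b} c p = subst₂ _≼_ (e a c) (e b c) (⊕-mono p (≼-refl {⊝ c}))
  where
  opaque
    unfolding Q
    e : ∀ a c → (a ⊕ c) ⊕ ⊝ c ≡ a
    e a c = solve 2 (λ a c → (a :+ c) :+ :- c := a) refl a c

-- For v = s and τ = 0 the inequality says s(M - s) ≤ 0. In general the nonnegative product `δ ⊗ w`
-- turns it into s(M - s) ≤ 24·τ·M, whereas 10s ≥ 1004τ and 10(M - s) ≥ 4M.
mid-range-contradiction : ∀ s v s₀ M τ → ¬ (τ ⊗ M ≼ 𝟘) → 𝟘 ≼ s → 𝟘 ≼ τ → 𝟘 ≼ M → M ≡ ι 1024 ⊗ τ →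
  ι 4 ⊗ (s ⊗ M) ⊕ ι 2 ⊗ (s ⊗ s) ⊕ v ⊗ v ≼ ι 4 ⊗ (ι 2 ⊗ τ ⊗ M) ⊕ ι 4 ⊗ (v ⊗ s) ⊕ ι 4 ⊗ (τ ⊗ M) ⊕ ι 2 ⊗ (s ⊗ M) ⊕ M ⊗ v →
  s₀ ≼ s ⊕ ι 2 ⊗ τ → s ≼ s₀ → 𝟘 ≼ v → v ≼ M → v ≼ s₀ ⊕ τ → M ≼ ι 10 ⊗ s₀ → ι 10 ⊗ s₀ ≼ ι 6 ⊗ M → ⊥
mid-range-contradiction s v s₀ M τ τM>0 s≽0 τ≽0 M≽0 M≡ ineq s₀≼ s≼s₀ v≽0 v≼M v≼ lo hi =
    absurd (ι-cancel {4016} {2400} (⊗-cancel⁺ (τ ⊗ M) τM>0 (subst₂ _≼_ (⊗-comm _ _) (⊗-comm _ _) product)))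
  where
  absurd : 4016 ℕ.≤ 2400 → ⊥
  absurd p with () ← ℕ.≤⇒≤ᵇ p
  w δ L R : Q
  w = (M ⊕ ι 3 ⊗ s) ⊖ v
  δ = (s ⊕ ι 3 ⊗ τ) ⊖ v
  L = ι 4 ⊗ (s ⊗ M) ⊕ ι 2 ⊗ (s ⊗ s) ⊕ v ⊗ v
  R = ι 4 ⊗ (ι 2 ⊗ τ ⊗ M) ⊕ ι 4 ⊗ (v ⊗ s) ⊕ ι 4 ⊗ (τ ⊗ M) ⊕ ι 2 ⊗ (s ⊗ M) ⊕ M ⊗ v
  s≼M : s ≼ M
  s≼M = ⊗-cancel-ι 9 (≼-trans (⊗-monoˡ (ι 10) (ι≽0 10) s≼s₀) (≼-trans hi (⊗-monoʳ M M≽0 (ι-mono {6} {10} (ℕ.m≤m+n 6 4)))))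
  w≽0 : 𝟘 ≼ w
  w≽0 = ⊖≽0 (≼-trans v≼M (≼⊕ʳ (⊗≽0 (ι≽0 3) s≽0)))
  δ≽0 : 𝟘 ≼ δ
  δ≽0 = ⊖≽0 (≼-trans v≼ (≼-trans-≡ (⊕-mono s₀≼ ≼-refl) (e s τ)))
    where
    opaque
      unfolding Q ι
      e : ∀ s τ → (s ⊕ ι 2 ⊗ τ) ⊕ τ ≡ s ⊕ ι 3 ⊗ τ
      e s τ = solve 2 (λ s τ → (s :+ con (+ 2 ℚ./ 1) :* τ) :+ τ := s :+ con (+ 3 ℚ./ 1) :* τ) refl s τ
  w≼4M : w ≼ ι 4 ⊗ M
  w≼4M = ≼-trans (≡-trans-≼ refl (≼-trans (⊕-mono-⊖ v≽0) (⊕-mono ≼-refl (⊗-monoˡ (ι 3) (ι≽0 3) s≼M)))) (≼-reflexive (e M))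
    where
    ⊕-mono-⊖ : ∀ {a b} → 𝟘 ≼ b → a ⊖ b ≼ a
    ⊕-mono-⊖ {a} {b} p = ⊖≽0⁻¹ (≼-trans-≡ p (e′ a b))
      where
      opaque
        unfolding Q
        e′ : ∀ a b → b ≡ a ⊖ (a ⊖ b)
        e′ a b = solve 2 (λ a b → b := a :- (a :- b)) refl a b
    opaque
      unfolding Q ι
      e : ∀ M → M ⊕ ι 3 ⊗ M ≡ ι 4 ⊗ M
      e M = solve 1 (λ M → M :+ con (+ 3 ℚ./ 1) :* M := con (+ 4 ℚ./ 1) :* M) refl M
  variance : s ⊗ (M ⊖ s) ≼ ι 12 ⊗ (τ ⊗ M) ⊕ ι 3 ⊗ τ ⊗ w
  variance = ⊕-cancelʳ R (≼-trans (≼-trans-≡ (≼⊕ʳ (⊗≽0 δ≽0 w≽0)) (e s v M τ)) (⊕-mono ≼-refl ineq))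
    where
    opaque
      unfolding Q ι
      e : ∀ s v M τ → (s ⊗ (M ⊖ s) ⊕ (ι 4 ⊗ (ι 2 ⊗ τ ⊗ M) ⊕ ι 4 ⊗ (v ⊗ s) ⊕ ι 4 ⊗ (τ ⊗ M) ⊕ ι 2 ⊗ (s ⊗ M) ⊕ M ⊗ v)) ⊕ ((s ⊕ ι 3 ⊗ τ) ⊖ v) ⊗ ((M ⊕ ι 3 ⊗ s) ⊖ v)
        ≡ (ι 12 ⊗ (τ ⊗ M) ⊕ ι 3 ⊗ τ ⊗ ((M ⊕ ι 3 ⊗ s) ⊖ v)) ⊕ (ι 4 ⊗ (s ⊗ M) ⊕ ι 2 ⊗ (s ⊗ s) ⊕ v ⊗ v)
      e s v M τ = solve 4 (λ s v M τ → let 2′ = con (+ 2 ℚ./ 1) ; 3′ = con (+ 3 ℚ./ 1) ; 4′ = con (+ 4 ℚ./ 1) ; 12′ = con (+ 12 ℚ./ 1) in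
        (s :* (M :- s) :+ (4′ :* (2′ :* τ :* M) :+ 4′ :* (v :* s) :+ 4′ :* (τ :* M) :+ 2′ :* (s :* M) :+ M :* v)) :+ ((s :+ 3′ :* τ) :- v) :* ((M :+ 3′ :* s) :- v)
        := (12′ :* (τ :* M) :+ 3′ :* τ :* ((M :+ 3′ :* s) :- v)) :+ (4′ :* (s :* M) :+ 2′ :* (s :* s) :+ v :* v)) refl s v M τ
  lower : ι 1004 ⊗ τ ≼ ι 10 ⊗ s
  lower = ⊕-cancelʳ (ι 20 ⊗ τ) (≡-trans-≼ (trans (sym (⊗-distribʳ τ _ _)) (trans (cong (_⊗ τ) (sym (ι-+ 1004 20))) (sym M≡))) (≼-trans lo (≼-trans-≡ (⊗-monoˡ (ι 10) (ι≽0 10) s₀≼)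
    (trans (⊗-distribˡ _ _ _) (cong (ι 10 ⊗ s ⊕_) (trans (sym (⊗-assoc _ _ _)) (cong (_⊗ τ) (sym (ι-* 10 2)))))))))
  upper : ι 4 ⊗ M ≼ ι 10 ⊗ (M ⊖ s)
  upper = ⊕-cancelʳ (ι 10 ⊗ s) (≼-trans (⊕-mono ≼-refl (≼-trans (⊗-monoˡ (ι 10) (ι≽0 10) s≼s₀) hi))
    (≼-reflexive (trans (trans (sym (⊗-distribʳ M _ _)) (cong (_⊗ M) (sym (ι-+ 4 6)))) (sym (trans (sym (⊗-distribˡ _ _ _)) (cong (ι 10 ⊗_) (⊖⊕-cancel M s)))))))
  product : ι 4016 ⊗ (τ ⊗ M) ≼ ι 2400 ⊗ (τ ⊗ M)
  product = ≡-trans-≼ (trans (cong (_⊗ (τ ⊗ M)) (ι-* 1004 4)) (⊗-interchange (ι 1004) (ι 4) τ M))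
    (≼-trans (⊗-mono (⊗≽0 (ι≽0 1004) τ≽0) (⊗≽0 (ι≽0 10) (⊖≽0 s≼M)) lower upper)
      (≡-trans-≼ (⊗-interchange (ι 10) s (ι 10) (M ⊖ s)) (≼-trans (⊗-monoˡ _ (⊗≽0 (ι≽0 10) (ι≽0 10)) (≼-trans variance (⊕-mono ≼-refl (⊗-monoˡ _ (⊗≽0 (ι≽0 3) τ≽0) w≼4M))))
        (≼-reflexive (trans (cong₂ _⊗_ (sym (ι-* 10 10)) (trans (cong (ι 12 ⊗ (τ ⊗ M) ⊕_) (trans (⊗-interchange (ι 3) τ (ι 4) M) (cong (_⊗ (τ ⊗ M)) (sym (ι-* 3 4))))) (trans (sym (⊗-distribʳ _ _ _)) (cong (_⊗ (τ ⊗ M)) (sym (ι-+ 12 12))))))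
          (trans (sym (⊗-assoc _ _ _)) (cong (_⊗ (τ ⊗ M)) (sym (ι-* 100 24)))))))))

∧-false : ∀ a {b} → b ≡ false → a ∧ b ≡ false
∧-false true p = p
∧-false false _ = refl

⇒∧-false : ∀ {a} b → a ≡ false → a ∧ b ≡ false
⇒∧-false b refl = refl

[[]]≼∧ : ∀ a b → [[ a ]] ≼ [[ a ∧ b ]] ⊕ [[ not b ]]
[[]]≼∧ true true = ≼⊕ʳ ≼-refl
[[]]≼∧ true false = ≼⊕ˡ ≼-refl
[[]]≼∧ false b = ≼⊕ʳ ([[]]≽0 (not b))

module MidRange (D K W₀ r : ℕ) (D≡K² : D ≡ suc K ℕ.* suc K) (W₀≡ : W₀ ≡ 1024) where

  open Families D K W₀ r D≡K²
  open Ends D K W₀ r D≡K²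
  open CoreInequality D K W₀ r D≡K²

  module _ (Λ-small : Λ ⊗ ι 1024 ≼ ι D) {m} {{_ : NonZero m}} {p₁ p₂ : (Fin m → Q) → Fin m → Q} (C₁ : Core m p₁) (C₂ : Core m p₂)
    (μ : (Fin m → Q) → Q) (decompose : ∀ f i → f i ≡ μ f ⊕ (p₁ f i ⊕ p₂ f i)) (sum₁ : ∀ f → sum (p₁ f) ≡ 𝟘) (sum₂ : ∀ f → sum (p₂ f) ≡ 𝟘)
    (Mμ : ∀ f → ι m ⊗ μ f ≡ sum f)
    (norms : ∀ f → sum (λ i → f i ⊗ f i) ≡ ι m ⊗ (μ f ⊗ μ f) ⊕ (sum (λ i → p₁ f i ⊗ p₁ f i) ⊕ sum (λ i → p₂ f i ⊗ p₂ f i))) where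

    private
      module C₁ = Core C₁
      module C₂ = Core C₂
      M τ : Q
      M = ι m
      τ = rcp 1024 ⊗ M
      M≡ : M ≡ ι 1024 ⊗ τ
      M≡ = sym (ι⊗rcp⊗ 1024 M)
      τ≽0 : 𝟘 ≼ τ
      τ≽0 = ⊗≽0 (rcp≽0 1023) (ι≽0 m)
      M≽1 : 𝟙 ≼ M
      M≽1 = ≡-trans-≼ (sym ι1) (ι-mono (ℕ.>-nonZero⁻¹ m))
      τM>0 : ¬ (τ ⊗ M ≼ 𝟘)
      τM>0 h = 1≼⇒pos M≽1 (⊗-cancel⁺ M (1≼⇒pos M≽1) (≼-trans-≡ (≡-trans-≼ (trans (cong (M ⊗_) M≡) (e M (ι 1024) τ)) (⊗-monoˡ (ι 1024) (ι≽0 1024) h)) (trans (⊗-zeroʳ _) (sym (⊗-zeroʳ M)))))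
        where
        e : ∀ M i t → M ⊗ (i ⊗ t) ≡ i ⊗ (t ⊗ M)
        e M i t = trans (⊗-comm _ _) (⊗-assoc _ _ _)
      few : ∀ {l} → ι W₀ ⊗ l ≼ M → l ≼ τ
      few {l} h = ⊗-cancel-ι 1023 (≼-trans-≡ (subst (λ w → ι w ⊗ l ≼ M) W₀≡ h) M≡)
      loss₁ : losses C₁.kept C₁.good ≼ τ
      loss₁ = few C₁.few-losses
      loss₂ : losses C₂.kept C₂.good ≼ τ
      loss₂ = few C₂.few-losses
      Λτ : Λ ⊗ M ≼ ι D ⊗ τ
      Λτ = ≡-trans-≼ (trans (cong (Λ ⊗_) M≡) (sym (⊗-assoc _ _ _))) (⊗-monoʳ τ τ≽0 Λ-small)

    -- If the gain were smaller, N would exceed S by at most τ = M/1024. Bad points are that rare as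
    -- well, so the core inequality would apply with all errors of order τ.
    mid-expansion : ∀ (S N : Fin m → Bool) → (∀ x a → S x ≡ true → C₁.kept x ≡ true → N (C₁.φ a x) ≡ true) → (∀ x a → S x ≡ true → C₂.kept x ≡ true → N (C₂.φ a x) ≡ true) →
      m ℕ.≤ 10 ℕ.* count S → 10 ℕ.* count S ℕ.≤ 6 ℕ.* m → W₀ ℕ.* count S ℕ.+ m ℕ.≤ W₀ ℕ.* count N
    mid-expansion S N closed₁ closed₂ lo hi with ≼-total (ι W₀ ⊗ ι (count S) ⊕ M) (ι W₀ ⊗ ι (count N))
    ... | inj₁ p = ι-cancel (subst₂ _≼_ (sym (trans (ι-+ (W₀ ℕ.* count S) m) (cong (_⊕ M) (ι-* W₀ (count S))))) (sym (ι-* W₀ (count N))) p)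
    ... | inj₂ p = ⊥-elim (mid-range-contradiction s v s₀ M τ τM>0 s≽0 τ≽0 (ι≽0 m) M≡ ineq s₀≼ s≼s₀ v≽0 v≼M v≼ (≼-trans-≡ (ι-mono lo) (trans (ι-* 10 (count S)) (cong (ι 10 ⊗_) (ι-count S))))
          (subst₂ _≼_ (trans (ι-* 10 (count S)) (cong (ι 10 ⊗_) (ι-count S))) (ι-* 6 m) (ι-mono hi)))
      where
      ok₁ ok₂ e? f? okf : Fin m → Bool
      ok₁ x = C₁.kept x ∧ C₁.good (false , x)
      ok₂ x = C₂.kept x ∧ C₂.good (false , x)
      -- Points lost for either core are dropped, so that the same indicators fit both cores before
      -- it is known which of them will be used.
      e? x = S x ∧ (ok₁ x ∧ ok₂ x)
      okf y = C₁.good (true , y) ∧ C₂.good (true , y)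
      f? y = N y ∧ okf y
      f : Fin m → Q
      f y = [[ f? y ]]
      s v s₀ v₀ : Q
      s = sum λ x → [[ e? x ]]
      v = sum f
      s₀ = sum λ x → [[ S x ]]
      v₀ = sum λ y → [[ N y ]]
      s≽0 : 𝟘 ≼ s
      s≽0 = sum≽0 λ x → [[]]≽0 (e? x)
      v≽0 : 𝟘 ≼ v
      v≽0 = sum≽0 λ x → [[]]≽0 (f? x)
      v≼M : v ≼ M
      v≼M = ≼-trans-≡ (sum-mono λ x → [[]]≼1 (f? x)) (trans (sum-const m 𝟙) (⊗-idʳ M))
      ∧≼ : ∀ a b → [[ a ∧ b ]] ≼ [[ a ]]
      ∧≼ true b = [[]]≼1 b
      ∧≼ false b = ≼-refl
      s≼s₀ : s ≼ s₀
      s≼s₀ = sum-mono λ x → ∧≼ (S x) _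
      s₀≼ : s₀ ≼ s ⊕ ι 2 ⊗ τ
      s₀≼ = ≼-trans (sum-mono λ x → ≼-trans ([[]]≼∧ (S x) (ok₁ x ∧ ok₂ x)) (⊕-mono ≼-refl (≼-trans (not∧≼ (ok₁ x) (ok₂ x)) (⊕-mono (not∧≼ (C₁.kept x) _) (not∧≼ (C₂.kept x) _)))))
        (≡-trans-≼ (trans (∑-distrib-+ _ _) (cong (s ⊕_) (trans (∑-distrib-+ _ _) (cong₂ _⊕_ (∑-distrib-+ _ _) (∑-distrib-+ _ _)))))
          (⊕-mono ≼-refl (≼-trans (⊕-mono (≼-trans (⊕-mono ≼-refl (≼⊕ʳ (bad≽0 C₁.good true))) loss₁) (≼-trans (⊕-mono ≼-refl (≼⊕ʳ (bad≽0 C₂.good true))) loss₂)) (≼-reflexive (sym (two⊗ τ))))))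
        where
        bad≽0 : ∀ (g : Bool × Fin m → Bool) b → 𝟘 ≼ sum (λ y → [[ not (g (b , y)) ]])
        bad≽0 g b = sum≽0 λ y → [[]]≽0 (not (g (b , y)))
      v≼ : v ≼ s₀ ⊕ τ
      v≼ = ≼-trans (sum-mono λ y → ∧≼ (N y) _) (⊗-cancel-ι 1023 (subst₂ _≼_ (cong₂ (λ w c → ι w ⊗ c) W₀≡ (ι-count N)) (trans (cong₂ _⊕_ (cong₂ (λ w c → ι w ⊗ c) W₀≡ (ι-count S)) M≡) (sym (⊗-distribˡ _ _ _))) p))
      miss-sum : ∀ (φ ψ : Fin m → Fin m) → (∀ x → ψ (φ x) ≡ x) → (∀ x → φ (ψ x) ≡ x) → (∀ x → e? x ≡ true → N (φ x) ≡ true) →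
        sum (λ x → [[ e? x ]] ⊗ [[ not (f? (φ x)) ]]) ≼ ι 2 ⊗ τ
      miss-sum φ ψ ψφ φψ hit = ≼-trans (sum-mono λ x → pt x (e? x) refl (N (φ x)) refl) (≡-trans-≼ (trans (sum-bij φ ψ ψφ φψ (λ y → [[ not (C₁.good (true , y)) ]] ⊕ [[ not (C₂.good (true , y)) ]])) (∑-distrib-+ _ _))
          (≼-trans (⊕-mono (≼-trans (≼-trans (≼⊕ˡ (below C₁.good false)) (≼⊕ˡ (sum≽0 λ x → [[]]≽0 (not (C₁.kept x))))) loss₁) (≼-trans (≼-trans (≼⊕ˡ (below C₂.good false)) (≼⊕ˡ (sum≽0 λ x → [[]]≽0 (not (C₂.kept x))))) loss₂))
            (≼-reflexive (sym (two⊗ τ)))))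
        where
        below : ∀ (g : Bool × Fin m → Bool) b → 𝟘 ≼ sum (λ y → [[ not (g (b , y)) ]])
        below g b = sum≽0 λ y → [[]]≽0 (not (g (b , y)))
        pt : ∀ x b → e? x ≡ b → ∀ c → N (φ x) ≡ c → [[ e? x ]] ⊗ [[ not (f? (φ x)) ]] ≼ [[ not (C₁.good (true , φ x)) ]] ⊕ [[ not (C₂.good (true , φ x)) ]]
        pt x false q c _ = ≡-trans-≼ (trans (cong (λ b → [[ b ]] ⊗ [[ not (f? (φ x)) ]]) q) (⊗-zeroˡ _)) (⊕≽0 ([[]]≽0 (not (C₁.good (true , φ x)))) ([[]]≽0 (not (C₂.good (true , φ x)))))
        pt x true q true n = ≡-trans-≼ (trans (cong₂ (λ b c → [[ b ]] ⊗ [[ not (c ∧ okf (φ x)) ]]) q n) (⊗-idˡ _)) (not∧≼ (C₁.good (true , φ x)) (C₂.good (true , φ x)))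
        pt x true q false n with () ← trans (sym n) (hit x q)
      X Y : Q
      X = sum λ i → p₁ f i ⊗ p₁ f i
      Y = sum λ i → p₂ f i ⊗ p₂ f i
      v-norm : v ≡ M ⊗ (μ f ⊗ μ f) ⊕ (X ⊕ Y)
      v-norm = trans (sum-cong λ y → sym ([[]]-idem (f? y))) (norms f)
      X≽0 : 𝟘 ≼ X
      X≽0 = sum≽0 λ i → sq≽0 _
      Y≽0 : 𝟘 ≼ Y
      Y≽0 = sum≽0 λ i → sq≽0 _
      μ²≽0 : 𝟘 ≼ M ⊗ (μ f ⊗ μ f)
      μ²≽0 = ⊗≽0 (ι≽0 m) (sq≽0 _)
      X≼M : X ≼ M
      X≼M = ≼-trans (≼-trans-≡ (≼-trans (≼⊕ʳ Y≽0) (≼⊕ˡ μ²≽0)) (sym v-norm)) v≼M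
      Y≼M : Y ≼ M
      Y≼M = ≼-trans (≼-trans-≡ (≼-trans (≼⊕ˡ X≽0) (≼⊕ˡ μ²≽0)) (sym v-norm)) v≼M
      half : ∀ {X Y} → Y ≼ X → v ≡ M ⊗ (μ f ⊗ μ f) ⊕ (X ⊕ Y) → ι 2 ⊗ Y ⊕ M ⊗ (μ f ⊗ μ f) ≼ v
      half {X} {Y} Y≼X q = ≡-trans-≼ (⊕-comm _ _) (≼-trans-≡ (⊕-mono ≼-refl (≡-trans-≼ (two⊗ Y) (⊕-mono Y≼X ≼-refl))) (sym q))
      split-true : ∀ {x} → e? x ≡ true → S x ≡ true × C₁.kept x ≡ true × C₂.kept x ≡ true
      split-true {x} q with ∧-true {S x} q
      ... | a , b with ∧-true {ok₁ x} b
      ...   | c , d = a , proj₁ (∧-true c) , proj₁ (∧-true d)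
      ineq : ι 4 ⊗ (s ⊗ M) ⊕ ι 2 ⊗ (s ⊗ s) ⊕ v ⊗ v ≼ ι 4 ⊗ (ι 2 ⊗ τ ⊗ M) ⊕ ι 4 ⊗ (v ⊗ s) ⊕ ι 4 ⊗ (τ ⊗ M) ⊕ ι 2 ⊗ (s ⊗ M) ⊕ M ⊗ v
      ineq with ≼-total Y X
      -- The core used is the one that contracts the larger part of `f`; the other part then has at
      -- most half of the variance.
      ... | inj₁ Y≼X = core-inequality C₁ e? f? (ι 2 ⊗ τ) τ (μ f) (p₂ f)
            (λ x g → ∧-false (S x) (⇒∧-false (ok₂ x) (∧-false (C₁.kept x) g))) (λ y g → ∧-false (N y) (⇒∧-false _ g))
            (λ a → miss-sum (C₁.φ a) (C₁.ψ a) (C₁.ψφ a) (C₁.φψ a) λ x q → closed₁ x a (proj₁ (split-true q)) (proj₁ (proj₂ (split-true q))))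
            (decompose f) (sum₂ f) (Mμ f) X≼M (half Y≼X v-norm) Λτ
      ... | inj₂ X≼Y = core-inequality C₂ e? f? (ι 2 ⊗ τ) τ (μ f) (p₁ f)
            (λ x g → ∧-false (S x) (∧-false (ok₁ x) (∧-false (C₂.kept x) g))) (λ y g → ∧-false (N y) (∧-false (C₁.good (true , y)) g))
            (λ a → miss-sum (C₂.φ a) (C₂.ψ a) (C₂.ψφ a) (C₂.φψ a) λ x q → closed₂ x a (proj₁ (split-true q)) (proj₂ (proj₂ (split-true q))))
            (λ y → trans (decompose f y) (cong (μ f ⊕_) (⊕-comm _ _))) (sum₁ f) (Mμ f) Y≼M (half X≼Y (trans v-norm (cong (M ⊗ (μ f ⊗ μ f) ⊕_) (⊕-comm X Y)))) Λτ

-- Counting subsets, and removal of a set that does not expand.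

_⊆ᵇ_ : ∀ {n} → (Fin n → Bool) → (Fin n → Bool) → Set
S ⊆ᵇ T = ∀ x → S x ≡ true → T x ≡ true

∃ᵇ : ∀ {n} → (Fin n → Bool) → Bool
∃ᵇ {zero} f = false
∃ᵇ {suc n} f = f zero ∨ ∃ᵇ (f ∘ suc)

∨-introʳ : ∀ a {b} → b ≡ true → a ∨ b ≡ true
∨-introʳ true _ = refl
∨-introʳ false p = p

∨-introˡ : ∀ {a} b → a ≡ true → a ∨ b ≡ true
∨-introˡ b refl = refl

∨-elim : ∀ a {b} → a ∨ b ≡ true → a ≡ true ⊎ b ≡ true
∨-elim true _ = inj₁ refl
∨-elim false p = inj₂ p

∧-intro : ∀ {a b} → a ≡ true → b ≡ true → a ∧ b ≡ true
∧-intro refl refl = refl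

∃ᵇ-intro : ∀ {n} (f : Fin n → Bool) i → f i ≡ true → ∃ᵇ f ≡ true
∃ᵇ-intro f zero p = ∨-introˡ _ p
∃ᵇ-intro f (suc i) p = ∨-introʳ (f zero) (∃ᵇ-intro (f ∘ suc) i p)

∃ᵇ-elim : ∀ {n} (f : Fin n → Bool) → ∃ᵇ f ≡ true → ∃ λ i → f i ≡ true
∃ᵇ-elim {suc n} f p with ∨-elim (f zero) p
... | inj₁ q = zero , q
... | inj₂ q with ∃ᵇ-elim (f ∘ suc) q
...   | i , r = suc i , r

∃ᵇ-≼ : ∀ {n} (f : Fin n → Bool) → [[ ∃ᵇ f ]] ≼ sum λ i → [[ f i ]]
∃ᵇ-≼ {zero} f = ≼-reflexive (sym (sum-zero _))
∃ᵇ-≼ {suc n} f = ≼-trans-≡ (go (f zero)) (sym (sum-suc _))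
  where
  go : ∀ a → [[ a ∨ ∃ᵇ (f ∘ suc) ]] ≼ [[ a ]] ⊕ sum (λ i → [[ f (suc i) ]])
  go true = ≼⊕ʳ (sum≽0 λ i → [[]]≽0 (f (suc i)))
  go false = ≼-trans-≡ (∃ᵇ-≼ (f ∘ suc)) (sym (⊕-idˡ _))

count-cong : ∀ {n} {S T : Fin n → Bool} → (∀ x → S x ≡ T x) → count S ≡ count T
count-cong {zero} p = refl
count-cong {suc n} p = cong₂ (λ b c → bit b ℕ.+ c) (p zero) (count-cong (p ∘ suc))

count-mono : ∀ {n} {S T : Fin n → Bool} → S ⊆ᵇ T → count S ℕ.≤ count T
count-mono {zero} p = ℕ.z≤n
count-mono {suc n} {S} {T} p = ℕ.+-mono-≤ (go (S zero) (T zero) (p zero)) (count-mono (p ∘ suc))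
  where
  go : ∀ a b → (a ≡ true → b ≡ true) → bit a ℕ.≤ bit b
  go false _ _ = ℕ.z≤n
  go true b f rewrite f refl = ℕ.≤-refl

count-not : ∀ {n} (S : Fin n → Bool) → count (not ∘ S) ℕ.+ count S ≡ n
count-not {zero} S = refl
count-not {suc n} S with S zero
... | true = trans (ℕ.+-suc _ _) (cong suc (count-not (S ∘ suc)))
... | false = cong suc (count-not (S ∘ suc))

count-∅ : ∀ n → count {n} (λ _ → false) ≡ 0
count-∅ zero = refl
count-∅ (suc n) = count-∅ n

count-∨ : ∀ {n} (S T : Fin n → Bool) → (∀ x → S x ≡ true → T x ≡ false) → count (λ x → S x ∨ T x) ≡ count S ℕ.+ count T
count-∨ {zero} S T d = refl
count-∨ {suc n} S T d = trans (cong₂ ℕ._+_ (go (S zero) (T zero) (d zero)) (count-∨ (S ∘ suc) (T ∘ suc) (d ∘ suc))) (e (bit (S zero)) (bit (T zero)) _ _)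
  where
  go : ∀ a b → (a ≡ true → b ≡ false) → bit (a ∨ b) ≡ bit a ℕ.+ bit b
  go false b _ = refl
  go true b f rewrite f refl = refl
  e : ∀ a b c d → a ℕ.+ b ℕ.+ (c ℕ.+ d) ≡ a ℕ.+ c ℕ.+ (b ℕ.+ d)
  e = ℕ-Ring.solve-∀

image : ∀ {n m} → (Fin n → Fin m) → (Fin n → Bool) → Fin m → Bool
image f T x = ∃ᵇ λ i → T i ∧ does (x Fin.≟ f i)

image-intro : ∀ {n m} (f : Fin n → Fin m) T i → T i ≡ true → image f T (f i) ≡ true
image-intro f T i p = ∃ᵇ-intro _ i (∧-intro p (dec-true (f i Fin.≟ f i) refl))

image-elim : ∀ {n m} (f : Fin n → Fin m) T x → image f T x ≡ true → ∃ λ i → T i ≡ true × x ≡ f i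
image-elim f T x p with ∃ᵇ-elim _ p
... | i , q with ∧-true {T i} q
...   | r , s = i , r , does⇒ (x Fin.≟ f i) s

count-image : ∀ {n m} (f : Fin n → Fin m) → (∀ {i j} → f i ≡ f j → i ≡ j) → ∀ T → count (image f T) ≡ count T
count-image {n} {m} f inj T = ℕ.≤-antisym (ι-cancel (≼-reflexive eq)) (ι-cancel (≼-reflexive (sym eq)))
  where
  pt : ∀ x → [[ image f T x ]] ≡ sum λ i → [[ T i ]] ⊗ [[≟]] x (f i)
  pt x with image f T x in e
  ... | false = sym (trans (sum-cong none) (sum-0 n))
    where
    none : ∀ i → [[ T i ]] ⊗ [[≟]] x (f i) ≡ 𝟘
    none i with T i in t | x Fin.≟ f i
    ... | false | _ = ⊗-zeroˡ _
    ... | true | no _ = ⊗-zeroʳ _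
    ... | true | yes refl with () ← trans (sym e) (image-intro f T i t)
  ... | true with image-elim f T x e
  ...   | i₀ , t , refl = sym (trans (sum-only i₀ _ other) (trans (cong₂ (λ a b → [[ a ]] ⊗ [[ b ]]) t (dec-true (f i₀ Fin.≟ f i₀) refl)) (⊗-idˡ 𝟙)))
    where
    other : ∀ i → i ≢ i₀ → [[ T i ]] ⊗ [[≟]] (f i₀) (f i) ≡ 𝟘
    other i ne = trans (cong (λ b → [[ T i ]] ⊗ [[ b ]]) (dec-false (f i₀ Fin.≟ f i) (λ q → ne (sym (inj q))))) (⊗-zeroʳ _)
  eq : ι (count (image f T)) ≡ ι (count T)
  eq = trans (ι-count _) (trans (sum-cong pt) (trans (∑-comm {m} {n} (λ x i → [[ T i ]] ⊗ [[≟]] x (f i)))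
    (trans (sum-cong λ i → trans (sum-⊗ˡ [[ T i ]] _) (trans (cong ([[ T i ]] ⊗_) (sum-≟ (f i))) (⊗-idʳ _))) (sym (ι-count T)))))

enum : ∀ {n} (S : Fin n → Bool) → Fin (count S) → Fin n
enum {suc n} S i with S zero
enum {suc n} S zero | true = zero
enum {suc n} S (suc i) | true = suc (enum (S ∘ suc) i)
enum {suc n} S i | false = suc (enum (S ∘ suc) i)

enum-∈ : ∀ {n} (S : Fin n → Bool) i → S (enum S i) ≡ true
enum-∈ {suc n} S i with S zero in e
enum-∈ {suc n} S zero | true = e
enum-∈ {suc n} S (suc i) | true = enum-∈ (S ∘ suc) i
enum-∈ {suc n} S i | false = enum-∈ (S ∘ suc) i

enum-mono : ∀ {n} (S : Fin n → Bool) i j → i Fin.< j → enum S i Fin.< enum S j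
enum-mono {suc n} S i j l with S zero
enum-mono {suc n} S zero (suc j) l | true = ℕ.s≤s ℕ.z≤n
enum-mono {suc n} S (suc i) (suc j) l | true = ℕ.s≤s (enum-mono (S ∘ suc) i j (ℕ.≤-pred l))
enum-mono {suc n} S i j l | false = ℕ.s≤s (enum-mono (S ∘ suc) i j l)

enum-onto : ∀ {n} (S : Fin n → Bool) x → S x ≡ true → ∃ λ i → enum S i ≡ x
enum-onto {suc n} S x p with S zero in e
enum-onto {suc n} S zero p | true = zero , refl
enum-onto {suc n} S (suc x) p | true with enum-onto (S ∘ suc) x p
... | i , q = suc i , cong suc q
enum-onto {suc n} S zero p | false with () ← trans (sym e) p
enum-onto {suc n} S (suc x) p | false with enum-onto (S ∘ suc) x p
... | i , q = i , cong suc q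

StrictMono : ∀ {n m} → (Fin n → Fin m) → Set
StrictMono f = ∀ i j → i Fin.< j → f i Fin.< f j

strict⇒reflects : ∀ {n m} {f : Fin n → Fin m} → StrictMono f → ∀ {i j} → f i ≡ f j → i ≡ j
strict⇒reflects {f = f} mono {i} {j} e with Fin.<-cmp i j
... | tri< l _ _ = ⊥-elim (ℕ.<-irrefl (cong toℕ e) (mono i j l))
... | tri≈ _ p _ = p
... | tri> _ _ l = ⊥-elim (ℕ.<-irrefl (cong toℕ (sym e)) (mono j i l))

restrict : ∀ {n m} (f g : Fin n → Fin m) → StrictMono f → StrictMono g → ∀ {M : BipGraph m} → IsMonotoneMatching M → IsMonotoneMatching (λ i j → M (f i) (g j))
restrict f g mf mg (mat , nc) =
  (λ i j k l p q → (λ e → strict⇒reflects mg (proj₁ (mat _ _ _ _ p q) (cong f e))) , (λ e → strict⇒reflects mf (proj₂ (mat _ _ _ _ p q) (cong g e))))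
  , (λ i j k l p q (a , b) → nc _ _ _ _ p q (mf i k a , mg l j b))

diagonal : ∀ {n} → BipGraph n
diagonal x y = does (x Fin.≟ y)

diagonal-mono : ∀ {n} → IsMonotoneMatching (diagonal {n})
diagonal-mono = (λ i j k l a b → (λ e → trans (sym (⇒≡ i j a)) (trans e (⇒≡ k l b))) , (λ e → trans (⇒≡ i j a) (trans e (sym (⇒≡ k l b)))))
  , λ i j k l a b (u , v) → ℕ.<-asym u (subst₂ (λ x y → toℕ x ℕ.< toℕ y) (sym (⇒≡ k l b)) (sym (⇒≡ i j a)) v)
  where
  ⇒≡ : ∀ i j → does (i Fin.≟ j) ≡ true → i ≡ j
  ⇒≡ i j = does⇒ (i Fin.≟ j)

record System (d m : ℕ) : Set where
  field
    M    : Fin d → BipGraph m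
    mono : ∀ k → IsMonotoneMatching (M k)

  Closed : (Fin m → Bool) → (Fin m → Bool) → Set
  Closed S N = ∀ k x y → S x ≡ true → M k x y ≡ true → N y ≡ true

  nb : (Fin m → Bool) → Fin m → Bool
  nb S y = ∃ᵇ λ k → ∃ᵇ λ x → S x ∧ M k x y

  nb-closed : ∀ S → Closed S (nb S)
  nb-closed S k x y p q = ∃ᵇ-intro _ k (∃ᵇ-intro _ x (∧-intro p q))

  nb-least : ∀ {S N} → Closed S N → nb S ⊆ᵇ N
  nb-least {S} c y p with ∃ᵇ-elim _ p
  ... | k , q with ∃ᵇ-elim (λ x → S x ∧ M k x y) q
  ...   | x , r with ∧-true {S x} r
  ...     | a , b = c k x y a b

Expanding : ∀ {d n} → ℕ → System d n → Set
Expanding {n = n} κ 𝒮 = ∀ S N → System.Closed 𝒮 S N → 2 ℕ.* count S ℕ.≤ n → suc κ ℕ.* count S ℕ.≤ κ ℕ.* count N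

-- Removing a largest set S₀ of expansion below 1 + 1/κ together with its neighbourhood: a violation in the rest could be added to S₀.
module Prune {d m} (κ : ℕ) .{{_ : NonZero κ}} (𝒮 : System d m) (0<m : 0 ℕ.< m)
  (hall : ∀ S N → System.Closed 𝒮 S N → count S ℕ.≤ count N)
  (mid : ∀ S N → System.Closed 𝒮 S N → m ℕ.≤ 10 ℕ.* count S → 10 ℕ.* count S ℕ.≤ 6 ℕ.* m → κ ℕ.* count S ℕ.+ m ℕ.≤ κ ℕ.* count N) where

  open System 𝒮

  -- The limit 6m/10 leaves room for adding a set of size at most m/2 to a bad set of size below
  -- m/10.
  Bad : (Fin m → Bool) → Set
  Bad S = 10 ℕ.* count S ℕ.≤ 6 ℕ.* m × κ ℕ.* count (nb S) ℕ.≤ suc κ ℕ.* count S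

  bad? : ∀ S → Dec (Bad S)
  bad? S = (10 ℕ.* count S ℕ.≤? 6 ℕ.* m) ×-dec (κ ℕ.* count (nb S) ℕ.≤? suc κ ℕ.* count S)

  ∅ : Fin m → Bool
  ∅ _ = false

  bad-∅ : Bad ∅
  bad-∅ = subst (λ c → 10 ℕ.* c ℕ.≤ 6 ℕ.* m) (sym (count-∅ m)) ℕ.z≤n ,
    ℕ.≤-trans (ℕ.≤-reflexive (trans (cong (κ ℕ.*_) (ℕ.n≤0⇒n≡0 (ℕ.≤-trans (count-mono {S = nb ∅} {∅} (nb-least (λ _ _ _ ()))) (ℕ.≤-reflexive (count-∅ m))))) (ℕ.*-zeroʳ κ))) ℕ.z≤n

  bad-cong : ∀ {S T} → (∀ x → S x ≡ T x) → Bad S → Bad T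
  bad-cong {S} {T} e (a , b) = subst (λ c → 10 ℕ.* c ℕ.≤ 6 ℕ.* m) (count-cong e) a ,
    ℕ.≤-trans (ℕ.*-monoʳ-≤ κ (count-mono (nb-least {T} {nb S} λ k x y p q → nb-closed S k x y (trans (e x) p) q))) (subst (λ c → κ ℕ.* count (nb S) ℕ.≤ suc κ ℕ.* c) (count-cong e) b)

  largest : ∀ k → (∀ S → Bad S → count S ℕ.≤ k) → ∃ λ S₀ → Bad S₀ × (∀ S → Bad S → count S ℕ.≤ count S₀)
  largest zero h = ∅ , bad-∅ , λ S b → ℕ.≤-trans (h S b) ℕ.z≤n
  largest (suc k) h with anySubset? (λ s → bad? (lookup s) ×-dec (count (lookup s) ℕ.≟ suc k))
  ... | yes (s , b , e) = lookup s , b , λ S bS → ℕ.≤-trans (h S bS) (ℕ.≤-reflexive (sym e))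
  ... | no none = largest k λ S b → ℕ.≤-pred (ℕ.≤∧≢⇒< (h S b) λ e → none (tabulate S , bad-cong (λ x → sym (Vec.lookup∘tabulate S x)) b , trans (count-cong (Vec.lookup∘tabulate S)) e))

  chosen : ∃ λ S₀ → Bad S₀ × (∀ S → Bad S → count S ℕ.≤ count S₀)
  chosen = largest m λ S _ → ℕ.≤-trans (ℕ.m≤n+m _ _) (ℕ.≤-reflexive (count-not S))

  module Remove (S₀ : Fin m → Bool) (bad₀ : Bad S₀) (max₀ : ∀ S → Bad S → count S ℕ.≤ count S₀) where

    A₁ B₁ : Fin m → Bool
    A₁ = not ∘ S₀
    B₁ = not ∘ nb S₀

    n : ℕ
    n = count B₁

    -- Between m/10 and 6m/10 a set gains m/κ neighbours by `mid`; for a bad set this would force m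
    -- ≤ |S₀|.
    small₀ : 10 ℕ.* count S₀ ℕ.< m
    small₀ with m ℕ.≤? 10 ℕ.* count S₀
    ... | no ¬p = ℕ.≰⇒> ¬p
    ... | yes p = ⊥-elim (ℕ.<-irrefl refl (ℕ.<-≤-trans (ℕ.*-monoˡ-< m {{ℕ.>-nonZero 0<m}} {6} {10} (ℕ.≤ᵇ⇒≤ 7 10 _)) (ℕ.≤-trans (ℕ.*-monoʳ-≤ 10 m≤) (proj₁ bad₀))))
      where
      m≤ : m ℕ.≤ count S₀
      m≤ = ℕ.+-cancelˡ-≤ (κ ℕ.* count S₀) _ _ (ℕ.≤-trans (mid S₀ (nb S₀) (nb-closed S₀) p (proj₁ bad₀)) (ℕ.≤-trans (proj₂ bad₀) (ℕ.≤-reflexive (ℕ.+-comm (count S₀) (κ ℕ.* count S₀)))))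

    n≤ : n ℕ.≤ count A₁
    n≤ = ℕ.+-cancelʳ-≤ (count S₀) _ _ (ℕ.≤-trans (ℕ.+-monoʳ-≤ n (hall S₀ (nb S₀) (nb-closed S₀))) (ℕ.≤-reflexive (trans (count-not (nb S₀)) (sym (count-not S₀)))))

    -- More vertices may remain in A than in B, so only the first n of A are kept. Expansion is a
    -- statement about subsets of A and survives this.
    eᴬ eᴮ : Fin n → Fin m
    eᴬ i = enum A₁ (Fin.inject≤ i n≤)
    eᴮ = enum B₁

    eᴬ-mono : StrictMono eᴬ
    eᴬ-mono i j l = enum-mono A₁ _ _ (subst₂ ℕ._<_ (sym (Fin.toℕ-inject≤ i n≤)) (sym (Fin.toℕ-inject≤ j n≤)) l)

    eᴮ-mono : StrictMono eᴮ
    eᴮ-mono = enum-mono B₁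

    pruned : System d n
    pruned = record { M = λ k i j → M k (eᴬ i) (eᴮ j) ; mono = λ k → restrict eᴬ eᴮ eᴬ-mono eᴮ-mono (mono k) }

    expanding : Expanding κ pruned
    expanding T N closed half with count T in eT
    ... | zero = ℕ.≤-trans (ℕ.≤-reflexive (ℕ.*-zeroʳ (suc κ))) ℕ.z≤n
    ... | suc t = ℕ.<⇒≤ (ℕ.+-cancelˡ-< (κ ℕ.* count (nb S₀)) _ _ (ℕ.≤-<-trans (ℕ.+-monoˡ-≤ (suc κ ℕ.* suc t) (proj₂ bad₀))
          (ℕ.<-≤-trans (subst (λ c → c ℕ.< κ ℕ.* count (nb S)) (trans (cong (suc κ ℕ.*_) countS) (ℕ.*-distribˡ-+ (suc κ) (count S₀) (suc t))) (ℕ.≰⇒> λ p → not-bad (room , p)))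
            (ℕ.≤-trans (ℕ.*-monoʳ-≤ κ (ℕ.≤-trans (count-mono (nb-least {S} {N′} closed′)) (ℕ.≤-reflexive countN′))) (ℕ.≤-reflexive (ℕ.*-distribˡ-+ κ (count (nb S₀)) (count N)))))))
      where
      S N′ : Fin m → Bool
      S x = S₀ x ∨ image eᴬ T x
      N′ y = nb S₀ y ∨ image eᴮ N y
      countS : count S ≡ count S₀ ℕ.+ suc t
      countS = trans (count-∨ S₀ (image eᴬ T) disjoint) (cong (count S₀ ℕ.+_) (trans (count-image eᴬ (strict⇒reflects eᴬ-mono) T) eT))
        where
        disjoint : ∀ x → S₀ x ≡ true → image eᴬ T x ≡ false
        disjoint x p with image eᴬ T x in e
        ... | false = refl
        ... | true with image-elim eᴬ T x e
        ...   | i , _ , refl with () ← trans (sym (enum-∈ A₁ (Fin.inject≤ i n≤))) (cong not p)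
      countN′ : count N′ ≡ count (nb S₀) ℕ.+ count N
      countN′ = trans (count-∨ (nb S₀) (image eᴮ N) disjoint) (cong (count (nb S₀) ℕ.+_) (count-image eᴮ (strict⇒reflects eᴮ-mono) N))
        where
        disjoint : ∀ x → nb S₀ x ≡ true → image eᴮ N x ≡ false
        disjoint x p with image eᴮ N x in e
        ... | false = refl
        ... | true with image-elim eᴮ N x e
        ...   | i , _ , refl with () ← trans (sym (enum-∈ B₁ i)) (cong not p)
      closed′ : Closed S N′
      closed′ k x y p q with ∨-elim (S₀ x) p
      ... | inj₁ s = ∨-introˡ _ (nb-closed S₀ k x y s q)
      ... | inj₂ s with image-elim eᴬ T x s
      ...   | i , t∈ , refl with nb S₀ y in ny
      ...     | true = refl
      ...     | false with enum-onto B₁ y (cong not ny)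
      ...       | j , refl = image-intro eᴮ N j (closed k i j t∈ q)
      room : 10 ℕ.* count S ℕ.≤ 6 ℕ.* m
      room = ℕ.≤-trans (ℕ.≤-reflexive (trans (cong (10 ℕ.*_) countS) (ring (count S₀) (suc t)))) (ℕ.≤-trans (ℕ.+-mono-≤ (ℕ.<⇒≤ small₀) (ℕ.*-monoʳ-≤ 5 (ℕ.≤-trans half n≤m))) (ℕ.≤-reflexive refl))
        where
        ring : ∀ a t → 10 ℕ.* (a ℕ.+ t) ≡ 10 ℕ.* a ℕ.+ 5 ℕ.* (2 ℕ.* t)
        ring = ℕ-Ring.solve-∀
        n≤m : n ℕ.≤ m
        n≤m = ℕ.≤-trans (ℕ.m≤m+n _ _) (ℕ.≤-reflexive (count-not (nb S₀)))
      not-bad : ¬ Bad S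
      not-bad b = ℕ.<-irrefl refl (ℕ.<-≤-trans (subst (count S₀ ℕ.<_) (sym countS) (ℕ.≤-trans (ℕ.≤-reflexive (ℕ.+-comm 1 (count S₀))) (ℕ.+-monoʳ-≤ (count S₀) (ℕ.s≤s ℕ.z≤n)))) (max₀ S b))

    m≤2n : m ℕ.≤ 2 ℕ.* n
    m≤2n = ℕ.+-cancelʳ-≤ (2 ℕ.* count (nb S₀)) _ _ (ℕ.≤-trans (ℕ.+-monoʳ-≤ m 2nb≤) (ℕ.≤-reflexive (trans (ring m) (trans (cong (2 ℕ.*_) (sym (count-not (nb S₀)))) (ℕ.*-distribˡ-+ 2 n (count (nb S₀)))))))
      where
      ring : ∀ m → m ℕ.+ m ≡ 2 ℕ.* m
      ring = ℕ-Ring.solve-∀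
      2nb≤ : 2 ℕ.* count (nb S₀) ℕ.≤ m
      2nb≤ = ℕ.≤-trans (ℕ.*-monoˡ-≤ (count (nb S₀)) (ℕ.m≤m+n 2 3)) (ℕ.*-cancelˡ-≤ (2 ℕ.* κ) {{ℕ.m*n≢0 2 κ}} (ℕ.≤-trans (ℕ.≤-reflexive (r₁ κ (count (nb S₀)))) (ℕ.≤-trans (ℕ.*-monoʳ-≤ 10 (proj₂ bad₀))
        (ℕ.≤-trans (ℕ.≤-reflexive (r₂ κ (count S₀))) (ℕ.≤-trans (ℕ.*-monoʳ-≤ (suc κ) (ℕ.<⇒≤ small₀)) (ℕ.*-monoˡ-≤ m (ℕ.≤-trans (ℕ.+-monoˡ-≤ κ (ℕ.>-nonZero⁻¹ κ)) (ℕ.≤-reflexive (ring κ)))))))))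
        where
        r₁ : ∀ k x → 2 ℕ.* k ℕ.* (5 ℕ.* x) ≡ 10 ℕ.* (k ℕ.* x)
        r₁ = ℕ-Ring.solve-∀
        r₂ : ∀ k x → 10 ℕ.* (suc k ℕ.* x) ≡ suc k ℕ.* (10 ℕ.* x)
        r₂ = ℕ-Ring.solve-∀

  result : ∃ λ n → m ℕ.≤ 2 ℕ.* n × ∃ λ (𝒫 : System d n) → Expanding κ 𝒫
  result with chosen
  ... | S₀ , b , mx = Remove.n S₀ b mx , Remove.m≤2n S₀ b mx , Remove.pruned S₀ b mx , Remove.expanding S₀ b mx

-- Reduction to three matchings.

# : ∀ {n} → (Fin n → Bool) → Q
# S = sum λ x → [[ S x ]]

_∖_ : ∀ {n} → (Fin n → Bool) → (Fin n → Bool) → Fin n → Bool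
(S ∖ T) x = S x ∧ not (T x)

#≽0 : ∀ {n} (S : Fin n → Bool) → 𝟘 ≼ # S
#≽0 S = sum≽0 λ x → [[]]≽0 (S x)

#-mono : ∀ {n} {S T : Fin n → Bool} → S ⊆ᵇ T → # S ≼ # T
#-mono {S = S} {T} p = sum-mono λ x → go (S x) (T x) (p x)
  where
  go : ∀ a b → (a ≡ true → b ≡ true) → [[ a ]] ≼ [[ b ]]
  go false b _ = [[]]≽0 b
  go true b f rewrite f refl = ≼-refl

#-∨ : ∀ {n} (S T : Fin n → Bool) → # (λ x → S x ∨ T x) ≼ # S ⊕ # T
#-∨ S T = ≼-trans-≡ (sum-mono λ x → go (S x) (T x)) (∑-distrib-+ _ _)
  where
  go : ∀ a b → [[ a ∨ b ]] ≼ [[ a ]] ⊕ [[ b ]]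
  go true b = ≼⊕ʳ ([[]]≽0 b)
  go false b = ≼-reflexive (sym (⊕-idˡ _))

#-∖ : ∀ {n} {S N : Fin n → Bool} → S ⊆ᵇ N → # N ≡ # S ⊕ # (N ∖ S)
#-∖ {S = S} {N} p = trans (sum-cong λ x → go (S x) (N x) (p x)) (∑-distrib-+ _ _)
  where
  go : ∀ a b → (a ≡ true → b ≡ true) → [[ b ]] ≡ [[ a ]] ⊕ [[ b ∧ not a ]]
  go false true _ = sym (⊕-idˡ 𝟙)
  go false false _ = sym (⊕-idˡ 𝟘)
  go true b f rewrite f refl = sym (⊕-idʳ 𝟙)

#-≼∖ : ∀ {n} (N S : Fin n → Bool) → # N ≼ # S ⊕ # (N ∖ S)
#-≼∖ N S = ≼-trans-≡ (sum-mono λ x → go (S x) (N x)) (∑-distrib-+ _ _)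
  where
  go : ∀ a b → [[ b ]] ≼ [[ a ]] ⊕ [[ b ∧ not a ]]
  go a true with a
  ... | true = ≼⊕ʳ ≼-refl
  ... | false = ≼⊕ˡ ≼-refl
  go a false = ⊕≽0 ([[]]≽0 a) ≼-refl

#-triangle : ∀ {n} (S T U : Fin n → Bool) → # (S ∖ U) ≼ # (S ∖ T) ⊕ # (T ∖ U)
#-triangle S T U = ≼-trans-≡ (sum-mono λ x → go (S x) (T x) (U x)) (∑-distrib-+ _ _)
  where
  go : ∀ a b c → [[ a ∧ not c ]] ≼ [[ a ∧ not b ]] ⊕ [[ b ∧ not c ]]
  go false b c = ⊕≽0 ≼-refl ([[]]≽0 (b ∧ not c))
  go true true c = ≼-reflexive (sym (⊕-idˡ _))
  go true false c = ≼-trans ([[]]≼1 (not c)) (≼⊕ʳ ≼-refl)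

#-self : ∀ {n} (S : Fin n → Bool) → # (S ∖ S) ≡ 𝟘
#-self {n} S = trans (sum-cong λ x → go (S x)) (sum-0 n)
  where
  go : ∀ a → [[ a ∧ not a ]] ≡ 𝟘
  go true = refl
  go false = refl

#-∃ : ∀ {k n} (F : Fin k → Fin n → Bool) → # (λ y → ∃ᵇ λ i → F i y) ≼ sum λ i → # (F i)
#-∃ F = ≼-trans-≡ (sum-mono λ y → ∃ᵇ-≼ (λ i → F i y)) (∑-comm (λ y i → [[ F i y ]]))

#-matching : ∀ {n} (M : BipGraph n) → IsMatching M → ∀ U → # (λ y → ∃ᵇ λ x → U x ∧ M x y) ≼ # U
#-matching {n} M mat U = ≼-trans (#-∃ λ x y → U x ∧ M x y) (sum-mono λ x → go x (U x))
  where
  go : ∀ x a → # (λ y → a ∧ M x y) ≼ [[ a ]]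
  go x false = ≼-reflexive (sum-0 n)
  go x true = Period.sum-single n (M x) λ i j p q → proj₁ (mat x i x j p q) refl

-- The involutions (0 1)(2 3)… and (1 2)(3 4)….
swap : ∀ {n} → Fin n → Fin n
swap {1} zero = zero
swap {suc (suc n)} zero = suc zero
swap {suc (suc n)} (suc zero) = zero
swap {suc (suc n)} (suc (suc i)) = suc (suc (swap i))

swap′ : ∀ {n} → Fin n → Fin n
swap′ zero = zero
swap′ (suc i) = suc (swap i)

swap² : ∀ {n} (i : Fin n) → swap (swap i) ≡ i
swap² {1} zero = refl
swap² {suc (suc n)} zero = refl
swap² {suc (suc n)} (suc zero) = refl
swap² {suc (suc n)} (suc (suc i)) = cong (λ i → suc (suc i)) (swap² i)

swap′² : ∀ {n} (i : Fin n) → swap′ (swap′ i) ≡ i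
swap′² zero = refl
swap′² (suc i) = cong suc (swap² i)

-- `end` is the loop at the first and the last block, where the diagonal inside the block replaces
-- the missing neighbouring block.
data Near {n} (i j : Fin n) : Set where
  up   : toℕ j ≡ suc (toℕ i) → Near i j
  down : toℕ i ≡ suc (toℕ j) → Near i j
  end  : j ≡ i → toℕ i ≡ 0 ⊎ suc (toℕ i) ≡ n → Near i j

swap-near : ∀ {n} (i : Fin n) → Near i (swap i)
swap-near {1} zero = end refl (inj₁ refl)
swap-near {suc (suc n)} zero = up refl
swap-near {suc (suc n)} (suc zero) = down refl
swap-near {suc (suc n)} (suc (suc i)) with swap-near i
... | up p = up (cong (2 ℕ.+_) p)
... | down p = down (cong (2 ℕ.+_) p)
swap-near {suc (suc (suc n))} (suc (suc zero)) | end p (inj₁ q) with n | p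
... | zero | _ = end refl (inj₂ refl)
... | suc _ | ()
swap-near {suc (suc n)} (suc (suc i)) | end p (inj₂ q) = end (cong (λ i → suc (suc i)) p) (inj₂ (cong (2 ℕ.+_) q))

swap′-near : ∀ {n} (i : Fin n) → Near i (swap′ i)
swap′-near zero = end refl (inj₁ refl)
swap′-near (suc i) with swap-near i
... | up p = up (cong suc p)
... | down p = down (cong suc p)
swap′-near {suc (suc n)} (suc zero) | end p (inj₁ q) with n | p
... | zero | _ = end refl (inj₂ refl)
... | suc _ | ()
swap′-near (suc i) | end p (inj₂ q) = end (cong suc p) (inj₂ (cong suc q))

-- At an inner block the two involutions choose different neighbours, so between them they compare
-- the traces on these two in both directions.
swap-pair : ∀ {q} (i : Fin q) → suc (toℕ i) ℕ.< q →
  (toℕ (swap (suc i)) ≡ toℕ i × toℕ (swap′ (suc i)) ≡ 2 ℕ.+ toℕ i) ⊎ (toℕ (swap (suc i)) ≡ 2 ℕ.+ toℕ i × toℕ (swap′ (suc i)) ≡ toℕ i)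
swap-pair {suc zero} zero (ℕ.s≤s ())
swap-pair {suc (suc q)} zero _ = inj₁ (refl , refl)
swap-pair {suc (suc (suc q))} (suc zero) _ = inj₂ (refl , refl)
swap-pair {suc (suc zero)} (suc zero) (ℕ.s≤s (ℕ.s≤s ()))
swap-pair {suc (suc q)} (suc (suc i)) (ℕ.s≤s (ℕ.s≤s l)) with swap-pair i l
... | inj₁ (a , b) = inj₁ (cong (2 ℕ.+_) a , cong (2 ℕ.+_) b)
... | inj₂ (a , b) = inj₂ (cong (2 ℕ.+_) a , cong (2 ℕ.+_) b)

-- With X the excess of N over S, one block has trace at most κ(1 + 4p²)X, and the trace on each of
-- the p blocks exceeds it by at most 2pX.
expansion-constant : ℕ → ℕ → ℕ
expansion-constant κ p = p ℕ.* (κ ℕ.* (1 ℕ.+ 4 ℕ.* (p ℕ.* p)) ℕ.+ 2 ℕ.* p)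

module ThreeMatchings {d n : ℕ} (κ : ℕ) (𝒮 : System d n) (expanding : Expanding κ 𝒮) where

  open System 𝒮

  p m C : ℕ
  p = suc (suc d)
  m = p ℕ.* n
  C = expansion-constant κ p

  -- Block i carries the matching M (i − 1), and the first and the last block carry the diagonal.
  padded : ∀ {d} → (Fin d → BipGraph n) → Fin (suc d) → BipGraph n
  padded {zero} M zero = diagonal
  padded {suc d} M zero = M zero
  padded {suc d} M (suc k) = padded (M ∘ suc) k

  padded-mono : ∀ {d} (M : Fin d → BipGraph n) → (∀ k → IsMonotoneMatching (M k)) → ∀ i → IsMonotoneMatching (padded M i)
  padded-mono {zero} M h zero = diagonal-mono
  padded-mono {suc d} M h zero = h zero
  padded-mono {suc d} M h (suc k) = padded-mono (M ∘ suc) (h ∘ suc) k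

  padded-inject : ∀ {d} (M : Fin d → BipGraph n) k → padded M (Fin.inject₁ k) ≡ M k
  padded-inject {suc d} M zero = refl
  padded-inject {suc d} M (suc k) = padded-inject (M ∘ suc) k

  padded-last : ∀ {d} (M : Fin d → BipGraph n) i → toℕ i ≡ d → padded M i ≡ diagonal
  padded-last {zero} M zero _ = refl
  padded-last {suc d} M (suc i) e = padded-last (M ∘ suc) i (ℕ.suc-injective e)

  inner : Fin p → BipGraph n
  inner zero = diagonal
  inner (suc i) = padded M i

  inner-mono : ∀ i → IsMonotoneMatching (inner i)
  inner-mono zero = diagonal-mono
  inner-mono (suc i) = padded-mono M mono i

  inner-end : ∀ i → toℕ i ≡ 0 ⊎ suc (toℕ i) ≡ p → inner i ≡ diagonal
  inner-end zero _ = refl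
  inner-end (suc i) (inj₂ e) = padded-last M i (ℕ.suc-injective (ℕ.suc-injective e))

  block : Fin m → Fin p
  block = Fin.quotient {p} n

  offset : Fin m → Fin n
  offset = Fin.remainder {p} n

  join : ∀ u → Fin.combine (block u) (offset u) ≡ u
  join = Fin.combine-remQuot {p} n

  toℕ-join : ∀ u → toℕ u ≡ n ℕ.* toℕ (block u) ℕ.+ toℕ (offset u)
  toℕ-join u = trans (cong toℕ (sym (join u))) (Fin.toℕ-combine (block u) (offset u))

  rise fall stay : BipGraph m
  rise u w = does (toℕ (block w) ℕ.≟ suc (toℕ (block u))) ∧ does (offset u Fin.≟ offset w)
  fall u w = rise w u
  stay u w = does (block u Fin.≟ block w) ∧ inner (block u) (offset u) (offset w)

  rise-shift : ∀ u w → rise u w ≡ true → toℕ w ≡ n ℕ.+ toℕ u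
  rise-shift u w h with ∧-true {does (toℕ (block w) ℕ.≟ suc (toℕ (block u)))} h
  ... | a , b = trans (toℕ-join w) (trans (cong₂ (λ i x → n ℕ.* i ℕ.+ toℕ x) (does⇒ (toℕ (block w) ℕ.≟ suc (toℕ (block u))) a) (sym (does⇒ (offset u Fin.≟ offset w) b)))
        (trans (cong (ℕ._+ toℕ (offset u)) (ℕ.*-suc n (toℕ (block u)))) (trans (ℕ.+-assoc n _ _) (cong (n ℕ.+_) (sym (toℕ-join u))))))

  shift-mono : ∀ {R : BipGraph m} c → (∀ u w → R u w ≡ true → toℕ w ≡ c ℕ.+ toℕ u) → IsMonotoneMatching R
  shift-mono c sh = (λ i j k l a b → (λ e → Fin.toℕ-injective (trans (sh i j a) (trans (cong (λ u → c ℕ.+ toℕ u) e) (sym (sh k l b)))))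
      , (λ e → Fin.toℕ-injective (ℕ.+-cancelˡ-≡ c _ _ (trans (sym (sh i j a)) (trans (cong toℕ e) (sh k l b))))))
    , λ i j k l a b (u , v) → ℕ.<-asym (ℕ.+-monoʳ-< c u) (subst₂ ℕ._<_ (sh k l b) (sh i j a) v)

  flip-mono : ∀ {R : BipGraph m} → IsMonotoneMatching R → IsMonotoneMatching (λ u w → R w u)
  flip-mono (mat , nc) = (λ i j k l a b → proj₂ (mat j i l k a b) , proj₁ (mat j i l k a b)) , λ i j k l a b (u , v) → nc l k j i b a (v , u)

  block-order : ∀ u w → u Fin.< w → block u Fin.< block w ⊎ (block u ≡ block w × offset u Fin.< offset w)
  block-order u w l with Fin.<-cmp (block u) (block w)
  ... | tri< b _ _ = inj₁ b
  ... | tri> _ _ b = ⊥-elim (ℕ.<-asym l (subst₂ Fin._<_ (join w) (join u) (Fin.combine-monoˡ-< (offset w) (offset u) b)))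
  ... | tri≈ _ e _ = inj₂ (e , ℕ.+-cancelˡ-< (n ℕ.* toℕ (block u)) _ _ (subst₂ ℕ._<_ (toℕ-join u) (trans (toℕ-join w) (cong (λ i → n ℕ.* toℕ i ℕ.+ toℕ (offset w)) (sym e))) l))

  stay-mono : IsMonotoneMatching stay
  stay-mono = (λ i j k l a b → (λ { refl → same-end i j l (stay⇒ i j a) (stay⇒ i l b) }) , (λ { refl → same-start i k j (stay⇒ i j a) (stay⇒ k j b) }))
    , λ i j k l a b (u , v) → crossing i j k l (stay⇒ i j a) (stay⇒ k l b) (block-order i k u) (block-order l j v)
    where
    Stay : Fin m → Fin m → Set
    Stay u w = block u ≡ block w × inner (block u) (offset u) (offset w) ≡ true
    stay⇒ : ∀ u w → stay u w ≡ true → Stay u w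
    stay⇒ u w h with ∧-true {does (block u Fin.≟ block w)} h
    ... | a , b = does⇒ (block u Fin.≟ block w) a , b
    glue : ∀ u w → block u ≡ block w → offset u ≡ offset w → u ≡ w
    glue u w a b = trans (sym (join u)) (trans (cong₂ Fin.combine a b) (join w))
    same-end : ∀ i j l → Stay i j → Stay i l → j ≡ l
    same-end i j l (a , x) (b , y) = glue j l (trans (sym a) b) (proj₁ (proj₁ (inner-mono (block i)) _ _ _ _ x y) refl)
    same-start : ∀ i k j → Stay i j → Stay k j → i ≡ k
    same-start i k j (a , x) (b , y) = glue i k ik (proj₂ (proj₁ (inner-mono (block i)) _ _ _ _ x (subst (λ c → inner c (offset k) (offset j) ≡ true) (sym ik) y)) refl)
      where
      ik : block i ≡ block k
      ik = trans a (sym b)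
    crossing : ∀ i j k l → Stay i j → Stay k l → block i Fin.< block k ⊎ (block i ≡ block k × offset i Fin.< offset k) → block l Fin.< block j ⊎ (block l ≡ block j × offset l Fin.< offset j) → ⊥
    crossing i j k l (a , x) (b , y) (inj₁ u) (inj₁ v) = ℕ.<-asym u (subst₂ Fin._<_ (sym b) (sym a) v)
    crossing i j k l (a , x) (b , y) (inj₁ u) (inj₂ (e , _)) = ℕ.<-irrefl (cong toℕ (trans a (trans (sym e) (sym b)))) u
    crossing i j k l (a , x) (b , y) (inj₂ (e , _)) (inj₁ v) = ℕ.<-irrefl (cong toℕ (trans (sym b) (trans (sym e) a))) v
    crossing i j k l (a , x) (b , y) (inj₂ (e , u)) (inj₂ (_ , v)) = proj₂ (inner-mono (block i)) _ _ _ _ x (subst (λ c → inner c (offset k) (offset l) ≡ true) (sym e) y) (u , v)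

  three : System 3 m
  three = record { M = λ { zero → rise ; (suc zero) → fall ; (suc (suc zero)) → stay }
                 ; mono = λ { zero → shift-mono n rise-shift ; (suc zero) → flip-mono (shift-mono n rise-shift) ; (suc (suc zero)) → stay-mono } }

  -- Moving around the cycle of blocks shows that a set S with small excess X has nearly equal traces on all blocks; then the expansion of one of them is visible.
  module _ (S N : Fin m → Bool) (closed : System.Closed three S N) where

    private
      Sᵢ Nᵢ : Fin p → Fin n → Bool
      Sᵢ i x = S (Fin.combine i x)
      Nᵢ i x = N (Fin.combine i x)

      block-combine : ∀ i (x : Fin n) → block (Fin.combine i x) ≡ i
      block-combine i x = quotient-combine i x
      offset-combine : ∀ (i : Fin p) x → offset (Fin.combine i x) ≡ x
      offset-combine i x = remainder-combine i x

      rise-edge : ∀ i j x → toℕ j ≡ suc (toℕ i) → rise (Fin.combine i x) (Fin.combine j x) ≡ true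
      rise-edge i j x e = ∧-intro (dec-true (_ ℕ.≟ _) (trans (cong toℕ (block-combine j x)) (trans e (cong (suc ∘ toℕ) (sym (block-combine i x))))))
        (dec-true (_ Fin.≟ _) (trans (offset-combine i x) (sym (offset-combine j x))))

      inner-edge : ∀ i x y → Sᵢ i x ≡ true → inner i x y ≡ true → Nᵢ i y ≡ true
      inner-edge i x y s e = closed (suc (suc zero)) _ _ s (∧-intro (dec-true (_ Fin.≟ _) (trans (block-combine i x) (sym (block-combine i y))))
        (trans (cong₂ (λ f z → f z (offset (Fin.combine i y))) (cong inner (block-combine i x)) (offset-combine i x)) (trans (cong (inner i x) (offset-combine i y)) e)))

      near : ∀ i j → Near i j → Sᵢ j ⊆ᵇ Nᵢ i
      near i j (up e) x s = closed (suc zero) _ _ s (rise-edge i j x e)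
      near i j (down e) x s = closed zero _ _ s (rise-edge j i x e)
      near i .i (end refl e) x s = inner-edge i x x s (trans (cong (λ f → f x x) (inner-end i e)) (dec-true (x Fin.≟ x) refl))

      X : Q
      X = # N ⊖ # S

      #-blocks : ∀ (T : Fin m → Bool) → # T ≡ sum {p} λ i → # {n} λ x → T (Fin.combine i x)
      #-blocks T = sum-combine p (λ u → [[ T u ]])

      module _ (v : Fin p → Fin p) (v² : ∀ i → v (v i) ≡ i) (v-near : ∀ i → Near i (v i)) where

        -- The trace of S on block `v i` lies in that of N on block i, and `v` permutes the blocks.
        -- So the surpluses add up to |N| - |S|, whichever involution is used.
        excess : sum (λ i → # (Nᵢ i ∖ Sᵢ (v i))) ≡ X
        excess = trans (e _ (# S)) (cong (_⊖ # S) (sym (trans (#-blocks N) (trans (sum-cong λ i → #-∖ {S = Sᵢ (v i)} {Nᵢ i} (near i (v i) (v-near i))) (trans (∑-distrib-+ _ _)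
            (cong (_⊕ sum (λ i → # (Nᵢ i ∖ Sᵢ (v i)))) (trans (sum-bij v v v² v² (λ i → # (Sᵢ i))) (sym (#-blocks S)))))))))
          where
          opaque
            unfolding Q
            e : ∀ x s → x ≡ (s ⊕ x) ⊖ s
            e x s = solve 2 (λ x s → x := (s :+ x) :- s) refl x s

        -- Whatever else of S is forced into N on block i, its part outside the trace on block `v i`
        -- belongs to the surplus.
        step-bound : ∀ i u → Sᵢ u ⊆ᵇ Nᵢ i → # (Sᵢ u ∖ Sᵢ (v i)) ≼ X
        step-bound i u sub = ≼-trans (#-mono λ x h → let a , b = ∧-true {Sᵢ u x} h in ∧-intro (sub x a) b)
          (≼-trans-≡ (term≼sum {f = λ i → # (Nᵢ i ∖ Sᵢ (v i))} (λ i → #≽0 (Nᵢ i ∖ Sᵢ (v i))) i) excess)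

      swap-step : ∀ i u → Near i u → # (Sᵢ u ∖ Sᵢ (swap i)) ≼ X
      swap-step i u nr = step-bound swap swap² swap-near i u (near i u nr)

      swap′-step : ∀ i u → Near i u → # (Sᵢ u ∖ Sᵢ (swap′ i)) ≼ X
      swap′-step i u nr = step-bound swap′ swap′² swap′-near i u (near i u nr)

      X≽0 : 𝟘 ≼ X
      X≽0 = ≼-trans-≡ (sum≽0 λ i → #≽0 (Nᵢ i ∖ Sᵢ (swap i))) (excess swap swap² swap-near)

      Close : Fin p → Fin p → ℕ → Set
      Close i j k = # (Sᵢ i ∖ Sᵢ j) ≼ ι k ⊗ X × # (Sᵢ j ∖ Sᵢ i) ≼ ι k ⊗ X

      close-step : ∀ {i j l k} → # (Sᵢ i ∖ Sᵢ j) ≼ X → # (Sᵢ j ∖ Sᵢ i) ≼ X → Close j l k → Close i l (suc k)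
      close-step {i} {j} {l} {k} a b (c , e) = ≼-trans (#-triangle (Sᵢ i) (Sᵢ j) (Sᵢ l)) (≼-trans-≡ (⊕-mono a c) (one+ k)) ,
          ≼-trans (#-triangle (Sᵢ l) (Sᵢ j) (Sᵢ i)) (≼-trans-≡ (⊕-mono e b) (trans (⊕-comm _ _) (one+ k)))
        where
        one+ : ∀ k → X ⊕ ι k ⊗ X ≡ ι (suc k) ⊗ X
        one+ k = trans (cong (_⊕ ι k ⊗ X) (sym (⊗-idˡ X))) (trans (sym (⊗-distribʳ X 𝟙 (ι k))) (cong (_⊗ X) (sym (ι-suc k))))

      -- Blocks two apart are both joined to the block between them, so their traces differ by at
      -- most X either way. The two parity classes meet at block 0, whose loop compares it with
      -- block 1.
      close-0 : ∀ t (i : Fin p) → toℕ i ≡ t → Close i zero t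
      close-0 zero zero _ = ≼-reflexive (trans (#-self (Sᵢ zero)) (sym z)) , ≼-reflexive (trans (#-self (Sᵢ zero)) (sym z))
        where
        z : ι 0 ⊗ X ≡ 𝟘
        z = trans (cong (_⊗ X) ι0) (⊗-zeroˡ X)
      close-0 (suc zero) (suc zero) _ = close-step {suc zero} {zero} {zero} {0} (swap′-step zero (suc zero) (up refl)) (swap-step zero zero (end refl (inj₁ refl))) (close-0 zero zero refl)
      close-0 (suc (suc t)) (suc i) e = weaken (close-step {suc i} {l} {zero} {t} (proj₁ both) (proj₂ both) (close-0 t l tl))
        where
        weaken : Close (suc i) zero (suc t) → Close (suc i) zero (suc (suc t))
        weaken (a , b) = ≼-trans a (⊗-monoʳ X X≽0 (ι-mono (ℕ.n≤1+n _))) , ≼-trans b (⊗-monoʳ X X≽0 (ι-mono (ℕ.n≤1+n _)))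
        t+1<  : suc t ℕ.< suc d
        t+1< = subst (ℕ._< suc d) (ℕ.suc-injective e) (Fin.toℕ<n i)
        k : Fin (suc d)
        k = Fin.fromℕ< (ℕ.<-trans (ℕ.n<1+n t) t+1<)
        tk : toℕ k ≡ t
        tk = Fin.toℕ-fromℕ< _
        l : Fin p
        l = Fin.inject₁ k
        tl : toℕ l ≡ t
        tl = trans (Fin.toℕ-inject₁ k) tk
        both : # (Sᵢ (suc i) ∖ Sᵢ l) ≼ X × # (Sᵢ l ∖ Sᵢ (suc i)) ≼ X
        both with swap-pair k (subst (λ a → suc a ℕ.< suc d) (sym tk) t+1<)
        ... | inj₁ (a , b) = subst (λ j → # (Sᵢ (suc i) ∖ Sᵢ j) ≼ X) (Fin.toℕ-injective (trans a (trans tk (sym tl)))) (swap-step (suc k) (suc i) (up (trans e (cong (2 ℕ.+_) (sym tk)))))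
                           , subst (λ j → # (Sᵢ l ∖ Sᵢ j) ≼ X) (Fin.toℕ-injective (trans b (trans (cong (2 ℕ.+_) tk) (sym e)))) (swap′-step (suc k) l (down (cong suc (trans tk (sym tl)))))
        ... | inj₂ (a , b) = subst (λ j → # (Sᵢ (suc i) ∖ Sᵢ j) ≼ X) (Fin.toℕ-injective (trans b (trans tk (sym tl)))) (swap′-step (suc k) (suc i) (up (trans e (cong (2 ℕ.+_) (sym tk)))))
                           , subst (λ j → # (Sᵢ l ∖ Sᵢ j) ≼ X) (Fin.toℕ-injective (trans a (trans (cong (2 ℕ.+_) tk) (sym e)))) (swap-step (suc k) l (down (cong suc (trans tk (sym tl)))))

      P B : Q
      P = ι p
      B = ι 2 ⊗ (P ⊗ X)

      close : ∀ i j → # (Sᵢ i ∖ Sᵢ j) ≼ B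
      close i j = ≼-trans (#-triangle (Sᵢ i) (Sᵢ zero) (Sᵢ j)) (≼-trans-≡ (⊕-mono (≼-trans (proj₁ (close-0 (toℕ i) i refl)) (bound i)) (≼-trans (proj₂ (close-0 (toℕ j) j refl)) (bound j))) (sym (two⊗ _)))
        where
        bound : ∀ i → ι (toℕ i) ⊗ X ≼ P ⊗ X
        bound i = ⊗-monoʳ X X≽0 (ι-mono (ℕ.<⇒≤ (Fin.toℕ<n i)))

    expansion : 2 ℕ.* count S ℕ.≤ m → suc C ℕ.* count S ℕ.≤ C ℕ.* count N
    expansion half = ι-cancel (subst₂ _≼_ (sym (ι-* (suc C) (count S))) (sym (ι-* C (count N))) (subst₂ (λ a b → ι (suc C) ⊗ a ≼ ι C ⊗ b) (sym (ι-count S)) (sym (ι-count N)) final))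
      where
      -- Some block has at most half of its points in S; the expansion hypothesis is applied to this
      -- one only.
      picked : ∃ λ i → ι 2 ⊗ # (Sᵢ i) ≼ ι n
      picked = pigeonhole (λ i → ι 2 ⊗ # (Sᵢ i)) (ι n) (≼-trans (≼-reflexive (trans (sum-⊗ˡ (ι 2) _) (trans (cong (ι 2 ⊗_) (trans (sym (#-blocks S)) (sym (ι-count S)))) (sym (ι-* 2 (count S))))))
        (≼-trans-≡ (ι-mono half) (ι-* p n)))
      i₀ : Fin p
      i₀ = proj₁ picked
      T N* : Fin n → Bool
      T = Sᵢ i₀
      slot : Fin d → Fin p
      slot k = suc (Fin.inject₁ k)
      -- A neighbour of T under matching k lies in T or has one of three defects: it is surplus of N
      -- in the block of k, it lies in another trace of S but not in T, or it comes from a point of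
      -- T that S misses in the block of k.
      N*₁ N*₂ N*₃ : Fin n → Bool
      N*₁ y = ∃ᵇ λ i → (Nᵢ i ∖ Sᵢ (swap i)) y
      N*₂ y = ∃ᵇ λ i → (Sᵢ (swap i) ∖ T) y
      N*₃ y = ∃ᵇ λ k → ∃ᵇ λ x → (T ∖ Sᵢ (slot k)) x ∧ M k x y
      N* y = T y ∨ (N*₁ y ∨ (N*₂ y ∨ N*₃ y))
      closed* : Closed T N*
      closed* k x y t e = go (Sᵢ (slot k) x) refl (T y) refl (Sᵢ (swap (slot k)) y) refl
        where
        go : ∀ a → Sᵢ (slot k) x ≡ a → ∀ b → T y ≡ b → ∀ c → Sᵢ (swap (slot k)) y ≡ c → N* y ≡ true
        go false s _ _ _ _ = ∨-introʳ (T y) (∨-introʳ (N*₁ y) (∨-introʳ (N*₂ y) (∃ᵇ-intro _ k (∃ᵇ-intro _ x (∧-intro (∧-intro t (cong not s)) e)))))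
        go true s true ty _ _ = ∨-introˡ _ ty
        go true s false ty true sy = ∨-introʳ (T y) (∨-introʳ (N*₁ y) (∨-introˡ (N*₃ y) (∃ᵇ-intro (λ i → (Sᵢ (swap i) ∖ T) y) (slot k) (∧-intro sy (cong not ty)))))
        go true s false ty false sy = ∨-introʳ (T y) (∨-introˡ (N*₂ y ∨ N*₃ y) (∃ᵇ-intro (λ i → (Nᵢ i ∖ Sᵢ (swap i)) y) (slot k)
          (∧-intro (inner-edge (slot k) x y s (trans (cong (λ f → f x y) (padded-inject M k)) e)) (cong not sy))))
      #N* : # N* ≼ # T ⊕ (X ⊕ (P ⊗ B ⊕ P ⊗ B))
      #N* = ≼-trans (#-∨ T _) (⊕-mono ≼-refl (≼-trans (#-∨ N*₁ _) (⊕-mono (≼-trans-≡ (#-∃ λ i → Nᵢ i ∖ Sᵢ (swap i)) (excess swap swap² swap-near))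
          (≼-trans (#-∨ N*₂ _) (⊕-mono (≼-trans (#-∃ λ i → Sᵢ (swap i) ∖ T) (≼-trans-≡ (sum-mono λ i → close (swap i) i₀) (sum-const p B)))
            (≼-trans (#-∃ λ k y → ∃ᵇ λ x → (T ∖ Sᵢ (slot k)) x ∧ M k x y) (≼-trans (≼-trans-≡ (sum-mono λ k → ≼-trans (#-matching (M k) (proj₁ (mono k)) (T ∖ Sᵢ (slot k))) (close i₀ (slot k))) (sum-const d B))
              (⊗-monoʳ B B≽0 (ι-mono (ℕ.≤-trans (ℕ.n≤1+n d) (ℕ.n≤1+n (suc d))))))))))))
        where
        B≽0 : 𝟘 ≼ B
        B≽0 = ⊗≽0 (ι≽0 2) (⊗≽0 (ι≽0 p) X≽0)
      T-expands : ι (suc κ) ⊗ # T ≼ ι κ ⊗ # N*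
      T-expands = subst₂ _≼_ (trans (ι-* (suc κ) (count T)) (cong (ι (suc κ) ⊗_) (ι-count T))) (trans (ι-* κ (count N*)) (cong (ι κ ⊗_) (ι-count N*)))
        (ι-mono (expanding T N* closed* (ι-cancel (subst (_≼ ι n) (trans (cong (ι 2 ⊗_) (sym (ι-count T))) (sym (ι-* 2 (count T)))) (proj₂ picked)))))
      T≼ : # T ≼ ι κ ⊗ (X ⊕ (P ⊗ B ⊕ P ⊗ B))
      T≼ = ⊕-cancelʳ (ι κ ⊗ # T) (≡-trans-≼ (trans (cong (_⊕ ι κ ⊗ # T) (sym (trans (cong (_⊗ # T) ι1) (⊗-idˡ _)))) (trans (sym (⊗-distribʳ (# T) (ι 1) (ι κ))) (cong (_⊗ # T) (sym (ι-+ 1 κ)))))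
        (≼-trans T-expands (≼-trans-≡ (⊗-monoˡ (ι κ) (ι≽0 κ) #N*) (trans (⊗-distribˡ _ _ _) (⊕-comm _ _)))))
      S≼ : # S ≼ ι C ⊗ X
      S≼ = ≡-trans-≼ (#-blocks S) (≼-trans (sum-mono λ i → ≼-trans (#-≼∖ (Sᵢ i) T) (⊕-mono T≼ (close i i₀)))
        (≼-reflexive (trans (sum-const p _) (trans (e P X (ι 2) (ι κ)) (trans (cong (λ c → P ⊗ (ι κ ⊗ c ⊕ ι 2 ⊗ P) ⊗ X) four) (cong (_⊗ X) (sym C≡)))))))
        where
        four : 𝟙 ⊕ (ι 2 ⊗ (P ⊗ P) ⊕ ι 2 ⊗ (P ⊗ P)) ≡ ι (1 ℕ.+ 4 ℕ.* (p ℕ.* p))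
        four = trans (cong (𝟙 ⊕_) (trans (sym (⊗-distribʳ _ (ι 2) (ι 2))) (cong₂ _⊗_ (sym (ι-+ 2 2)) (sym (ι-* p p))))) (trans (cong (𝟙 ⊕_) (sym (ι-* 4 (p ℕ.* p)))) (sym (ι-suc _)))
        C≡ : ι C ≡ P ⊗ (ι κ ⊗ ι (1 ℕ.+ 4 ℕ.* (p ℕ.* p)) ⊕ ι 2 ⊗ P)
        C≡ = trans (ι-* p _) (cong (P ⊗_) (trans (ι-+ (κ ℕ.* (1 ℕ.+ 4 ℕ.* (p ℕ.* p))) (2 ℕ.* p)) (cong₂ _⊕_ (ι-* κ (1 ℕ.+ 4 ℕ.* (p ℕ.* p))) (ι-* 2 p))))
        opaque
          unfolding Q
          e : ∀ P X t b → P ⊗ (b ⊗ (X ⊕ (P ⊗ (t ⊗ (P ⊗ X)) ⊕ P ⊗ (t ⊗ (P ⊗ X)))) ⊕ t ⊗ (P ⊗ X)) ≡ P ⊗ (b ⊗ (𝟙 ⊕ (t ⊗ (P ⊗ P) ⊕ t ⊗ (P ⊗ P))) ⊕ t ⊗ P) ⊗ X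
          e P X t b = solve 4 (λ P X t b → P :* (b :* (X :+ (P :* (t :* (P :* X)) :+ P :* (t :* (P :* X)))) :+ t :* (P :* X)) := P :* (b :* (con ℚ.1ℚ :+ (t :* (P :* P) :+ t :* (P :* P))) :+ t :* P) :* X) refl P X t b
      final : ι (suc C) ⊗ # S ≼ ι C ⊗ # N
      final = ≡-trans-≼ (trans (cong (_⊗ # S) (ι-suc C)) (trans (⊗-distribʳ _ _ _) (cong (_⊕ ι C ⊗ # S) (⊗-idˡ _))))
        (≼-trans (⊕-mono S≼ ≼-refl) (≼-reflexive (trans (sym (⊗-distribˡ (ι C) X (# S))) (cong (ι C ⊗_) (⊖⊕-cancel (# N) (# S))))))

-- Return to the original rationals, and assembly of the graphs.

opaque
  unfolding Q ι

  ⟦_⟧ : Q → ℚ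
  ⟦ x ⟧ = x

  ⟦⟧-mono : ∀ {x y} → x ≼ y → ⟦ x ⟧ ≤ℚ ⟦ y ⟧
  ⟦⟧-mono p = p

  ⟦⟧-pos : ∀ {x} → ¬ (x ≼ 𝟘) → 0ℚ <ℚ ⟦ x ⟧
  ⟦⟧-pos p = ℚ.≰⇒> p

  ⟦𝟙⟧ : ⟦ 𝟙 ⟧ ≡ 1ℚ
  ⟦𝟙⟧ = refl

  ⟦⊕⟧ : ∀ x y → ⟦ x ⊕ y ⟧ ≡ ⟦ x ⟧ ℚ.+ ⟦ y ⟧
  ⟦⊕⟧ x y = refl

  ⟦⊗⟧ : ∀ x y → ⟦ x ⊗ y ⟧ ≡ ⟦ x ⟧ ℚ.* ⟦ y ⟧
  ⟦⊗⟧ x y = refl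

  ⟦ι⟧ : ∀ k → ⟦ ι k ⟧ ≡ toℚ k
  ⟦ι⟧ zero = refl
  ⟦ι⟧ (suc k) = trans (cong (1ℚ ℚ.+_) (trans (⟦ι⟧ k) (ℚ.normalize-coprime {k} {0} (Coprime.sym (Coprime.1-coprimeTo k)))))
    (trans (cong (ℚ._/ 1) (trans (cong (λ z → + 1 ℤ.+ z) (sym (ℤ.pos-* k 1))) (sym (ℤ.pos-+ 1 (k ℕ.* 1))))) (cong (λ n → (+ suc n) ℚ./ 1) (ℕ.*-identityʳ k)))

gap : ℕ → ℚ
gap c = ⟦ rcp c ⟧

gap>0 : ∀ c → NonZero c → 0ℚ <ℚ gap c
gap>0 (suc c) _ = ⟦⟧-pos λ p → 𝟙⋠𝟘 (≡-trans-≼ (sym (rcp-inv c)) (≼-trans-≡ (⊗-monoˡ (ι (suc c)) (ι≽0 (suc c)) p) (⊗-zeroʳ (ι (suc c)))))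

gap≤1 : ∀ c → NonZero c → gap c ≤ℚ 1ℚ
gap≤1 (suc c) _ = subst (gap (suc c) ≤ℚ_) ⟦𝟙⟧ (⟦⟧-mono (⊗-cancel-ι c (≡-trans-≼ (rcp-inv c) (≼-trans-≡ (1≼ι c) (sym (⊗-idʳ (ι (suc c))))))))

gap-expands : ∀ c → NonZero c → ∀ s t → suc c ℕ.* s ℕ.≤ c ℕ.* t → (1ℚ ℚ.+ gap c) ℚ.* toℚ s ≤ℚ toℚ t
gap-expands (suc c) _ s t h = subst₂ _≤ℚ_ (trans (⟦⊗⟧ _ _) (cong₂ ℚ._*_ (trans (⟦⊕⟧ 𝟙 _) (cong (ℚ._+ gap (suc c)) ⟦𝟙⟧)) (⟦ι⟧ s))) (⟦ι⟧ t) (⟦⟧-mono {(𝟙 ⊕ rcp (suc c)) ⊗ ι s} {ι t} (⊗-cancel-ι c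
  (≡-trans-≼ (trans (sym (⊗-assoc _ _ _)) (trans (cong (_⊗ ι s) (trans (⊗-distribˡ (ι (suc c)) 𝟙 (rcp (suc c))) (trans (cong₂ _⊕_ (⊗-idʳ _) (rcp-inv c)) (trans (⊕-comm _ _) (sym (ι-suc (suc c))))))) (sym (ι-* (suc (suc c)) s))))
    (≼-trans-≡ (ι-mono h) (ι-* (suc c) t)))))

count-lookup : ∀ {n} (S : Subset n) → ∣ S ∣ₛ ≡ count (lookup S)
count-lookup [] = refl
count-lookup (true ∷ S) = cong suc (count-lookup S)
count-lookup (false ∷ S) = count-lookup S

module FromCores (D K W₀ r : ℕ) (D≡K² : D ≡ suc K ℕ.* suc K) where

  open Ends D K W₀ r D≡K²

  module _ {m part} (C : Core m part) where
    open Core C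

    piece-edges : Fin D → Bool → BipGraph m
    piece-edges a b x y = kept x ∧ (does (piece a x Bool.≟ b) ∧ does (φ a x Fin.≟ y))

    private
      Edge : Fin D → Bool → Fin m → Fin m → Set
      Edge a b x y = kept x ≡ true × piece a x ≡ b × φ a x ≡ y

      edge⇒ : ∀ a b x y → piece-edges a b x y ≡ true → Edge a b x y
      edge⇒ a b x y h with ∧-true {kept x} h
      ... | k , h′ with ∧-true {does (piece a x Bool.≟ b)} h′
      ...   | p , q = k , does⇒ (piece a x Bool.≟ b) p , does⇒ (φ a x Fin.≟ y) q

    edge⇐ : ∀ a x → kept x ≡ true → piece-edges a (piece a x) x (φ a x) ≡ true
    edge⇐ a x k = ∧-intro k (∧-intro (dec-true (piece a x Bool.≟ piece a x) refl) (dec-true (φ a x Fin.≟ φ a x) refl))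

    piece-edges-mono : ∀ a b → IsMonotoneMatching (piece-edges a b)
    piece-edges-mono a b = (λ i j k l p q → match i j k l (edge⇒ a b i j p) (edge⇒ a b k l q)) , λ i j k l p q → cross i j k l (edge⇒ a b i j p) (edge⇒ a b k l q)
      where
      match : ∀ i j k l → Edge a b i j → Edge a b k l → (i ≡ k → j ≡ l) × (j ≡ l → i ≡ k)
      match i .(φ a i) k .(φ a k) (_ , _ , refl) (_ , _ , refl) = cong (φ a) , λ e → trans (sym (ψφ a i)) (trans (cong (ψ a) e) (ψφ a k))
      cross : ∀ i j k l → Edge a b i j → Edge a b k l → ¬ (i Fin.< k × l Fin.< j)
      cross i .(φ a i) k .(φ a k) (ki , pi , refl) (kk , pk , refl) (u , v) = ℕ.<-asym (mono a i k ki kk (trans pi (sym pk)) u) v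

  module _ {m p₁ p₂} (C₁ : Core m p₁) (C₂ : Core m p₂) where

    pick : Fin D → Fin 4 → BipGraph m
    pick a zero = piece-edges C₁ a true
    pick a (suc zero) = piece-edges C₁ a false
    pick a (suc (suc zero)) = piece-edges C₂ a true
    pick a (suc (suc (suc zero))) = piece-edges C₂ a false

    pick-mono : ∀ a c → IsMonotoneMatching (pick a c)
    pick-mono a zero = piece-edges-mono C₁ a true
    pick-mono a (suc zero) = piece-edges-mono C₁ a false
    pick-mono a (suc (suc zero)) = piece-edges-mono C₂ a true
    pick-mono a (suc (suc (suc zero))) = piece-edges-mono C₂ a false

    -- Both cores contribute D permutations with two pieces each, hence 4D matchings. The diagonal
    -- is added so that a set never has fewer neighbours than elements.
    system : System (suc (D ℕ.* 4)) m
    system = record { M = matching ; mono = matching-mono }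
      where
      matching : Fin (suc (D ℕ.* 4)) → BipGraph m
      matching zero = diagonal
      matching (suc k) = pick (Fin.quotient {D} 4 k) (Fin.remainder {D} 4 k)
      matching-mono : ∀ k → IsMonotoneMatching (matching k)
      matching-mono zero = diagonal-mono
      matching-mono (suc k) = pick-mono (Fin.quotient {D} 4 k) (Fin.remainder {D} 4 k)

    module _ {S N : Fin m → Bool} (closed : System.Closed system S N) where

      hall : count S ℕ.≤ count N
      hall = count-mono λ x s → closed zero x x s (dec-true (x Fin.≟ x) refl)

      picked : ∀ a c x y → S x ≡ true → pick a c x y ≡ true → N y ≡ true
      picked a c x y s e = closed (suc (Fin.combine a c)) x y s (trans (cong₂ (λ a c → pick a c x y) (quotient-combine a c) (remainder-combine a c)) e)

      closed₁ : ∀ x a → S x ≡ true → Core.kept C₁ x ≡ true → N (Core.φ C₁ a x) ≡ true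
      closed₁ x a s k with Core.piece C₁ a x in e
      ... | true = picked a zero x _ s (subst (λ b → piece-edges C₁ a b x (Core.φ C₁ a x) ≡ true) e (edge⇐ C₁ a x k))
      ... | false = picked a (suc zero) x _ s (subst (λ b → piece-edges C₁ a b x (Core.φ C₁ a x) ≡ true) e (edge⇐ C₁ a x k))

      closed₂ : ∀ x a → S x ≡ true → Core.kept C₂ x ≡ true → N (Core.φ C₂ a x) ≡ true
      closed₂ x a s k with Core.piece C₂ a x in e
      ... | true = picked a (suc (suc zero)) x _ s (subst (λ b → piece-edges C₂ a b x (Core.φ C₂ a x) ≡ true) e (edge⇐ C₂ a x k))
      ... | false = picked a (suc (suc (suc zero))) x _ s (subst (λ b → piece-edges C₂ a b x (Core.φ C₂ a x) ≡ true) e (edge⇐ C₂ a x k))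

module Conclusion (K D W₀ r : ℕ) (K-^ : suc K ≡ pow2 40) (D-^ : D ≡ pow2 80) (W₀-^ : W₀ ≡ pow2 10) (r-^ : suc r ≡ pow2 56) where

  open Numbers K D W₀ r K-^ D-^ W₀-^ r-^
  open FromCores D K W₀ r D≡K²
  private
    module Δ = Decomposition dg dg-nz

  -- Here 1024·Λ = 2^10·2^2·2^56 = 2^68, well below D = 2^80. Hence the contracted part costs at
  -- most M/1024 per colour.
  Λ-small : Families.Λ D K W₀ r D≡K² ⊗ ι 1024 ≼ ι D
  Λ-small = ≡-trans-≼ (trans (cong (_⊗ ι 1024) (sym (ι-* 4 (suc r)))) (sym (ι-* (4 ℕ.* suc r) 1024)))
    (≼-trans-≡ (ι-mono (ℕ.≤-trans (ℕ.≤-reflexive (trans (cong₂ ℕ._*_ (cong₂ ℕ._*_ (pow2-≡ 2) r-^) (pow2-≡ 10)) (sym (trans (pow2-+ 58 10) (cong (ℕ._* pow2 10) (pow2-+ 2 56)))))) (pow2-mono {68} {80} (ℕ.≤ᵇ⇒≤ 68 80 _)))) (cong ι (sym D-^)))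

  W₀>0 : NonZero W₀
  W₀>0 = subst NonZero (sym W₀-^) (pow2-nz 10)

  degree : ℕ
  degree = suc (D ℕ.* 4)

  systems : ∀ j → System degree (size (levels j))
  systems j = system (core-odd j) (core-even j)

  systems-hall : ∀ j S N → System.Closed (systems j) S N → count S ℕ.≤ count N
  systems-hall j S N c = hall (core-odd j) (core-even j) {S} {N} c

  systems-mid : ∀ j S N → System.Closed (systems j) S N → size (levels j) ℕ.≤ 10 ℕ.* count S → 10 ℕ.* count S ℕ.≤ 6 ℕ.* size (levels j) →
    W₀ ℕ.* count S ℕ.+ size (levels j) ℕ.≤ W₀ ℕ.* count N
  systems-mid j S N c = MidRange.mid-expansion D K W₀ r D≡K² (trans W₀-^ (sym (pow2-≡ 10))) Λ-small {size t} {{Δ.size-nz t}} (core-odd j) (core-even j)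
      (Δ.mean t) (Δ.decompose t) (Δ.part-sum true t) (Δ.part-sum false t) (λ f → sym (Δ.mean-eq t f)) (Δ.norms t)
      S N (closed₁ (core-odd j) (core-even j) {S} {N} c) (closed₂ (core-odd j) (core-even j) {S} {N} c)
    where
    t : ℕ
    t = levels j

  2j≤twice : ∀ j → 2 ℕ.* j ℕ.≤ twice j
  2j≤twice zero = ℕ.z≤n
  2j≤twice (suc j) = ℕ.≤-trans (ℕ.≤-reflexive (ℕ.*-suc 2 j)) (ℕ.s≤s (ℕ.s≤s (2j≤twice j)))

  expanding-systems : ∀ j → ∃ λ n → j ℕ.≤ n × ∃ λ (𝒮 : System degree n) → Expanding W₀ 𝒮
  expanding-systems j =
    let n , m≤2n , 𝒮 , ex = Prune.result W₀ {{W₀>0}} (systems j) (size>0 (levels j)) (systems-hall j) (systems-mid j)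
    in n , ℕ.*-cancelˡ-≤ 2 (ℕ.≤-trans (2j≤twice j) (ℕ.≤-trans (ℕ.n≤1+n (twice j)) (ℕ.≤-trans (t≤size (levels j)) m≤2n))) , 𝒮 , ex

  C : ℕ
  C = expansion-constant W₀ (suc (suc degree))

  C>0 : NonZero C
  C>0 = ℕ.>-nonZero (ℕ.<-≤-trans (ℕ.s≤s ℕ.z≤n) (ℕ.≤-trans (ℕ.≤-trans (ℕ.m≤m*n 2 (suc (suc degree))) (ℕ.m≤n+m _ (W₀ ℕ.* (1 ℕ.+ 4 ℕ.* (suc (suc degree) ℕ.* suc (suc degree)))))) (ℕ.m≤n*m _ (suc (suc degree)))))

  graph : ∀ N → (∃ λ n → N ℕ.≤ n × ∃ λ (𝒮 : System degree n) → Expanding W₀ 𝒮) → Σ ℕ λ n → (N ℕ.≤ n) × Σ (BipGraph n) λ E → IsExpander (gap C) E × IsMonotone 3 E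
  graph N (n , N≤n , 𝒮 , ex) = T.m , ℕ.≤-trans N≤n (ℕ.m≤m+n n _) , E , expander , System.M T.three , System.mono T.three , λ i j → mk⇔ (∃ᵇ-elim (λ k → System.M T.three k i j)) (λ (k , e) → ∃ᵇ-intro (λ k → System.M T.three k i j) k e)
    where
    module T = ThreeMatchings W₀ 𝒮 ex
    E : BipGraph T.m
    E u w = ∃ᵇ λ k → System.M T.three k u w
    expander : IsExpander (gap C) E
    expander S half = gap-expands C C>0 ∣ S ∣ₛ ∣ nbhd E S ∣ₛ (subst₂ (λ a b → suc C ℕ.* a ℕ.≤ C ℕ.* b) (sym (count-lookup S)) (sym (count-lookup (nbhd E S)))
        (T.expansion (lookup S) (lookup (nbhd E S)) closed (subst (λ c → 2 ℕ.* c ℕ.≤ T.m) (count-lookup S) half)))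
      where
      closed : System.Closed T.three (lookup S) (lookup (nbhd E S))
      closed k x y s e = trans (Vec.lookup∘tabulate _ y) (trans (isYes≗does _) (dec-true (Fin.any? _) (x , Vec.lookup⇒[]= x S s , ∃ᵇ-intro (λ k → System.M T.three k x y) k e)))

module Instance = Conclusion (ℕ.pred (pow2 40)) (pow2 80) (pow2 10) (ℕ.pred (pow2 56)) (suc-pred-pow2 40) refl refl (suc-pred-pow2 56)

open import Data.Nat using (_≤_)
open import Data.Rational using (_<_)

theorem2 : Σ ℚ λ ε → (0ℚ < ε) × (ε ≤ℚ 1ℚ) ×
    ((N : ℕ) → Σ ℕ λ n → (N ≤ n) × Σ (BipGraph n) λ E →
    IsExpander ε E × IsMonotone 3 E)
theorem2 = gap C , gap>0 C C>0 , gap≤1 C C>0 , λ N → graph N (expanding-systems N)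
  where
  open Instance
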